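{- Let $\Gamma=R_n(a,r)$ be a non-trivially unstable Rose Window graph. (i) If $n$ is odd, then $\Gamma$ is isomorphic to a graph in the family W3. (ii) If $n$ is even and the canonical double cover $\Gamma\times\mathbf{K}_2$ is not edge-transitive, then $\Gamma$ is isomorphic to a graph in one of the families W1, W4, W5, W6, W7, W8, W9. (iii) If $n$ is even and $\Gamma\times\mathbf{K}_2$ is edge-transitive, then $\Gamma$ is isomorphic to a graph in one of the families W2 and W4.
   Context: All graphs are finite and simple. For an integer $n\ge 3$ and nonzero $a,r\in\mathbb{Z}_n$, the Rose Window graph $R_n(a,r)$ has vertex set $\{u_i,v_i : i\in\mathbb{Z}_n\}$ and edges $\{u_i,u_{i+1}\},\{v_i,v_{i+r}\},\{u_i,v_i\},\{u_{i+a},v_i\}$ for $i\in\mathbb{Z}_n$ (indices mod $n$; elements of $\mathbb{Z}_n$ are also regarded as integers). The canonical double cover $\Gamma\times\mathbf{K}_2$ of a graph $\Gamma$ has vertex set $V(\Gamma)\times\{0,1\}$ and edges $\{(u,0),(v,1)\}$ for $\{u,v\}\in E(\Gamma)$. $\Gamma$ is stable if $\mathrm{Aut}(\Gamma\times\mathbf{K}_2)\cong \mathrm{Aut}(\Gamma)\times\mathbb{Z}_2$, and unstable otherwise. An unstable graph is trivially unstable if it is disconnected, or bipartite with nontrivial automorphism group, or has two distinct vertices with the same neighborhood; it is non-trivially unstable if it is unstable, connected, non-bipartite, and no two distinct vertices have the same neighborhood. The families (each consisting of the graphs $R_N(A,R)$ with the listed parameters, $m$ a positive integer, all congruences meaningful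 in the respective ring) are: W1: $(N,A,R)=(4m,2m,R)$; W2: $(2m,m+2,m+1)$; W3: $(m,2d,1)$ with $m$ odd, $m\ge 5$, $d^2\equiv\pm1 \pmod m$, $d\not\equiv\pm1\pmod m$; W4: $(2m,A,m-1)$ with $A\ne m$; W5: $(8m,A,2m)$ with $A$ even; W6: $(4m,m,R)$ with $m,R$ odd, $m\ge3$; W7: $(2m,m,m-1)$ with $m$ odd; W8: $(2m,m,R)$ with $m$ odd, $R$ even, $R^2\equiv\pm1\pmod m$, $R\not\equiv\pm1\pmod m$; W9: $(2m,A,m-s)$ with $s^2\equiv1\pmod{2m}$, $sA\equiv -A\pmod{2m}$, $A<m$. -}

module Defs where

open import Level using (0ℓ)
open import Data.Nat using (ℕ; zero; suc; _+_; _*_; _∸_; _≤_; _<_)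
open import Data.Nat.Divisibility using (_∣_)
open import Data.Fin using (Fin; toℕ)
open import Data.Bool using (Bool; _xor_)
open import Data.Sum using (_⊎_; inj₁; inj₂)
open import Data.Product using (Σ; ∃; ∃-syntax; _×_; _,_; proj₁; proj₂)
open import Relation.Nullary using (¬_)
open import Relation.Binary.PropositionalEquality using (_≡_; _≢_)
open import Relation.Binary.Construct.Closure.ReflexiveTransitive using (Star)
open import Function.Bundles using (_↔_; _⇔_; Inverse)

Cong : ℕ → ℕ → ℕ → Set
Cong n x y = ∃[ k ] ((x ≡ y + k * n) ⊎ (y ≡ x + k * n))

record Graph : Set₁ where
  field
    V   : Set
    Adj : V → V → Set
open Graph public

record Aut (G : Graph) : Set where
  field
    perm     : V G ↔ V G
    preserve : ∀ x y → Adj G x y ⇔ Adj G (Inverse.to perm x) (Inverse.to perm y)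
open Aut public

app : ∀ {G} → Aut G → V G → V G
app σ = Inverse.to (perm σ)

Isomorphic : Graph → Graph → Set
Isomorphic G H = Σ (V G ↔ V H) λ f →
  ∀ x y → Adj G x y ⇔ Adj H (Inverse.to f x) (Inverse.to f y)

_×K₂ : Graph → Graph
G ×K₂ = record
  { V   = V G × Bool
  ; Adj = λ p q → Adj G (proj₁ p) (proj₁ q) × (proj₂ p ≢ proj₂ q)
  }

-- Stability: Aut(G × K₂) ≅ Aut(G) × ℤ₂ as abstract groups.
-- Group operation on automorphisms is composition (equality: pointwise);
-- ℤ₂ is Bool with xor.

_≈AZ_ : ∀ {G} → Aut G × Bool → Aut G × Bool → Set
_≈AZ_ {G} (σ , b) (τ , c) = (∀ x → app σ x ≡ app τ x) × b ≡ c

IsComp : ∀ {G} → Aut G → Aut G → Aut G → Set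
IsComp ρ σ τ = ∀ x → app ρ x ≡ app σ (app τ x)

record GroupIso (H G : Graph) : Set where
  field
    φ        : Aut H → Aut G × Bool
    φ-cong   : ∀ σ τ → (∀ x → app σ x ≡ app τ x) → _≈AZ_ {G} (φ σ) (φ τ)
    φ-inj    : ∀ σ τ → _≈AZ_ {G} (φ σ) (φ τ) → (∀ x → app σ x ≡ app τ x)
    φ-surj   : ∀ y → Σ (Aut H) λ σ → _≈AZ_ {G} (φ σ) y
    φ-hom    : ∀ ρ σ τ → IsComp {H} ρ σ τ →
               IsComp {G} (proj₁ (φ ρ)) (proj₁ (φ σ)) (proj₁ (φ τ)) ×
               proj₂ (φ ρ) ≡ proj₂ (φ σ) xor proj₂ (φ τ)

Stable : Graph → Set
Stable G = GroupIso (G ×K₂) G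

Unstable : Graph → Set
Unstable G = ¬ Stable G

Connected : Graph → Set
Connected G = ∀ x y → Star (Adj G) x y

Bipartite : Graph → Set
Bipartite G = Σ (V G → Bool) λ c → ∀ x y → Adj G x y → c x ≢ c y

HasTwins : Graph → Set
HasTwins G = Σ (V G) λ x → Σ (V G) λ y →
  x ≢ y × (∀ z → Adj G x z ⇔ Adj G y z)

NontriviallyUnstable : Graph → Set
NontriviallyUnstable G =
  Unstable G × Connected G × ¬ Bipartite G × ¬ HasTwins G

EdgeTransitive : Graph → Set
EdgeTransitive G = ∀ x y x' y' → Adj G x y → Adj G x' y' →
  Σ (Aut G) λ σ → ((app σ x ≡ x' × app σ y ≡ y') ⊎ (app σ x ≡ y' × app σ y ≡ x'))

-- Rose Window graph R_n(a,r): vertices u_i = inj₁ i, v_i = inj₂ i (i ∈ ℤ_n)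
-- edges u_i u_{i+1}, v_i v_{i+r}, u_i v_i, u_{i+a} v_i

RWAdj : (n a r : ℕ) → Fin n ⊎ Fin n → Fin n ⊎ Fin n → Set
RWAdj n a r (inj₁ i) (inj₁ j) = Cong n (toℕ i + 1) (toℕ j) ⊎ Cong n (toℕ j + 1) (toℕ i)
RWAdj n a r (inj₂ i) (inj₂ j) = Cong n (toℕ i + r) (toℕ j) ⊎ Cong n (toℕ j + r) (toℕ i)
RWAdj n a r (inj₁ i) (inj₂ j) = Cong n (toℕ i) (toℕ j) ⊎ Cong n (toℕ i) (toℕ j + a)
RWAdj n a r (inj₂ j) (inj₁ i) = Cong n (toℕ i) (toℕ j) ⊎ Cong n (toℕ i) (toℕ j + a)

RW : (n a r : ℕ) → Graph
RW n a r = record { V = Fin n ⊎ Fin n ; Adj = RWAdj n a r }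

RWParams : ℕ → ℕ → ℕ → Set
RWParams n a r = 3 ≤ n × (0 < a × a < n) × (0 < r × r < n)

Odd : ℕ → Set
Odd k = ¬ (2 ∣ k)

Even : ℕ → Set
Even k = 2 ∣ k

W1 : ℕ → ℕ → ℕ → Set
W1 N A R = ∃[ m ] (1 ≤ m × N ≡ 4 * m × A ≡ 2 * m)

W2 : ℕ → ℕ → ℕ → Set
W2 N A R = ∃[ m ] (1 ≤ m × N ≡ 2 * m × Cong N A (m + 2) × Cong N R (m + 1))

W3 : ℕ → ℕ → ℕ → Set
W3 N A R = ∃[ m ] ∃[ d ] (1 ≤ m × N ≡ m × Cong N A (2 * d) × R ≡ 1 ×
  Odd m × 5 ≤ m × (Cong m (d * d) 1 ⊎ Cong m (d * d + 1) 0) ×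
  ¬ Cong m d 1 × ¬ Cong m (d + 1) 0)

W4 : ℕ → ℕ → ℕ → Set
W4 N A R = ∃[ m ] (1 ≤ m × N ≡ 2 * m × A ≢ m × Cong N R (m ∸ 1))

W5 : ℕ → ℕ → ℕ → Set
W5 N A R = ∃[ m ] (1 ≤ m × N ≡ 8 * m × Even A × R ≡ 2 * m)

W6 : ℕ → ℕ → ℕ → Set
W6 N A R = ∃[ m ] (1 ≤ m × N ≡ 4 * m × A ≡ m × Odd m × Odd R × 3 ≤ m)

W7 : ℕ → ℕ → ℕ → Set
W7 N A R = ∃[ m ] (1 ≤ m × N ≡ 2 * m × A ≡ m × Cong N R (m ∸ 1) × Odd m)

W8 : ℕ → ℕ → ℕ → Set
W8 N A R = ∃[ m ] (1 ≤ m × N ≡ 2 * m × A ≡ m × Odd m × Even R ×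
  (Cong m (R * R) 1 ⊎ Cong m (R * R + 1) 0) ×
  ¬ Cong m R 1 × ¬ Cong m (R + 1) 0)

W9 : ℕ → ℕ → ℕ → Set
W9 N A R = ∃[ m ] ∃[ s ] (1 ≤ m × N ≡ 2 * m × Cong N (R + s) m ×
  Cong N (s * s) 1 × Cong N (s * A + A) 0 × A < m)

IsoToFamily : (ℕ → ℕ → ℕ → Set) → Graph → Set
IsoToFamily W G = ∃[ N ] ∃[ A ] ∃[ R ] (RWParams N A R × W N A R × Isomorphic G (RW N A R))

-- Suppose that some automorphism σ of the double cover does not commute with the exchange of its levels.
--
-- If the cover is not edge-transitive, the spokes form an orbit, so σ maps the lines of rim edges to lines of
-- rim edges or of hub edges.  Translations and reflections lift to the cover and commute with the exchange, hence
-- σ may be assumed to fix u₀ and u₁, or to send them to v₀ and v_r.  Then σ is affine on each of the at most two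
-- rim lines, and comparing the images of the spokes and of the hub edges leaves the congruences between a, r
-- and n that define the families.
--
-- If the cover is edge-transitive, the number of walks of given length closing up along an edge is the same for all
-- edges.  These numbers depend only on which of the linear forms x + y a + z r vanish modulo n, that is, on a
-- sublattice of ℤ³; a search over partially known sublattices, whose soundness is proved and which is run by
-- evaluation, leaves few possibilities for a and r.  In these the numbers of walks between the neighbours of a
-- vertex single out a matching of the neighbours that σ respects, and following it shows that σ commutes with the
-- exchange, except for the parameters of W3 and W4.
module Submission where

open import Defs
open import Data.Nat as ℕ using (ℕ; zero; suc)
import Data.Nat.Properties as ℕₚ
open import Data.Integer as ℤ using (ℤ; +_; -[1+_]; _+_; _*_; _-_; -_)
import Data.Integer.Properties as ℤₚ
open import Data.Integer.Tactic.RingSolver using (solve; solve-∀)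
open import Data.Bool using (Bool; true; false; not; _xor_; if_then_else_)
import Data.Bool.Properties as 𝔹ₚ
open import Data.Product using (Σ; _×_; _,_; proj₁; proj₂)
open import Data.Empty using (⊥; ⊥-elim)
open import Relation.Nullary using (¬_; Dec; yes; no; contradiction)
open import Relation.Binary.PropositionalEquality
open import Function using (_∘_)
open import Data.List.Relation.Unary.Any using (Any; here; there)
open import Data.Sum as Sum using (_⊎_; inj₁; inj₂)

-- Everything is constructive, although instability is a negation and edge-transitivity of the cover
-- is not evidently decidable. So no offending σ is ever extracted: the arithmetic conditions behind
-- the families are decided, and where they fail every automorphism of the cover is shown to commute
-- with the exchange, which makes the graph stable. For odd n neither alternative on
-- edge-transitivity is given; there the conditions of W3 are tested, and their failure refutes
-- edge-transitivity.
--
-- The stubborn parameters are 4r = 4, a = r - 3, up to signs. There the matching only shows that σ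
-- preserves or reverses a direction on all edges. The cover is a stack of levels with eight
-- vertices each, closing up with a twist at a height that grows with n. Level-preserving maps are
-- controlled by enumerating their restrictions to 23 consecutive levels: they turn out to have
-- period 12, so that only the residue of the height modulo 12 matters, and finitely many residues
-- are checked.

-- Congruences modulo n and rose window structures on a graph.

module RoseWindow where
  import Data.Nat.Divisibility as ℕ∣
  open import Data.Integer.DivMod using (_%ℕ_; _/ℕ_; a≡a%ℕn+[a/ℕn]*n; n%ℕd<d)
  open import Data.Integer.Divisibility.Signed
  open import Data.Fin using (Fin; toℕ; fromℕ<)
  import Data.Fin.Properties as Finₚ
  open import Data.List using ([]; _∷_)
  open import Data.Sum using (_⊎_; inj₁; inj₂; [_,_])
  open import Function.Bundles using (Equivalence; mk⇔; mk↔ₛ′)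

  open Equivalence using (to; from)

  -- Modular arithmetic

  module Mod (n : ℕ) where

    D : ℤ → Set
    D x = + n ∣ x

    infix 4 _≈_
    -- A record and not a synonym of `D (x - y)`: the type then determines both sides, whereas a
    -- difference does not.
    record _≈_ (x y : ℤ) : Set where
      constructor mk
      field diff : D (x - y)
    open _≈_ public

    D0 : D (+ 0)
    D0 = divides (+ 0) refl

    Dn : D (+ n)
    Dn = ∣-refl

    D? : ∀ x → Dec (D x)
    D? x = + n ∣? x

    lin1 : ∀ {e y} (c : ℤ) → D e → y ≡ c * e → D y
    lin1 c p refl = ∣n⇒∣m*n c p

    lin2 : ∀ {e f y} (c d : ℤ) → D e → D f → y ≡ c * e + d * f → D y
    lin2 c d p q refl = ∣m∣n⇒∣m+n (∣n⇒∣m*n c p) (∣n⇒∣m*n d q)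

    lin3 : ∀ {e f g y} (b c d : ℤ) → D e → D f → D g → y ≡ b * e + (c * f + d * g) → D y
    lin3 b c d p q r refl = ∣m∣n⇒∣m+n (∣n⇒∣m*n b p) (lin2 c d q r refl)

    ≈-reflexive : ∀ {x y} → x ≡ y → x ≈ y
    ≈-reflexive {x} refl = mk (subst D (sym (ℤₚ.+-inverseʳ x)) D0)

    ≈-refl : ∀ {x} → x ≈ x
    ≈-refl = ≈-reflexive refl

    -- The shape of nearly all arithmetic below: the difference in the conclusion is exhibited as an
    -- integer combination of the differences in the hypotheses, and the identity is left to the
    -- ring solver.
    lin₁ : ∀ {u v x y} c → u ≈ v → x - y ≡ c * (u - v) → x ≈ y
    lin₁ c (mk p) e = mk (lin1 c p e)

    lin₂ : ∀ {u v u' v' x y} c d → u ≈ v → u' ≈ v' → x - y ≡ c * (u - v) + d * (u' - v') → x ≈ y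
    lin₂ c d (mk p) (mk q) e = mk (lin2 c d p q e)

    lin₃ : ∀ {u v u' v' u″ v″ x y} b c d → u ≈ v → u' ≈ v' → u″ ≈ v″ →
      x - y ≡ b * (u - v) + (c * (u' - v') + d * (u″ - v″)) → x ≈ y
    lin₃ b c d (mk p) (mk q) (mk r) e = mk (lin3 b c d p q r e)

    ≈-sym : ∀ {x y} → x ≈ y → y ≈ x
    ≈-sym {x} {y} p = lin₁ (- + 1) p (solve (x ∷ y ∷ []))

    ≈-trans : ∀ {x y z} → x ≈ y → y ≈ z → x ≈ z
    ≈-trans {x} {y} {z} p q = lin₂ (+ 1) (+ 1) p q (solve (x ∷ y ∷ z ∷ []))

    _≈?_ : ∀ x y → Dec (x ≈ y)
    x ≈? y with D? (x - y)
    ... | yes p = yes (mk p)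
    ... | no ¬p = no (λ q → ¬p (diff q))

    ≈-via : ∀ {u v x y} → u ≈ v → x - y ≡ u - v → x ≈ y
    ≈-via (mk p) e = mk (subst D (sym e) p)

    ≈-neg-via : ∀ {u v x y} → u ≈ v → y - x ≡ u - v → x ≈ y
    ≈-neg-via p e = ≈-sym (≈-via p e)

    ≈-to : ∀ x y {u v} → u ≈ v → x - y ≡ u - v → x ≈ y
    ≈-to x y = ≈-via

    ≈-to⁻ : ∀ x y {u v} → u ≈ v → y - x ≡ u - v → x ≈ y
    ≈-to⁻ x y = ≈-neg-via

    +-cong≈ : ∀ {x y z w} → x ≈ y → z ≈ w → (x + z) ≈ (y + w)
    +-cong≈ {x} {y} {z} {w} p q = lin₂ (+ 1) (+ 1) p q (solve (x ∷ y ∷ z ∷ w ∷ []))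

    +-congˡ≈ : ∀ {x y} z → x ≈ y → (x + z) ≈ (y + z)
    +-congˡ≈ z p = +-cong≈ p ≈-refl

    +-congʳ≈ : ∀ z {x y} → x ≈ y → (z + x) ≈ (z + y)
    +-congʳ≈ z p = +-cong≈ (≈-refl {z}) p

    *-cong≈ : ∀ c {x y} → x ≈ y → (c * x) ≈ (c * y)
    *-cong≈ c {x} {y} p = lin₁ c p (solve (c ∷ x ∷ y ∷ []))

    neg-cong≈ : ∀ {x y} → x ≈ y → (- x) ≈ (- y)
    neg-cong≈ {x} {y} p = lin₁ (- + 1) p (solve (x ∷ y ∷ []))

    D⇒≈ : ∀ {x} → D x → x ≈ + 0
    D⇒≈ {x} p = mk (subst D (sym (ℤₚ.+-identityʳ x)) p)

    ≈⇒D : ∀ {x} → x ≈ + 0 → D x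
    ≈⇒D {x} (mk p) = subst D (ℤₚ.+-identityʳ x) p

    cong⇒≈ : ∀ {x y} → Cong n x y → + x ≈ + y
    cong⇒≈ {x} {y} (k , inj₁ refl) = mk (divides (+ k) (begin
        + (y ℕ.+ k ℕ.* n) - + y          ≡⟨ cong (_- + y) (ℤₚ.pos-+ y (k ℕ.* n)) ⟩
        (+ y + + (k ℕ.* n)) - + y        ≡⟨ cong (λ z → (+ y + z) - + y) (ℤₚ.pos-* k n) ⟩
        (+ y + + k * + n) - + y          ≡⟨ lem (+ y) (+ k) (+ n) ⟩
        + k * + n ∎))
      where
        open ≡-Reasoning
        lem : ∀ y k n → (y + k * n) - y ≡ k * n
        lem = solve-∀
    cong⇒≈ {x} (k , inj₂ refl) = ≈-sym (cong⇒≈ (k , inj₁ refl))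

    ≈⇒cong : ∀ {x y} → + x ≈ + y → Cong n x y
    ≈⇒cong {x} {y} (mk (divides (+ k) e)) = k , inj₁ (ℤₚ.+-injective (begin
        + x                    ≡⟨ lem (+ x) (+ y) ⟩
        + y + (+ x - + y)      ≡⟨ cong (_+_ (+ y)) (trans e (sym (ℤₚ.pos-* k n))) ⟩
        + y + + (k ℕ.* n)      ≡⟨ sym (ℤₚ.pos-+ y (k ℕ.* n)) ⟩
        + (y ℕ.+ k ℕ.* n) ∎))
      where
        open ≡-Reasoning
        lem : ∀ x y → x ≡ y + (x - y)
        lem = solve-∀
    ≈⇒cong {x} {y} (mk (divides -[1+ k ] e)) = suc k , inj₂ (ℤₚ.+-injective (begin
        + y                           ≡⟨ lem (+ x) (+ y) ⟩
        + x - (+ x - + y)             ≡⟨ cong (_-_ (+ x)) e ⟩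
        + x - (- + suc k * + n)       ≡⟨ lem2 (+ x) (+ suc k) (+ n) ⟩
        + x + + suc k * + n           ≡⟨ cong (_+_ (+ x)) (sym (ℤₚ.pos-* (suc k) n)) ⟩
        + x + + (suc k ℕ.* n)         ≡⟨ sym (ℤₚ.pos-+ x (suc k ℕ.* n)) ⟩
        + (x ℕ.+ suc k ℕ.* n) ∎))
      where
        open ≡-Reasoning
        lem : ∀ x y → y ≡ x - (x - y)
        lem = solve-∀
        lem2 : ∀ x k n → x - (- k * n) ≡ x + k * n
        lem2 = solve-∀

    D⇒∣ : ∀ {x} → D (+ x) → n ℕ∣.∣ x
    D⇒∣ = ∣⇒∣ᵤ

    ¬D-small : ∀ {x} → 0 ℕ.< x → x ℕ.< n → ¬ D (+ x)
    ¬D-small {suc x} _ x<n d = ℕₚ.<⇒≱ x<n (ℕ∣.∣⇒≤ (D⇒∣ d))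

    module _ .{{_ : ℕ.NonZero n}} where

      ι : ℤ → Fin n
      ι x = fromℕ< (n%ℕd<d x n)

      ι≈ : ∀ x → + toℕ (ι x) ≈ x
      ι≈ x = ≈-sym (mk (divides (x /ℕ n) (begin
          x - + toℕ (ι x)                                  ≡⟨ cong (λ z → x - + z) (Finₚ.toℕ-fromℕ< _) ⟩
          x - + (x %ℕ n)                                   ≡⟨ cong (_- + (x %ℕ n)) (a≡a%ℕn+[a/ℕn]*n x n) ⟩
          + (x %ℕ n) + (x /ℕ n) * + n - + (x %ℕ n)         ≡⟨ lem (+ (x %ℕ n)) ((x /ℕ n) * + n) ⟩
          (x /ℕ n) * + n ∎)))
        where
          open ≡-Reasoning
          lem : ∀ x y → x + y - x ≡ y
          lem = solve-∀

      toℕ-≈-inj : ∀ {i j : Fin n} → + toℕ i ≈ + toℕ j → i ≡ j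
      toℕ-≈-inj {i} {j} p = Finₚ.toℕ-injective (go (≈⇒cong p))
        where
          small : ∀ {x y} → x ℕ.< n → ∀ k → x ≡ y ℕ.+ k ℕ.* n → x ≡ y
          small {x} {y} _ zero e = trans e (ℕₚ.+-identityʳ y)
          small {x} {y} x<n (suc k) refl = contradiction x<n (ℕₚ.≤⇒≯ (ℕₚ.≤-trans (ℕₚ.m≤m+n n (k ℕ.* n)) (ℕₚ.m≤n+m _ y)))
          go : Cong n (toℕ i) (toℕ j) → toℕ i ≡ toℕ j
          go (k , inj₁ e) = small (Finₚ.toℕ<n i) k e
          go (k , inj₂ e) = sym (small (Finₚ.toℕ<n j) k e)

      ι-cong : ∀ {x y} → x ≈ y → ι x ≡ ι y
      ι-cong {x} {y} p = toℕ-≈-inj (≈-trans (ι≈ x) (≈-trans p (≈-sym (ι≈ y))))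

      ι-inj : ∀ {x y} → ι x ≡ ι y → x ≈ y
      ι-inj {x} {y} p = ≈-trans (≈-sym (ι≈ x)) (≈-trans (≈-reflexive (cong (λ i → + toℕ i) p)) (ι≈ y))

      ι-toℕ : ∀ i → ι (+ toℕ i) ≡ i
      ι-toℕ i = toℕ-≈-inj (ι≈ _)

  -- Rose window structure on a graph; the parameters are integers, and the type of a
  -- vertex is false for u and true for v.

  RoseAdj : (n : ℕ) (a r : ℤ) → Bool → ℤ → Bool → ℤ → Set
  RoseAdj n a r false x false y = let open Mod n in y ≈ (x + + 1) ⊎ y ≈ (x - + 1)
  RoseAdj n a r false x true  y = let open Mod n in y ≈ x ⊎ y ≈ (x - a)
  RoseAdj n a r true  x false y = let open Mod n in y ≈ x ⊎ y ≈ (x + a)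
  RoseAdj n a r true  x true  y = let open Mod n in y ≈ (x + r) ⊎ y ≈ (x - r)

  -- The graph stays fixed while its labelling varies. Changing the sign of a or r then alters the
  -- structure only, and facts about the graph itself (edge-transitivity, twins, automorphisms of
  -- the cover) need no transport.
  record Rose (G : Graph) (n : ℕ) (a r : ℤ) : Set where
    open Mod n
    field
      vtx      : Bool → ℤ → V G
      vtx-cong : ∀ t {x y} → x ≈ y → vtx t x ≡ vtx t y
      vtx-inj  : ∀ {t t' x y} → vtx t x ≡ vtx t' y → t ≡ t' × x ≈ y
      typ      : V G → Bool
      idx      : V G → ℤ
      vtx-surj : ∀ p → vtx (typ p) (idx p) ≡ p
      adj⇒     : ∀ {t x t' y} → Adj G (vtx t x) (vtx t' y) → RoseAdj n a r t x t' y
      adj⇐     : ∀ {t x t' y} → RoseAdj n a r t x t' y → Adj G (vtx t x) (vtx t' y)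

  module _ (n a r : ℕ) .{{_ : ℕ.NonZero n}} where
    open Mod n

    private
      ve : Bool → ℤ → Fin n ⊎ Fin n
      ve false x = inj₁ (ι x)
      ve true  x = inj₂ (ι x)

      eqn : ∀ x k y → + (toℕ (ι x) ℕ.+ k) ≈ + toℕ (ι y) → (x + + k) ≈ y
      eqn x k y p = ≈-trans (+-congˡ≈ (+ k) (≈-sym (ι≈ x)))
        (≈-trans (≈-reflexive (sym (ℤₚ.pos-+ (toℕ (ι x)) k))) (≈-trans p (ι≈ y)))

      eqn' : ∀ x k y → (x + + k) ≈ y → + (toℕ (ι x) ℕ.+ k) ≈ + toℕ (ι y)
      eqn' x k y p = ≈-trans (≈-reflexive (ℤₚ.pos-+ (toℕ (ι x)) k))
        (≈-trans (+-congˡ≈ (+ k) (ι≈ x)) (≈-trans p (≈-sym (ι≈ y))))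

      eqn0 : ∀ x y → + toℕ (ι x) ≈ + toℕ (ι y) → x ≈ y
      eqn0 x y p = ≈-trans (≈-sym (ι≈ x)) (≈-trans p (ι≈ y))

      eqn0' : ∀ x y → x ≈ y → + toℕ (ι x) ≈ + toℕ (ι y)
      eqn0' x y p = ≈-trans (ι≈ x) (≈-trans p (≈-sym (ι≈ y)))

      flip+ : ∀ {x y k} → (y + k) ≈ x → y ≈ (x - k)
      flip+ {x} {y} {k} p = ≈-via p (solve (x ∷ y ∷ k ∷ []))

      flip- : ∀ {x y k} → y ≈ (x - k) → (y + k) ≈ x
      flip- {x} {y} {k} p = ≈-via p (solve (x ∷ y ∷ k ∷ []))

      a⇒ : ∀ t x t' y → RWAdj n a r (ve t x) (ve t' y) → RoseAdj n (+ a) (+ r) t x t' y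
      a⇒ false x false y (inj₁ c) = inj₁ (≈-sym (eqn x 1 y (cong⇒≈ c)))
      a⇒ false x false y (inj₂ c) = inj₂ (flip+ (eqn y 1 x (cong⇒≈ c)))
      a⇒ false x true y (inj₁ c) = inj₁ (≈-sym (eqn0 x y (cong⇒≈ c)))
      a⇒ false x true y (inj₂ c) = inj₂ (flip+ (eqn y a x (≈-sym (cong⇒≈ c))))
      a⇒ true x false y (inj₁ c) = inj₁ (eqn0 y x (cong⇒≈ c))
      a⇒ true x false y (inj₂ c) = inj₂ (≈-sym (eqn x a y (≈-sym (cong⇒≈ c))))
      a⇒ true x true y (inj₁ c) = inj₁ (≈-sym (eqn x r y (cong⇒≈ c)))
      a⇒ true x true y (inj₂ c) = inj₂ (flip+ (eqn y r x (cong⇒≈ c)))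

      a⇐ : ∀ t x t' y → RoseAdj n (+ a) (+ r) t x t' y → RWAdj n a r (ve t x) (ve t' y)
      a⇐ false x false y (inj₁ c) = inj₁ (≈⇒cong (eqn' x 1 y (≈-sym c)))
      a⇐ false x false y (inj₂ c) = inj₂ (≈⇒cong (eqn' y 1 x (flip- c)))
      a⇐ false x true y (inj₁ c) = inj₁ (≈⇒cong (eqn0' x y (≈-sym c)))
      a⇐ false x true y (inj₂ c) = inj₂ (≈⇒cong (≈-sym (eqn' y a x (flip- c))))
      a⇐ true x false y (inj₁ c) = inj₁ (≈⇒cong (eqn0' y x c))
      a⇐ true x false y (inj₂ c) = inj₂ (≈⇒cong (≈-sym (eqn' x a y (≈-sym c))))
      a⇐ true x true y (inj₁ c) = inj₁ (≈⇒cong (eqn' x r y (≈-sym c)))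
      a⇐ true x true y (inj₂ c) = inj₂ (≈⇒cong (eqn' y r x (flip- c)))

      ty : Fin n ⊎ Fin n → Bool
      ty (inj₁ _) = false
      ty (inj₂ _) = true

      ix : Fin n ⊎ Fin n → ℤ
      ix (inj₁ i) = + toℕ i
      ix (inj₂ i) = + toℕ i

      sj : ∀ p → ve (ty p) (ix p) ≡ p
      sj (inj₁ i) = cong inj₁ (ι-toℕ i)
      sj (inj₂ i) = cong inj₂ (ι-toℕ i)

      cg : ∀ t {x y} → x ≈ y → ve t x ≡ ve t y
      cg false p = cong inj₁ (ι-cong p)
      cg true  p = cong inj₂ (ι-cong p)

      ij : ∀ t t' {x y} → ve t x ≡ ve t' y → t ≡ t' × x ≈ y
      ij false false e = refl , ι-inj (inj₁-inj e)
        where inj₁-inj : ∀ {i j : Fin n} → inj₁ {B = Fin n} i ≡ inj₁ j → i ≡ j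
              inj₁-inj refl = refl
      ij true true e = refl , ι-inj (inj₂-inj e)
        where inj₂-inj : ∀ {i j : Fin n} → inj₂ {A = Fin n} i ≡ inj₂ j → i ≡ j
              inj₂-inj refl = refl
      ij false true ()
      ij true false ()

    rose : Rose (RW n a r) n (+ a) (+ r)
    rose = record
      { vtx = ve ; vtx-cong = cg ; vtx-inj = λ {t} {t'} → ij t t' ; typ = ty ; idx = ix
      ; vtx-surj = sj ; adj⇒ = λ {t} {x} {t'} {y} → a⇒ t x t' y ; adj⇐ = λ {t} {x} {t'} {y} → a⇐ t x t' y }

  module _ {G : Graph} {n : ℕ} where
    open Mod n
    open Rose

    retarget : ∀ {a r a' r'} → a ≈ a' → r ≈ r' → Rose G n a r → Rose G n a' r'
    retarget {a} {r} {a'} {r'} p q P = record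
      { vtx = vtx P ; vtx-cong = vtx-cong P ; vtx-inj = vtx-inj P ; typ = typ P ; idx = idx P
      ; vtx-surj = vtx-surj P
      ; adj⇒ = λ {t} {x} {t'} {y} e → move p q t x t' y (adj⇒ P e)
      ; adj⇐ = λ {t} {x} {t'} {y} e → adj⇐ P (move (≈-sym p) (≈-sym q) t x t' y e) }
      where
        move : ∀ {a r a' r'} → a ≈ a' → r ≈ r' → ∀ t x t' y → RoseAdj n a r t x t' y → RoseAdj n a' r' t x t' y
        move p q false x false y e = e
        move p q false x true y (inj₁ e) = inj₁ e
        move p q false x true y (inj₂ e) = inj₂ (≈-trans e (+-congʳ≈ x (neg-cong≈ p)))
        move p q true x false y (inj₁ e) = inj₁ e
        move p q true x false y (inj₂ e) = inj₂ (≈-trans e (+-congʳ≈ x p))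
        move p q true x true y (inj₁ e) = inj₁ (≈-trans e (+-congʳ≈ x q))
        move p q true x true y (inj₂ e) = inj₂ (≈-trans e (+-congʳ≈ x (neg-cong≈ q)))

    negate-r : ∀ {a r} → Rose G n a r → Rose G n a (- r)
    negate-r {a} {r} P = record
      { vtx = vtx P ; vtx-cong = vtx-cong P ; vtx-inj = vtx-inj P ; typ = typ P ; idx = idx P
      ; vtx-surj = vtx-surj P
      ; adj⇒ = λ {t} {x} {t'} {y} e → f t x t' y (adj⇒ P e)
      ; adj⇐ = λ {t} {x} {t'} {y} e → adj⇐ P (g t x t' y e) }
      where
        f : ∀ t x t' y → RoseAdj n a r t x t' y → RoseAdj n a (- r) t x t' y
        f false x false y e = e
        f false x true y e = e
        f true x false y e = e
        f true x true y (inj₁ e) = inj₂ (≈-via e (solve (x ∷ y ∷ r ∷ [])))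
        f true x true y (inj₂ e) = inj₁ e
        g : ∀ t x t' y → RoseAdj n a (- r) t x t' y → RoseAdj n a r t x t' y
        g false x false y e = e
        g false x true y e = e
        g true x false y e = e
        g true x true y (inj₁ e) = inj₂ e
        g true x true y (inj₂ e) = inj₁ (≈-via e (solve (x ∷ y ∷ r ∷ [])))

    -- Relabelling v_i as v_{i+a} exchanges the two spokes at each vertex.
    negate-a : ∀ {a r} → Rose G n a r → Rose G n (- a) r
    negate-a {a} {r} P = record
      { vtx = vt
      ; vtx-cong = vc
      ; vtx-inj = λ {t} {t'} → vi t t'
      ; typ = typ P ; idx = λ p → ix (typ P p) (idx P p)
      ; vtx-surj = λ p → trans (vs (typ P p) (idx P p)) (vtx-surj P p)
      ; adj⇒ = λ {t} {x} {t'} {y} → f t x t' y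
      ; adj⇐ = λ {t} {x} {t'} {y} → g t x t' y }
      where
        vt : Bool → ℤ → V G
        vt false x = vtx P false x
        vt true  x = vtx P true (x - a)
        ix : Bool → ℤ → ℤ
        ix false x = x
        ix true  x = x + a
        ix-back : ∀ x a → x + a - a ≡ x
        ix-back = solve-∀
        vc : ∀ t {x y} → x ≈ y → vt t x ≡ vt t y
        vc false e = vtx-cong P false e
        vc true  e = vtx-cong P true (+-congˡ≈ (- a) e)
        vi : ∀ t t' {x y} → vt t x ≡ vt t' y → t ≡ t' × x ≈ y
        vi false false e = vtx-inj P e
        vi true true {x} {y} e = refl , ≈-via (proj₂ (vtx-inj P e)) (solve (x ∷ y ∷ a ∷ []))
        vi false true e with () ← proj₁ (vtx-inj P e)
        vi true false e with () ← proj₁ (vtx-inj P e)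
        vs : ∀ t x → vt t (ix t x) ≡ vtx P t x
        vs false x = refl
        vs true x = cong (vtx P true) (ix-back x a)
        f : ∀ t x t' y → Adj G (vt t x) (vt t' y) → RoseAdj n (- a) r t x t' y
        f false x false y e = adj⇒ P e
        f false x true y e with adj⇒ P e
        ... | inj₁ e = inj₂ (≈-via e (solve (x ∷ y ∷ a ∷ [])))
        ... | inj₂ e = inj₁ (≈-via e (solve (x ∷ y ∷ a ∷ [])))
        f true x false y e with adj⇒ P e
        ... | inj₁ e = inj₂ e
        ... | inj₂ e = inj₁ (≈-via e (solve (x ∷ y ∷ a ∷ [])))
        f true x true y e with adj⇒ P e
        ... | inj₁ e = inj₁ (≈-via e (solve (x ∷ y ∷ a ∷ r ∷ [])))
        ... | inj₂ e = inj₂ (≈-via e (solve (x ∷ y ∷ a ∷ r ∷ [])))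
        g : ∀ t x t' y → RoseAdj n (- a) r t x t' y → Adj G (vt t x) (vt t' y)
        g false x false y e = adj⇐ P e
        g false x true y (inj₁ e) = adj⇐ P {false} {x} {true} {y - a} (inj₂ (+-congˡ≈ (- a) e))
        g false x true y (inj₂ e) = adj⇐ P {false} {x} {true} {y - a} (inj₁ (≈-via e (solve (x ∷ y ∷ a ∷ []))))
        g true x false y (inj₁ e) = adj⇐ P {true} {x - a} {false} {y} (inj₂ (≈-via e (solve (x ∷ y ∷ a ∷ []))))
        g true x false y (inj₂ e) = adj⇐ P {true} {x - a} {false} {y} (inj₁ e)
        g true x true y (inj₁ e) = adj⇐ P {true} {x - a} {true} {y - a} (inj₁ (≈-via e (solve (x ∷ y ∷ a ∷ r ∷ []))))
        g true x true y (inj₂ e) = adj⇐ P {true} {x - a} {true} {y - a} (inj₂ (≈-via e (solve (x ∷ y ∷ a ∷ r ∷ []))))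

  rose-iso : ∀ {G H n a r} → Rose G n a r → Rose H n a r → Isomorphic G H
  rose-iso {G} {H} P Q =
      mk↔ₛ′ f g
        (λ y → trans (f-vtx _ _) (Q.vtx-surj y))
        (λ x → trans (g-vtx _ _) (P.vtx-surj x))
    , λ x y → mk⇔ (λ e → Q.adj⇐ (P.adj⇒ (subst₂ (Adj G) (sym (P.vtx-surj x)) (sym (P.vtx-surj y)) e)))
                  (λ e → subst₂ (Adj G) (P.vtx-surj x) (P.vtx-surj y) (P.adj⇐ (Q.adj⇒ e)))
    where
      module P = Rose P
      module Q = Rose Q
      f : V G → V H
      f x = Q.vtx (P.typ x) (P.idx x)
      g : V H → V G
      g y = P.vtx (Q.typ y) (Q.idx y)
      f-vtx : ∀ t x → f (P.vtx t x) ≡ Q.vtx t x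
      f-vtx t x with P.vtx-inj (P.vtx-surj (P.vtx t x))
      ... | p , q = trans (cong (λ t → Q.vtx t _) p) (Q.vtx-cong t q)
      g-vtx : ∀ t x → g (Q.vtx t x) ≡ P.vtx t x
      g-vtx t x with Q.vtx-inj (Q.vtx-surj (Q.vtx t x))
      ... | p , q = trans (cong (λ t → P.vtx t _) p) (P.vtx-cong t q)

-- Automorphisms of the canonical double cover.

module DoubleCover where
  open RoseWindow
  open import Data.List using ([]; _∷_)
  open import Data.Sum using (inj₁; inj₂; [_,_])
  open import Relation.Binary.Construct.Closure.ReflexiveTransitive using (Star; ε; _◅_)
  open import Function.Bundles using (Inverse; Equivalence; mk⇔; mk↔ₛ′)

  open Equivalence using (to; from)

  -- Automorphisms

  module _ {G : Graph} where

    inv : Aut G → V G → V G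
    inv σ = Inverse.from (perm σ)

    app-inv : ∀ σ p → app σ (inv σ p) ≡ p
    app-inv σ p = Inverse.inverseˡ (perm σ) refl

    inv-app : ∀ σ p → inv σ (app σ p) ≡ p
    inv-app σ p = Inverse.inverseʳ (perm σ) refl

    app-injective : ∀ σ {p q} → app σ p ≡ app σ q → p ≡ q
    app-injective σ {p} {q} e = trans (sym (inv-app σ p)) (trans (cong (inv σ) e) (inv-app σ q))

    app-adj : ∀ σ {p q} → Adj G p q → Adj G (app σ p) (app σ q)
    app-adj σ {p} {q} = to (preserve σ p q)

    mkAut : (f g : V G → V G) → (∀ p → f (g p) ≡ p) → (∀ p → g (f p) ≡ p) →
            (∀ {p q} → Adj G p q → Adj G (f p) (f q)) → (∀ {p q} → Adj G p q → Adj G (g p) (g q)) → Aut G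
    mkAut f g fg gf fa ga = record
      { perm = mk↔ₛ′ f g fg gf
      ; preserve = λ p q → mk⇔ fa (λ e → subst₂ (Adj G) (gf p) (gf q) (ga e)) }

    inv-adj : ∀ σ {p q} → Adj G p q → Adj G (inv σ p) (inv σ q)
    inv-adj σ {p} {q} e = from (preserve σ _ _) (subst₂ (Adj G) (sym (app-inv σ p)) (sym (app-inv σ q)) e)

    _⊙_ : Aut G → Aut G → Aut G
    σ ⊙ ρ = mkAut (app σ ∘ app ρ) (inv ρ ∘ inv σ)
      (λ p → trans (cong (app σ) (app-inv ρ _)) (app-inv σ p))
      (λ p → trans (cong (inv ρ) (inv-app σ _)) (inv-app ρ p))
      (app-adj σ ∘ app-adj ρ) (inv-adj ρ ∘ inv-adj σ)

    invert : Aut G → Aut G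
    invert σ = mkAut (inv σ) (app σ) (inv-app σ) (app-inv σ) (inv-adj σ) (app-adj σ)

  not-≢ : ∀ b → b ≢ not b
  not-≢ false ()
  not-≢ true ()

  ≢⇒≡not : ∀ {b c : Bool} → b ≢ c → c ≡ not b
  ≢⇒≡not {false} {false} p = ⊥-elim (p refl)
  ≢⇒≡not {false} {true} p = refl
  ≢⇒≡not {true} {false} p = refl
  ≢⇒≡not {true} {true} p = ⊥-elim (p refl)

  flip : ∀ {A : Set} → A × Bool → A × Bool
  flip (x , b) = x , not b

  Commutes : ∀ {G} → Aut (G ×K₂) → Set
  Commutes σ = ∀ p → app σ (flip p) ≡ flip (app σ p)

  module _ {G : Graph} where

    -- Allows σ to be normalised: translations and reflections commute with `flip`, so it is enough
    -- to treat their product with σ.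
    commutes-cancel : ∀ (ρ σ : Aut (G ×K₂)) → Commutes ρ → Commutes (ρ ⊙ σ) → Commutes σ
    commutes-cancel ρ σ cρ c p = app-injective ρ (trans (c p) (sym (cρ (app σ p))))

    commutes-inv : ∀ (σ : Aut (G ×K₂)) → Commutes σ → ∀ p → inv σ (flip p) ≡ flip (inv σ p)
    commutes-inv σ c p = app-injective σ
      (trans (app-inv σ _) (sym (trans (c _) (cong flip (app-inv σ p)))))

    -- If every automorphism of the cover commutes with the swap of the two levels, then it
    -- descends to G, and connectedness makes its action on the levels uniform.
    stable : Connected G → V G → (∀ σ → Commutes {G} σ) → Stable G
    stable conn x₀ comm = record
      { φ = λ σ → down σ , f σ x₀
      ; φ-cong = λ σ ρ e → (λ x → cong proj₁ (e (x , false))) , cong proj₂ (e (x₀ , false))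
      ; φ-inj = λ σ ρ e p → trans (split σ p) (trans (cong₂ (λ y c → y , proj₂ p xor c) (proj₁ e _) (proj₂ e)) (sym (split ρ p)))
      ; φ-surj = λ { (α , c) → lift α c , ((λ x → refl) , refl) }
      ; φ-hom = λ ρ σ τ e →
          (λ x → trans (cong proj₁ (e (x , false))) (indep σ (proj₁ (app τ (x , false))) _))
        , trans (cong proj₂ (trans (e (x₀ , false)) (split σ _))) (𝔹ₚ.xor-comm (f τ x₀) (f σ x₀)) }
      where
        indep : ∀ σ x b → proj₁ (app σ (x , b)) ≡ proj₁ (app σ (x , false))
        indep σ x false = refl
        indep σ x true = cong proj₁ (comm σ (x , false))
        indep-inv : ∀ σ x b → proj₁ (inv σ (x , b)) ≡ proj₁ (inv σ (x , false))
        indep-inv σ x false = refl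
        indep-inv σ x true = cong proj₁ (commutes-inv σ (comm σ) (x , false))
        f : Aut (G ×K₂) → V G → Bool
        f σ x = proj₂ (app σ (x , false))
        f-adj : ∀ σ {x y} → Adj G x y → f σ x ≡ f σ y
        f-adj σ {x} {y} e =
          trans (sym (𝔹ₚ.not-involutive _)) (trans (cong not (sym (≢⇒≡not (proj₂ (app-adj σ {x , false} {y , true} (e , λ ()))))))
            (trans (cong not (cong proj₂ (comm σ (y , false)))) (𝔹ₚ.not-involutive _)))
        f-star : ∀ σ {x y} → Star (Adj G) x y → f σ x ≡ f σ y
        f-star σ ε = refl
        f-star σ (e ◅ s) = trans (f-adj σ e) (f-star σ s)
        split : ∀ σ p → app σ p ≡ (proj₁ (app σ (proj₁ p , false)) , proj₂ p xor f σ x₀)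
        split σ (x , false) = cong (proj₁ (app σ (x , false)) ,_) (f-star σ (conn x x₀))
        split σ (x , true) = trans (comm σ (x , false)) (cong (λ c → proj₁ (app σ (x , false)) , not c) (f-star σ (conn x x₀)))
        down : Aut (G ×K₂) → Aut G
        down σ = mkAut (λ x → proj₁ (app σ (x , false))) (λ x → proj₁ (inv σ (x , false)))
          (λ x → trans (sym (indep σ _ _)) (cong proj₁ (app-inv σ (x , false))))
          (λ x → trans (sym (indep-inv σ _ _)) (cong proj₁ (inv-app σ (x , false))))
          (λ {x} {y} e → subst (Adj G _) (indep σ y true) (proj₁ (app-adj σ {x , false} {y , true} (e , λ ()))))
          (λ {x} {y} e → subst (Adj G _) (indep-inv σ y true) (proj₁ (inv-adj σ {x , false} {y , true} (e , λ ()))))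
        xor-cancel : ∀ b c → (b xor c) xor c ≡ b
        xor-cancel false false = refl
        xor-cancel false true = refl
        xor-cancel true false = refl
        xor-cancel true true = refl
        xor-≢ : ∀ c {b b'} → b ≢ b' → b xor c ≢ b' xor c
        xor-≢ c {b} {b'} ne e = ne (trans (sym (xor-cancel b c)) (trans (cong (_xor c) e) (xor-cancel b' c)))
        lift : Aut G → Bool → Aut (G ×K₂)
        lift α c = mkAut (λ { (x , b) → app α x , b xor c }) (λ { (x , b) → inv α x , b xor c })
          (λ { (x , b) → cong₂ _,_ (app-inv α x) (xor-cancel b c) })
          (λ { (x , b) → cong₂ _,_ (inv-app α x) (xor-cancel b c) })
          (λ { (e , d) → app-adj α e , xor-≢ c d })
          (λ { (e , d) → inv-adj α e , xor-≢ c d })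

    -- The cover of a connected non-bipartite graph is connected. Here `h x` compares the values at
    -- the two lifts of x and is constant along edges; were it `true`, the values of `f` on one
    -- level would be a proper 2-colouring of the graph.
    cover-constant : Connected G → ¬ Bipartite G → (f : V G × Bool → Bool) →
      (∀ p q → Adj (G ×K₂) p q → f p ≡ f q) → ∀ p q → f p ≡ f q
    cover-constant conn nb f inv (x , b) (y , c) = trans (level x b) (trans (star (conn x y)) (sym (level y c)))
      where
        ad : ∀ {x y} → Adj G x y → ∀ b → f (x , b) ≡ f (y , not b)
        ad e b = inv _ _ (e , not-≢ b)
        h : V G → Bool
        h x = f (x , false) xor f (x , true)
        h-adj : ∀ {x y} → Adj G x y → h x ≡ h y
        h-adj {x} {y} e = trans (cong₂ _xor_ (ad e false) (ad e true)) (𝔹ₚ.xor-comm (f (y , true)) (f (y , false)))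
        h-star : ∀ {x y} → Star (Adj G) x y → h x ≡ h y
        h-star ε = refl
        h-star (e ◅ s) = trans (h-adj e) (h-star s)
        xor-true : ∀ {b c} → b xor c ≡ true → b ≢ c
        xor-true {false} {true} _ ()
        xor-true {true} {false} _ ()
        xor-false : ∀ {b c} → b xor c ≡ false → b ≡ c
        xor-false {false} {false} _ = refl
        xor-false {true} {true} _ = refl
        h-false : ∀ x → h x ≡ false
        h-false x with h x in eq
        ... | false = refl
        ... | true = ⊥-elim (nb ((λ y → f (y , false)) , λ y z e q →
                  xor-true {f (z , false)} {f (z , true)} (trans (h-star (conn z x)) eq) (trans (sym q) (ad e false))))
        lev : ∀ x → f (x , false) ≡ f (x , true)
        lev x = xor-false (h-false x)
        level : ∀ x b → f (x , b) ≡ f (x , false)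
        level x false = refl
        level x true = sym (lev x)
        star : ∀ {x y} → Star (Adj G) x y → f (x , false) ≡ f (y , false)
        star ε = refl
        star {x} (e ◅ s) = trans (ad e false) (trans (level _ true) (star s))

  -- The canonical double cover of a rose window graph

  module Cover {G : Graph} {n : ℕ} {a r : ℤ} (P : Rose G n a r) where
    open Mod n public
    open Rose P public

    Cov : Graph
    Cov = G ×K₂

    C : Bool → ℤ → Bool → V Cov
    C t x b = vtx t x , b

    type : V Cov → Bool
    type p = typ (proj₁ p)

    index : V Cov → ℤ
    index p = idx (proj₁ p)

    C-surj : ∀ p → C (type p) (index p) (proj₂ p) ≡ p
    C-surj p = cong (_, proj₂ p) (vtx-surj (proj₁ p))

    C-cong : ∀ {t b x y} → x ≈ y → C t x b ≡ C t y b
    C-cong {t} {b} e = cong (_, b) (vtx-cong t e)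

    C-inj : ∀ {t t' x y b c} → C t x b ≡ C t' y c → x ≈ y
    C-inj e = proj₂ (vtx-inj (cong proj₁ e))

    C-type : ∀ {t t' x y b c} → C t x b ≡ C t' y c → t ≡ t'
    C-type e = proj₁ (vtx-inj (cong proj₁ e))

    C-level : ∀ {t t' x y b c} → C t x b ≡ C t' y c → b ≡ c
    C-level e = cong proj₂ e

    type-C : ∀ t x b → type (C t x b) ≡ t
    type-C t x b = C-type (C-surj (C t x b))

    cadj⇐ : ∀ {t x t' y b c} → RoseAdj n a r t x t' y → c ≡ not b → Adj Cov (C t x b) (C t' y c)
    cadj⇐ {b = b} e refl = adj⇐ e , not-≢ b

    cadj⇒ : ∀ {t x t' y b c} → Adj Cov (C t x b) (C t' y c) → RoseAdj n a r t x t' y × c ≡ not b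
    cadj⇒ (e , d) = adj⇒ e , ≢⇒≡not d

    img-adj : ∀ (σ : Aut Cov) p q → Adj Cov p q → Adj Cov (app σ p) (app σ q)
    img-adj σ p q = app-adj {Cov} σ {p} {q}

    pre-adj : ∀ (σ : Aut Cov) p q → Adj Cov p q → Adj Cov (inv σ p) (inv σ q)
    pre-adj σ p q = inv-adj {Cov} σ {p} {q}

    -- Coordinates determine a vertex only modulo n, so a map is prescribed on coordinates together
    -- with its compatibility with `≈`; `ext` evaluates it at the chosen representatives.
    record Map : Set where
      field
        on      : Bool → ℤ → Bool → V Cov
        on-cong : ∀ t b {x y} → x ≈ y → on t x b ≡ on t y b
        on-adj  : ∀ t x t' y b → RoseAdj n a r t x t' y → Adj Cov (on t x b) (on t' y (not b))

      ext : V Cov → V Cov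
      ext p = on (type p) (index p) (proj₂ p)

      ext-C : ∀ t x b → ext (C t x b) ≡ on t x b
      ext-C t x b with vtx-inj (vtx-surj (vtx t x))
      ... | e , d = trans (cong (λ t' → on t' (idx (vtx t x)) b) e) (on-cong t b d)

      ext-adj : ∀ {p q} → Adj Cov p q → Adj Cov (ext p) (ext q)
      ext-adj {p} {q} e with cadj⇒ (subst₂ (Adj Cov) (sym (C-surj p)) (sym (C-surj q)) e)
      ... | e' , l = subst (λ c → Adj Cov (ext p) (on (type q) (index q) c)) (sym l)
                       (on-adj (type p) (index p) (type q) (index q) (proj₂ p) e')

    open Map

    autOf : (f g : Map) → (∀ t x b → ext f (on g t x b) ≡ C t x b) → (∀ t x b → ext g (on f t x b) ≡ C t x b) → Aut Cov
    autOf f g fg gf = mkAut (ext f) (ext g)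
      (λ p → trans (fg (type p) (index p) (proj₂ p)) (C-surj p))
      (λ p → trans (gf (type p) (index p) (proj₂ p)) (C-surj p))
      (ext-adj f) (ext-adj g)

    transMap : ℤ → Bool → Map
    transMap c e = record
      { on = λ t x b → C t (x + c) (b xor e)
      ; on-cong = λ t b p → C-cong (+-congˡ≈ c p)
      ; on-adj = λ t x t' y b p → cadj⇐ (h t x t' y p) (sym (𝔹ₚ.not-distribˡ-xor b e)) }
      where
        h : ∀ t x t' y → RoseAdj n a r t x t' y → RoseAdj n a r t (x + c) t' (y + c)
        h false x false y (inj₁ p) = inj₁ (≈-via p (solve (x ∷ y ∷ c ∷ [])))
        h false x false y (inj₂ p) = inj₂ (≈-via p (solve (x ∷ y ∷ c ∷ [])))
        h false x true y (inj₁ p) = inj₁ (≈-via p (solve (x ∷ y ∷ c ∷ [])))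
        h false x true y (inj₂ p) = inj₂ (≈-via p (solve (x ∷ y ∷ c ∷ a ∷ [])))
        h true x false y (inj₁ p) = inj₁ (≈-via p (solve (x ∷ y ∷ c ∷ [])))
        h true x false y (inj₂ p) = inj₂ (≈-via p (solve (x ∷ y ∷ c ∷ a ∷ [])))
        h true x true y (inj₁ p) = inj₁ (≈-via p (solve (x ∷ y ∷ c ∷ r ∷ [])))
        h true x true y (inj₂ p) = inj₂ (≈-via p (solve (x ∷ y ∷ c ∷ r ∷ [])))

    private
      xor-twice : ∀ b e → (b xor e) xor e ≡ b
      xor-twice false false = refl
      xor-twice false true = refl
      xor-twice true false = refl
      xor-twice true true = refl

    translate : ℤ → Bool → Aut Cov
    translate c e = autOf (transMap c e) (transMap (- c) e) fg gf
      where
        fg : ∀ t x b → ext (transMap c e) (C t (x + - c) (b xor e)) ≡ C t x b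
        fg t x b = trans (ext-C (transMap c e) t (x + - c) (b xor e)) (cong₂ (C t) (solve (x ∷ c ∷ [])) (xor-twice b e))
        gf : ∀ t x b → ext (transMap (- c) e) (C t (x + c) (b xor e)) ≡ C t x b
        gf t x b = trans (ext-C (transMap (- c) e) t (x + c) (b xor e)) (cong₂ (C t) (solve (x ∷ c ∷ [])) (xor-twice b e))

    translate-C : ∀ c e t x b → app (translate c e) (C t x b) ≡ C t (x + c) (b xor e)
    translate-C c e t x b = ext-C (transMap c e) t x b

    -- The offset a on the u side makes the two kinds of spokes change places: near becomes far and
    -- far becomes near.
    mirror : ℤ → Bool → ℤ → ℤ
    mirror c false x = c + a - x
    mirror c true  x = c - x

    reflMap : ℤ → Map
    reflMap c = record
      { on = λ t x b → C t (mirror c t x) b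
      ; on-cong = λ t b p → C-cong (mc t p)
      ; on-adj = λ t x t' y b p → cadj⇐ (h t x t' y p) refl }
      where
        mc : ∀ t {x y} → x ≈ y → mirror c t x ≈ mirror c t y
        mc false p = +-congʳ≈ (c + a) (neg-cong≈ p)
        mc true p = +-congʳ≈ c (neg-cong≈ p)
        h : ∀ t x t' y → RoseAdj n a r t x t' y → RoseAdj n a r t (mirror c t x) t' (mirror c t' y)
        h false x false y (inj₁ p) = inj₂ (≈-to⁻ (c + a - y) (c + a - x - + 1) p (solve (x ∷ y ∷ c ∷ a ∷ r ∷ [])))
        h false x false y (inj₂ p) = inj₁ (≈-to⁻ (c + a - y) (c + a - x + + 1) p (solve (x ∷ y ∷ c ∷ a ∷ r ∷ [])))
        h false x true y (inj₁ p) = inj₂ (≈-to⁻ (c - y) (c + a - x - a) p (solve (x ∷ y ∷ c ∷ a ∷ r ∷ [])))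
        h false x true y (inj₂ p) = inj₁ (≈-to⁻ (c - y) (c + a - x) p (solve (x ∷ y ∷ c ∷ a ∷ r ∷ [])))
        h true x false y (inj₁ p) = inj₂ (≈-to⁻ (c + a - y) (c - x + a) p (solve (x ∷ y ∷ c ∷ a ∷ r ∷ [])))
        h true x false y (inj₂ p) = inj₁ (≈-to⁻ (c + a - y) (c - x) p (solve (x ∷ y ∷ c ∷ a ∷ r ∷ [])))
        h true x true y (inj₁ p) = inj₂ (≈-to⁻ (c - y) (c - x - r) p (solve (x ∷ y ∷ c ∷ a ∷ r ∷ [])))
        h true x true y (inj₂ p) = inj₁ (≈-to⁻ (c - y) (c - x + r) p (solve (x ∷ y ∷ c ∷ a ∷ r ∷ [])))

    reflect : ℤ → Aut Cov
    reflect c = autOf (reflMap c) (reflMap c) ff ff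
      where
        mm : ∀ t x → mirror c t (mirror c t x) ≡ x
        mm false x = eq c a x
          where eq : ∀ c a x → c + a - (c + a - x) ≡ x
                eq = solve-∀
        mm true x = eq c x
          where eq : ∀ c x → c - (c - x) ≡ x
                eq = solve-∀
        ff : ∀ t x b → ext (reflMap c) (C t (mirror c t x) b) ≡ C t x b
        ff t x b = trans (ext-C (reflMap c) t _ b) (cong (λ z → C t z b) (mm t x))

    reflect-C : ∀ c t x b → app (reflect c) (C t x b) ≡ C t (mirror c t x) b
    reflect-C c t x b = ext-C (reflMap c) t x b

    translate-commutes : ∀ c e → Commutes {G} (translate c e)
    translate-commutes c e p = cong (C (type p) (index p + c)) (sym (𝔹ₚ.not-distribˡ-xor (proj₂ p) e))

    reflect-commutes : ∀ c → Commutes {G} (reflect c)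
    reflect-commutes c p = refl

-- Partially known lattices of linear forms and a sound search over them.

module LinearForms where
  open RoseWindow
  open import Data.Integer.DivMod using (_/ℕ_)
  open import Data.Bool using (Bool; true; false; _∧_; _∨_; if_then_else_; T)
  open import Data.List as List using (List; []; _∷_; map)
  open import Data.List.Relation.Unary.All using (All; []; _∷_)
  open import Data.Maybe using (Maybe; just; nothing)
  open import Data.Sum using (_⊎_; inj₁; inj₂; [_,_])
  open import Relation.Nullary using (¬_; Dec; yes; no; contradiction)

  -- Linear forms x + y a + z r

  record Form : Set where
    no-eta-equality
    pattern
    constructor ⟨_,_,_⟩
    field c1 ca cr : ℤ
  open Form public

  _⊞_ : Form → Form → Form
  ⟨ x , y , z ⟩ ⊞ ⟨ x' , y' , z' ⟩ = ⟨ x + x' , y + y' , z + z' ⟩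

  _⊡_ : ℤ → Form → Form
  q ⊡ ⟨ x , y , z ⟩ = ⟨ q * x , q * y , q * z ⟩

  ⊟_ : Form → Form
  ⊟ ⟨ x , y , z ⟩ = ⟨ - x , - y , - z ⟩

  0F : Form
  0F = ⟨ + 0 , + 0 , + 0 ⟩

  infix 7 _==ℤ_ _==F_

  _==ℤ_ : ℤ → ℤ → Bool
  (+ m) ==ℤ (+ n) = m ℕ.≡ᵇ n
  -[1+ m ] ==ℤ -[1+ n ] = m ℕ.≡ᵇ n
  _ ==ℤ _ = false

  _==F_ : Form → Form → Bool
  ⟨ x , y , z ⟩ ==F ⟨ x' , y' , z' ⟩ = x ==ℤ x' ∧ (y ==ℤ y' ∧ z ==ℤ z')

  ∧-true : ∀ {b c} → b ∧ c ≡ true → b ≡ true × c ≡ true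
  ∧-true {true} {true} _ = refl , refl

  ==ℤ-sound : ∀ x y → x ==ℤ y ≡ true → x ≡ y
  ==ℤ-sound (+ m) (+ n) e = cong +_ (ℕₚ.≡ᵇ⇒≡ m n (subst T (sym e) _))
  ==ℤ-sound -[1+ m ] -[1+ n ] e = cong -[1+_] (ℕₚ.≡ᵇ⇒≡ m n (subst T (sym e) _))

  ==F-sound : ∀ f g → f ==F g ≡ true → f ≡ g
  ==F-sound ⟨ x , y , z ⟩ ⟨ x' , y' , z' ⟩ e with ∧-true {x ==ℤ x'} e
  ... | p , q with ∧-true {y ==ℤ y'} q
  ... | q , s rewrite ==ℤ-sound x x' p | ==ℤ-sound y y' q | ==ℤ-sound z z' s = refl

  -- A sublattice of ℤ³ in echelon form; a zero vector stands for an absent pivot.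
  record Basis : Set where
    no-eta-equality
    pattern
    constructor basis
    field br ba b1 : Form

  -- A zero pivot gets quotient 0, so an absent basis vector changes nothing. Soundness holds for
  -- any choice of quotient, since only multiples of basis vectors are ever subtracted.
  quot : ℤ → ℤ → ℤ
  quot x (+ suc k) = x /ℕ suc k
  quot x (+ zero) = + 0
  quot x -[1+ k ] = - (x /ℕ suc k)

  eliminate : (Form → ℤ) → Form → Form → Form
  eliminate p b f = f ⊞ ((- quot (p f) (p b)) ⊡ b)

  reduce : Basis → Form → Form
  reduce (basis br ba b1) f = eliminate c1 b1 (eliminate ca ba (eliminate cr br f))

  positive : (Form → ℤ) → Form → Form
  positive p f with p f
  ... | + _ = f
  ... | -[1+ _ ] = ⊟ f

  -- The fuel affects only the quality of the echelon form. What is used about the result is that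
  -- both forms still lie in the lattice, which is true after any number of steps; a poor basis
  -- could make a run return `false`, never a wrong `true`.
  euclid : ℕ → (Form → ℤ) → Form → Form → Form × Form
  euclid zero p g f = g , f
  euclid (suc k) p g f = if p f ==ℤ + 0 then (positive p g , f) else euclid k p f (eliminate p f g)

  euclid′ : (Form → ℤ) → Form → Form → Form × Form
  euclid′ p g f = euclid (ℤ.∣ p g ∣ ℕ.+ (ℤ.∣ p f ∣ ℕ.+ 2)) p g f

  insertForm : Basis → Form → Basis
  insertForm (basis br ba b1) f =
    let br' , f₁ = euclid′ cr br f
        ba' , f₂ = euclid′ ca ba f₁
        b1' , _  = euclid′ c1 b1 f₂
    in basis br' ba' b1'

  data Status : Set where
    inside outside unknown : Status

  elem : List Form → Form → Bool
  elem [] f = false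
  elem (g ∷ gs) f = (g ==F f) ∨ elem gs f

  -- A form is `outside` only if it matches an excluded form modulo the basis. Lattices are closed
  -- under negation, so the negative is looked up as well, reduced once more because negation
  -- destroys the normal form.
  status : Basis → List Form → Form → Status
  status B N f = if g ==F 0F then inside else (if elem N g then outside else
                   (if elem N (reduce B (⊟ g)) then outside else unknown))
    where g = reduce B f

  Count : Set
  Count = List (Form × ℕ)

  -- `lo` takes the forms known to vanish, `hi` also the undecided ones; `open?` keeps one undecided
  -- form to branch on, and `nothing` there certifies that the value is exact.
  record Interval : Set where
    no-eta-equality
    pattern
    constructor interval
    field
      lo hi : ℕ
      open? : Maybe Form
  open Interval

  orElse : Maybe Form → Maybe Form → Maybe Form
  orElse (just f) _ = just f
  orElse nothing m = m

  weigh : Form → ℕ → Status → Interval → Interval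
  weigh f m inside (interval l h u) = interval (m ℕ.+ l) (m ℕ.+ h) u
  weigh f m outside i = i
  weigh f m unknown (interval l h u) = interval l (m ℕ.+ h) (just f)

  bounds : Basis → List Form → Count → Interval
  bounds B N [] = interval 0 0 nothing
  bounds B N ((f , m) ∷ ws) = weigh f m (status B N f) (bounds B N ws)

  squares : Basis → List Form → List Count → Interval
  squares B N [] = interval 0 0 nothing
  squares B N (c ∷ cs) with bounds B N c | squares B N cs
  ... | interval l h u | interval l' h' u' = interval (l ℕ.* l ℕ.+ l') (h ℕ.* h ℕ.+ h') (orElse u u')

  -- The members of a constraint have one common value, which lies above the largest lower bound and
  -- below the smallest upper bound.
  lowest highest : List Interval → ℕ
  lowest [] = 0
  lowest (interval l h u ∷ is) = l ℕ.⊔ lowest is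
  highest [] = 0
  highest (interval l h u ∷ []) = h
  highest (interval l h u ∷ i ∷ is) = h ℕ.⊓ highest (i ∷ is)

  firstOpen : List Interval → Maybe Form
  firstOpen [] = nothing
  firstOpen (interval _ _ u ∷ is) = orElse u (firstOpen is)

  data Verdict : Set where
    absurd  : Verdict
    branch  : Form → Verdict
    decided : Verdict

  judge : Basis → List Form → List (List (List Count)) → Verdict
  judge B N [] = decided
  judge B N (con ∷ cons) = go (map (squares B N) con)
    where
      go : List Interval → Verdict
      go is = if highest is ℕ.<ᵇ lowest is then absurd else next (firstOpen is)
        where next : Maybe Form → Verdict
              next (just f) = branch f
              next nothing = judge B N cons

  -- A problem: balance constraints, alternative conclusions, and a final test on further counts.
  record Problem : Set where
    constructor problem
    field
      cons  : List (List (List Count))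
      goals : List (List Form)
      final : List Count
      test  : List ℕ → Bool

  allInside : Basis → List Form → Bool
  allInside B [] = true
  allInside B (f ∷ fs) = (reduce B f ==F 0F) ∧ allInside B fs

  anyGoal : Basis → List (List Form) → Bool
  anyGoal B [] = false
  anyGoal B (g ∷ gs) = allInside B g ∨ anyGoal B gs

  -- A branch is contradictory when 0 appears among the excluded forms. A split on f either adjoins
  -- f to the basis and reduces the excluded forms anew, or excludes f; the fuel bounds the number
  -- of splits along a branch.
  search : Problem → ℕ → Basis → List Form → Bool
  search P zero B N = false
  search P (suc k) B N = elem N 0F ∨ (anyGoal B (Problem.goals P) ∨ react (judge B N (Problem.cons P)))
    where
      split : Form → Bool
      split f = let B' = insertForm B f in
        search P k B' (map (reduce B') N) ∧ search P k B (reduce B f ∷ N)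
      conclude : List Interval → Bool
      conclude is = next (firstOpen is)
        where next : Maybe Form → Bool
              next (just f) = split f
              next nothing = Problem.test P (map lo is)
      react : Verdict → Bool
      react absurd = true
      react (branch f) = split f
      react decided = conclude (map (bounds B N) (Problem.final P))

  run : Problem → ℕ → List Form → List Form → Bool
  run P k ins outs = let B = List.foldr (λ f B → insertForm B f) (basis 0F 0F 0F) ins in search P k B (map (reduce B) outs)

  indicator : ∀ {A : Set} → Dec A → ℕ
  indicator (yes _) = 1
  indicator (no _)  = 0

  indicator-yes : ∀ {A : Set} (d : Dec A) → A → indicator d ≡ 1
  indicator-yes (yes _) _ = refl
  indicator-yes (no ¬p) p = contradiction p ¬p

  indicator-no : ∀ {A : Set} (d : Dec A) → ¬ A → indicator d ≡ 0
  indicator-no (yes p) ¬p = contradiction p ¬p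
  indicator-no (no _) _ = refl

  module Lattice (n : ℕ) (a r : ℤ) where
    open Mod n

    -- Opaque because integer multiplication unfolds during conversion checking.
    opaque
      ev : Form → ℤ
      ev ⟨ x , y , z ⟩ = x + y * a + z * r

      ev≡ : ∀ x y z → ev ⟨ x , y , z ⟩ ≡ x + y * a + z * r
      ev≡ x y z = refl

    ev-⊞ : ∀ f q b → ev (f ⊞ (q ⊡ b)) ≡ ev f + q * ev b
    ev-⊞ ⟨ x , y , z ⟩ q ⟨ x' , y' , z' ⟩ = trans (ev≡ _ _ _) (trans (lem x y z x' y' z' q a r)
        (sym (cong₂ (λ u v → u + q * v) (ev≡ x y z) (ev≡ x' y' z'))))
      where lem : ∀ x y z x' y' z' q a r → (x + q * x') + (y + q * y') * a + (z + q * z') * r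
                    ≡ (x + y * a + z * r) + q * (x' + y' * a + z' * r)
            lem = solve-∀

    ev-+ : ∀ f g → ev (f ⊞ g) ≡ ev f + ev g
    ev-+ ⟨ x , y , z ⟩ ⟨ x' , y' , z' ⟩ = trans (ev≡ _ _ _) (trans (lem x y z x' y' z' a r)
        (sym (cong₂ _+_ (ev≡ x y z) (ev≡ x' y' z'))))
      where lem : ∀ x y z x' y' z' a r → (x + x') + (y + y') * a + (z + z') * r
                    ≡ (x + y * a + z * r) + (x' + y' * a + z' * r)
            lem = solve-∀

    ev-⊟ : ∀ f → ev (⊟ f) ≡ - ev f
    ev-⊟ ⟨ x , y , z ⟩ = trans (ev≡ _ _ _) (trans (lem x y z a r) (cong -_ (sym (ev≡ x y z))))
      where lem : ∀ x y z a r → (- x) + (- y) * a + (- z) * r ≡ - (x + y * a + z * r)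
            lem = solve-∀

    ev-0 : ev 0F ≡ + 0
    ev-0 = trans (ev≡ _ _ _) (lem a r)
      where lem : ∀ a r → + 0 + + 0 * a + + 0 * r ≡ + 0
            lem = solve-∀

    L : Form → Set
    L f = D (ev f)

    ind : Form → ℕ
    ind f = indicator (D? (ev f))

    ind-in : ∀ {f} → L f → ind f ≡ 1
    ind-in p = indicator-yes (D? _) p

    ind-out : ∀ {f} → ¬ L f → ind f ≡ 0
    ind-out p = indicator-no (D? _) p

    count : Count → ℕ
    count [] = 0
    count ((f , m) ∷ ws) = m ℕ.* ind f ℕ.+ count ws

    energy : List Count → ℕ
    energy [] = 0
    energy (c ∷ cs) = count c ℕ.* count c ℕ.+ energy cs

    Balanced : List (List Count) → Set
    Balanced con = Σ ℕ λ v → All (λ q → energy q ≡ v) con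

    L-sub : ∀ {f} q {b} → L f → L b → L (f ⊞ (q ⊡ b))
    L-sub {f} q {b} p p' = subst D (sym (ev-⊞ f q b)) (lin2 (+ 1) q p p' (lem (ev f) (ev b) q))
      where lem : ∀ e b q → e + q * b ≡ + 1 * e + q * b
            lem = solve-∀

    L-unsub : ∀ {f} q {b} → L b → L (f ⊞ (q ⊡ b)) → L f
    L-unsub {f} q {b} p p' = lin2 (+ 1) (- q) (subst D (ev-⊞ f q b) p') p (lem (ev f) (ev b) q)
      where lem : ∀ e b q → e ≡ + 1 * (e + q * b) + (- q) * b
            lem = solve-∀

    L-neg : ∀ {f} → L f → L (⊟ f)
    L-neg {f} p = lin1 (- + 1) p (trans (ev-⊟ f) (lem (ev f)))
      where lem : ∀ e → - e ≡ (- + 1) * e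
            lem = solve-∀

    L0 : L 0F
    L0 = subst D (sym ev-0) D0

    -- The basis spans a known part of the lattice of forms whose value n divides. Nothing is
    -- claimed about the rest, and this is what allows reasoning without knowing n, a and r.
    LB : Basis → Set
    LB (basis x y z) = L x × L y × L z

    reduce⇒ : ∀ B {f} → LB B → L f → L (reduce B f)
    reduce⇒ (basis _ _ _) (x , y , z) p = L-sub _ (L-sub _ (L-sub _ p x) y) z

    reduce⇐ : ∀ B {f} → LB B → L (reduce B f) → L f
    reduce⇐ (basis _ _ _) (x , y , z) p = L-unsub _ x (L-unsub _ y (L-unsub _ z p))

    L-positive : ∀ p {f} → L f → L (positive p f)
    L-positive p {f} h with p f
    ... | + _ = h
    ... | -[1+ _ ] = L-neg {f} h

    L-euclid : ∀ k p {g f} → L g → L f → L (proj₁ (euclid k p g f)) × L (proj₂ (euclid k p g f))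
    L-euclid zero p lg lf = lg , lf
    L-euclid (suc k) p {g} {f} lg lf with p f ==ℤ + 0
    ... | true = L-positive p lg , lf
    ... | false = L-euclid k p lf (L-sub _ lg lf)

    L-euclid′ : ∀ p {g f} → L g → L f → L (proj₁ (euclid′ p g f)) × L (proj₂ (euclid′ p g f))
    L-euclid′ p {g} {f} = L-euclid (ℤ.∣ p g ∣ ℕ.+ (ℤ.∣ p f ∣ ℕ.+ 2)) p

    LB-insert : ∀ B {f} → LB B → L f → LB (insertForm B f)
    LB-insert (basis br ba b1) {f} (x , y , z) p =
      let x' , p₁ = L-euclid′ cr x p
          y' , p₂ = L-euclid′ ca y p₁
          z' , _  = L-euclid′ c1 z p₂
      in x' , y' , z'

    Out : List Form → Set
    Out = All (λ f → ¬ L f)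

    elem-out : ∀ N f → Out N → elem N f ≡ true → ¬ L f
    elem-out (g ∷ N) f (o ∷ os) e with g ==F f in eq
    ... | true = subst (λ h → ¬ L h) (==F-sound g f eq) o
    ... | false = elem-out N f os e

    Means : Form → Status → Set
    Means f inside = L f
    Means f outside = ¬ L f
    Means f unknown = L f ⊎ ¬ L f

    L? : ∀ f → L f ⊎ ¬ L f
    L? f with D? (ev f)
    ... | yes p = inj₁ p
    ... | no p = inj₂ p

    status-sound : ∀ B N f → LB B → Out N → Means f (status B N f)
    status-sound B N f lb o with reduce B f ==F 0F in e₁
    ... | true = reduce⇐ B lb (subst L (sym (==F-sound _ _ e₁)) L0)
    ... | false with elem N (reduce B f) in e₂
    ... | true = elem-out N _ o e₂ ∘ reduce⇒ B lb
    ... | false with elem N (reduce B (⊟ reduce B f)) in e₃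
    ... | true = elem-out N _ o e₃ ∘ reduce⇒ B lb ∘ L-neg {reduce B f} ∘ reduce⇒ B lb
    ... | false = L? f

    Bounds : Interval → ℕ → Set
    Bounds i v = lo i ℕ.≤ v × v ℕ.≤ hi i × (open? i ≡ nothing → v ≡ lo i)

    bounds-sound : ∀ B N → LB B → Out N → ∀ c → Bounds (bounds B N c) (count c)
    bounds-sound B N lb o [] = ℕ.z≤n , ℕ.z≤n , λ _ → refl
    bounds-sound B N lb o ((f , m) ∷ ws) with bounds B N ws | bounds-sound B N lb o ws
    ... | interval l h u | p , q , t with status B N f | status-sound B N f lb o
    ... | inside | s rewrite ind-in {f} s | ℕₚ.*-identityʳ m =
          ℕₚ.+-monoʳ-≤ m p , ℕₚ.+-monoʳ-≤ m q , λ e → cong (m ℕ.+_) (t e)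
    ... | outside | s rewrite ind-out {f} s | ℕₚ.*-zeroʳ m = p , q , t
    ... | unknown | inj₁ s rewrite ind-in {f} s | ℕₚ.*-identityʳ m =
          ℕₚ.≤-trans p (ℕₚ.m≤n+m _ m) , ℕₚ.+-monoʳ-≤ m q , λ ()
    ... | unknown | inj₂ s rewrite ind-out {f} s | ℕₚ.*-zeroʳ m = p , ℕₚ.≤-trans q (ℕₚ.m≤n+m _ m) , λ ()

    orElse-nothing : ∀ u v → orElse u v ≡ nothing → u ≡ nothing × v ≡ nothing
    orElse-nothing nothing v e = refl , e

    squares-sound : ∀ B N → LB B → Out N → ∀ q → Bounds (squares B N q) (energy q)
    squares-sound B N lb o [] = ℕ.z≤n , ℕ.z≤n , λ _ → refl
    squares-sound B N lb o (c ∷ cs) with bounds B N c | bounds-sound B N lb o c | squares B N cs | squares-sound B N lb o cs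
    ... | interval l h u | p , q , t | interval l' h' u' | p' , q' , t' =
        ℕₚ.+-mono-≤ (ℕₚ.*-mono-≤ p p) p' , ℕₚ.+-mono-≤ (ℕₚ.*-mono-≤ q q) q'
      , λ e → let e₁ , e₂ = orElse-nothing u u' e in cong₂ (λ x y → x ℕ.* x ℕ.+ y) (t e₁) (t' e₂)

    lowest-sound : ∀ B N → LB B → Out N → ∀ {v} con → All (λ q → energy q ≡ v) con → lowest (map (squares B N) con) ℕ.≤ v
    lowest-sound B N lb o [] _ = ℕ.z≤n
    lowest-sound B N lb o (q ∷ con) (refl ∷ es) with squares B N q | squares-sound B N lb o q
    ... | interval l h u | p , _ = ℕₚ.⊔-lub p (lowest-sound B N lb o con es)

    highest-sound : ∀ B N → LB B → Out N → ∀ {v} q con → All (λ q → energy q ≡ v) (q ∷ con) → v ℕ.≤ highest (map (squares B N) (q ∷ con))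
    highest-sound B N lb o q [] (refl ∷ es) with squares B N q | squares-sound B N lb o q
    ... | interval l h u | _ , p , _ = p
    highest-sound B N lb o q (q' ∷ con) (refl ∷ es) with squares B N q | squares-sound B N lb o q
    ... | interval l h u | _ , p , _ = ℕₚ.⊓-glb p (highest-sound B N lb o q' con es)

    lowest≤highest : ∀ B N → LB B → Out N → ∀ con → Balanced con → lowest (map (squares B N) con) ℕ.≤ highest (map (squares B N) con)
    lowest≤highest B N lb o [] _ = ℕ.z≤n
    lowest≤highest B N lb o (q ∷ con) (v , es) = ℕₚ.≤-trans (lowest-sound B N lb o (q ∷ con) es) (highest-sound B N lb o q con es)

    judge-sound : ∀ B N → LB B → Out N → ∀ cons → All Balanced cons → judge B N cons ≢ absurd
    judge-sound B N lb o (con ∷ cons) (bal ∷ bs) e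
      with highest (map (squares B N) con) ℕ.<ᵇ lowest (map (squares B N) con) in eq
    ... | true = ℕₚ.<⇒≱ (ℕₚ.<ᵇ⇒< _ _ (subst T (sym eq) _)) (lowest≤highest B N lb o con bal)
    ... | false with firstOpen (map (squares B N) con)
    judge-sound B N lb o (con ∷ cons) (bal ∷ bs) () | false | just f
    ... | nothing = judge-sound B N lb o cons bs e

    record Solved (P : Problem) : Set where
      constructor solved
      field outcome : Any (All L) (Problem.goals P) ⊎ Problem.test P (map count (Problem.final P)) ≡ true

    allInside-sound : ∀ B → LB B → ∀ fs → allInside B fs ≡ true → All L fs
    allInside-sound B lb [] e = []
    allInside-sound B lb (f ∷ fs) e with ∧-true {reduce B f ==F 0F} e
    ... | p , q = reduce⇐ B lb (subst L (sym (==F-sound _ _ p)) L0) ∷ allInside-sound B lb fs q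

    anyGoal-sound : ∀ B → LB B → ∀ gs → anyGoal B gs ≡ true → Any (All L) gs
    anyGoal-sound B lb (g ∷ gs) e with allInside B g in eq
    ... | true = here (allInside-sound B lb g eq)
    ... | false = there (anyGoal-sound B lb gs e)

    firstOpen-nothing : ∀ B N → LB B → Out N → ∀ cs → firstOpen (map (bounds B N) cs) ≡ nothing →
      map lo (map (bounds B N) cs) ≡ map count cs
    firstOpen-nothing B N lb o [] e = refl
    firstOpen-nothing B N lb o (c ∷ cs) e with bounds B N c | bounds-sound B N lb o c
    ... | interval l h u | _ , _ , t with orElse-nothing u _ e
    ... | e₁ , e₂ = cong₂ _∷_ (sym (t e₁)) (firstOpen-nothing B N lb o cs e₂)

    out-reduce : ∀ B → LB B → ∀ {N} → Out N → Out (map (reduce B) N)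
    out-reduce B lb [] = []
    out-reduce B lb (o ∷ os) = (o ∘ reduce⇐ B lb) ∷ out-reduce B lb os

    -- Both branches of a split have succeeded, and divisibility by n is decidable, so the actual n,
    -- a, r choose the branch to follow. A branch closed as `absurd` would contradict the equality
    -- of the energies.
    search-sound : ∀ P k B N → LB B → Out N → All Balanced (Problem.cons P) → search P k B N ≡ true → Solved P
    search-sound P (suc k) B N lb o bal e with elem N 0F in e₁
    ... | true = ⊥-elim (elem-out N 0F o e₁ L0)
    ... | false with anyGoal B (Problem.goals P) in e₂
    ... | true = solved (inj₁ (anyGoal-sound B lb _ e₂))
    ... | false with judge B N (Problem.cons P) in e₃
    ... | absurd = ⊥-elim (judge-sound B N lb o (Problem.cons P) bal e₃)
    ... | branch f = splitting f e
      where
        splitting : ∀ f → search P k (insertForm B f) (map (reduce (insertForm B f)) N) ∧ search P k B (reduce B f ∷ N) ≡ true → Solved P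
        splitting f e with ∧-true {search P k (insertForm B f) (map (reduce (insertForm B f)) N)} e | L? f
        ... | p , q | inj₁ l = let lb' = LB-insert B lb l in
                search-sound P k (insertForm B f) _ lb' (out-reduce (insertForm B f) lb' o) bal p
        ... | p , q | inj₂ ¬l = search-sound P k B _ lb ((¬l ∘ reduce⇐ B lb) ∷ o) bal q
    ... | decided with firstOpen (map (bounds B N) (Problem.final P)) in e₄
    ... | nothing = solved (inj₂ (trans (cong (Problem.test P) (sym (firstOpen-nothing B N lb o (Problem.final P) e₄))) e))
    ... | just f = splitting f e
      where
        splitting : ∀ f → search P k (insertForm B f) (map (reduce (insertForm B f)) N) ∧ search P k B (reduce B f ∷ N) ≡ true → Solved P
        splitting f e with ∧-true {search P k (insertForm B f) (map (reduce (insertForm B f)) N)} e | L? f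
        ... | p , q | inj₁ l = let lb' = LB-insert B lb l in
                search-sound P k (insertForm B f) _ lb' (out-reduce (insertForm B f) lb' o) bal p
        ... | p , q | inj₂ ¬l = search-sound P k B _ lb ((¬l ∘ reduce⇐ B lb) ∷ o) bal q

    run-sound : ∀ P k ins outs → All L ins → Out outs → All Balanced (Problem.cons P) → run P k ins outs ≡ true → Solved P
    run-sound P k ins outs li lo bal e = search-sound P k _ _ lb (out-reduce _ lb lo) bal e
      where
        go : ∀ ins → All L ins → LB (List.foldr (λ f B → insertForm B f) (basis 0F 0F 0F) ins)
        go [] [] = L0 , L0 , L0
        go (f ∷ fs) (l ∷ ls) = LB-insert _ (go fs ls) l
        lb = go ins li

-- Symbolic walks and the constraints fed to the search.

module SymbolicWalks where
  open RoseWindow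
  open LinearForms
  open import Data.Bool using (Bool; true; false; not; _∧_; if_then_else_)
  open import Data.List as List using (List; []; _∷_; map)

  -- Symbolic walks from a vertex of type t and index given by a linear form

  Place : Set
  Place = Bool × Form

  data Dir : Set where
    fwd bwd near far : Dir

  dirs : List Dir
  dirs = fwd ∷ bwd ∷ near ∷ far ∷ []

  target : Bool → Dir → Bool
  target false fwd = false
  target false bwd = false
  target false _   = true
  target true fwd = true
  target true bwd = true
  target true _   = false

  offset : Bool → Dir → Form
  offset false fwd = ⟨ + 1 , + 0 , + 0 ⟩
  offset false bwd = ⟨ - + 1 , + 0 , + 0 ⟩
  offset false far = ⟨ + 0 , - + 1 , + 0 ⟩
  offset true fwd = ⟨ + 0 , + 0 , + 1 ⟩
  offset true bwd = ⟨ + 0 , + 0 , - + 1 ⟩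
  offset true far = ⟨ + 0 , + 1 , + 0 ⟩
  offset _ near = 0F

  neighbour : Place → Dir → Place
  neighbour (t , f) d = target t d , f ⊞ offset t d

  neighbours : Place → List Place
  neighbours s = map (neighbour s) dirs

  _==B_ : Bool → Bool → Bool
  true ==B b = b
  false ==B b = not b

  _==P_ : Place → Place → Bool
  (t , f) ==P (t' , f') = (t ==B t') ∧ (f ==F f')

  Weighted : Set
  Weighted = List (Place × ℕ)

  add : Place → ℕ → Weighted → Weighted
  add s m [] = (s , m) ∷ []
  add s m ((s' , m') ∷ w) = if s ==P s' then (s' , m ℕ.+ m') ∷ w else (s' , m') ∷ add s m w

  addAll : List Place → ℕ → Weighted → Weighted
  addAll [] m w = w
  addAll (s ∷ ss) m w = add s m (addAll ss m w)

  advance : Weighted → Weighted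
  advance [] = []
  advance ((s , m) ∷ w) = addAll (neighbours s) m (advance w)

  walk : ℕ → Weighted → Weighted
  walk zero w = w
  walk (suc k) w = walk k (advance w)

  arrivals : Place → Weighted → Count
  arrivals t [] = []
  arrivals t (((t' , f) , m) ∷ w) =
    if t' ==B proj₁ t then (f ⊞ ((- + 1) ⊡ proj₂ t) , m) ∷ arrivals t w else arrivals t w

  walks : ℕ → Place → Place → Count
  walks k s t = arrivals t (walk k ((s , 1) ∷ []))

  Arc : Set
  Arc = Place × Place

  arcAt : Bool → Dir → Arc
  arcAt t d = (t , 0F) , neighbour (t , 0F) d

  closing : ℕ → Arc → List Count
  closing k (x , y) = walks k y x ∷ []

  -- Simply adding these counts over the neighbours of y would give the number of walks of length k
  -- + 1 from y to x. The sum of their squares, taken by `energy`, is a further invariant of the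
  -- arc.
  corners : ℕ → Arc → List Count
  corners k (x , y) = map (λ w → walks k w x) (neighbours y)

  -- Levels alternate in the cover, so closing walks along an edge have odd length and walks from a
  -- neighbour of y to x have even length. One arc stands for each kind of edge. `corners` treats
  -- the two ends differently, so the spoke occurs there in both directions; rim and hub edges can
  -- be reversed by a reflection and a translation.
  balance : List (List (List Count))
  balance = (closing 3 (arcAt false fwd) ∷ closing 3 (arcAt true fwd) ∷ closing 3 (arcAt false near) ∷ []) ∷
            (closing 5 (arcAt false fwd) ∷ closing 5 (arcAt true fwd) ∷ closing 5 (arcAt false near) ∷ []) ∷
            (corners 4 (arcAt false fwd) ∷ corners 4 (arcAt true fwd) ∷ corners 4 (arcAt false near) ∷ corners 4 (arcAt true near) ∷ []) ∷ []

  -- The survivors of the main search, with s and t for the signs attached to r and a: up to signs,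
  -- 4r = 4 with a = r - 3, and 4r = 4 with a = -4.
  formA formB : ℤ → ℤ → List Form
  formA s t = ⟨ + 4 , + 0 , - (+ 4 * s) ⟩ ∷ ⟨ + 3 , t , - s ⟩ ∷ []
  formB s t = ⟨ + 4 , t , + 0 ⟩ ∷ ⟨ + 4 , + 0 , + 4 * s ⟩ ∷ []

  nondegenerate : List Form
  nondegenerate = ⟨ + 1 , + 0 , + 0 ⟩ ∷ ⟨ + 2 , + 0 , + 0 ⟩ ∷ ⟨ + 0 , + 1 , + 0 ⟩ ∷ ⟨ + 0 , + 0 , + 1 ⟩ ∷ ⟨ + 0 , + 0 , + 2 ⟩ ∷ []

  -- Left out of the main search and treated apart: r = ±1, where straight lines can be followed; 2r
  -- = ±2, which leads to W4; and n dividing 4.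
  easy : List Form
  easy = ⟨ + 1 , + 0 , + 1 ⟩ ∷ ⟨ + 1 , + 0 , - + 1 ⟩ ∷ ⟨ + 2 , + 0 , + 2 ⟩ ∷ ⟨ + 2 , + 0 , - + 2 ⟩ ∷ ⟨ + 4 , + 0 , + 0 ⟩ ∷ []

  signs : (ℤ → ℤ → List Form) → List (List Form)
  signs F = F (+ 1) (+ 1) ∷ F (+ 1) (- + 1) ∷ F (- + 1) (+ 1) ∷ F (- + 1) (- + 1) ∷ []

  mainGoals : List (List Form)
  mainGoals = signs formA List.++ signs formB

  -- The goal forms reappear as final counts, so that a branch continues to split until each of them
  -- is decided. As the test is constantly `false`, a branch can end only in a goal or a
  -- contradiction.
  mainProblem : Problem
  mainProblem = problem balance mainGoals (map (map (λ f → f , 1)) mainGoals) (λ _ → false)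

  -- Corners (pairs of neighbours of a vertex), flagged when paired by a given matching

  infix 7 _==D_

  _==D_ : Dir → Dir → Bool
  fwd ==D fwd = true
  bwd ==D bwd = true
  near ==D near = true
  far ==D far = true
  _ ==D _ = false

  Matching : Set
  Matching = Bool → Dir → Dir

  -- `straight` continues rim lines, hub lines and chains of spokes. `twisted` pairs the two edges
  -- that lead up and the two that lead down in the layering used for 4r = 4, a = r - 3.
  straight twisted : Matching
  straight _ fwd = bwd
  straight _ bwd = fwd
  straight _ near = far
  straight _ far = near
  twisted false fwd = far
  twisted false bwd = near
  twisted false near = bwd
  twisted false far = fwd
  twisted true fwd = near
  twisted true bwd = far
  twisted true near = fwd
  twisted true far = bwd

  flag : Matching → Bool × Dir × Dir → Bool
  flag μ (t , i , j) = j ==D μ t i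

  corner : ℕ → Bool × Dir × Dir → Count
  corner k (t , i , j) = walks k (neighbour (t , 0F) i) (neighbour (t , 0F) j)

  allCorners : List (Bool × Dir × Dir)
  allCorners = List.cartesianProduct (false ∷ true ∷ []) (List.cartesianProduct dirs dirs)

  agree : ℕ → List Bool → List ℕ → Bool
  agree c [] [] = true
  agree c (b ∷ bs) (v ∷ vs) = ((v ℕ.≡ᵇ c) ==B b) ∧ agree c bs vs
  agree c _ _ = false

  common : List Bool → List ℕ → ℕ
  common (true ∷ _) (v ∷ _) = v
  common (false ∷ bs) (_ ∷ vs) = common bs vs
  common _ _ = 0

  -- The matched pairs must have one walk count in common which no other pair attains, a neighbour
  -- paired with itself included. The first matched pair supplies the reference value.
  separates : Matching → List ℕ → Bool
  separates μ vs = agree (common fl vs) fl vs where fl = map (flag μ) allCorners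

  separation : List (List Form) → Matching → ℕ → Problem
  separation goals μ k = problem balance goals (map (corner k) allCorners) (separates μ)

-- Walk counts in the cover and their invariance.

module WalkCounting where
  open RoseWindow
  open DoubleCover
  open LinearForms
  open SymbolicWalks
  open import Data.Nat.ListAction using (sum)
  open import Data.Nat.ListAction.Properties using (sum-↭)
  open import Data.Bool using (Bool; true; false; not)
  open import Data.List using (List; []; _∷_; map)
  import Data.List.Properties as Listₚ
  open import Data.List.Relation.Unary.All using ([]; _∷_)
  open import Data.List.Relation.Unary.Unique.Propositional using (Unique)
  import Data.List.Relation.Unary.AllPairs as AllPairs
  import Data.List.Relation.Unary.Unique.Propositional.Properties as Uniqueₚ
  open import Data.List.Membership.Propositional using (_∈_)
  open import Data.List.Membership.Propositional.Properties using (∈-map⁺; ∈-map⁻)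
  open import Data.List.Membership.Propositional.Properties.WithK using (unique∧set⇒bag)
  open import Data.List.Relation.Binary.BagAndSetEquality using (∼bag⇒↭)
  open import Data.List.Relation.Binary.Permutation.Propositional using (_↭_)
  import Data.List.Relation.Binary.Permutation.Propositional.Properties as ↭ₚ
  open import Data.Sum using (inj₁; inj₂; [_,_])
  open import Function.Bundles using (mk⇔)

  -- Counting walks in the cover

  module Counting {G : Graph} {n : ℕ} {a r : ℤ} (P : Rose G n a r) where
    open Cover P public
    open Lattice n a r public

    move : Bool → Dir → ℤ → ℤ
    move false fwd x = x + + 1
    move false bwd x = x - + 1
    move false near x = x
    move false far x = x - a
    move true fwd x = x + r
    move true bwd x = x - r
    move true near x = x
    move true far x = x + a

    N : Bool → ℤ → Bool → Dir → V Cov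
    N t x b d = C (target t d) (move t d x) (not b)

    step-adj : ∀ t d x → RoseAdj n a r t x (target t d) (move t d x)
    step-adj false fwd x = inj₁ ≈-refl
    step-adj false bwd x = inj₂ ≈-refl
    step-adj false near x = inj₁ ≈-refl
    step-adj false far x = inj₂ ≈-refl
    step-adj true fwd x = inj₁ ≈-refl
    step-adj true bwd x = inj₂ ≈-refl
    step-adj true near x = inj₁ ≈-refl
    step-adj true far x = inj₂ ≈-refl

    N-adj : ∀ t x b d → Adj Cov (C t x b) (N t x b d)
    N-adj t x b d = cadj⇐ (step-adj t d x) refl

    N-view : ∀ {t x b q} → Adj Cov (C t x b) q → Σ Dir λ d → q ≡ N t x b d
    N-view {t} {x} {b} {q} e with cadj⇒ {t} {x} {type q} {index q} {b} {proj₂ q} (subst (Adj Cov (C t x b)) (sym (C-surj q)) e)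
    ... | e' , l = go t (type q) (index q) e' refl {refl}
      where
        fin : ∀ {t' y z} → t' ≡ type q → y ≈ z → y ≡ index q → q ≡ C t' z (not b)
        fin refl p refl = trans (sym (C-surj q)) (trans (C-cong p) (cong (C (type q) _) l))
        go : ∀ t t' y → RoseAdj n a r t x t' y → t' ≡ type q → {p : y ≡ index q} → Σ Dir λ d → q ≡ N t x b d
        go false false y (inj₁ p) e {i} = fwd , fin e p i
        go false false y (inj₂ p) e {i} = bwd , fin e p i
        go false true y (inj₁ p) e {i} = near , fin e p i
        go false true y (inj₂ p) e {i} = far , fin e p i
        go true false y (inj₁ p) e {i} = near , fin e p i
        go true false y (inj₂ p) e {i} = far , fin e p i
        go true true y (inj₁ p) e {i} = fwd , fin e p i
        go true true y (inj₂ p) e {i} = bwd , fin e p i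

    move-cong : ∀ t d {x y} → x ≈ y → move t d x ≈ move t d y
    move-cong false fwd p = +-congˡ≈ (+ 1) p
    move-cong false bwd p = +-congˡ≈ (- + 1) p
    move-cong false near p = p
    move-cong false far p = +-congˡ≈ (- a) p
    move-cong true fwd p = +-congˡ≈ r p
    move-cong true bwd p = +-congˡ≈ (- r) p
    move-cong true near p = p
    move-cong true far p = +-congˡ≈ a p

    N-cong : ∀ {t t' x y b c} → C t x b ≡ C t' y c → ∀ d → N t x b d ≡ N t' y c d
    N-cong {t} {t'} {x} {y} e d with C-type e | C-level e
    ... | refl | refl = C-cong {target t d} {_} {move t d x} {move t d y} (move-cong t d (C-inj {t} {t} e))

    nbrs : V Cov → List (V Cov)
    nbrs p = map (N (type p) (index p) (proj₂ p)) dirs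

    nbrs-C : ∀ t x b → nbrs (C t x b) ≡ map (N t x b) dirs
    nbrs-C t x b = Listₚ.map-cong (N-cong {type (C t x b)} {t} {index (C t x b)} {x} {b} {b} (C-surj (C t x b))) dirs

    ∈-dirs : ∀ d → d ∈ dirs
    ∈-dirs fwd = here refl
    ∈-dirs bwd = there (here refl)
    ∈-dirs near = there (there (here refl))
    ∈-dirs far = there (there (there (here refl)))

    _≟_ : (p q : V Cov) → Dec (p ≡ q)
    p ≟ q with type p 𝔹ₚ.≟ type q | index p ≈? index q | proj₂ p 𝔹ₚ.≟ proj₂ q
    ... | yes e | yes i | yes b = yes (trans (sym (C-surj p)) (trans (cong₂ (λ t b → C t (index p) b) e b) (trans (C-cong i) (C-surj q))))
    ... | no ¬e | _ | _ = no λ { refl → ¬e refl }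
    ... | yes _ | no ¬i | _ = no λ { refl → ¬i ≈-refl }
    ... | yes _ | yes _ | no ¬b = no λ { refl → ¬b refl }

    paths : ℕ → V Cov → V Cov → ℕ
    paths zero p q = indicator (p ≟ q)
    paths (suc k) p q = sum (map (λ w → paths k w q) (nbrs p))

    place : ℤ → Bool → Place → V Cov
    place x b (t , f) = C t (x + ev f) b

    N-place : ∀ x b s d → place x (not b) (neighbour s d) ≡ N (proj₁ s) (x + ev (proj₂ s)) b d
    N-place x b (t , f) d = C-cong (≈-reflexive (trans (cong (_+_ x) (ev-+ f (offset t d))) (go t d (ev f))))
      where
        l1 : ∀ x e a r → x + (e + (+ 1 + + 0 * a + + 0 * r)) ≡ x + e + + 1
        l1 = solve-∀
        l2 : ∀ x e a r → x + (e + (- + 1 + + 0 * a + + 0 * r)) ≡ x + e - + 1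
        l2 = solve-∀
        l3 : ∀ x e a r → x + (e + (+ 0 + (- + 1) * a + + 0 * r)) ≡ x + e - a
        l3 = solve-∀
        l4 : ∀ x e a r → x + (e + (+ 0 + + 0 * a + + 1 * r)) ≡ x + e + r
        l4 = solve-∀
        l5 : ∀ x e a r → x + (e + (+ 0 + + 0 * a + (- + 1) * r)) ≡ x + e - r
        l5 = solve-∀
        l6 : ∀ x e a r → x + (e + (+ 0 + + 1 * a + + 0 * r)) ≡ x + e + a
        l6 = solve-∀
        l7 : ∀ x e → x + (e + + 0) ≡ x + e
        l7 = solve-∀
        via : ∀ z {e' e w} → e' ≡ e → x + (z + e) ≡ w → x + (z + e') ≡ w
        via z refl h = h
        go : ∀ t d z → x + (z + ev (offset t d)) ≡ move t d (x + z)
        go false fwd z = via z (ev≡ _ _ _) (l1 x z a r)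
        go false bwd z = via z (ev≡ _ _ _) (l2 x z a r)
        go false near z = via z ev-0 (l7 x z)
        go false far z = via z (ev≡ _ _ _) (l3 x z a r)
        go true fwd z = via z (ev≡ _ _ _) (l4 x z a r)
        go true bwd z = via z (ev≡ _ _ _) (l5 x z a r)
        go true near z = via z ev-0 (l7 x z)
        go true far z = via z (ev≡ _ _ _) (l6 x z a r)

    wsum : (Place → ℕ) → Weighted → ℕ
    wsum g [] = 0
    wsum g ((s , m) ∷ w) = m ℕ.* g s ℕ.+ wsum g w

    ==B-sound : ∀ b c → b ==B c ≡ true → b ≡ c
    ==B-sound true true e = refl
    ==B-sound false false e = refl

    wsum-add : ∀ g s m w → wsum g (add s m w) ≡ m ℕ.* g s ℕ.+ wsum g w
    wsum-add g s m [] = refl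
    wsum-add g s@(t , f) m ((s'@(t' , f') , m') ∷ w) with s ==P s' in eq
    ... | true with ∧-true {t ==B t'} eq
    ... | e₁ , e₂ with ==B-sound t t' e₁ | ==F-sound f f' e₂
    ... | refl | refl = trans (cong (ℕ._+ wsum g w) (ℕₚ.*-distribʳ-+ (g s) m m')) (ℕₚ.+-assoc (m ℕ.* g s) _ _)
    wsum-add g s m ((s' , m') ∷ w) | false = begin
        m' ℕ.* g s' ℕ.+ wsum g (add s m w)           ≡⟨ cong (m' ℕ.* g s' ℕ.+_) (wsum-add g s m w) ⟩
        m' ℕ.* g s' ℕ.+ (m ℕ.* g s ℕ.+ wsum g w)     ≡⟨ ℕₚ.+-assoc (m' ℕ.* g s') _ _ ⟨
        m' ℕ.* g s' ℕ.+ m ℕ.* g s ℕ.+ wsum g w       ≡⟨ cong (ℕ._+ wsum g w) (ℕₚ.+-comm (m' ℕ.* g s') _) ⟩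
        m ℕ.* g s ℕ.+ m' ℕ.* g s' ℕ.+ wsum g w       ≡⟨ ℕₚ.+-assoc (m ℕ.* g s) _ _ ⟩
        m ℕ.* g s ℕ.+ (m' ℕ.* g s' ℕ.+ wsum g w) ∎
      where open ≡-Reasoning

    wsum-addAll : ∀ g ss m w → wsum g (addAll ss m w) ≡ m ℕ.* sum (map g ss) ℕ.+ wsum g w
    wsum-addAll g [] m w = cong (ℕ._+ wsum g w) (sym (ℕₚ.*-zeroʳ m))
    wsum-addAll g (s ∷ ss) m w = begin
        wsum g (add s m (addAll ss m w))                            ≡⟨ wsum-add g s m (addAll ss m w) ⟩
        m ℕ.* g s ℕ.+ wsum g (addAll ss m w)                        ≡⟨ cong (m ℕ.* g s ℕ.+_) (wsum-addAll g ss m w) ⟩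
        m ℕ.* g s ℕ.+ (m ℕ.* sum (map g ss) ℕ.+ wsum g w)           ≡⟨ ℕₚ.+-assoc (m ℕ.* g s) _ _ ⟨
        m ℕ.* g s ℕ.+ m ℕ.* sum (map g ss) ℕ.+ wsum g w             ≡⟨ cong (ℕ._+ wsum g w) (ℕₚ.*-distribˡ-+ m (g s) _) ⟨
        m ℕ.* sum (map g (s ∷ ss)) ℕ.+ wsum g w ∎
      where open ≡-Reasoning

    wsum-advance : ∀ g w → wsum g (advance w) ≡ wsum (λ s → sum (map g (neighbours s))) w
    wsum-advance g [] = refl
    wsum-advance g ((s , m) ∷ w) = trans (wsum-addAll g (neighbours s) m (advance w))
      (cong (m ℕ.* sum (map g (neighbours s)) ℕ.+_) (wsum-advance g w))

    wsum-cong : ∀ {g h} → (∀ s → g s ≡ h s) → ∀ w → wsum g w ≡ wsum h w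
    wsum-cong e [] = refl
    wsum-cong e ((s , m) ∷ w) = cong₂ (λ u v → m ℕ.* u ℕ.+ v) (e s) (wsum-cong e w)

    flips : ℕ → Bool → Bool
    flips zero b = b
    flips (suc k) b = flips k (not b)

    paths-suc : ∀ k x b q s → paths (suc k) (place x b s) q ≡ sum (map (λ s' → paths k (place x (not b) s') q) (neighbours s))
    paths-suc k x b q s@(t , f) = cong sum (begin
        map (λ w → paths k w q) (nbrs (place x b s))                       ≡⟨ cong (map (λ w → paths k w q)) (nbrs-C t (x + ev f) b) ⟩
        map (λ w → paths k w q) (map (N t (x + ev f) b) dirs)              ≡⟨ cong (map (λ w → paths k w q)) (Listₚ.map-cong (λ d → sym (N-place x b s d)) dirs) ⟩
        map (λ w → paths k w q) (map (λ d → place x (not b) (neighbour s d)) dirs) ≡⟨⟩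
        map (λ s' → paths k (place x (not b) s') q) (neighbours s) ∎)
      where open ≡-Reasoning

    paths-walk : ∀ k x b q w → wsum (λ s → paths k (place x b s) q) w ≡ wsum (λ s → paths 0 (place x (flips k b) s) q) (walk k w)
    paths-walk zero x b q w = refl
    paths-walk (suc k) x b q w = begin
        wsum (λ s → paths (suc k) (place x b s) q) w                                          ≡⟨ wsum-cong (paths-suc k x b q) w ⟩
        wsum (λ s → sum (map (λ s' → paths k (place x (not b) s') q) (neighbours s))) w       ≡⟨ wsum-advance _ w ⟨
        wsum (λ s → paths k (place x (not b) s) q) (advance w)                                ≡⟨ paths-walk k x (not b) q (advance w) ⟩
        wsum (λ s → paths 0 (place x (flips k (not b)) s) q) (walk k (advance w)) ∎
      where open ≡-Reasoning

    indicator-⇔ : ∀ {A B : Set} (d : Dec A) (e : Dec B) → (A → B) → (B → A) → indicator d ≡ indicator e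
    indicator-⇔ (yes p) e f g = sym (indicator-yes e (f p))
    indicator-⇔ (no ¬p) e f g = sym (indicator-no e (¬p ∘ g))

    L⇒≈ : ∀ x f g → L (f ⊞ ((- + 1) ⊡ g)) → (x + ev f) ≈ (x + ev g)
    L⇒≈ x f g l = mk (lin1 (+ 1) (subst D (ev-⊞ f (- + 1) g) l) (lem x (ev f) (ev g)))
      where lem : ∀ x f g → x + f - (x + g) ≡ + 1 * (f + (- + 1) * g)
            lem = solve-∀

    ≈⇒L : ∀ x f g → (x + ev f) ≈ (x + ev g) → L (f ⊞ ((- + 1) ⊡ g))
    ≈⇒L x f g (mk p) = subst D (sym (ev-⊞ f (- + 1) g)) (lin1 (+ 1) p (lem x (ev f) (ev g)))
      where lem : ∀ x f g → f + (- + 1) * g ≡ + 1 * (x + f - (x + g))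
            lem = solve-∀

    wsum-arrivals : ∀ x b t w → wsum (λ s → paths 0 (place x b s) (place x b t)) w ≡ count (arrivals t w)
    wsum-arrivals x b t [] = refl
    wsum-arrivals x b (t , g) (((t' , f) , m) ∷ w) with t' ==B t in eq
    ... | true with refl ← ==B-sound t' t eq = cong₂ (λ u v → m ℕ.* u ℕ.+ v)
            (indicator-⇔ (place x b (t' , f) ≟ place x b (t' , g)) (D? (ev (f ⊞ ((- + 1) ⊡ g))))
              (λ e → ≈⇒L x f g (C-inj e)) (λ l → C-cong (L⇒≈ x f g l)))
            (wsum-arrivals x b (t' , g) w)
    ... | false = trans (cong₂ (λ u v → m ℕ.* u ℕ.+ v) (indicator-no (place x b (t' , f) ≟ place x b (t , g)) ne) (wsum-arrivals x b (t , g) w))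
                    (cong (ℕ._+ count (arrivals (t , g) w)) (ℕₚ.*-zeroʳ m))
      where
        ==B-refl : ∀ b → b ==B b ≡ true
        ==B-refl true = refl
        ==B-refl false = refl
        ne : C t' (x + ev f) b ≢ C t (x + ev g) b
        ne e with refl ← C-type e with () ← trans (sym (==B-refl t')) eq

    -- The bridge from evaluation to the cover. The symbolic walks know nothing of n, a, r; a walk
    -- reaches its target exactly when the difference of two forms is divisible by n. The final
    -- level is forced by the length, hence `flips`.
    paths-walks : ∀ k x b s t → paths k (place x b s) (place x (flips k b) t) ≡ count (walks k s t)
    paths-walks k x b s t = begin
        paths k (place x b s) q                                    ≡⟨ lem (paths k (place x b s) q) ⟩
        wsum (λ s → paths k (place x b s) q) ((s , 1) ∷ [])        ≡⟨ paths-walk k x b q ((s , 1) ∷ []) ⟩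
        wsum (λ s → paths 0 (place x (flips k b) s) q) (walk k ((s , 1) ∷ [])) ≡⟨ wsum-arrivals x (flips k b) t (walk k ((s , 1) ∷ [])) ⟩
        count (walks k s t) ∎
      where
        open ≡-Reasoning
        q = place x (flips k b) t
        lem : ∀ m → m ≡ 1 ℕ.* m ℕ.+ 0
        lem m = sym (trans (ℕₚ.+-identityʳ _) (ℕₚ.*-identityˡ m))

  -- Exactly what makes the four directions at every vertex lead to four different neighbours.
  record Simple (n : ℕ) (a r : ℤ) : Set where
    open Mod n
    field
      3≤n : 3 ℕ.≤ n
      a≉0 : ¬ a ≈ + 0
      2r≉0 : ¬ (+ 2 * r) ≈ + 0

  module Invariance {G : Graph} {n : ℕ} {a r : ℤ} (P : Rose G n a r) (S : Simple n a r) where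
    open Counting P public
    open Simple S public

    1≉0 : ¬ D (+ 1)
    1≉0 = ¬D-small (ℕ.s≤s ℕ.z≤n) (ℕₚ.≤-trans (ℕ.s≤s (ℕ.s≤s ℕ.z≤n)) 3≤n)

    2≉0 : ¬ D (+ 2)
    2≉0 = ¬D-small (ℕ.s≤s ℕ.z≤n) 3≤n

    private
      ¬rim : ∀ x → ¬ (x + + 1) ≈ (x - + 1)
      ¬rim x (mk p) = 2≉0 (lin1 (+ 1) p (lem x))
        where lem : ∀ x → + 2 ≡ + 1 * (x + + 1 - (x - + 1))
              lem = solve-∀

      ¬hub : ∀ x → ¬ (x + r) ≈ (x - r)
      ¬hub x (mk p) = 2r≉0 (mk (lin1 (+ 1) p (lem x r)))
        where lem : ∀ x r → + 2 * r - + 0 ≡ + 1 * (x + r - (x - r))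
              lem = solve-∀

      ¬in : ∀ x → ¬ x ≈ (x - a)
      ¬in x (mk p) = a≉0 (mk (lin1 (+ 1) p (lem x a)))
        where lem : ∀ x a → a - + 0 ≡ + 1 * (x - (x - a))
              lem = solve-∀

      ¬out : ∀ x → ¬ x ≈ (x + a)
      ¬out x (mk p) = a≉0 (mk (lin1 (- + 1) p (lem x a)))
        where lem : ∀ x a → a - + 0 ≡ (- + 1) * (x - (x + a))
              lem = solve-∀

    N-inj : ∀ t {x b} d d' → N t x b d ≡ N t x b d' → d ≡ d'
    N-inj t {x} d d' e = go t d d' (C-type e) (C-inj e)
      where
        go : ∀ t d d' → target t d ≡ target t d' → move t d x ≈ move t d' x → d ≡ d'
        go t fwd fwd _ _ = refl
        go t bwd bwd _ _ = refl
        go t near near _ _ = refl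
        go t far far _ _ = refl
        go false fwd bwd _ p = ⊥-elim (¬rim x p)
        go false bwd fwd _ p = ⊥-elim (¬rim x (≈-sym p))
        go false near far _ p = ⊥-elim (¬in x p)
        go false far near _ p = ⊥-elim (¬in x (≈-sym p))
        go true fwd bwd _ p = ⊥-elim (¬hub x p)
        go true bwd fwd _ p = ⊥-elim (¬hub x (≈-sym p))
        go true near far _ p = ⊥-elim (¬out x p)
        go true far near _ p = ⊥-elim (¬out x (≈-sym p))
        go false fwd near () _
        go false fwd far () _
        go false bwd near () _
        go false bwd far () _
        go false near fwd () _
        go false near bwd () _
        go false far fwd () _
        go false far bwd () _
        go true fwd near () _
        go true fwd far () _
        go true bwd near () _
        go true bwd far () _
        go true near fwd () _
        go true near bwd () _
        go true far fwd () _
        go true far bwd () _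

    dirs-unique : Unique dirs
    dirs-unique = ((λ ()) ∷ (λ ()) ∷ (λ ()) ∷ []) AllPairs.∷ ((λ ()) ∷ (λ ()) ∷ []) AllPairs.∷ ((λ ()) ∷ []) AllPairs.∷ [] AllPairs.∷ AllPairs.[]

    nbrs-unique : ∀ p → Unique (nbrs p)
    nbrs-unique p = Uniqueₚ.map⁺ {f = N (type p) (index p) (proj₂ p)} (λ {d} {d'} → N-inj (type p) d d') dirs-unique

    adj⇒∈ : ∀ {p q} → Adj Cov p q → q ∈ nbrs p
    adj⇒∈ {p} {q} e with N-view {type p} {index p} {proj₂ p} {q} (subst (λ p → Adj Cov p q) (sym (C-surj p)) e)
    ... | d , refl = ∈-map⁺ (N (type p) (index p) (proj₂ p)) (∈-dirs d)

    ∈⇒adj : ∀ {p q} → q ∈ nbrs p → Adj Cov p q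
    ∈⇒adj {p} {q} m with ∈-map⁻ (N (type p) (index p) (proj₂ p)) m
    ... | d , _ , refl = subst (λ p' → Adj Cov p' (N (type p) (index p) (proj₂ p) d)) (C-surj p) (N-adj (type p) (index p) (proj₂ p) d)

    -- By `Simple` neither list has repetitions, and their members agree because σ and its inverse
    -- preserve adjacency. Sums over neighbours are therefore carried along by σ.
    nbrs-↭ : ∀ σ p → nbrs (app σ p) ↭ map (app σ) (nbrs p)
    nbrs-↭ σ p = ∼bag⇒↭ (unique∧set⇒bag (nbrs-unique _) (Uniqueₚ.map⁺ (app-injective σ) (nbrs-unique p)) (mk⇔ f g))
      where
        f : ∀ {q} → q ∈ nbrs (app σ p) → q ∈ map (app σ) (nbrs p)
        f {q} m = subst (_∈ map (app σ) (nbrs p)) (app-inv σ q)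
          (∈-map⁺ (app σ) (adj⇒∈ (subst (λ p' → Adj Cov p' (inv σ q)) (inv-app σ p) (pre-adj σ (app σ p) q (∈⇒adj m)))))
        g : ∀ {q} → q ∈ map (app σ) (nbrs p) → q ∈ nbrs (app σ p)
        g m with ∈-map⁻ (app σ) m
        ... | w , w∈ , refl = adj⇒∈ (img-adj σ p w (∈⇒adj w∈))

    sum-nbrs : ∀ σ (g : V Cov → ℕ) p → sum (map g (nbrs (app σ p))) ≡ sum (map (g ∘ app σ) (nbrs p))
    sum-nbrs σ g p = trans (sum-↭ (↭ₚ.map⁺ g (nbrs-↭ σ p))) (cong sum (sym (Listₚ.map-∘ {g = g} {f = app σ} (nbrs p))))

    paths-invariant : ∀ σ k p q → paths k (app σ p) (app σ q) ≡ paths k p q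
    paths-invariant σ zero p q = indicator-⇔ (app σ p ≟ app σ q) (p ≟ q) (app-injective σ) (cong (app σ))
    paths-invariant σ (suc k) p q = trans (sum-nbrs σ (λ w → paths k w (app σ q)) p)
      (cong sum (Listₚ.map-cong (λ w → paths-invariant σ k w q) (nbrs p)))

    turning : ℕ → V Cov → V Cov → ℕ
    turning k p q = sum (map (λ w → paths k w p ℕ.* paths k w p) (nbrs q))

    turning-invariant : ∀ σ k p q → turning k (app σ p) (app σ q) ≡ turning k p q
    turning-invariant σ k p q = trans (sum-nbrs σ (λ w → paths k w (app σ p) ℕ.* paths k w (app σ p)) q)
      (cong sum (Listₚ.map-cong (λ w → cong₂ ℕ._*_ (paths-invariant σ k w p) (paths-invariant σ k w p)) (nbrs q)))

-- Orbits of automorphisms on the edges of the cover.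

module EdgeOrbits where
  open RoseWindow
  open DoubleCover
  open LinearForms
  open SymbolicWalks
  open WalkCounting
  open import Data.Bool using (Bool; true; false; not; _xor_)
  open import Data.Sum using (_⊎_; inj₁; inj₂; [_,_])

  -- Edge-transitivity

  module Edges {G : Graph} {n : ℕ} {a r : ℤ} (P : Rose G n a r) where
    open Counting P public

    data Kind : Set where
      rimK hubK spokeK : Kind

    kind : Bool → Dir → Kind
    kind _ near = spokeK
    kind _ far = spokeK
    kind false _ = rimK
    kind true _ = hubK

    record Carries (p q p' q' : V Cov) : Set where
      constructor carries
      field
        by : Aut Cov
        ends : (app by p ≡ p' × app by q ≡ q') ⊎ (app by p ≡ q' × app by q ≡ p')

    carries-sym : ∀ {p q p' q'} → Carries p q p' q' → Carries p' q' p q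
    carries-sym (carries σ (inj₁ (refl , refl))) = carries (invert σ) (inj₁ (inv-app σ _ , inv-app σ _))
    carries-sym (carries σ (inj₂ (refl , refl))) = carries (invert σ) (inj₂ (inv-app σ _ , inv-app σ _))

    carries-trans : ∀ {p q p' q' p″ q″} → Carries p q p' q' → Carries p' q' p″ q″ → Carries p q p″ q″
    carries-trans (carries σ (inj₁ (refl , refl))) (carries ρ e) = carries (ρ ⊙ σ) e
    carries-trans (carries σ (inj₂ (refl , refl))) (carries ρ (inj₁ (e , e'))) = carries (ρ ⊙ σ) (inj₂ (e' , e))
    carries-trans (carries σ (inj₂ (refl , refl))) (carries ρ (inj₂ (e , e'))) = carries (ρ ⊙ σ) (inj₁ (e' , e))

    base : Kind → V Cov × V Cov
    base rimK = C false (+ 0) false , C false (+ 1) true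
    base hubK = C true (+ 0) false , C true r true
    base spokeK = C false (+ 0) false , C true (+ 0) true

    translate-to : ∀ c e t x b {y b'} → x + c ≡ y → b xor e ≡ b' → app (translate c e) (C t x b) ≡ C t y b'
    translate-to c e t x b refl refl = translate-C c e t x b

    private
      e₁ : ∀ x → + 0 + x ≡ x
      e₁ = solve-∀
      e₂ : ∀ x → + 1 + x ≡ x + + 1
      e₂ = solve-∀
      e₃ : ∀ x → + 0 + (x - + 1) ≡ x - + 1
      e₃ = solve-∀
      e₄ : ∀ x → + 1 + (x - + 1) ≡ x
      e₄ = solve-∀
      e₅ : ∀ x r → r + x ≡ x + r
      e₅ = solve-∀
      e₆ : ∀ x r → + 0 + (x - r) ≡ x - r
      e₆ = solve-∀
      e₇ : ∀ x r → r + (x - r) ≡ x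
      e₇ = solve-∀
      e₈ : ∀ x a → - a + a - + 0 + x ≡ x
      e₈ = solve-∀
      e₉ : ∀ x a → - a - + 0 + x ≡ x - a
      e₉ = solve-∀
      e₁₀ : ∀ x a → + 0 + a - + 0 + x ≡ x + a
      e₁₀ = solve-∀
      e₁₁ : ∀ x → + 0 - + 0 + x ≡ x
      e₁₁ = solve-∀

    -- The group of translations and reflections has three orbits on edges.
    standard : ∀ t x b d → Carries (proj₁ (base (kind t d))) (proj₂ (base (kind t d))) (C t x b) (N t x b d)
    standard false x b fwd = carries (translate x b) (inj₁
      (translate-to x b false (+ 0) false (e₁ x) refl , translate-to x b false (+ 1) true (e₂ x) refl))
    standard false x b bwd = carries (translate (x - + 1) (not b)) (inj₂
      ( translate-to (x - + 1) (not b) false (+ 0) false (e₃ x) refl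
      , translate-to (x - + 1) (not b) false (+ 1) true (e₄ x) (𝔹ₚ.not-involutive b)))
    standard true x b fwd = carries (translate x b) (inj₁
      (translate-to x b true (+ 0) false (e₁ x) refl , translate-to x b true r true (e₅ x r) refl))
    standard true x b bwd = carries (translate (x - r) (not b)) (inj₂
      ( translate-to (x - r) (not b) true (+ 0) false (e₆ x r) refl
      , translate-to (x - r) (not b) true r true (e₇ x r) (𝔹ₚ.not-involutive b)))
    standard false x b near = carries (translate x b) (inj₁
      (translate-to x b false (+ 0) false (e₁ x) refl , translate-to x b true (+ 0) true (e₁ x) refl))
    standard true x b near = carries (translate x (not b)) (inj₂
      ( translate-to x (not b) false (+ 0) false (e₁ x) refl
      , translate-to x (not b) true (+ 0) true (e₁ x) (𝔹ₚ.not-involutive b)))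
    standard false x b far = carries (translate x b ⊙ reflect (- a)) (inj₁
      ( trans (cong (app (translate x b)) (reflect-C (- a) false (+ 0) false)) (translate-to x b false (- a + a - + 0) false (e₈ x a) refl)
      , trans (cong (app (translate x b)) (reflect-C (- a) true (+ 0) true)) (translate-to x b true (- a - + 0) true (e₉ x a) refl)))
    standard true x b far = carries (translate x (not b) ⊙ reflect (+ 0)) (inj₂
      ( trans (cong (app (translate x (not b))) (reflect-C (+ 0) false (+ 0) false)) (translate-to x (not b) false (+ 0 + a - + 0) false (e₁₀ x a) refl)
      , trans (cong (app (translate x (not b))) (reflect-C (+ 0) true (+ 0) true)) (translate-to x (not b) true (+ 0 - + 0) true (e₁₁ x) (𝔹ₚ.not-involutive b))))

    Linked : Kind → Kind → Set
    Linked k k' = Carries (proj₁ (base k)) (proj₂ (base k)) (proj₁ (base k')) (proj₂ (base k'))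

    link : ∀ {t x b d t' x' b' d'} (σ : Aut Cov) → app σ (C t x b) ≡ C t' x' b' → app σ (N t x b d) ≡ N t' x' b' d' →
           Linked (kind t d) (kind t' d')
    link {t} {x} {b} {d} {t'} {x'} {b'} {d'} σ e e' = carries-trans (standard t x b d)
      (carries-trans (carries σ (inj₁ (e , e'))) (carries-sym (standard t' x' b' d')))

    edge-kind : ∀ p q → Adj Cov p q → Σ Kind λ k → Carries (proj₁ (base k)) (proj₂ (base k)) p q
    edge-kind p q e with N-view {type p} {index p} {proj₂ p} {q} (subst (λ p → Adj Cov p q) (sym (C-surj p)) e)
    ... | d , refl = kind (type p) d , subst (λ p' → Carries (proj₁ (base (kind (type p) d))) (proj₂ (base (kind (type p) d))) p' q) (C-surj p) (standard (type p) (index p) (proj₂ p) d)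

    all-linked : (∀ k → Linked spokeK k) → EdgeTransitive Cov
    all-linked h p q p' q' e e' with edge-kind p q e | edge-kind p' q' e'
    ... | k , c | k' , c' with carries-trans (carries-sym c) (carries-trans (carries-sym (h k)) (carries-trans (h k') c'))
    ... | carries σ o = σ , o

    image : ∀ (σ : Aut Cov) t x b d t' x' b' → app σ (C t x b) ≡ C t' x' b' → Σ Dir λ d' → app σ (N t x b d) ≡ N t' x' b' d'
    image σ t x b d t' x' b' e = N-view {t'} {x'} {b'} {app σ (N t x b d)}
      (subst (λ p → Adj Cov p (app σ (N t x b d))) e (img-adj σ _ _ (N-adj t x b d)))

    -- An automorphism taking a spoke to a rim edge takes the spokes and hub edges at a
    -- vertex v to edges at a vertex u, so it merges all three orbits; likewise for hub edges.
    spoke-moved : ∀ σ t x b d → target t d ≡ not t →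
      ∀ t' x' b' d' → app σ (C t x b) ≡ C t' x' b' → app σ (N t x b d) ≡ N t' x' b' d' → target t' d' ≡ t' → EdgeTransitive Cov
    spoke-moved σ false x b d s t' x' b' d' e e' m = go t' d' d e e' m s
      where
        refl-link : ∀ k → Linked k k
        refl-link k = carries (translate (+ 0) false) (inj₁ (id≡ _ , id≡ _))
          where id≡ : ∀ p → app (translate (+ 0) false) p ≡ p
                id≡ p = trans (cong₂ (C (type p)) (lem (index p)) (𝔹ₚ.xor-identityʳ (proj₂ p))) (C-surj p)
                  where lem : ∀ x → x + + 0 ≡ x
                        lem = solve-∀
        conclude : Linked spokeK rimK → Linked spokeK hubK → EdgeTransitive Cov
        conclude lr lh = all-linked λ { rimK → lr ; hubK → lh ; spokeK → refl-link spokeK }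
        toRim : Linked spokeK rimK → ∀ d₀ → Linked hubK (kind false d₀) → EdgeTransitive Cov
        toRim l fwd h = conclude l (carries-trans l (carries-sym h))
        toRim l bwd h = conclude l (carries-trans l (carries-sym h))
        toRim l near h = conclude l (carries-sym h)
        toRim l far h = conclude l (carries-sym h)
        toHub : Linked spokeK hubK → ∀ d₀ → Linked rimK (kind true d₀) → EdgeTransitive Cov
        toHub l fwd h = conclude (carries-trans l (carries-sym h)) l
        toHub l bwd h = conclude (carries-trans l (carries-sym h)) l
        toHub l near h = conclude (carries-sym h) l
        toHub l far h = conclude (carries-sym h) l
        rimCase : ∀ d d₁ → kind false d ≡ spokeK → app σ (C false x b) ≡ C false x' b' → (target false d ≡ true) →
          app σ (N false x b d) ≡ C false d₁ (not b') → Linked (kind false d) rimK → EdgeTransitive Cov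
        rimCase d y ks e td e' l with image σ true (move false d x) (not b) fwd false y (not b')
                                         (trans (cong (λ t → app σ (C t (move false d x) (not b))) (sym td)) e')
        ... | d₂ , e₂ = toRim (subst (λ k → Linked k rimK) ks l) d₂
                          (link {true} {move false d x} {not b} {fwd} {false} {y} {not b'} {d₂} σ
                            (trans (cong (λ t → app σ (C t (move false d x) (not b))) (sym td)) e') e₂)
        hubCase : kind false d ≡ spokeK → app σ (C false x b) ≡ C true x' b' → Linked (kind false d) hubK → EdgeTransitive Cov
        hubCase ks e l with image σ false x b fwd true x' b' e
        ... | d₂ , e₂ = toHub (subst (λ k → Linked k hubK) ks l) d₂ (link {false} {x} {b} {fwd} {true} {x'} {b'} {d₂} σ e e₂)
        kspoke : ∀ d → target false d ≡ true → kind false d ≡ spokeK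
        kspoke near _ = refl
        kspoke far _ = refl
        go : ∀ t' d' d₀ → app σ (C false x b) ≡ C t' x' b' → app σ (N false x b d) ≡ N t' x' b' d' → target t' d' ≡ t' → target false d ≡ true → EdgeTransitive Cov
        go false fwd _ e e' m s = rimCase d _ (kspoke d s) e s e' (link {false} {x} {b} {d} {false} {x'} {b'} {fwd} σ e e')
        go false bwd _ e e' m s = rimCase d _ (kspoke d s) e s e' (link {false} {x} {b} {d} {false} {x'} {b'} {bwd} σ e e')
        go true fwd _ e e' m s = hubCase (kspoke d s) e (link {false} {x} {b} {d} {true} {x'} {b'} {fwd} σ e e')
        go true bwd _ e e' m s = hubCase (kspoke d s) e (link {false} {x} {b} {d} {true} {x'} {b'} {bwd} σ e e')
        go false near _ e e' () s
        go false far _ e e' () s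
        go true near _ e e' () s
        go true far _ e e' () s
    -- Seen from its other end the spoke starts at a u; turning both the spoke and its image around
    -- leads back to the first clause.
    spoke-moved σ true x b d s t' x' b' d' e e' m =
        spoke-moved σ false (move true d x) (not b) (back d) refl' t' (move t' d' x') (not b') (back₂ t' d') im₁ im₂ (m₂ t' d' m)
      where
        back : Dir → Dir
        back near = near
        back d = far
        refl' : target false (back d) ≡ true
        refl' = tb d s
          where tb : ∀ d → target true d ≡ false → target false (back d) ≡ true
                tb near _ = refl
                tb far _ = refl
        back₂ : Bool → Dir → Dir
        back₂ _ fwd = bwd
        back₂ _ d = fwd
        m₂ : ∀ t' d' → target t' d' ≡ t' → target t' (back₂ t' d') ≡ t'
        m₂ false fwd _ = refl
        m₂ false bwd _ = refl
        m₂ true fwd _ = refl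
        m₂ true bwd _ = refl
        im₁ : app σ (C false (move true d x) (not b)) ≡ C t' (move t' d' x') (not b')
        im₁ = trans (cong (λ t → app σ (C t (move true d x) (not b))) (sym s)) (trans e' (cong (λ t → C t (move t' d' x') (not b')) m))
        undo : ∀ d → target true d ≡ false → move false (back d) (move true d x) ≡ x
        undo near _ = refl
        undo far _ = lem x a
          where lem : ∀ x a → x + a - a ≡ x
                lem = solve-∀
        undo₂ : ∀ t' d' → target t' d' ≡ t' → move t' (back₂ t' d') (move t' d' x') ≡ x'
        undo₂ false fwd _ = lem x'
          where lem : ∀ x → x + + 1 - + 1 ≡ x
                lem = solve-∀
        undo₂ false bwd _ = lem x'
          where lem : ∀ x → x - + 1 + + 1 ≡ x
                lem = solve-∀
        undo₂ true fwd _ = lem x' r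
          where lem : ∀ x r → x + r - r ≡ x
                lem = solve-∀
        undo₂ true bwd _ = lem x' r
          where lem : ∀ x r → x - r + r ≡ x
                lem = solve-∀
        im₂ : app σ (N false (move true d x) (not b) (back d)) ≡ N t' (move t' d' x') (not b') (back₂ t' d')
        im₂ = trans (cong (app σ) {N false (move true d x) (not b) (back d)} {C true x b}
                      (trans (cong₂ (λ t z → C t z (not (not b))) refl' (undo d s)) (cong (C true x) (𝔹ₚ.not-involutive b))))
               (trans e (sym (trans (cong₂ (λ t z → C t z (not (not b'))) (m₂ t' d' m) (undo₂ t' d' m)) (cong (C t' x') (𝔹ₚ.not-involutive b')))))

-- Matchings of neighbours that all automorphisms respect.

module RespectedMatchings where
  open RoseWindow
  open DoubleCover
  open LinearForms
  open SymbolicWalks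
  open WalkCounting
  open EdgeOrbits
  open import Data.Bool using (Bool; true; false; not; if_then_else_)
  open import Data.List using ([]; _∷_; map)
  import Data.List.Properties as Listₚ
  open import Data.List.Relation.Unary.All as All using (All; []; _∷_)
  open import Data.List.Membership.Propositional using (_∈_)
  open import Data.List.Membership.Propositional.Properties using (∈-cartesianProduct⁺)
  open import Data.Nat.ListAction using (sum)
  open import Data.Sum using (_⊎_; inj₁; inj₂; [_,_])

  par : ℕ → Bool
  par zero = false
  par (suc k) = not (par k)

  half : ℕ → ℕ
  half zero = 0
  half (suc k) = if par k then suc (half k) else half k

  par-2* : ∀ k → par (2 ℕ.* k) ≡ false
  par-2* zero = refl
  par-2* (suc k) rewrite ℕₚ.+-suc k (k ℕ.+ 0) = trans (𝔹ₚ.not-involutive _) (par-2* k)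

  half-2* : ∀ k → half (2 ℕ.* k) ≡ k
  half-2* zero = refl
  half-2* (suc k) rewrite ℕₚ.+-suc k (k ℕ.+ 0) | par-2* k = cong suc (half-2* k)

  module Transitive {G : Graph} {n : ℕ} {a r : ℤ} (P : Rose G n a r) (S : Simple n a r)
                    (et : EdgeTransitive (G ×K₂)) where
    open Invariance P S public
    open Edges P using (translate-to; image)

    private
      p₀ p₁ : V Cov
      p₀ = C false (+ 0) false
      p₁ = C false (+ 1) true

      turn : Aut Cov
      turn = translate (+ 0) true ⊙ reflect (+ 1 - a)

      turn₀ : app turn p₀ ≡ p₁
      turn₀ = trans (cong (app (translate (+ 0) true)) (reflect-C (+ 1 - a) false (+ 0) false))
                (translate-to (+ 0) true false (+ 1 - a + a - + 0) false {+ 1} {true} (lem a) refl)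
        where lem : ∀ a → + 1 - a + a - + 0 + + 0 ≡ + 1
              lem = solve-∀

      turn₁ : app turn p₁ ≡ p₀
      turn₁ = trans (cong (app (translate (+ 0) true)) (reflect-C (+ 1 - a) false (+ 1) true))
                (translate-to (+ 0) true false (+ 1 - a + a - + 1) true {+ 0} {false} (lem a) refl)
        where lem : ∀ a → + 1 - a + a - + 1 + + 0 ≡ + 0
              lem = solve-∀

    -- `turn` reverses the rim edge between `p₀` and `p₁`, so edge-transitivity of the cover already
    -- gives transitivity on arcs.
    arc : ∀ t x b d → Σ (Aut Cov) λ σ → app σ p₀ ≡ C t x b × app σ p₁ ≡ N t x b d
    arc t x b d with et p₀ p₁ (C t x b) (N t x b d) (N-adj false (+ 0) false fwd) (N-adj t x b d)
    ... | σ , inj₁ (e , e') = σ , e , e'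
    ... | σ , inj₂ (e , e') = σ ⊙ turn , trans (cong (app σ) turn₀) e' , trans (cong (app σ) turn₁) e

    0+0F : + 0 + ev 0F ≡ + 0
    0+0F = trans (cong (_+_ (+ 0)) ev-0) refl

    place₀ : ∀ t b → place (+ 0) b (t , 0F) ≡ C t (+ 0) b
    place₀ t b = cong (λ z → C t z b) 0+0F

    place₁ : ∀ t d b → place (+ 0) (not b) (neighbour (t , 0F) d) ≡ N t (+ 0) b d
    place₁ t d b = trans (N-place (+ 0) b (t , 0F) d) (N-cong (place₀ t b) d)

    closing-value : ∀ k t d → flips k true ≡ false →
      energy (closing k (arcAt t d)) ≡ paths k p₁ p₀ ℕ.* paths k p₁ p₀ ℕ.+ 0
    closing-value k t d e = cong (λ v → v ℕ.* v ℕ.+ 0) (begin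
        count (walks k (neighbour (t , 0F) d) (t , 0F))                    ≡⟨ paths-walks k (+ 0) true _ _ ⟨
        paths k (place (+ 0) true (neighbour (t , 0F) d)) (place (+ 0) (flips k true) (t , 0F))
                                                                           ≡⟨ cong₂ (paths k) (place₁ t d false) (trans (cong (λ b → place (+ 0) b (t , 0F)) e) (place₀ t false)) ⟩
        paths k (N t (+ 0) false d) (C t (+ 0) false)                      ≡⟨ cong₂ (paths k) (sym e₁) (sym e₀) ⟩
        paths k (app σ p₁) (app σ p₀)                                      ≡⟨ paths-invariant σ k p₁ p₀ ⟩
        paths k p₁ p₀ ∎)
      where
        open ≡-Reasoning
        σ = proj₁ (arc t (+ 0) false d)
        e₀ = proj₁ (proj₂ (arc t (+ 0) false d))
        e₁ = proj₂ (proj₂ (arc t (+ 0) false d))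

    corners-value : ∀ k t d → flips k false ≡ false →
      energy (corners k (arcAt t d)) ≡ turning k p₀ p₁
    corners-value k t d e = begin
        energy (corners k ((t , 0F) , y))                          ≡⟨ go (neighbours y) ⟩
        sum (map (λ w → val w ℕ.* val w) (neighbours y))           ≡⟨ cong sum (lemma y) ⟩
        sum (map g (nbrs (place (+ 0) true y)))                    ≡⟨ cong (λ p → sum (map g (nbrs p))) (trans (place₁ t d false) (sym e₁)) ⟩
        sum (map g (nbrs (app σ p₁)))                              ≡⟨ cong (λ p → turning k p (app σ p₁)) (trans (trans (cong (λ b → place (+ 0) b (t , 0F)) e) (place₀ t false)) (sym e₀)) ⟩
        turning k (app σ p₀) (app σ p₁)                            ≡⟨ turning-invariant σ k p₀ p₁ ⟩
        turning k p₀ p₁ ∎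
      where
        open ≡-Reasoning
        y = neighbour (t , 0F) d
        x₀ = place (+ 0) (flips k false) (t , 0F)
        σ = proj₁ (arc t (+ 0) false d)
        e₀ = proj₁ (proj₂ (arc t (+ 0) false d))
        e₁ = proj₂ (proj₂ (arc t (+ 0) false d))
        g : V Cov → ℕ
        g w = paths k w x₀ ℕ.* paths k w x₀
        val : Place → ℕ
        val w = paths k (place (+ 0) false w) x₀
        go : ∀ ws → energy (map (λ w → walks k w (t , 0F)) ws) ≡ sum (map (λ w → val w ℕ.* val w) ws)
        go [] = refl
        go (w ∷ ws) = cong₂ ℕ._+_ (cong (λ v → v ℕ.* v) (sym (paths-walks k (+ 0) false w (t , 0F)))) (go ws)
        lemma : ∀ s → map (λ w → val w ℕ.* val w) (neighbours s) ≡ map g (nbrs (place (+ 0) true s))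
        lemma s@(t' , f) = begin
          map (λ w → val w ℕ.* val w) (map (neighbour s) dirs)                    ≡⟨⟩
          map g (map (λ d → place (+ 0) false (neighbour s d)) dirs)              ≡⟨ cong (map g) (Listₚ.map-cong (N-place (+ 0) true s) dirs) ⟩
          map g (map (N t' (+ 0 + ev f) true) dirs)                               ≡⟨ cong (map g) (nbrs-C t' (+ 0 + ev f) true) ⟨
          map g (nbrs (place (+ 0) true s)) ∎

    balanced : All Balanced balance
    balanced =
        (_ , closing-value 3 false fwd refl ∷ closing-value 3 true fwd refl ∷ closing-value 3 false near refl ∷ [])
      ∷ (_ , closing-value 5 false fwd refl ∷ closing-value 5 true fwd refl ∷ closing-value 5 false near refl ∷ [])
      ∷ (_ , corners-value 4 false fwd refl ∷ corners-value 4 true fwd refl ∷ corners-value 4 false near refl ∷ corners-value 4 true near refl ∷ [])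
      ∷ []

    -- A matching of the neighbours of every vertex that is respected by all automorphisms

    Respected : Matching → Set
    Respected μ = ∀ (σ : Aut Cov) t x b i t' x' b' i' → app σ (C t x b) ≡ C t' x' b' → app σ (N t x b i) ≡ N t' x' b' i' →
      app σ (N t x b (μ t i)) ≡ N t' x' b' (μ t' i')

    ==D-refl : ∀ d → d ==D d ≡ true
    ==D-refl fwd = refl
    ==D-refl bwd = refl
    ==D-refl near = refl
    ==D-refl far = refl

    ==D-sound : ∀ d e → d ==D e ≡ true → d ≡ e
    ==D-sound fwd fwd _ = refl
    ==D-sound bwd bwd _ = refl
    ==D-sound near near _ = refl
    ==D-sound far far _ = refl

    Separated : Matching → ℕ → Set
    Separated μ k = Σ ℕ λ c → ∀ t i j → (count (corner k (t , i , j)) ℕ.≡ᵇ c) ≡ (j ==D μ t i)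

    agree-sound : ∀ μ k c xs → agree c (map (flag μ) xs) (map count (map (corner k) xs)) ≡ true →
      All (λ x → (count (corner k x) ℕ.≡ᵇ c) ≡ flag μ x) xs
    agree-sound μ k c [] _ = []
    agree-sound μ k c (x ∷ xs) e with ∧-true {(count (corner k x) ℕ.≡ᵇ c) ==B flag μ x} e
    ... | p , q = ==B-sound _ _ p ∷ agree-sound μ k c xs q

    ∈-allCorners : ∀ t i j → (t , i , j) ∈ allCorners
    ∈-allCorners t i j = ∈-cartesianProduct⁺ (∈-types t) (∈-cartesianProduct⁺ (∈-dirs i) (∈-dirs j))
      where
        ∈-types : ∀ t → t ∈ (false ∷ true ∷ [])
        ∈-types false = here refl
        ∈-types true = there (here refl)

    separated : ∀ μ k → separates μ (map count (map (corner k) allCorners)) ≡ true → Separated μ k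
    separated μ k sep = go allCorners ∈-allCorners sep
      where
        go : ∀ xs → (∀ t i j → (t , i , j) ∈ xs) → agree (common (map (flag μ) xs) (map count (map (corner k) xs))) (map (flag μ) xs) (map count (map (corner k) xs)) ≡ true → Separated μ k
        go xs mem e = _ , λ t i j → All.lookup (agree-sound μ k _ xs e) (mem t i j)

    -- σ preserves the number of walks between two neighbours of a vertex, and the reference count
    -- occurs at matched pairs only, so partners go to partners. The length must be even because two
    -- neighbours of a vertex share a level.
    respected : ∀ μ k → (∀ b → flips k b ≡ b) → Separated μ k → Respected μ
    respected μ k fl (c , value) σ t x b i t' x' b' i' e eᵢ with image σ t x b (μ t i) t' x' b' e
    ... | j' , eⱼ = trans eⱼ (cong (N t' x' b') (==D-sound j' (μ t' i') (trans (sym (value t' i' j')) same)))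
      where
        paths-corner : ∀ t x b i j → paths k (N t x b i) (N t x b j) ≡ count (corner k (t , i , j))
        paths-corner t x b i j = trans (cong₂ (paths k) (sym (pl i)) (trans (sym (pl j)) (cong (λ c → place x c (neighbour (t , 0F) j)) (sym (fl (not b))))))
            (paths-walks k x (not b) (neighbour (t , 0F) i) (neighbour (t , 0F) j))
          where pl : ∀ i → place x (not b) (neighbour (t , 0F) i) ≡ N t x b i
                pl i = trans (N-place x b (t , 0F) i) (N-cong (cong (λ z → C t z b) (trans (cong (_+_ x) ev-0) (ℤₚ.+-identityʳ x))) i)
        counts : count (corner k (t' , i' , j')) ≡ count (corner k (t , i , μ t i))
        counts = begin
          count (corner k (t' , i' , j'))                     ≡⟨ paths-corner t' x' b' i' j' ⟨
          paths k (N t' x' b' i') (N t' x' b' j')             ≡⟨ cong₂ (paths k) (sym eᵢ) (sym eⱼ) ⟩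
          paths k (app σ (N t x b i)) (app σ (N t x b (μ t i))) ≡⟨ paths-invariant σ k _ _ ⟩
          paths k (N t x b i) (N t x b (μ t i))               ≡⟨ paths-corner t x b i (μ t i) ⟩
          count (corner k (t , i , μ t i)) ∎
          where open ≡-Reasoning
        same : (count (corner k (t' , i' , j')) ℕ.≡ᵇ c) ≡ true
        same = trans (cong (ℕ._≡ᵇ c) counts) (trans (value t i (μ t i)) (==D-refl (μ t i)))

    -- Sequences of vertices that leave each vertex by the partner of the edge of arrival

    record Step (μ : Matching) (p q s : V Cov) : Set where
      constructor step-at
      field
        {t} : Bool
        {x} : ℤ
        {b} : Bool
        i : Dir
        at : q ≡ C t x b
        prev : p ≡ N t x b i
        next : s ≡ N t x b (μ t i)

    Line : Matching → (ℕ → V Cov) → Set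
    Line μ f = ∀ k → Step μ (f k) (f (suc k)) (f (suc (suc k)))

    -- The edge of arrival determines its direction, since different directions lead to different
    -- neighbours, and the direction determines its partner. Two consecutive vertices thus determine
    -- the whole line.
    line-unique : ∀ {μ f g} → Line μ f → Line μ g → f 0 ≡ g 0 → f 1 ≡ g 1 → ∀ k → f k ≡ g k × f (suc k) ≡ g (suc k)
    line-unique lf lg e₀ e₁ zero = e₀ , e₁
    line-unique {μ} {f} {g} lf lg e₀ e₁ (suc k) with line-unique lf lg e₀ e₁ k
    ... | p , q = q , next (lf k) (lg k) p q
      where
        next : ∀ {p q s p' q' s'} → Step μ p q s → Step μ p' q' s' → p ≡ p' → q ≡ q' → s ≡ s'
        next (step-at {t} {x} {b} i refl refl refl) (step-at {t'} {x'} {b'} i' refl refl refl) e e' with C-type e'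
        ... | refl with N-inj t' {x'} {b'} i i' (trans (sym (N-cong e' i)) e)
        ... | refl = N-cong e' (μ t' i)

    image-line : ∀ {μ f} → Respected μ → ∀ (σ : Aut Cov) → Line μ f → Line μ (app σ ∘ f)
    image-line {μ} resp σ l k with l k
    ... | step-at {t} {x} {b} i e e' e″ with type (app σ (C t x b)) | index (app σ (C t x b)) | proj₂ (app σ (C t x b)) | C-surj (app σ (C t x b))
    ... | t' | x' | b' | s with image σ t x b i t' x' b' (sym s)
    ... | i' , eᵢ = step-at i' (trans (cong (app σ) e) (sym s)) (trans (cong (app σ) e') eᵢ)
                      (trans (cong (app σ) e″) (resp σ t x b i t' x' b' i' (sym s) eᵢ))

    -- The spoke line runs through u_0, v_0, u_a, v_a, u_{2a}, and so on; the parity of k gives its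
    -- type and level, half of k the multiple of a.
    rimLine rimLine⁻ spokeLine : ℕ → V Cov
    rimLine k = C false (+ k) (par k)
    rimLine⁻ k = C false (- + k) (par k)
    spokeLine k = C (par k) (+ half k * a) (par k)

    private
      +suc : ∀ k → + suc k ≡ + k + + 1
      +suc k = trans (cong +_ (sym (ℕₚ.+-comm k 1))) (ℤₚ.pos-+ k 1)

      N≡ : ∀ {t t' x y b b'} → t ≡ t' → x ≡ y → b ≡ b' → C t x b ≡ C t' y b'
      N≡ refl refl refl = refl

    rimLine-line : Line straight rimLine
    rimLine-line k = step-at bwd refl
      (N≡ refl (trans (lem (+ k)) (cong (_- + 1) (sym (+suc k)))) (sym (𝔹ₚ.not-involutive _)))
      (N≡ refl (+suc (suc k)) refl)
      where lem : ∀ k → k ≡ k + + 1 - + 1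
            lem = solve-∀

    rimLine⁻-line : Line straight rimLine⁻
    rimLine⁻-line k = step-at fwd refl
      (N≡ refl (trans (lem (+ k)) (cong (λ z → - z + + 1) (sym (+suc k)))) (sym (𝔹ₚ.not-involutive _)))
      (N≡ refl (trans (cong -_ (+suc (suc k))) (ℤₚ.neg-distrib-+ (+ suc k) (+ 1))) refl)
      where lem : ∀ k → - k ≡ - (k + + 1) + + 1
            lem = solve-∀

    spokeLine-line : Line straight spokeLine
    spokeLine-line k with par k
    ... | false = step-at near refl refl (N≡ refl (trans (cong (_* a) (+suc (half k))) (lem (+ half k) a)) refl)
      where lem : ∀ h a → (h + + 1) * a ≡ h * a + a
            lem = solve-∀
    ... | true = step-at far refl (N≡ refl (trans (lem (+ half k) a) (cong (λ z → z * a - a) (sym (+suc (half k))))) refl) refl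
      where lem : ∀ h a → h * a ≡ (h + + 1) * a - a
            lem = solve-∀

    module Straight (resp : Respected straight) where

      private
        σ : Aut Cov
        σ = proj₁ (arc false (+ 0) false near)

        σ₀ : app σ p₀ ≡ C false (+ 0) false
        σ₀ = proj₁ (proj₂ (arc false (+ 0) false near))

        σ₁ : app σ p₁ ≡ C true (+ 0) true
        σ₁ = proj₂ (proj₂ (arc false (+ 0) false near))

      rim→spoke : ∀ k → app σ (rimLine k) ≡ spokeLine k
      rim→spoke k = proj₁ (line-unique (image-line resp σ rimLine-line) spokeLine-line
        (trans σ₀ (N≡ refl (lem a) refl)) (trans σ₁ (N≡ refl (lem a) refl)) k)
        where lem : ∀ a → + 0 ≡ + 0 * a
              lem = solve-∀

      -- σ fixes u₀ and takes one rim edge at u₀ to a spoke, hence both spokes to rim edges.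
      spoke→rim : (∀ k → app σ (spokeLine k) ≡ rimLine k) ⊎ (∀ k → app σ (spokeLine k) ≡ rimLine⁻ k)
      spoke→rim with image σ false (+ 0) false near false (+ 0) false σ₀
      ... | fwd , e = inj₁ (λ k → proj₁ (line-unique (image-line resp σ spokeLine-line) rimLine-line s₀ (trans (cong (app σ) s₁) e) k))
        where s₀ = trans (cong (app σ) (N≡ refl (lem a) refl)) σ₀
                where lem : ∀ a → + 0 * a ≡ + 0
                      lem = solve-∀
              s₁ : spokeLine 1 ≡ N false (+ 0) false near
              s₁ = N≡ refl (lem a) refl
                where lem : ∀ a → + 0 * a ≡ + 0
                      lem = solve-∀
      ... | bwd , e = inj₂ (λ k → proj₁ (line-unique (image-line resp σ spokeLine-line) rimLine⁻-line s₀ (trans (cong (app σ) s₁) e) k))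
        where s₀ = trans (cong (app σ) (N≡ refl (lem a) refl)) σ₀
                where lem : ∀ a → + 0 * a ≡ + 0
                      lem = solve-∀
              s₁ : spokeLine 1 ≡ N false (+ 0) false near
              s₁ = N≡ refl (lem a) refl
                where lem : ∀ a → + 0 * a ≡ + 0
                      lem = solve-∀
      ... | near , e with N-inj false fwd near (app-injective σ (trans σ₁ (sym e)))
      ... | ()
      spoke→rim | far , e with N-inj false bwd near (app-injective σ (trans (resp σ false (+ 0) false fwd false (+ 0) false near σ₀ σ₁) (sym e)))
      ... | ()

      lines-close : ∀ k → (rimLine k ≡ rimLine 0 → spokeLine k ≡ spokeLine 0) × (spokeLine k ≡ spokeLine 0 → rimLine k ≡ rimLine 0)
      lines-close k = (λ e → trans (sym (rim→spoke k)) (trans (cong (app σ) e) (rim→spoke 0)))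
                    , (λ e → app-injective σ (trans (rim→spoke k) (trans e (sym (rim→spoke 0)))))

      -- After 2m steps the rim line is at u_{2m} and the spoke line at u_{ma}, both on the starting
      -- level. σ maps the first line to the second, so one has returned exactly when the other has.
      close-rim : ∀ m → (+ 2 * + m) ≈ + 0 → (+ m * a) ≈ + 0
      close-rim m e = C-inj-0 (proj₁ (lines-close (2 ℕ.* m)) (trans (N≡ refl (ℤₚ.pos-* 2 m) (par-2* m)) (C-cong e)))
        where
          C-inj-0 : spokeLine (2 ℕ.* m) ≡ spokeLine 0 → (+ m * a) ≈ + 0
          C-inj-0 q = ≈-trans (≈-reflexive (cong (λ h → + h * a) (sym (half-2* m)))) (≈-trans (C-inj q) (≈-reflexive (lem a)))
            where lem : ∀ a → + 0 * a ≡ + 0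
                  lem = solve-∀

      close-spoke : ∀ m → (+ m * a) ≈ + 0 → (+ 2 * + m) ≈ + 0
      close-spoke m e = ≈-trans (≈-reflexive (sym (ℤₚ.pos-* 2 m))) (C-inj (proj₂ (lines-close (2 ℕ.* m))
          (trans (N≡ (par-2* m) (cong (λ h → + h * a) (half-2* m)) (par-2* m)) (C-cong (≈-trans e (≈-reflexive (lem a)))))))
        where lem : ∀ a → + 0 ≡ + 0 * a
              lem = solve-∀

      -- If a = 2e, then u_a is both vertex 2 of the spoke line and vertex 2e of the rim line. σ
      -- sends it to vertex ±2 of the rim line and to vertex 2e of the spoke line, which is u_{ea}.
      rim-square : ∀ e → a ≈ (+ 2 * + e) → (+ e * a) ≈ + 2 ⊎ (+ e * a) ≈ (- + 2)
      rim-square e h with spoke→rim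
      ... | inj₁ f = inj₁ (C-inj (trans (sym same) (f 2)))
        where same : app σ (spokeLine 2) ≡ C false (+ e * a) false
              same = trans (cong (app σ) (trans (C-cong (≈-trans (≈-reflexive (lem a)) (≈-trans h (≈-reflexive (sym (ℤₚ.pos-* 2 e)))))) (N≡ refl refl (sym (par-2* e)))))
                       (trans (rim→spoke (2 ℕ.* e)) (N≡ (par-2* e) (cong (λ h → + h * a) (half-2* e)) (par-2* e)))
                where lem : ∀ a → + 1 * a ≡ a
                      lem = solve-∀
      ... | inj₂ f = inj₂ (C-inj (trans (sym same) (f 2)))
        where same : app σ (spokeLine 2) ≡ C false (+ e * a) false
              same = trans (cong (app σ) (trans (C-cong (≈-trans (≈-reflexive (lem a)) (≈-trans h (≈-reflexive (sym (ℤₚ.pos-* 2 e)))))) (N≡ refl refl (sym (par-2* e)))))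
                       (trans (rim→spoke (2 ℕ.* e)) (N≡ (par-2* e) (cong (λ h → + h * a) (half-2* e)) (par-2* e)))
                where lem : ∀ a → + 1 * a ≡ a
                      lem = solve-∀

-- Parity of indices, bipartite parameters and twins.

module Parity where
  open RoseWindow
  open import Data.Integer.DivMod using (_%ℕ_; _/ℕ_; a≡a%ℕn+[a/ℕn]*n; n%ℕd<d)
  open import Data.Integer.Divisibility.Signed using (divides)
  open import Data.Bool using (Bool; true; false; not)
  open import Data.List using (_∷_; [])
  open import Function.Bundles using (mk⇔)

  -- Parity

  EvenZ OddZ : ℤ → Set
  EvenZ x = Σ ℤ λ q → x ≡ + 2 * q
  OddZ x = Σ ℤ λ q → x ≡ + 2 * q + + 1

  parity : ∀ x → EvenZ x ⊎ OddZ x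
  parity x with x %ℕ 2 | n%ℕd<d x 2 | a≡a%ℕn+[a/ℕn]*n x 2
  ... | 0 | _ | e = inj₁ (x /ℕ 2 , trans e (lem (x /ℕ 2)))
    where lem : ∀ q → + 0 + q * + 2 ≡ + 2 * q
          lem = solve-∀
  ... | 1 | _ | e = inj₂ (x /ℕ 2 , trans e (lem (x /ℕ 2)))
    where lem : ∀ q → + 1 + q * + 2 ≡ + 2 * q + + 1
          lem = solve-∀
  ... | suc (suc _) | ℕ.s≤s (ℕ.s≤s ()) | _

  2∤1 : ∀ q → + 2 * q ≢ + 1
  2∤1 q e = Mod.¬D-small 2 {1} (ℕ.s≤s ℕ.z≤n) (ℕ.s≤s (ℕ.s≤s ℕ.z≤n)) (divides q (trans (sym e) (ℤₚ.*-comm (+ 2) q)))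

  even≢odd : ∀ {x} → EvenZ x → ¬ OddZ x
  even≢odd (q , refl) (q' , e) = 2∤1 (q - q') (trans (lem q q') (trans (cong (_- + 2 * q') e) (lem' q')))
    where lem : ∀ q q' → + 2 * (q - q') ≡ + 2 * q - + 2 * q'
          lem = solve-∀
          lem' : ∀ q' → + 2 * q' + + 1 - + 2 * q' ≡ + 1
          lem' = solve-∀

  even-+ : ∀ {x y} → EvenZ x → EvenZ y → EvenZ (x + y)
  even-+ (p , refl) (q , refl) = p + q , sym (ℤₚ.*-distribˡ-+ (+ 2) p q)

  even-* : ∀ x {y} → EvenZ y → EvenZ (x * y)
  even-* x (q , refl) = x * q , lem x q
    where lem : ∀ x q → x * (+ 2 * q) ≡ + 2 * (x * q)
          lem = solve-∀

  odd+1 : ∀ {x} → OddZ x → EvenZ (x + + 1)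
  odd+1 (q , refl) = q + + 1 , lem q
    where lem : ∀ q → + 2 * q + + 1 + + 1 ≡ + 2 * (q + + 1)
          lem = solve-∀

  even+1 : ∀ {x} → EvenZ x → OddZ (x + + 1)
  even+1 (q , refl) = q , refl

  odd-+ : ∀ {x y} → EvenZ x → OddZ y → OddZ (x + y)
  odd-+ (p , refl) (q , refl) = p + q , lem p q
    where lem : ∀ p q → + 2 * p + (+ 2 * q + + 1) ≡ + 2 * (p + q) + + 1
          lem = solve-∀

  even-neg : ∀ {x} → EvenZ x → EvenZ (- x)
  even-neg (p , refl) = - p , lem p
    where lem : ∀ p → - (+ 2 * p) ≡ + 2 * (- p)
          lem = solve-∀

  odd-neg : ∀ {x} → OddZ x → OddZ (- x)
  odd-neg (p , refl) = - p - + 1 , lem p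
    where lem : ∀ p → - (+ 2 * p + + 1) ≡ + 2 * (- p - + 1) + + 1
          lem = solve-∀

  odd-+-odd : ∀ {x y} → OddZ x → OddZ y → EvenZ (x + y)
  odd-+-odd (p , refl) (q , refl) = p + q + + 1 , lem p q
    where lem : ∀ p q → + 2 * p + + 1 + (+ 2 * q + + 1) ≡ + 2 * (p + q + + 1)
          lem = solve-∀

  odd-* : ∀ {x y} → OddZ x → OddZ y → OddZ (x * y)
  odd-* (p , refl) (q , refl) = + 2 * p * q + p + q , lem p q
    where lem : ∀ p q → (+ 2 * p + + 1) * (+ 2 * q + + 1) ≡ + 2 * (+ 2 * p * q + p + q) + + 1
          lem = solve-∀

  bit : ℤ → Bool
  bit x = isOdd (parity x)
    where isOdd : EvenZ x ⊎ OddZ x → Bool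
          isOdd (inj₁ _) = false
          isOdd (inj₂ _) = true

  bit-even : ∀ {x} → EvenZ x → bit x ≡ false
  bit-even {x} e with parity x
  ... | inj₁ _ = refl
  ... | inj₂ o = ⊥-elim (even≢odd e o)

  bit-odd : ∀ {x} → OddZ x → bit x ≡ true
  bit-odd {x} o with parity x
  ... | inj₁ e = ⊥-elim (even≢odd e o)
  ... | inj₂ _ = refl

  bit-same : ∀ {x y} → EvenZ (x - y) → bit x ≡ bit y
  bit-same {x} {y} e with parity y
  ... | inj₁ e' = bit-even (subst EvenZ (lem x y) (even-+ e e'))
    where lem : ∀ x y → x - y + y ≡ x
          lem = solve-∀
  ... | inj₂ o = bit-odd (subst OddZ (lem x y) (odd-+ e o))
    where lem : ∀ x y → x - y + y ≡ x
          lem = solve-∀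

  bit-suc : ∀ x → bit (x + + 1) ≡ not (bit x)
  bit-suc x with parity x
  ... | inj₁ e = bit-odd (even+1 e)
  ... | inj₂ o = bit-even (odd+1 o)

  bit-odd+ : ∀ x {y} → OddZ y → bit (x + y) ≡ not (bit x)
  bit-odd+ x {y} (q , refl) = trans (bit-same {x + (+ 2 * q + + 1)} {x + + 1} (q , lem x q)) (bit-suc x)
    where lem : ∀ x q → x + (+ 2 * q + + 1) - (x + + 1) ≡ + 2 * q
          lem = solve-∀

  bit-even+ : ∀ x {y} → EvenZ y → bit (x + y) ≡ bit x
  bit-even+ x {y} (q , refl) = bit-same (q , lem x q)
    where lem : ∀ x q → x + + 2 * q - x ≡ + 2 * q
          lem = solve-∀

  module _ {G : Graph} {n : ℕ} {a r : ℤ} (P : Rose G n a r) where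
    open Mod n
    open Rose P

    even-D : EvenZ (+ n) → ∀ {x} → D x → EvenZ x
    even-D e {x} (divides q eq) = subst EvenZ (sym eq) (even-* q e)

    even-≈ : EvenZ (+ n) → ∀ {x y} → x ≈ y → EvenZ (x - y)
    even-≈ e p = even-D e (diff p)

    -- With a even and r odd the parity of the index, complemented on the v_i, is a
    -- proper colouring.
    bipartite : EvenZ (+ n) → EvenZ a → OddZ r → Bipartite G
    bipartite en ea or = col , λ x y e → subst₂ (λ p q → col p ≢ col q) (vtx-surj x) (vtx-surj y)
        (λ q → go (typ x) (idx x) (typ y) (idx y)
          (adj⇒ (subst₂ (Adj G) (sym (vtx-surj x)) (sym (vtx-surj y)) e))
          (trans (sym (col-vtx (typ x) (idx x))) (trans q (col-vtx (typ y) (idx y)))))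
      where
        c : Bool → ℤ → Bool
        c false x = bit x
        c true x = not (bit x)
        col : V G → Bool
        col p = c (typ p) (idx p)
        col-vtx : ∀ t x → col (vtx t x) ≡ c t x
        col-vtx t x with vtx-inj (vtx-surj (vtx t x))
        ... | e , d = trans (cong (λ t' → c t' (idx (vtx t x))) e) (same t (idx (vtx t x)) d)
          where same : ∀ t y → y ≈ x → c t y ≡ c t x
                same false y d = bit-same (even-≈ en d)
                same true y d = cong not (bit-same (even-≈ en d))
        col' : ∀ x y → y ≈ x → bit y ≡ bit x
        col' x y p = bit-same (even-≈ en p)
        fix : ∀ b → b ≢ not b
        fix false ()
        fix true ()
        go : ∀ t x t' y → RoseAdj n a r t x t' y → c t x ≢ c t' y
        go false x false y (inj₁ p) q = fix (bit x) (trans q (trans (col' _ _ p) (bit-suc x)))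
        go false x false y (inj₂ p) q = fix (bit x) (trans q (trans (col' _ _ p) (bit-odd+ x (- + 1 , refl))))
        go false x true y (inj₁ p) q = fix (bit x) (trans q (cong not (col' _ _ p)))
        go false x true y (inj₂ p) q = fix (bit x) (trans q (cong not (trans (col' _ _ p) (bit-even+ x (even-neg ea)))))
        go true x false y (inj₁ p) q = fix (bit x) (sym (trans q (col' _ _ p)))
        go true x false y (inj₂ p) q = fix (bit x) (sym (trans q (trans (col' _ _ p) (bit-even+ x ea))))
        go true x true y (inj₁ p) q = fix (not (bit x)) (trans q (cong not (trans (col' _ _ p) (bit-odd+ x or))))
        go true x true y (inj₂ p) q = fix (not (bit x)) (trans q (cong not (trans (col' _ _ p) (bit-odd+ x (odd-neg or)))))

    twins⁺ : a ≈ + 2 → r ≈ + 1 → HasTwins G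
    twins⁺ ha hr = vtx true (+ 0) , vtx false (+ 1) , (λ e → case (proj₁ (vtx-inj e))) ,
        λ z → mk⇔ (λ e → subst (Adj G _) (vtx-surj z) (adj⇐ (f (typ z) (idx z) (adj⇒ (subst (Adj G _) (sym (vtx-surj z)) e)))))
                  (λ e → subst (Adj G _) (vtx-surj z) (adj⇐ (g (typ z) (idx z) (adj⇒ (subst (Adj G _) (sym (vtx-surj z)) e)))))
      where
        case : true ≢ false
        case ()
        f : ∀ t y → RoseAdj n a r true (+ 0) t y → RoseAdj n a r false (+ 1) t y
        f false y (inj₁ p) = inj₂ p
        f false y (inj₂ p) = inj₁ (lin₂ (+ 1) (+ 1) p ha (solve (y ∷ a ∷ [])))
        f true y (inj₁ p) = inj₁ (lin₂ (+ 1) (+ 1) p hr (solve (y ∷ r ∷ [])))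
        f true y (inj₂ p) = inj₂ (lin₃ (+ 1) (- + 1) (+ 1) p hr ha (solve (y ∷ a ∷ r ∷ [])))
        g : ∀ t y → RoseAdj n a r false (+ 1) t y → RoseAdj n a r true (+ 0) t y
        g false y (inj₁ p) = inj₂ (lin₂ (+ 1) (- + 1) p ha (solve (y ∷ a ∷ [])))
        g false y (inj₂ p) = inj₁ p
        g true y (inj₁ p) = inj₁ (lin₂ (+ 1) (- + 1) p hr (solve (y ∷ r ∷ [])))
        g true y (inj₂ p) = inj₂ (lin₃ (+ 1) (+ 1) (- + 1) p hr ha (solve (y ∷ a ∷ r ∷ [])))

  module _ {G : Graph} {n : ℕ} {a r : ℤ} (P : Rose G n a r) where
    open Mod n

    ≈-neg : ∀ {x y} → x ≈ (- y) → (- x) ≈ y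
    ≈-neg {x} {y} p = lin₁ (- + 1) p (solve (x ∷ y ∷ []))

    twins : a ≈ + 2 ⊎ a ≈ (- + 2) → r ≈ + 1 ⊎ r ≈ (- + 1) → HasTwins G
    twins (inj₁ p) (inj₁ q) = twins⁺ P p q
    twins (inj₁ p) (inj₂ q) = twins⁺ (negate-r P) p (≈-neg q)
    twins (inj₂ p) (inj₁ q) = twins⁺ (negate-a P) (≈-neg p) q
    twins (inj₂ p) (inj₂ q) = twins⁺ (negate-r (negate-a P)) (≈-neg p) (≈-neg q)

-- Level-preserving maps of the layered graph, by enumeration.

module LayeredGraph where
  open RoseWindow
  open LinearForms using (∧-true)
  open SymbolicWalks using (_==B_)
  open import Data.Bool using (Bool; true; false; not; _∧_; _∨_; if_then_else_; T)
  open import Data.List as List using (List; []; _∷_; map; concatMap)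
  open import Data.List.Relation.Unary.All using ([]; _∷_)
  open import Data.List.Membership.Propositional using (_∈_)
  open import Data.List.Membership.Propositional.Properties using (∈-++⁺ˡ; ∈-++⁺ʳ)
  open import Data.Maybe using (Maybe; just; nothing)

  -- The layered graph: eight vertices (t , y), y ∈ ℤ₄, on every level

  data ℤ₄ : Set where
    q0 q1 q2 q3 : ℤ₄

  succ pred : ℤ₄ → ℤ₄
  succ q0 = q1
  succ q1 = q2
  succ q2 = q3
  succ q3 = q0
  pred q0 = q3
  pred q1 = q0
  pred q2 = q1
  pred q3 = q2

  Sym : Set
  Sym = Bool × ℤ₄

  up down : Sym → List Sym
  up (false , y) = (false , y) ∷ (true , pred y) ∷ []
  up (true , y) = (false , y) ∷ (true , succ y) ∷ []
  down (false , y) = (false , y) ∷ (true , y) ∷ []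
  down (true , y) = (false , succ y) ∷ (true , pred y) ∷ []

  _==Q_ : ℤ₄ → ℤ₄ → Bool
  q0 ==Q q0 = true
  q1 ==Q q1 = true
  q2 ==Q q2 = true
  q3 ==Q q3 = true
  _ ==Q _ = false

  _==S_ : Sym → Sym → Bool
  (t , y) ==S (t' , y') = (t ==B t') ∧ (y ==Q y')

  ==Q-sound : ∀ x y → x ==Q y ≡ true → x ≡ y
  ==Q-sound q0 q0 _ = refl
  ==Q-sound q1 q1 _ = refl
  ==Q-sound q2 q2 _ = refl
  ==Q-sound q3 q3 _ = refl

  ==Q-refl : ∀ x → x ==Q x ≡ true
  ==Q-refl q0 = refl
  ==Q-refl q1 = refl
  ==Q-refl q2 = refl
  ==Q-refl q3 = refl

  ==S-sound : ∀ s s' → s ==S s' ≡ true → s ≡ s'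
  ==S-sound (t , y) (t' , y') e with ∧-true {t ==B t'} e
  ==S-sound (true , y) (true , y') e | p , q = cong (true ,_) (==Q-sound y y' q)
  ==S-sound (false , y) (false , y') e | p , q = cong (false ,_) (==Q-sound y y' q)

  ==S-refl : ∀ s → s ==S s ≡ true
  ==S-refl (true , y) = ==Q-refl y
  ==S-refl (false , y) = ==Q-refl y

  memS : Sym → List Sym → Bool
  memS s [] = false
  memS s (s' ∷ ss) = (s ==S s') ∨ memS s ss

  memS-complete : ∀ {s ss} → s ∈ ss → memS s ss ≡ true
  memS-complete {s} (here refl) rewrite ==S-refl s = refl
  memS-complete {s} {s' ∷ ss} (there m) with s ==S s'
  ... | true = refl
  ... | false = memS-complete m

  memS-sound : ∀ s ss → memS s ss ≡ true → s ∈ ss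
  memS-sound s (s' ∷ ss) e with s ==S s' in eq
  ... | true = here (==S-sound s s' eq)
  ... | false = there (memS-sound s ss e)

  syms : List Sym
  syms = (false , q0) ∷ (false , q1) ∷ (false , q2) ∷ (false , q3) ∷ (true , q0) ∷ (true , q1) ∷ (true , q2) ∷ (true , q3) ∷ []

  ∈-syms : ∀ s → s ∈ syms
  ∈-syms (false , q0) = here refl
  ∈-syms (false , q1) = there (here refl)
  ∈-syms (false , q2) = there (there (here refl))
  ∈-syms (false , q3) = there (there (there (here refl)))
  ∈-syms (true , q0) = there (there (there (there (here refl))))
  ∈-syms (true , q1) = there (there (there (there (there (here refl)))))
  ∈-syms (true , q2) = there (there (there (there (there (there (here refl))))))
  ∈-syms (true , q3) = there (there (there (there (there (there (there (here refl)))))))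

  Spot : Set
  Spot = ℕ × Sym

  Env : Set
  Env = List (Spot × Sym)

  _==V_ : Spot → Spot → Bool
  (l , s) ==V (l' , s') = (l ℕ.≡ᵇ l') ∧ (s ==S s')

  find : Spot → Env → Maybe Sym
  find v [] = nothing
  find v ((w , o) ∷ env) = if v ==V w then just o else find v env

  _⇒b_ : Bool → Bool → Bool
  true ⇒b b = b
  false ⇒b b = true

  compatible : Spot → Sym → Spot × Sym → Bool
  compatible (l , s) o ((l' , s') , o') =
    if l ℕ.≡ᵇ l' then (not (s ==S s') ⇒b not (o ==S o')) else
    (if l' ℕ.≡ᵇ suc l then (memS s' (up s) ⇒b memS o' (up o)) else
    (if l ℕ.≡ᵇ suc l' then (memS s (up s') ⇒b memS o (up o')) else true))

  -- Only the k latest assignments are compared. For the order below, k = 24 always reaches the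
  -- assigned spots of the same and adjacent levels; a shorter reach would merely keep more
  -- candidates and stay sound.
  consistent : ℕ → Spot → Sym → Env → Bool
  consistent zero v o env = true
  consistent (suc k) v o [] = true
  consistent (suc k) v o (e ∷ env) = compatible v o e ∧ consistent k v o env

  record Item : Set where
    constructor item
    field
      spot from : Spot
      rising : Bool

  choices : Bool → Maybe Sym → List Sym
  choices b nothing = syms
  choices true (just o) = up o
  choices false (just o) = down o

  extend : ℕ → Item → Env → List Env
  extend k (item v w b) env = concatMap (λ o → if consistent k v o env then ((v , o) ∷ env) ∷ [] else []) (choices b (find w env))

  explore : ℕ → List Item → List Env → List Env
  explore k [] envs = envs
  explore k (i ∷ is) envs = explore k is (concatMap (extend k i) envs)

  tops : ℕ → ℕ → List Item
  tops l zero = []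
  tops l (suc k) = map (λ s → item (suc l , s) (l , below (down s)) true) syms List.++ tops (suc l) k
    where below : List Sym → Sym
          below [] = (false , q0)
          below (s ∷ _) = s

  -- After the first spot, each one is adjacent to a spot already assigned and so has at most two
  -- candidates. Levels 0 and 1 are joined by two disjoint 8-cycles, which are traversed in turn;
  -- the spot on level 2 in between provides the passage from one to the other.
  items : List Item
  items =
      item (0 , u q0) (1 , u q0) false
    ∷ item (1 , u q0) (0 , u q0) true ∷ item (0 , v q0) (1 , u q0) false
    ∷ item (1 , v q1) (0 , v q0) true ∷ item (0 , u q2) (1 , v q1) false
    ∷ item (1 , u q2) (0 , u q2) true ∷ item (0 , v q2) (1 , u q2) false
    ∷ item (1 , v q3) (0 , u q0) true
    ∷ item (2 , u q0) (1 , u q0) true ∷ item (1 , v q0) (2 , u q0) false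
    ∷ item (0 , u q1) (1 , v q0) false ∷ item (1 , u q1) (0 , u q1) true
    ∷ item (0 , v q1) (1 , u q1) false ∷ item (1 , v q2) (0 , v q1) true
    ∷ item (0 , u q3) (1 , v q2) false ∷ item (1 , u q3) (0 , u q3) true
    ∷ item (0 , v q3) (1 , u q3) false
    -- Levels 2 to 22, as `halving` looks up level 2 * 11. The dropped entry is the spot on level 2
    -- listed above.
    ∷ List.drop 1 (tops 1 21)
    where u v : ℤ₄ → Sym
          u = false ,_
          v = true ,_

  lower : Sym → Sym
  lower (t , y) = t , pred y

  sameAt differAt : Env → Spot → Spot → Bool
  sameAt env v w with find v env | find w env
  ... | just o | just o' = o ==S o'
  ... | _ | _ = false
  differAt env v w with find v env | find w env
  ... | just o | just o' = not (o ==S o')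
  ... | _ | _ = false

  shiftAt : Env → Spot → Spot → Bool
  shiftAt env v w with find v env | find w env
  ... | just o | just o' = o ==S lower o'
  ... | _ | _ = false

  antipodeAt : Env → Spot → Spot → Bool
  antipodeAt env v w with find v env | find w env
  ... | just o | just o' = o ==S lower (lower o')
  ... | _ | _ = false

  allb anyb : ∀ {A : Set} → (A → Bool) → List A → Bool
  allb p [] = true
  allb p (x ∷ xs) = p x ∧ allb p xs
  anyb p [] = false
  anyb p (x ∷ xs) = p x ∨ anyb p xs

  periodic : Env → Bool
  periodic env = allb (λ s → sameAt env (12 , s) (0 , s)) syms

  -- An implication: if levels 2j and 0 are mapped alike, then level j is mapped like level 0 up to
  -- `lower`. It is conditional because the premise will be known only for the residue of κ.
  halving : Env → ℕ → Bool
  halving env j = anyb (λ s → differAt env (2 ℕ.* j , s) (0 , s)) syms ∨ allb (λ s → shiftAt env (j , lower s) (0 , s)) syms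

  antipodal : Env → Bool
  antipodal env = allb (λ s → antipodeAt env (0 , lower (lower s)) (0 , s)) syms

  halves : List ℕ
  halves = 1 ∷ 3 ∷ 5 ∷ 7 ∷ 9 ∷ 11 ∷ []

  good : Env → Bool
  good env = periodic env ∧ (antipodal env ∧ allb (halving env) halves)

  -- The origin of the period 12: all candidates for the restriction of a level-preserving map to
  -- levels 0 to 22 are listed, beginning with any of eight images for the first spot, and each of
  -- them passes the three tests.
  window : allb good (explore 24 items ([] ∷ [])) ≡ true
  window = refl

  valid : Item → Bool
  valid (item (l , s) (l' , s') true) = (l ℕ.≡ᵇ suc l') ∧ memS s (up s')
  valid (item (l , s) (l' , s') false) = (l' ℕ.≡ᵇ suc l) ∧ memS s' (up s)

  items-valid : allb valid items ≡ true
  items-valid = refl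

  allb-lookup : ∀ {A : Set} (p : A → Bool) {xs x} → allb p xs ≡ true → x ∈ xs → p x ≡ true
  allb-lookup p {y ∷ xs} e (here refl) = proj₁ (∧-true {p y} e)
  allb-lookup p {y ∷ xs} e (there m) = allb-lookup p (proj₂ (∧-true {p y} e)) m

  up⇒down : ∀ s s' → s' ∈ up s → s ∈ down s'
  up⇒down (false , q0) _ (here refl) = here refl
  up⇒down (false , q1) _ (here refl) = here refl
  up⇒down (false , q2) _ (here refl) = here refl
  up⇒down (false , q3) _ (here refl) = here refl
  up⇒down (false , q0) _ (there (here refl)) = here refl
  up⇒down (false , q1) _ (there (here refl)) = here refl
  up⇒down (false , q2) _ (there (here refl)) = here refl
  up⇒down (false , q3) _ (there (here refl)) = here refl
  up⇒down (true , q0) _ (here refl) = there (here refl)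
  up⇒down (true , q1) _ (here refl) = there (here refl)
  up⇒down (true , q2) _ (here refl) = there (here refl)
  up⇒down (true , q3) _ (here refl) = there (here refl)
  up⇒down (true , q0) _ (there (here refl)) = there (here refl)
  up⇒down (true , q1) _ (there (here refl)) = there (here refl)
  up⇒down (true , q2) _ (there (here refl)) = there (here refl)
  up⇒down (true , q3) _ (there (here refl)) = there (here refl)

  ≡ᵇ-true : ∀ m n → (m ℕ.≡ᵇ n) ≡ true → m ≡ n
  ≡ᵇ-true m n e = ℕₚ.≡ᵇ⇒≡ m n (subst T (sym e) _)

  module Layered (F : ℕ → Sym → Sym)
                 (rise : ∀ l s s' → s' ∈ up s → F (suc l) s' ∈ up (F l s))
                 (F-inj : ∀ l s s' → F l s ≡ F l s' → s ≡ s')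
                 (is : List Item) (ok : allb valid is ≡ true) (depth : ℕ) (win : allb good (explore depth is ([] ∷ [])) ≡ true) where

    at : Spot → Sym
    at (l , s) = F l s

    graph : List Spot → Env
    graph = map (λ v → v , at v)

    find-graph : ∀ v vs {o} → find v (graph vs) ≡ just o → o ≡ at v
    find-graph v@(l , s) ((l' , s') ∷ vs) e with (l ℕ.≡ᵇ l') ∧ (s ==S s') in eq
    ... | false = find-graph v vs e
    ... | true with ∧-true {l ℕ.≡ᵇ l'} eq | e
    ... | p , q | refl = cong₂ F (sym (≡ᵇ-true l l' p)) (sym (==S-sound s s' q))

    ⇒b-intro : ∀ {b c} → (b ≡ true → c ≡ true) → (b ⇒b c) ≡ true
    ⇒b-intro {true} f = f refl
    ⇒b-intro {false} f = refl

    compatible-at : ∀ v w → compatible v (at v) (w , at w) ≡ true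
    compatible-at (l , s) (l' , s') with l ℕ.≡ᵇ l' in e₁
    ... | true with refl ← ≡ᵇ-true l l' e₁ = ⇒b-intro (distinct s s')
      where
        distinct : ∀ s s' → not (s ==S s') ≡ true → not (F l s ==S F l s') ≡ true
        distinct s s' e with F l s ==S F l s' in q
        ... | false = refl
        ... | true with refl ← F-inj l s s' (==S-sound _ _ q) with () ← trans (sym e) (cong not (==S-refl s))
    ... | false with l' ℕ.≡ᵇ suc l in e₂
    ... | true with refl ← ≡ᵇ-true l' (suc l) e₂ = ⇒b-intro λ m → memS-complete (rise l s s' (memS-sound _ _ m))
    ... | false with l ℕ.≡ᵇ suc l' in e₃
    ... | true with refl ← ≡ᵇ-true l (suc l') e₃ = ⇒b-intro λ m → memS-complete (rise l' s' s (memS-sound _ _ m))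
    ... | false = refl

    consistent-at : ∀ k v vs → consistent k v (at v) (graph vs) ≡ true
    consistent-at zero v vs = refl
    consistent-at (suc k) v [] = refl
    consistent-at (suc k) v (w ∷ vs) rewrite compatible-at v w = consistent-at k v vs

    choices-at : ∀ v w b vs → valid (item v w b) ≡ true → at v ∈ choices b (find w (graph vs))
    choices-at v w b vs ok with find w (graph vs) in eq
    ... | nothing = ∈-syms (at v)
    choices-at (l , s) (l' , s') true vs ok | just o with ∧-true {l ℕ.≡ᵇ suc l'} ok
    ... | p , q with refl ← ≡ᵇ-true l (suc l') p with refl ← find-graph (l' , s') vs eq = rise l' s' s (memS-sound _ _ q)
    choices-at (l , s) (l' , s') false vs ok | just o with ∧-true {l' ℕ.≡ᵇ suc l} ok
    ... | p , q with refl ← ≡ᵇ-true l' (suc l) p with refl ← find-graph (l' , s') vs eq = up⇒down _ _ (rise l s s' (memS-sound _ _ q))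

    ∈-concatMap : ∀ {A B : Set} (f : A → List B) {x xs y} → x ∈ xs → y ∈ f x → y ∈ concatMap f xs
    ∈-concatMap f {x} {_ ∷ xs} (here refl) m = ∈-++⁺ˡ m
    ∈-concatMap f {x} {x' ∷ xs} (there i) m = ∈-++⁺ʳ (f x') (∈-concatMap f i m)

    extend-at : ∀ i vs → valid i ≡ true → graph (Item.spot i ∷ vs) ∈ extend depth i (graph vs)
    extend-at (item v w b) vs ok = ∈-concatMap (λ o → if consistent depth v o (graph vs) then ((v , o) ∷ graph vs) ∷ [] else []) (choices-at v w b vs ok) kept
      where
        kept : graph (v ∷ vs) ∈ (if consistent depth v (at v) (graph vs) then ((v , at v) ∷ graph vs) ∷ [] else [])
        kept rewrite consistent-at depth v vs = here refl

    -- The true restriction of `F` passes every compatibility test and is never discarded. It is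
    -- therefore among the final environments and has whatever properties were checked for all of
    -- them.
    explore-at : ∀ is vs envs → allb valid is ≡ true → graph vs ∈ envs → Σ (List Spot) λ ws → graph ws ∈ explore depth is envs
    explore-at [] vs envs ok m = vs , m
    explore-at (i ∷ is) vs envs ok m = explore-at is (Item.spot i ∷ vs) (concatMap (extend depth i) envs) (proj₂ (∧-true {valid i} ok))
      (∈-concatMap (extend depth i) m (extend-at i vs (proj₁ (∧-true {valid i} ok))))

    private
      found : Σ (List Spot) λ ws → graph ws ∈ explore depth is ([] ∷ [])
      found = explore-at is [] ([] ∷ []) ok (here refl)

      ws : List Spot
      ws = proj₁ found

      good-ws : good (graph ws) ≡ true
      good-ws = allb-lookup good win (proj₂ found)

      good-parts : ∀ env → good env ≡ true → periodic env ≡ true × antipodal env ≡ true × allb (halving env) halves ≡ true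
      good-parts env e = let p , q = ∧-true {periodic env} e ; p' , q' = ∧-true {antipodal env} q in p , p' , q'

      parts : periodic (graph ws) ≡ true × antipodal (graph ws) ≡ true × allb (halving (graph ws)) halves ≡ true
      parts = good-parts (graph ws) good-ws

    sameAt-sound : ∀ vs v w → sameAt (graph vs) v w ≡ true → at v ≡ at w
    sameAt-sound vs v w e with find v (graph vs) in e₁ | find w (graph vs) in e₂
    ... | just o | just o' = trans (sym (find-graph v vs e₁)) (trans (==S-sound o o' e) (find-graph w vs e₂))

    differAt-sound : ∀ vs v w → differAt (graph vs) v w ≡ true → at v ≢ at w
    differAt-sound vs v w e q with find v (graph vs) in e₁ | find w (graph vs) in e₂
    ... | just o | just o' with refl ← trans (find-graph v vs e₁) (trans q (sym (find-graph w vs e₂)))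
        with () ← trans (sym e) (cong not (==S-refl o))

    shiftAt-sound : ∀ vs v w → shiftAt (graph vs) v w ≡ true → at v ≡ lower (at w)
    shiftAt-sound vs v w e with find v (graph vs) in e₁ | find w (graph vs) in e₂
    ... | just o | just o' = trans (sym (find-graph v vs e₁)) (trans (==S-sound o (lower o') e) (cong lower (find-graph w vs e₂)))

    antipodeAt-sound : ∀ vs v w → antipodeAt (graph vs) v w ≡ true → at v ≡ lower (lower (at w))
    antipodeAt-sound vs v w e with find v (graph vs) in e₁ | find w (graph vs) in e₂
    ... | just o | just o' = trans (sym (find-graph v vs e₁)) (trans (==S-sound o (lower (lower o')) e) (cong (lower ∘ lower) (find-graph w vs e₂)))

    period : ∀ s → F 12 s ≡ F 0 s
    period s = sameAt-sound ws _ _ (allb-lookup (λ s → sameAt (graph ws) (12 , s) (0 , s)) (proj₁ parts) (∈-syms s))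

    antipode : ∀ s → F 0 (lower (lower s)) ≡ lower (lower (F 0 s))
    antipode s = antipodeAt-sound ws _ _ (allb-lookup (λ s → antipodeAt (graph ws) (0 , lower (lower s)) (0 , s)) (proj₁ (proj₂ parts)) (∈-syms s))

    anyb-sound : ∀ {A : Set} (p : A → Bool) xs → anyb p xs ≡ true → Σ A λ x → p x ≡ true
    anyb-sound p (x ∷ xs) e with p x in eq
    ... | true = x , eq
    ... | false = anyb-sound p xs e

    ∨-split : ∀ b {c} → b ∨ c ≡ true → b ≡ true ⊎ c ≡ true
    ∨-split true e = inj₁ refl
    ∨-split false e = inj₂ e

    halved : ∀ j → j ∈ halves → (∀ s → F (2 ℕ.* j) s ≡ F 0 s) → ∀ s → F j (lower s) ≡ lower (F 0 s)
    halved j m h s = go (graph ws) refl (allb-lookup (halving (graph ws)) (proj₂ (proj₂ parts)) m)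
      where
        go : ∀ env → env ≡ graph ws → halving env j ≡ true → F j (lower s) ≡ lower (F 0 s)
        go env refl e with ∨-split (anyb (λ s → differAt env (2 ℕ.* j , s) (0 , s)) syms) e
        ... | inj₁ d = let s' , d' = anyb-sound (λ s → differAt env (2 ℕ.* j , s) (0 , s)) syms d in ⊥-elim (differAt-sound ws _ _ d' (h s'))
        ... | inj₂ d = shiftAt-sound ws _ _ (allb-lookup (λ s → shiftAt env (j , lower s) (0 , s)) d (∈-syms s))

-- The family 4r = 4, a = r - 3: every automorphism commutes with the exchange.

module TwistedFamily where
  open RoseWindow
  open DoubleCover
  open LinearForms using (∧-true)
  open SymbolicWalks
  open WalkCounting
  open EdgeOrbits
  open RespectedMatchings
  open LayeredGraph
  import Data.Nat.DivMod as ℕ÷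
  open import Data.Nat.Tactic.RingSolver using () renaming (solve-∀ to solveℕ)
  open import Data.Fin using (toℕ)
  open import Data.List using ([]; _∷_)
  open import Data.List.Membership.Propositional using (_∈_)

  par-+ : ∀ m k → par (m ℕ.+ k) ≡ par m xor par k
  par-+ zero k = refl
  par-+ (suc m) k = trans (cong not (par-+ m k)) (𝔹ₚ.not-distribˡ-xor (par m) (par k))

  odd-residue : ∀ m → par m ≡ true → Σ ℕ λ q → Σ ℕ λ j → j ∈ halves × m ≡ q ℕ.* 12 ℕ.+ j
  odd-residue m odd = m ℕ÷./ 12 , m ℕ÷.% 12 , small (m ℕ÷.% 12) (ℕ÷.m%n<n m 12) podd , eq
    where
      eq : m ≡ (m ℕ÷./ 12) ℕ.* 12 ℕ.+ m ℕ÷.% 12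
      eq = trans (ℕ÷.m≡m%n+[m/n]*n m 12) (ℕₚ.+-comm (m ℕ÷.% 12) _)
      par-*12 : ∀ q → par (q ℕ.* 12) ≡ false
      par-*12 zero = refl
      par-*12 (suc q) = trans (par-+ 12 (q ℕ.* 12)) (par-*12 q)
      podd : par (m ℕ÷.% 12) ≡ true
      podd = trans (trans (cong (_xor par (m ℕ÷.% 12)) (sym (par-*12 (m ℕ÷./ 12)))) (sym (par-+ ((m ℕ÷./ 12) ℕ.* 12) (m ℕ÷.% 12)))) (trans (cong par (sym eq)) odd)
      small : ∀ j → j ℕ.< 12 → par j ≡ true → j ∈ halves
      small 1 _ _ = here refl
      small 3 _ _ = there (here refl)
      small 5 _ _ = there (there (here refl))
      small 7 _ _ = there (there (there (here refl)))
      small 9 _ _ = there (there (there (there (here refl))))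
      small 11 _ _ = there (there (there (there (there (here refl)))))
      small 0 _ ()
      small 2 _ ()
      small 4 _ ()
      small 6 _ ()
      small 8 _ ()
      small 10 _ ()
      small (suc (suc (suc (suc (suc (suc (suc (suc (suc (suc (suc (suc j)))))))))))) lt _ =
        ⊥-elim (ℕₚ.<⇒≱ lt (ℕₚ.m≤m+n 12 j))

  -- The family 4r = 4, a = r - 3: with κ = r - 1, the vertices of level x are
  -- u_{x+κy} and v_{x+1+κy}.

  module FamilyA {G : Graph} {n : ℕ} .{{_ : ℕ.NonZero n}} (κ : ℕ) (P : Rose G n (+ κ - + 2) (+ 1 + + κ))
                 (S : Simple n (+ κ - + 2) (+ 1 + + κ)) (et : EdgeTransitive (G ×K₂))
                 (conn : Connected G) (nb : ¬ Bipartite G)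
                 (twist : Transitive.Respected P S et twisted)
                 (4κ : Mod._≈_ n (+ 4 * + κ) (+ 0)) (2κ : ¬ Mod._≈_ n (+ 2 * + κ) (+ 0)) (oddκ : par κ ≡ true) where

    open Transitive P S et
    open Edges P using (translate-to; image)

    val : ℤ₄ → ℤ
    val q0 = + 0
    val q1 = + 1
    val q2 = + 2
    val q3 = + 3

    level : Bool → ℤ → ℤ
    level false x = x
    level true x = x + + 1

    Vx : ℕ → Sym → V Cov
    Vx x (t , y) = C t (level t (+ x) + + κ * val y) (par x)

    private
      k : ℤ
      k = + κ

      wrap : ∀ k → (+ 4 * k) ≈ + 0 → (k * + 3) ≈ (k * + 0 - k)
      wrap k h = lin₁ (+ 1) h (solve (k ∷ []))

      wrap' : ∀ k → (+ 4 * k) ≈ + 0 → (k * + 0) ≈ (k * + 3 + k)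
      wrap' k h = lin₁ (- + 1) h (solve (k ∷ []))

      eq-d₁ : ∀ k → k * + 0 ≡ k * + 1 - k
      eq-d₁ = solve-∀
      eq-d₂ : ∀ k → k * + 1 ≡ k * + 2 - k
      eq-d₂ = solve-∀
      eq-d₃ : ∀ k → k * + 2 ≡ k * + 3 - k
      eq-d₃ = solve-∀
      eq-s₁ : ∀ k → k * + 1 ≡ k * + 0 + k
      eq-s₁ = solve-∀
      eq-s₂ : ∀ k → k * + 2 ≡ k * + 1 + k
      eq-s₂ = solve-∀
      eq-s₃ : ∀ k → k * + 3 ≡ k * + 2 + k
      eq-s₃ = solve-∀

    κ-pred : ∀ y → (+ κ * val (pred y)) ≈ (+ κ * val y - + κ)
    κ-pred q0 = wrap k 4κ
    κ-pred q1 = ≈-reflexive (eq-d₁ k)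
    κ-pred q2 = ≈-reflexive (eq-d₂ k)
    κ-pred q3 = ≈-reflexive (eq-d₃ k)

    κ-succ : ∀ y → (+ κ * val (succ y)) ≈ (+ κ * val y + + κ)
    κ-succ q0 = ≈-reflexive (eq-s₁ k)
    κ-succ q1 = ≈-reflexive (eq-s₂ k)
    κ-succ q2 = ≈-reflexive (eq-s₃ k)
    κ-succ q3 = wrap' k 4κ

    private
      nope : ∀ k c u w → (+ 4 * k) ≈ + 0 → ¬ (+ 2 * k) ≈ + 0 → c * u + + 4 * w ≡ + 2 → ¬ (k * c) ≈ + 0
      nope k c u w h4 h2 e p = h2 (lin₂ u w p h4 (trans (cong (λ z → z * k - + 0) (sym e)) (lem k c u w)))
        where lem : ∀ k c u w → (c * u + + 4 * w) * k - + 0 ≡ u * (k * c - + 0) + w * (+ 4 * k - + 0)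
              lem = solve-∀

      sub : ∀ k i j → (k * i) ≈ (k * j) → (k * (i - j)) ≈ + 0
      sub k i j p = lin₁ (+ 1) p (solve (k ∷ i ∷ j ∷ []))

    val-inj : ∀ y y' → (+ κ * val y) ≈ (+ κ * val y') → y ≡ y'
    val-inj q0 q0 _ = refl
    val-inj q1 q1 _ = refl
    val-inj q2 q2 _ = refl
    val-inj q3 q3 _ = refl
    val-inj q0 q1 p = ⊥-elim (nope k (- + 1) (- + 2) (+ 0) 4κ 2κ refl (sub k (+ 0) (+ 1) p))
    val-inj q1 q2 p = ⊥-elim (nope k (- + 1) (- + 2) (+ 0) 4κ 2κ refl (sub k (+ 1) (+ 2) p))
    val-inj q2 q3 p = ⊥-elim (nope k (- + 1) (- + 2) (+ 0) 4κ 2κ refl (sub k (+ 2) (+ 3) p))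
    val-inj q1 q0 p = ⊥-elim (nope k (+ 1) (+ 2) (+ 0) 4κ 2κ refl (sub k (+ 1) (+ 0) p))
    val-inj q2 q1 p = ⊥-elim (nope k (+ 1) (+ 2) (+ 0) 4κ 2κ refl (sub k (+ 2) (+ 1) p))
    val-inj q3 q2 p = ⊥-elim (nope k (+ 1) (+ 2) (+ 0) 4κ 2κ refl (sub k (+ 3) (+ 2) p))
    val-inj q0 q2 p = ⊥-elim (nope k (- + 2) (- + 1) (+ 0) 4κ 2κ refl (sub k (+ 0) (+ 2) p))
    val-inj q1 q3 p = ⊥-elim (nope k (- + 2) (- + 1) (+ 0) 4κ 2κ refl (sub k (+ 1) (+ 3) p))
    val-inj q2 q0 p = ⊥-elim (nope k (+ 2) (+ 1) (+ 0) 4κ 2κ refl (sub k (+ 2) (+ 0) p))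
    val-inj q3 q1 p = ⊥-elim (nope k (+ 2) (+ 1) (+ 0) 4κ 2κ refl (sub k (+ 3) (+ 1) p))
    val-inj q0 q3 p = ⊥-elim (nope k (- + 3) (- + 2) (- + 1) 4κ 2κ refl (sub k (+ 0) (+ 3) p))
    val-inj q3 q0 p = ⊥-elim (nope k (+ 3) (+ 2) (- + 1) 4κ 2κ refl (sub k (+ 3) (+ 0) p))

    Vx-inj : ∀ x s s' → Vx x s ≡ Vx x s' → s ≡ s'
    Vx-inj x (t , y) (t' , y') e with C-type e
    ... | refl = cong (t ,_) (val-inj y y' (cancel (level t (+ x)) (+ κ * val y) (+ κ * val y') (C-inj e)))
      where cancel : ∀ l u v → (l + u) ≈ (l + v) → u ≈ v
            cancel l u v p = ≈-via p (solve (l ∷ u ∷ v ∷ []))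

    private
      +suc : ∀ x → + suc x ≡ + x + + 1
      +suc x = trans (cong +_ (sym (ℕₚ.+-comm x 1))) (ℤₚ.pos-+ x 1)

      C≡ : ∀ {t x y b b'} → x ≈ y → b ≡ b' → C t x b ≡ C t y b'
      C≡ p refl = C-cong p

    Up : Bool → Dir → Bool
    Up _ fwd = true
    Up _ bwd = false
    Up false near = false
    Up false far = true
    Up true near = true
    Up true far = false

    across : Sym → Dir → Sym
    across (false , y) fwd = false , y
    across (false , y) far = true , pred y
    across (false , y) bwd = false , y
    across (false , y) near = true , y
    across (true , y) fwd = true , succ y
    across (true , y) near = false , y
    across (true , y) bwd = true , pred y
    across (true , y) far = false , succ y

    rising : ∀ x s d → Up (proj₁ s) d ≡ true → N (proj₁ s) (level (proj₁ s) (+ x) + + κ * val (proj₂ s)) (par x) d ≡ Vx (suc x) (across s d)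
    rising x (false , y) fwd _ = C≡ (≈-reflexive (trans (lem (+ x) (k * val y)) (cong (_+ k * val y) (sym (+suc x))))) refl
      where lem : ∀ x z → x + z + + 1 ≡ x + + 1 + z
            lem = solve-∀
    rising x (false , y) far _ = C≡ (≈-sym (≈-trans (≈-reflexive (cong (λ w → w + + 1 + k * val (pred y)) (+suc x))) (go (+ x) k (k * val y) (k * val (pred y)) (κ-pred y)))) refl
      where go : ∀ x k z z' → z' ≈ (z - k) → (x + + 1 + + 1 + z') ≈ (x + z - (k - + 2))
            go x k z z' p = ≈-via p (solve (x ∷ k ∷ z ∷ z' ∷ []))
    rising x (true , y) fwd _ = C≡ (≈-sym (≈-trans (≈-reflexive (cong (λ w → w + + 1 + k * val (succ y)) (+suc x))) (go (+ x) k (k * val y) (k * val (succ y)) (κ-succ y)))) refl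
      where go : ∀ x k z z' → z' ≈ (z + k) → (x + + 1 + + 1 + z') ≈ (x + + 1 + z + (+ 1 + k))
            go x k z z' p = ≈-via p (solve (x ∷ k ∷ z ∷ z' ∷ []))
    rising x (true , y) near _ = C≡ (≈-reflexive (cong (_+ k * val y) (sym (+suc x)))) refl

    falling : ∀ x s d → Up (proj₁ s) d ≡ false → N (proj₁ s) (level (proj₁ s) (+ suc x) + + κ * val (proj₂ s)) (par (suc x)) d ≡ Vx x (across s d)
    falling x (false , y) bwd _ = C≡ (≈-reflexive (trans (cong (λ w → w + k * val y - + 1) (+suc x)) (lem (+ x) (k * val y)))) (𝔹ₚ.not-involutive _)
      where lem : ∀ x z → x + + 1 + z - + 1 ≡ x + z
            lem = solve-∀
    falling x (false , y) near _ = C≡ (≈-reflexive (cong (_+ k * val y) (+suc x))) (𝔹ₚ.not-involutive _)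
    falling x (true , y) bwd _ = C≡ (≈-sym (≈-trans (go (+ x) k (k * val y) (k * val (pred y)) (κ-pred y)) (≈-reflexive (cong (λ w → w + + 1 + k * val y - (+ 1 + k)) (sym (+suc x)))))) (𝔹ₚ.not-involutive _)
      where go : ∀ x k z z' → z' ≈ (z - k) → (x + + 1 + z') ≈ (x + + 1 + + 1 + z - (+ 1 + k))
            go x k z z' p = ≈-via p (solve (x ∷ k ∷ z ∷ z' ∷ []))
    falling x (true , y) far _ = C≡ (≈-sym (≈-trans (go (+ x) k (k * val y) (k * val (succ y)) (κ-succ y)) (≈-reflexive (cong (λ w → w + + 1 + k * val y + (k - + 2)) (sym (+suc x)))))) (𝔹ₚ.not-involutive _)
      where go : ∀ x k z z' → z' ≈ (z + k) → (x + z') ≈ (x + + 1 + + 1 + z + (k - + 2))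
            go x k z z' p = ≈-via p (solve (x ∷ k ∷ z ∷ z' ∷ []))

    across-up : ∀ s d → Up (proj₁ s) d ≡ true → across s d ∈ up s
    across-up (false , y) fwd _ = here refl
    across-up (false , y) far _ = there (here refl)
    across-up (true , y) near _ = here refl
    across-up (true , y) fwd _ = there (here refl)

    up-across : ∀ s w → w ∈ up s → Σ Dir λ d → Up (proj₁ s) d ≡ true × w ≡ across s d
    up-across (false , y) w (here refl) = fwd , refl , refl
    up-across (false , y) w (there (here refl)) = far , refl , refl
    up-across (true , y) w (here refl) = near , refl , refl
    up-across (true , y) w (there (here refl)) = fwd , refl , refl

    down-across : ∀ s w → s ∈ down w → Σ Dir λ d → Up (proj₁ w) d ≡ false × s ≡ across w d
    down-across s (false , y) (here refl) = bwd , refl , refl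
    down-across s (false , y) (there (here refl)) = near , refl , refl
    down-across s (true , y) (here refl) = far , refl , refl
    down-across s (true , y) (there (here refl)) = bwd , refl , refl

    -- Climbing κ levels adds κ to the index, and lowering y takes it away again; as κ is odd, only
    -- the level in the cover has changed. The exchange thus becomes a shift of levels combined with
    -- `lower`.
    lower-Vx : ∀ x s → flip (Vx x s) ≡ Vx (κ ℕ.+ x) (lower s)
    lower-Vx x (t , y) = C≡ (≈-sym (≈-trans (≈-reflexive (cong (λ w → level t w + k * val (pred y)) (ℤₚ.pos-+ κ x))) (go t (+ x) k (k * val y) (k * val (pred y)) (κ-pred y))))
        (sym (trans (par-+ κ x) (cong (_xor par x) oddκ)))
      where go : ∀ t x k z z' → z' ≈ (z - k) → (level t (k + x) + z') ≈ (level t x + z)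
            go false x k z z' p = ≈-to (k + x + z') (x + z) p (solve (x ∷ k ∷ z ∷ z' ∷ []))
            go true x k z z' p = ≈-to (k + x + + 1 + z') (x + + 1 + z) p (solve (x ∷ k ∷ z ∷ z' ∷ []))

    -- Climbing 2κ levels moves y by two steps, and moving it up or down by two is the same since 4κ
    -- = 0. This is the twist with which the stack of levels closes up.
    around : ∀ x s → Vx (2 ℕ.* κ ℕ.+ x) s ≡ Vx x (lower (lower s))
    around x s@(t , y) = C≡ (≈-trans (≈-reflexive (cong (λ w → level t w + k * val y) (trans (ℤₚ.pos-+ (2 ℕ.* κ) x) (cong (_+ + x) (ℤₚ.pos-* 2 κ)))))
          (go t (+ x) k (k * val y) (k * val (pred y)) (k * val (pred (pred y))) (κ-pred y) (κ-pred (pred y)) 4κ))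
        (trans (par-+ (2 ℕ.* κ) x) (cong (_xor par x) (par-2* κ)))
      where go : ∀ t x k z z' z″ → z' ≈ (z - k) → z″ ≈ (z' - k) → (+ 4 * k) ≈ + 0 → (level t (+ 2 * k + x) + z) ≈ (level t x + z″)
            go false x k z z' z″ p q h = lin₃ {x = + 2 * k + x + z} {y = x + z″} (- + 1) (- + 1) (+ 1) p q h (solve (x ∷ k ∷ z ∷ z' ∷ z″ ∷ []))
            go true x k z z' z″ p q h = lin₃ {x = + 2 * k + x + + 1 + z} {y = x + + 1 + z″} (- + 1) (- + 1) (+ 1) p q h (solve (x ∷ k ∷ z ∷ z' ∷ z″ ∷ []))

    Vx-surj : ∀ p → Σ ℕ λ x → Σ Sym λ s → Vx x s ≡ p
    Vx-surj p = adjust (type p) (index p) (proj₂ p) (C-surj p)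
      where
        adjust : ∀ t z b → C t z b ≡ p → Σ ℕ λ x → Σ Sym λ s → Vx x s ≡ p
        adjust t z b e with level' t z | level'-eq t z
          where
            level' : Bool → ℤ → ℤ
            level' false z = z
            level' true z = z - + 1
            level'-eq : ∀ t z → level t (level' t z) ≡ z
            level'-eq false z = refl
            level'-eq true z = lem z
              where lem : ∀ z → z - + 1 + + 1 ≡ z
                    lem = solve-∀
        ... | w | ew with par (toℕ (ι w)) 𝔹ₚ.≟ b
        ... | yes pb = toℕ (ι w) , (t , q0) , trans (C≡ (fin t w (ι≈ w) ew) pb) e
          where fin : ∀ t w {i} → i ≈ w → level t w ≡ z → (level t i + k * + 0) ≈ z
                fin false w {i} q refl = ≈-to (i + k * + 0) w q (lem i w k)
                  where lem : ∀ i w k → i + k * + 0 - w ≡ i - w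
                        lem = solve-∀
                fin true w {i} q refl = ≈-to (i + + 1 + k * + 0) (w + + 1) q (lem i w k)
                  where lem : ∀ i w k → i + + 1 + k * + 0 - (w + + 1) ≡ i - w
                        lem = solve-∀
        -- The chosen representative lies on the wrong level of the cover. Adding the odd number κ
        -- corrects the parity, and y = 3 restores the index because κ + 3κ = 0.
        ... | no ¬pb = κ ℕ.+ toℕ (ι w) , (t , q3) , trans (C≡ (≈-trans (≈-reflexive (cong (λ u → level t u + k * + 3) (ℤₚ.pos-+ κ (toℕ (ι w))))) (fin t w (ι≈ w) ew)) (trans (par-+ κ (toℕ (ι w))) (trans (cong (_xor par (toℕ (ι w))) oddκ) (sym (≢⇒≡not ¬pb))))) e
          where fin : ∀ t w {i} → i ≈ w → level t w ≡ z → (level t (k + i) + k * + 3) ≈ z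
                fin false w {i} q refl = lin₂ {x = k + i + k * + 3} {y = w} (+ 1) (+ 1) q 4κ (lem i w k)
                  where lem : ∀ i w k → k + i + k * + 3 - w ≡ + 1 * (i - w) + + 1 * (+ 4 * k - + 0)
                        lem = solve-∀
                fin true w {i} q refl = lin₂ {x = k + i + + 1 + k * + 3} {y = w + + 1} (+ 1) (+ 1) q 4κ (lem i w k)
                  where lem : ∀ i w k → k + i + + 1 + k * + 3 - (w + + 1) ≡ + 1 * (i - w) + + 1 * (+ 4 * k - + 0)
                        lem = solve-∀

    Rises : Aut Cov → Set
    Rises σ = ∀ t x b d t' x' b' d' → app σ (C t x b) ≡ C t' x' b' → app σ (N t x b d) ≡ N t' x' b' d' → Up t' d' ≡ Up t d

    twisted-Up : ∀ t d → Up t (twisted t d) ≡ Up t d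
    twisted-Up false fwd = refl
    twisted-Up false bwd = refl
    twisted-Up false near = refl
    twisted-Up false far = refl
    twisted-Up true fwd = refl
    twisted-Up true bwd = refl
    twisted-Up true near = refl
    twisted-Up true far = refl

    Up-pair : ∀ t d e → Up t d ≡ Up t e → d ≢ e → d ≡ twisted t e
    Up-pair false fwd fwd _ ne = ⊥-elim (ne refl)
    Up-pair false bwd bwd _ ne = ⊥-elim (ne refl)
    Up-pair false near near _ ne = ⊥-elim (ne refl)
    Up-pair false far far _ ne = ⊥-elim (ne refl)
    Up-pair true fwd fwd _ ne = ⊥-elim (ne refl)
    Up-pair true bwd bwd _ ne = ⊥-elim (ne refl)
    Up-pair true near near _ ne = ⊥-elim (ne refl)
    Up-pair true far far _ ne = ⊥-elim (ne refl)
    Up-pair false fwd far _ _ = refl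
    Up-pair false far fwd _ _ = refl
    Up-pair false bwd near _ _ = refl
    Up-pair false near bwd _ _ = refl
    Up-pair true fwd near _ _ = refl
    Up-pair true near fwd _ _ = refl
    Up-pair true bwd far _ _ = refl
    Up-pair true far bwd _ _ = refl
    Up-pair false fwd bwd () _
    Up-pair false fwd near () _
    Up-pair false bwd fwd () _
    Up-pair false bwd far () _
    Up-pair false near fwd () _
    Up-pair false near far () _
    Up-pair false far bwd () _
    Up-pair false far near () _
    Up-pair true fwd bwd () _
    Up-pair true fwd far () _
    Up-pair true bwd fwd () _
    Up-pair true bwd near () _
    Up-pair true near bwd () _
    Up-pair true near far () _
    Up-pair true far fwd () _
    Up-pair true far near () _

    -- σ either preserves or reverses the direction of all edges at a vertex, because it
    -- respects the matching; the choice is the same at all vertices.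
    at-vertex : ∀ σ t x b t' x' b' → app σ (C t x b) ≡ C t' x' b' →
      ∀ d₀ d₀' d d' → app σ (N t x b d₀) ≡ N t' x' b' d₀' → app σ (N t x b d) ≡ N t' x' b' d' →
      Up t' d' xor Up t d ≡ Up t' d₀' xor Up t d₀
    at-vertex σ t x b t' x' b' e d₀ d₀' d d' e₀ e' with Up t d 𝔹ₚ.≟ Up t d₀ | Up t' d' 𝔹ₚ.≟ Up t' d₀'
    ... | yes p | yes q = cong₂ _xor_ q p
    ... | no p | no q = xor-both (Up t' d') (Up t d) (Up t' d₀') (Up t d₀) q p
      where
        xor-both : ∀ a b c d → a ≢ c → b ≢ d → a xor b ≡ c xor d
        xor-both a b c d p q with refl ← ≢⇒≡not p with refl ← ≢⇒≡not q =
          trans (sym (𝔹ₚ.not-involutive (a xor b))) (trans (cong not (𝔹ₚ.not-distribˡ-xor a b)) (𝔹ₚ.not-distribʳ-xor (not a) b))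
    ... | yes p | no q = ⊥-elim (q (sym-case (d ==D d₀) refl))
      where
        sym-case : ∀ z → (d ==D d₀) ≡ z → Up t' d' ≡ Up t' d₀'
        sym-case true z with ==D-sound d d₀ z
        ... | refl = cong (Up t') (N-inj t' {x'} {b'} d' d₀' (trans (sym e') e₀))
        sym-case false z with Up-pair t d d₀ p (λ { refl → case (trans (sym (==D-refl d)) z) })
          where case : true ≢ false
                case ()
        ... | refl = trans (cong (Up t') (N-inj t' {x'} {b'} d' (twisted t' d₀') (trans (sym e') (twist σ t x b d₀ t' x' b' d₀' e e₀)))) (twisted-Up t' d₀')
    ... | no p | yes q = ⊥-elim (p (sym-case (d' ==D d₀') refl))
      where
        sym-case : ∀ z → (d' ==D d₀') ≡ z → Up t d ≡ Up t d₀
        sym-case true z with ==D-sound d' d₀' z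
        ... | refl = cong (Up t) (N-inj t {x} {b} d d₀ (app-injective σ (trans e' (sym e₀))))
        sym-case false z with Up-pair t' d' d₀' q (λ { refl → case (trans (sym (==D-refl d')) z) })
          where case : true ≢ false
                case ()
        ... | refl = trans (cong (Up t) (N-inj t {x} {b} d (twisted t d₀) (app-injective σ (trans e' (sym (twist σ t x b d₀ t' x' b' d₀' e e₀)))))) (twisted-Up t d₀)

    private
      back : ∀ t d → Σ Dir λ d* → Up (target t d) d* ≡ not (Up t d) × target (target t d) d* ≡ t × (∀ x → move (target t d) d* (move t d x) ≡ x)
      back false fwd = bwd , refl , refl , lem
        where lem : ∀ x → x + + 1 - + 1 ≡ x
              lem = solve-∀
      back false bwd = fwd , refl , refl , lem
        where lem : ∀ x → x - + 1 + + 1 ≡ x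
              lem = solve-∀
      back false near = near , refl , refl , λ x → refl
      back false far = far , refl , refl , λ x → lem x (+ κ)
        where lem : ∀ x k → x - (k - + 2) + (k - + 2) ≡ x
              lem = solve-∀
      back true fwd = bwd , refl , refl , λ x → lem x (+ κ)
        where lem : ∀ x k → x + (+ 1 + k) - (+ 1 + k) ≡ x
              lem = solve-∀
      back true bwd = fwd , refl , refl , λ x → lem x (+ κ)
        where lem : ∀ x k → x - (+ 1 + k) + (+ 1 + k) ≡ x
              lem = solve-∀
      back true near = near , refl , refl , λ x → refl
      back true far = far , refl , refl , λ x → lem x (+ κ)
        where lem : ∀ x k → x + (k - + 2) - (k - + 2) ≡ x
              lem = solve-∀

      back-N : ∀ t x b d → N (target t d) (move t d x) (not b) (proj₁ (back t d)) ≡ C t x b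
      back-N t x b d with back t d
      ... | d* , _ , e , f = trans (cong (λ t' → C t' (move (target t d) d* (move t d x)) (not (not b))) e)
          (trans (cong (λ z → C t z (not (not b))) (f x)) (cong (C t x) (𝔹ₚ.not-involutive b)))

    module _ (σ : Aut Cov) where

      private
        img : ∀ t x b d → Σ Dir λ d' → app σ (N t x b d) ≡ N (type (app σ (C t x b))) (index (app σ (C t x b))) (proj₂ (app σ (C t x b))) d'
        img t x b d = image σ t x b d _ _ _ (sym (C-surj (app σ (C t x b))))

        turned : Bool → ℤ → Bool → Dir → Bool
        turned t x b d = Up (type (app σ (C t x b))) (proj₁ (img t x b d)) xor Up t d

        reverses : V Cov → Bool
        reverses p = turned (type p) (index p) (proj₂ p) fwd

        turned-any : ∀ t x b t' x' b' d d' → app σ (C t x b) ≡ C t' x' b' → app σ (N t x b d) ≡ N t' x' b' d' →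
          Up t' d' xor Up t d ≡ reverses (C t x b)
        turned-any t x b t' x' b' d d' e e' =
          trans (at-vertex σ t x b t' x' b' e fwd (proj₁ i₂) d d' (proj₂ i₂) e') matches
          where
            q = C t x b
            i₂ : Σ Dir λ d' → app σ (N t x b fwd) ≡ N t' x' b' d'
            i₂ = image σ t x b fwd t' x' b' e
            i₃ = img (type q) (index q) (proj₂ q) fwd
            same : C (type q) (index q) (proj₂ q) ≡ C t x b
            same = C-surj q
            e₃ : C (type (app σ (C (type q) (index q) b))) (index (app σ (C (type q) (index q) b))) (proj₂ (app σ (C (type q) (index q) b))) ≡ C t' x' b'
            e₃ = trans (C-surj _) (trans (cong (app σ) same) e)
            agree' : ∀ s y c d₁ d₂ → C s y c ≡ C t' x' b' → N s y c d₁ ≡ N t' x' b' d₂ → Up s d₁ ≡ Up t' d₂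
            agree' s y c d₁ d₂ p q with C-type p
            ... | refl = cong (Up s) (N-inj s {x'} {b'} d₁ d₂ (trans (sym (N-cong p d₁)) q))
            matches : Up t' (proj₁ i₂) xor Up t fwd ≡ reverses (C t x b)
            matches = cong₂ _xor_ (sym (agree' _ _ _ (proj₁ i₃) (proj₁ i₂) e₃
                        (trans (sym (proj₂ i₃)) (trans (cong (app σ) (N-cong same fwd)) (proj₂ i₂))))) refl

        not-xor-not : ∀ a b → not a xor not b ≡ a xor b
        not-xor-not a b = trans (sym (𝔹ₚ.not-distribˡ-xor a (not b))) (trans (cong not (sym (𝔹ₚ.not-distribʳ-xor a b))) (𝔹ₚ.not-involutive _))

        along : ∀ t x b d → reverses (C t x b) ≡ reverses (N t x b d)
        along t x b d = trans (sym (turned-any t x b t' x' b' d d' e e')) (trans (sym (not-xor-not (Up t' d') (Up t d)))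
            (trans (cong₂ _xor_ (sym (proj₁ (proj₂ (back t' d')))) (sym (proj₁ (proj₂ (back t d)))))
              (turned-any (target t d) (move t d x) (not b) (target t' d') (move t' d' x') (not b') (proj₁ (back t d)) (proj₁ (back t' d'))
                e' (trans (cong (app σ) (back-N t x b d)) (trans e (sym (back-N t' x' b' d')))))))
          where
            t' = type (app σ (C t x b))
            x' = index (app σ (C t x b))
            b' = proj₂ (app σ (C t x b))
            e : app σ (C t x b) ≡ C t' x' b'
            e = sym (C-surj (app σ (C t x b)))
            d' = proj₁ (img t x b d)
            e' = proj₂ (img t x b d)

        uniform : ∀ p q → reverses p ≡ reverses q
        uniform = cover-constant conn nb reverses edge
          where
            edge : ∀ p q → Adj Cov p q → reverses p ≡ reverses q
            edge p q a with N-view {type p} {index p} {proj₂ p} {q} (subst (λ p → Adj Cov p q) (sym (C-surj p)) a)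
            ... | d , refl = trans (cong reverses (sym (C-surj p))) (along (type p) (index p) (proj₂ p) d)

        xor-false : ∀ {a b} → a xor b ≡ false → a ≡ b
        xor-false {false} {false} _ = refl
        xor-false {true} {true} _ = refl

        xor-true : ∀ {a b} → a xor b ≡ true → a ≡ not b
        xor-true {false} {true} _ = refl
        xor-true {true} {false} _ = refl

      orientation : Rises σ ⊎ (∀ t x b d t' x' b' d' → app σ (C t x b) ≡ C t' x' b' → app σ (N t x b d) ≡ N t' x' b' d' → Up t' d' ≡ not (Up t d))
      orientation with reverses (C false (+ 0) false) in eq
      ... | false = inj₁ λ t x b d t' x' b' d' e e' → xor-false (trans (turned-any t x b t' x' b' d d' e e') (trans (uniform _ _) eq))
      ... | true = inj₂ λ t x b d t' x' b' d' e e' → xor-true (trans (turned-any t x b t' x' b' d d' e e') (trans (uniform _ _) eq))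

    translate-N : ∀ c e t x b d → app (translate c e) (N t x b d) ≡ N t (x + c) (b xor e) d
    translate-N c e t x b d = trans (translate-C c e (target t d) (move t d x) (not b)) (cong₂ (C (target t d)) (go t d) (sym (𝔹ₚ.not-distribˡ-xor b e)))
      where
        go : ∀ t d → move t d x + c ≡ move t d (x + c)
        go false fwd = lem x c
          where lem : ∀ x c → x + + 1 + c ≡ x + c + + 1
                lem = solve-∀
        go false bwd = lem x c
          where lem : ∀ x c → x - + 1 + c ≡ x + c - + 1
                lem = solve-∀
        go false near = refl
        go false far = lem x c (+ κ)
          where lem : ∀ x c k → x - (k - + 2) + c ≡ x + c - (k - + 2)
                lem = solve-∀
        go true fwd = lem x c (+ κ)
          where lem : ∀ x c k → x + (+ 1 + k) + c ≡ x + c + (+ 1 + k)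
                lem = solve-∀
        go true bwd = lem x c (+ κ)
          where lem : ∀ x c k → x - (+ 1 + k) + c ≡ x + c - (+ 1 + k)
                lem = solve-∀
        go true near = refl
        go true far = lem x c (+ κ)
          where lem : ∀ x c k → x + (k - + 2) + c ≡ x + c + (k - + 2)
                lem = solve-∀

    turnDir : Dir → Dir
    turnDir fwd = bwd
    turnDir bwd = fwd
    turnDir near = far
    turnDir far = near

    Up-turn : ∀ t d → Up t (turnDir d) ≡ not (Up t d)
    Up-turn false fwd = refl
    Up-turn false bwd = refl
    Up-turn false near = refl
    Up-turn false far = refl
    Up-turn true fwd = refl
    Up-turn true bwd = refl
    Up-turn true near = refl
    Up-turn true far = refl

    reflect-N : ∀ t x b d → app (reflect (+ 0)) (N t x b d) ≡ N t (mirror (+ 0) t x) b (turnDir d)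
    reflect-N t x b d = trans (reflect-C (+ 0) (target t d) (move t d x) (not b)) (go t d)
      where
        go : ∀ t d → C (target t d) (mirror (+ 0) (target t d) (move t d x)) (not b) ≡ N t (mirror (+ 0) t x) b (turnDir d)
        go false fwd = cong (λ z → C false z (not b)) (lem x (+ κ - + 2))
          where lem : ∀ x a → + 0 + a - (x + + 1) ≡ + 0 + a - x - + 1
                lem = solve-∀
        go false bwd = cong (λ z → C false z (not b)) (lem x (+ κ - + 2))
          where lem : ∀ x a → + 0 + a - (x - + 1) ≡ + 0 + a - x + + 1
                lem = solve-∀
        go false near = cong (λ z → C true z (not b)) (lem x (+ κ - + 2))
          where lem : ∀ x a → + 0 - x ≡ + 0 + a - x - a
                lem = solve-∀
        go false far = cong (λ z → C true z (not b)) (lem x (+ κ - + 2))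
          where lem : ∀ x a → + 0 - (x - a) ≡ + 0 + a - x
                lem = solve-∀
        go true fwd = cong (λ z → C true z (not b)) (lem x (+ 1 + + κ))
          where lem : ∀ x r → + 0 - (x + r) ≡ + 0 - x - r
                lem = solve-∀
        go true bwd = cong (λ z → C true z (not b)) (lem x (+ 1 + + κ))
          where lem : ∀ x r → + 0 - (x - r) ≡ + 0 - x + r
                lem = solve-∀
        go true near = cong (λ z → C false z (not b)) (lem x (+ κ - + 2))
          where lem : ∀ x a → + 0 + a - x ≡ + 0 - x + a
                lem = solve-∀
        go true far = cong (λ z → C false z (not b)) (lem x (+ κ - + 2))
          where lem : ∀ x a → + 0 + a - (x + a) ≡ + 0 - x
                lem = solve-∀

    private
      strip : ∀ {s y c t' x' b' d₁ d₂} → C s y c ≡ C t' x' b' → N s y c d₁ ≡ N t' x' b' d₂ → Up t' d₂ ≡ Up s d₁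
      strip {s} {y} {c} {t'} {x'} {b'} {d₁} {d₂} p q with C-type p
      ... | refl = cong (Up s) (N-inj s {x'} {b'} d₂ d₁ (trans (sym q) (N-cong p d₁)))

    translate-rises : ∀ c e σ → Rises σ → Rises (translate c e ⊙ σ)
    translate-rises c e σ h t x b d t' x' b' d' eq eq' = trans (strip {d₁ = d₁} p q) (h t x b d t₁ x₁ b₁ d₁ (sym (C-surj _)) e₁)
      where
        t₁ = type (app σ (C t x b))
        x₁ = index (app σ (C t x b))
        b₁ = proj₂ (app σ (C t x b))
        i = image σ t x b d t₁ x₁ b₁ (sym (C-surj (app σ (C t x b))))
        d₁ = proj₁ i
        e₁ = proj₂ i
        p : C t₁ (x₁ + c) (b₁ xor e) ≡ C t' x' b'
        p = trans (sym (translate-C c e t₁ x₁ b₁)) (trans (cong (app (translate c e)) (C-surj (app σ (C t x b)))) eq)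
        q : N t₁ (x₁ + c) (b₁ xor e) d₁ ≡ N t' x' b' d'
        q = trans (sym (translate-N c e t₁ x₁ b₁ d₁)) (trans (cong (app (translate c e)) (sym e₁)) eq')

    reflect-rises : ∀ σ → (∀ t x b d t' x' b' d' → app σ (C t x b) ≡ C t' x' b' → app σ (N t x b d) ≡ N t' x' b' d' → Up t' d' ≡ not (Up t d)) →
      Rises (reflect (+ 0) ⊙ σ)
    reflect-rises σ h t x b d t' x' b' d' eq eq' =
        trans (strip {d₁ = turnDir d₁} p q) (trans (Up-turn t₁ d₁) (trans (cong not (h t x b d t₁ x₁ b₁ d₁ (sym (C-surj _)) e₁)) (𝔹ₚ.not-involutive _)))
      where
        t₁ = type (app σ (C t x b))
        x₁ = index (app σ (C t x b))
        b₁ = proj₂ (app σ (C t x b))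
        i = image σ t x b d t₁ x₁ b₁ (sym (C-surj (app σ (C t x b))))
        d₁ = proj₁ i
        e₁ = proj₂ i
        p : C t₁ (mirror (+ 0) t₁ x₁) b₁ ≡ C t' x' b'
        p = trans (sym (reflect-C (+ 0) t₁ x₁ b₁)) (trans (cong (app (reflect (+ 0))) (C-surj (app σ (C t x b)))) eq)
        q : N t₁ (mirror (+ 0) t₁ x₁) b₁ (turnDir d₁) ≡ N t' x' b' d'
        q = trans (sym (reflect-N t₁ x₁ b₁ d₁)) (trans (cong (app (reflect (+ 0))) (sym e₁)) eq')

    module Rigid (σ : Aut Cov) (h : Rises σ) (s₀ : Sym) (start : app σ (Vx 0 (false , q0)) ≡ Vx 0 s₀) where

      Known : ℕ → Sym → Set
      Known x s = Σ Sym λ s' → app σ (Vx x s) ≡ Vx x s'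

      rise : ∀ x s s' w → app σ (Vx x s) ≡ Vx x s' → w ∈ up s → Σ Sym λ w' → w' ∈ up s' × app σ (Vx (suc x) w) ≡ Vx (suc x) w'
      rise x s s' w e m with up-across s w m
      ... | d , u , refl with image σ (proj₁ s) (level (proj₁ s) (+ x) + + κ * val (proj₂ s)) (par x) d (proj₁ s') (level (proj₁ s') (+ x) + + κ * val (proj₂ s')) (par x) e
      ... | d' , e' = across s' d' , across-up s' d' u'
                    , trans (cong (app σ) (sym (rising x s d u))) (trans e' (rising x s' d' u'))
        where u' : Up (proj₁ s') d' ≡ true
              u' = trans (h _ _ _ d _ _ _ d' e e') u

      fall : ∀ x s w w' → app σ (Vx (suc x) w) ≡ Vx (suc x) w' → s ∈ down w → Known x s
      fall x s w w' e m with down-across s w m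
      ... | d , u , refl with image σ (proj₁ w) (level (proj₁ w) (+ suc x) + + κ * val (proj₂ w)) (par (suc x)) d (proj₁ w') (level (proj₁ w') (+ suc x) + + κ * val (proj₂ w')) (par (suc x)) e
      ... | d' , e' = across w' d' , trans (cong (app σ) (sym (falling x w d u))) (trans e' (falling x w' d' u'))
        where u' : Up (proj₁ w') d' ≡ false
              u' = trans (h _ _ _ d _ _ _ d' e e') u

      rise′ : ∀ {x} s w → Known x s → w ∈ up s → Known (suc x) w
      rise′ {x} s w (s' , e) m = let w' , _ , e' = rise x s s' w e m in w' , e'

      fall′ : ∀ {x} s w → Known (suc x) w → s ∈ down w → Known x s
      fall′ {x} s w (w' , e) m = fall x s w w' e m

      𝕦 𝕧 : ℤ₄ → Sym
      𝕦 y = false , y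
      𝕧 y = true , y

      -- Zigzags between two consecutive levels stay inside one of two 8-cycles and reach only four
      -- of the eight vertices of a level; the other four need a detour through the second level
      -- above.
      spread : ∀ {x} → Known x (𝕦 q0) → ∀ s → Known x s
      spread {x} k₀ = go
        where
          v₀ : Known x (𝕧 q0)
          v₀ = fall′ (𝕧 q0) (𝕦 q0) (rise′ (𝕦 q0) (𝕦 q0) k₀ (here refl)) (there (here refl))
          u₂ : Known x (𝕦 q2)
          u₂ = fall′ (𝕦 q2) (𝕧 q1) (rise′ (𝕧 q0) (𝕧 q1) v₀ (there (here refl))) (here refl)
          v₂ : Known x (𝕧 q2)
          v₂ = fall′ (𝕧 q2) (𝕦 q2) (rise′ (𝕦 q2) (𝕦 q2) u₂ (here refl)) (there (here refl))
          w₀ : Known (suc x) (𝕧 q0)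
          w₀ = fall′ (𝕧 q0) (𝕦 q0) (rise′ (𝕦 q0) (𝕦 q0) (rise′ (𝕦 q0) (𝕦 q0) k₀ (here refl)) (here refl)) (there (here refl))
          u₁ : Known x (𝕦 q1)
          u₁ = fall′ (𝕦 q1) (𝕧 q0) w₀ (here refl)
          v₁ : Known x (𝕧 q1)
          v₁ = fall′ (𝕧 q1) (𝕦 q1) (rise′ (𝕦 q1) (𝕦 q1) u₁ (here refl)) (there (here refl))
          u₃ : Known x (𝕦 q3)
          u₃ = fall′ (𝕦 q3) (𝕧 q2) (rise′ (𝕧 q1) (𝕧 q2) v₁ (there (here refl))) (here refl)
          v₃ : Known x (𝕧 q3)
          v₃ = fall′ (𝕧 q3) (𝕦 q3) (rise′ (𝕦 q3) (𝕦 q3) u₃ (here refl)) (there (here refl))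
          go : ∀ s → Known x s
          go (false , q0) = k₀
          go (false , q1) = u₁
          go (false , q2) = u₂
          go (false , q3) = u₃
          go (true , q0) = v₀
          go (true , q1) = v₁
          go (true , q2) = v₂
          go (true , q3) = v₃

      known : ∀ x s → Known x s
      known zero = spread (s₀ , start)
      known (suc x) = spread (rise′ (𝕦 q0) (𝕦 q0) (known x (𝕦 q0)) (here refl))

      π : ℕ → Sym → Sym
      π x s = proj₁ (known x s)

      π-eq : ∀ x s → app σ (Vx x s) ≡ Vx x (π x s)
      π-eq x s = proj₂ (known x s)

      π-rise : ∀ x s s' → s' ∈ up s → π (suc x) s' ∈ up (π x s)
      π-rise x s s' m with rise x s (π x s) s' (π-eq x s) m
      ... | w' , m' , e = subst (_∈ up (π x s)) (Vx-inj (suc x) _ _ (trans (sym e) (π-eq (suc x) s'))) m'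

      π-inj : ∀ x s s' → π x s ≡ π x s' → s ≡ s'
      π-inj x s s' e = Vx-inj x s s' (app-injective σ (trans (π-eq x s) (trans (cong (Vx x) e) (sym (π-eq x s')))))

      -- The enumeration starts at level 0; shifting the origin applies it to the levels from any x
      -- on.
      module At (x : ℕ) = Layered (λ l → π (l ℕ.+ x)) (λ l → π-rise (l ℕ.+ x)) (λ l → π-inj (l ℕ.+ x)) items items-valid 24 window

      period : ∀ q x s → π (q ℕ.* 12 ℕ.+ x) s ≡ π x s
      period zero x s = refl
      period (suc q) x s = trans (At.period (q ℕ.* 12 ℕ.+ x) s) (period q x s)

      -- By `around`, a shift by 2κ levels is the antipode in y, and `antipode` says that every
      -- `π x` commutes with that.
      close : ∀ x s → π (2 ℕ.* κ ℕ.+ x) s ≡ π x s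
      close x s = Vx-inj (2 ℕ.* κ ℕ.+ x) _ _ (begin
          Vx (2 ℕ.* κ ℕ.+ x) (π (2 ℕ.* κ ℕ.+ x) s)       ≡⟨ π-eq (2 ℕ.* κ ℕ.+ x) s ⟨
          app σ (Vx (2 ℕ.* κ ℕ.+ x) s)                   ≡⟨ cong (app σ) (around x s) ⟩
          app σ (Vx x (lower (lower s)))                 ≡⟨ π-eq x (lower (lower s)) ⟩
          Vx x (π x (lower (lower s)))                   ≡⟨ cong (Vx x) (At.antipode x s) ⟩
          Vx x (lower (lower (π x s)))                   ≡⟨ around x (π x s) ⟨
          Vx (2 ℕ.* κ ℕ.+ x) (π x s) ∎)
        where open ≡-Reasoning

      -- Write κ = 12q + j. Periodicity turns `close` into `π (2j + x) = π x`, the premise of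
      -- `halved` at the odd residue j; its conclusion is carried back from j to κ by periodicity.
      shifted : ∀ x s → π (κ ℕ.+ x) (lower s) ≡ lower (π x s)
      shifted x s with odd-residue κ oddκ
      ... | q , j , m , eq = begin
          π (κ ℕ.+ x) (lower s)                     ≡⟨ cong (λ y → π y (lower s)) (trans (cong (ℕ._+ x) eq) (ℕₚ.+-assoc (q ℕ.* 12) j x)) ⟩
          π (q ℕ.* 12 ℕ.+ (j ℕ.+ x)) (lower s)      ≡⟨ period q (j ℕ.+ x) (lower s) ⟩
          π (j ℕ.+ x) (lower s)                     ≡⟨ At.halved x j m half-turn s ⟩
          lower (π x s) ∎
        where
          open ≡-Reasoning
          lem : ∀ q j x → 2 ℕ.* (q ℕ.* 12 ℕ.+ j) ℕ.+ x ≡ (2 ℕ.* q) ℕ.* 12 ℕ.+ (2 ℕ.* j ℕ.+ x)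
          lem = solveℕ
          half-turn : ∀ s → π (2 ℕ.* j ℕ.+ x) s ≡ π x s
          half-turn s = trans (sym (period (2 ℕ.* q) (2 ℕ.* j ℕ.+ x) s))
            (trans (cong (λ y → π y s) (trans (sym (lem q j x)) (cong (λ k → 2 ℕ.* k ℕ.+ x) (sym eq)))) (close x s))

      commutes : Commutes {G} σ
      commutes p with Vx-surj p
      ... | x , s , refl = begin
          app σ (flip (Vx x s))                     ≡⟨ cong (app σ) (lower-Vx x s) ⟩
          app σ (Vx (κ ℕ.+ x) (lower s))            ≡⟨ π-eq (κ ℕ.+ x) (lower s) ⟩
          Vx (κ ℕ.+ x) (π (κ ℕ.+ x) (lower s))      ≡⟨ cong (Vx (κ ℕ.+ x)) (shifted x s) ⟩
          Vx (κ ℕ.+ x) (lower (π x s))              ≡⟨ lower-Vx x (π x s) ⟨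
          flip (Vx x (π x s))                       ≡⟨ cong flip (π-eq x s) ⟨
          flip (app σ (Vx x s)) ∎
        where open ≡-Reasoning

    commutes-rising : ∀ σ → Rises σ → Commutes {G} σ
    commutes-rising σ h with Vx-surj (app σ (Vx 0 (false , q0)))
    ... | x , s , e = commutes-cancel (translate (- + x) (par x)) σ (translate-commutes (- + x) (par x))
        (Rigid.commutes (translate (- + x) (par x) ⊙ σ) (translate-rises (- + x) (par x) σ h) s
          (trans (cong (app (translate (- + x) (par x))) (sym e))
            (trans (translate-C (- + x) (par x) (proj₁ s) _ (par x)) (trans (cong (C (proj₁ s) _) (𝔹ₚ.xor-same (par x))) (cong (λ z → C (proj₁ s) z false) (go (proj₁ s) (+ x) (+ κ * val (proj₂ s))))))))
      where
        go : ∀ t x z → level t x + z + - x ≡ level t (+ 0) + z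
        go false x z = lem x z
          where lem : ∀ x z → x + z + - x ≡ + 0 + z
                lem = solve-∀
        go true x z = lem x z
          where lem : ∀ x z → x + + 1 + z + - x ≡ + 0 + + 1 + z
                lem = solve-∀

    commutes-all : ∀ σ → Commutes {G} σ
    commutes-all σ with orientation σ
    ... | inj₁ h = commutes-rising σ h
    ... | inj₂ h = commutes-cancel (reflect (+ 0)) σ (reflect-commutes (+ 0)) (commutes-rising (reflect (+ 0) ⊙ σ) (reflect-rises σ h))

-- The main search, run by evaluation.

module MainSearch where
  open LinearForms
  open SymbolicWalks
  open import Data.Integer
  open import Data.List
  open import Data.Bool using (true)

  mainOut : List Form
  mainOut = nondegenerate ++ easy

  main-run : run mainProblem 60 [] mainOut ≡ true
  main-run = refl

-- Searches for the special parameters.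

module SpecialSearches where
  open LinearForms
  open SymbolicWalks
  open import Data.Integer hiding (_*_; _^_)
  open import Data.List
  open import Data.Bool using (true; false)
  open MainSearch using (mainOut)

  halfProblem torusProblem problemB problemA : Problem
  halfProblem = problem balance [] [] (λ _ → false)
  torusProblem = separation [] straight 2
  problemB = separation ((⟨ + 24 , + 0 , + 0 ⟩ ∷ []) ∷ []) straight 4
  problemA = separation [] twisted 6

  halfIn halfOut torusIn torusOut inB inB′ inA : List Form
  halfIn = ⟨ + 2 , + 0 , - + 2 ⟩ ∷ ⟨ + 0 , + 2 , + 0 ⟩ ∷ []
  halfOut = nondegenerate ++ ⟨ + 1 , + 0 , + 1 ⟩ ∷ ⟨ + 1 , + 0 , - + 1 ⟩ ∷ ⟨ + 4 , + 0 , + 0 ⟩ ∷ []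
  torusIn = ⟨ + 1 , + 0 , - + 1 ⟩ ∷ []
  torusOut = nondegenerate ++ ⟨ + 4 , + 0 , + 0 ⟩ ∷ ⟨ + 2 , + 1 , + 0 ⟩ ∷ ⟨ + 2 , - + 1 , + 0 ⟩ ∷ []
  inB = ⟨ + 4 , + 1 , + 0 ⟩ ∷ ⟨ + 4 , + 0 , - + 4 ⟩ ∷ []
  inB′ = ⟨ + 12 , + 0 , + 0 ⟩ ∷ inB
  inA = ⟨ + 4 , + 0 , - + 4 ⟩ ∷ ⟨ + 3 , + 1 , - + 1 ⟩ ∷ []

  half-run : run halfProblem 60 halfIn halfOut ≡ true
  half-run = refl

  torus-run : run torusProblem 60 torusIn torusOut ≡ true
  torus-run = refl

  B-run : run problemB 60 inB mainOut ≡ true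
  B-run = refl

  B-run′ : run halfProblem 60 inB′ mainOut ≡ true
  B-run′ = refl

  A-run : run problemA 60 inA mainOut ≡ true
  A-run = refl

-- What the searches say about edge-transitive covers.

module WalkConclusions where
  open RoseWindow
  open DoubleCover
  open LinearForms
  open SymbolicWalks
  open WalkCounting
  open EdgeOrbits
  open RespectedMatchings
  open Parity
  open TwistedFamily
  open MainSearch
  open SpecialSearches
  open import Data.Integer.Divisibility.Signed using (divides)
  open import Data.List as List using (List; []; _∷_; map)
  open import Data.List.Relation.Unary.All using (All; []; _∷_)

  module Residues (n : ℕ) where
    open Mod n

    module Even (m : ℕ) (n≡2m : n ≡ 2 ℕ.* m) where

      2m≡n : + 2 * + m ≡ + n
      2m≡n = trans (sym (ℤₚ.pos-* 2 m)) (cong +_ (sym n≡2m))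

      2m≈0 : (+ 2 * + m) ≈ + 0
      2m≈0 = D⇒≈ (subst D (sym 2m≡n) Dn)

      even-n : EvenZ (+ n)
      even-n = + m , sym 2m≡n

      m≉0 : 3 ℕ.≤ n → ¬ (+ m) ≈ + 0
      m≉0 3≤n p = ¬D-small (pos m n≡2m 3≤n) (small m n≡2m 3≤n) (≈⇒D p)
        where
          pos : ∀ m → n ≡ 2 ℕ.* m → 3 ℕ.≤ n → 0 ℕ.< m
          pos zero refl ()
          pos (suc m) _ _ = ℕ.s≤s ℕ.z≤n
          small : ∀ m → n ≡ 2 ℕ.* m → 3 ℕ.≤ n → m ℕ.< n
          small zero refl ()
          small (suc m) refl _ = ℕₚ.m<m+n (suc m) (ℕ.s≤s ℕ.z≤n)

      halve : ∀ x → (+ 2 * x) ≈ + 0 → x ≈ + 0 ⊎ x ≈ + m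
      halve x (mk (divides q e)) with parity q
      ... | inj₁ (q' , refl) = inj₁ (mk (divides q' (ℤₚ.*-cancelˡ-≡ (+ 2) _ _ (trans (lem x) (trans e (lem' q' (+ n)))))))
        where lem : ∀ x → + 2 * (x - + 0) ≡ + 2 * x - + 0
              lem = solve-∀
              lem' : ∀ q n → + 2 * q * n ≡ + 2 * (q * n)
              lem' = solve-∀
      ... | inj₂ (q' , refl) = inj₂ (mk (divides q' (ℤₚ.*-cancelˡ-≡ (+ 2) _ _ (trans (lem x (+ m)) (trans (cong₂ _-_ e 2m≡n) (lem' q' (+ n)))))))
        where lem : ∀ x m → + 2 * (x - m) ≡ (+ 2 * x - + 0) - + 2 * m
              lem = solve-∀
              lem' : ∀ q n → (+ 2 * q + + 1) * n - n ≡ + 2 * (q * n)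
              lem' = solve-∀

    module Odd (odd : OddZ (+ n)) where

      halve : ∀ x → (+ 2 * x) ≈ + 0 → x ≈ + 0
      halve x p = go odd
        where
          go : OddZ (+ n) → x ≈ + 0
          go (h , e) = mk (lin2 (- h) (+ 1 * x) (diff p) Dn (trans (lem x h) (cong (λ z → - h * (+ 2 * x - + 0) + + 1 * x * z) (sym e))))
            where lem : ∀ x h → x - + 0 ≡ - h * (+ 2 * x - + 0) + + 1 * x * (+ 2 * h + + 1)
                  lem = solve-∀

  f₁ : ∀ a r → + 1 ≡ + 1 + + 0 * a + + 0 * r
  f₁ = solve-∀
  f₂ : ∀ a r → + 2 ≡ + 2 + + 0 * a + + 0 * r
  f₂ = solve-∀
  f₃ : ∀ a r → a ≡ + 0 + + 1 * a + + 0 * r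
  f₃ = solve-∀
  f₄ : ∀ a r → r ≡ + 0 + + 0 * a + + 1 * r
  f₄ = solve-∀
  f₅ : ∀ a r → + 2 * r ≡ + 0 + + 0 * a + + 2 * r
  f₅ = solve-∀
  f₆ : ∀ a r → + 1 + r ≡ + 1 + + 0 * a + + 1 * r
  f₆ = solve-∀
  f₇ : ∀ a r → + 1 - r ≡ + 1 + + 0 * a + (- + 1) * r
  f₇ = solve-∀
  f₈ : ∀ a r → + 2 + + 2 * r ≡ + 2 + + 0 * a + + 2 * r
  f₈ = solve-∀
  f₉ : ∀ a r → + 2 - + 2 * r ≡ + 2 + + 0 * a + (- + 2) * r
  f₉ = solve-∀
  f₁₀ : ∀ a r → + 4 ≡ + 4 + + 0 * a + + 0 * r
  f₁₀ = solve-∀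
  f₁₁ : ∀ a r → + 2 + a ≡ + 2 + + 1 * a + + 0 * r
  f₁₁ = solve-∀
  f₁₂ : ∀ a r → + 2 - a ≡ + 2 + (- + 1) * a + + 0 * r
  f₁₂ = solve-∀
  f₁₃ : ∀ a r → + 2 * a ≡ + 0 + + 2 * a + + 0 * r
  f₁₃ = solve-∀
  f₁₄ : ∀ a r → + 4 - + 4 * r ≡ + 4 + + 0 * a + (- + 4) * r
  f₁₄ = solve-∀
  f₁₅ : ∀ a r → + 3 + a - r ≡ + 3 + + 1 * a + (- + 1) * r
  f₁₅ = solve-∀
  f₁₆ : ∀ a r → + 4 + a ≡ + 4 + + 1 * a + + 0 * r
  f₁₆ = solve-∀
  f₁₇ : ∀ a r → + 24 ≡ + 24 + + 0 * a + + 0 * r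
  f₁₇ = solve-∀
  f₁₈ : ∀ a r → + 12 ≡ + 12 + + 0 * a + + 0 * r
  f₁₈ = solve-∀

  module Forms (n : ℕ) (a r : ℤ) where
    open Lattice n a r
    open Mod n

    form : ∀ {x y z v} → v ≈ + 0 → v ≡ x + y * a + z * r → L ⟨ x , y , z ⟩
    form {x} {y} {z} p e = subst D (trans e (sym (ev≡ x y z))) (≈⇒D p)

    unform : ∀ {x y z v} → v ≡ x + y * a + z * r → L ⟨ x , y , z ⟩ → v ≈ + 0
    unform {x} {y} {z} e l = D⇒≈ (subst D (trans (ev≡ x y z) (sym e)) l)

    apart : ∀ {x y z v} → ¬ v ≈ + 0 → v ≡ x + y * a + z * r → ¬ L ⟨ x , y , z ⟩
    apart ne e l = ne (unform e l)

  -- What the walk counts say when the cover is edge-transitive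

  module Conclude {G : Graph} {n : ℕ} {a r : ℤ} (P : Rose G n a r) (S : Simple n a r) (et : EdgeTransitive (G ×K₂)) where
    open Transitive P S et
    open Forms n a r

    r≉0 : ¬ r ≈ + 0
    r≉0 p = 2r≉0 (≈-trans (*-cong≈ (+ 2) p) ≈-refl)

    nondegenerate-out : Out nondegenerate
    nondegenerate-out = apart (1≉0 ∘ ≈⇒D) (f₁ a r) ∷ apart (2≉0 ∘ ≈⇒D) (f₂ a r) ∷ apart a≉0 (f₃ a r) ∷ apart r≉0 (f₄ a r) ∷ apart 2r≉0 (f₅ a r) ∷ []

    record Hard : Set where
      constructor hard
      field
        r≉-1 : ¬ (+ 1 + r) ≈ + 0
        r≉1 : ¬ (+ 1 - r) ≈ + 0
        2r≉-2 : ¬ (+ 2 + + 2 * r) ≈ + 0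
        2r≉2 : ¬ (+ 2 - + 2 * r) ≈ + 0
        4≉0 : ¬ (+ 4) ≈ + 0

    easy-out : Hard → Out easy
    easy-out (hard p q s t u) = apart p (f₆ a r) ∷ apart q (f₇ a r) ∷ apart s (f₈ a r) ∷ apart t (f₉ a r) ∷ apart u (f₁₀ a r) ∷ []

    infixr 5 _+++_
    _+++_ : ∀ {xs ys} → Out xs → Out ys → Out (xs List.++ ys)
    [] +++ q = q
    (x ∷ p) +++ q = x ∷ (p +++ q)

    unsolvable : ∀ {cons fin} → Solved (problem cons [] fin (λ _ → false)) → ⊥
    unsolvable (solved (inj₁ ()))
    unsolvable (solved (inj₂ ()))

    out-main : Hard → Out mainOut
    out-main h = nondegenerate-out +++ easy-out h

    extract : Solved mainProblem → Any (All L) mainGoals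
    extract (solved (inj₁ g)) = g

    main : Hard → Any (All L) mainGoals
    main h = extract (run-sound mainProblem 60 [] mainOut [] (out-main h) balanced main-run)

    -- With a nonzero and n = 2m, 2a = 0 means a = m, which W4 forbids; this excludes it when 2r =
    -- 2.
    half-turn : (+ 2 - + 2 * r) ≈ + 0 → (+ 2 * a) ≈ + 0 → ¬ (+ 1 + r) ≈ + 0 → ¬ (+ 1 - r) ≈ + 0 → ¬ (+ 4) ≈ + 0 → ⊥
    half-turn p q s t u = unsolvable (run-sound halfProblem 60 halfIn halfOut (form p (f₉ a r) ∷ form q (f₁₃ a r) ∷ [])
      (nondegenerate-out +++ (apart s (f₆ a r) ∷ apart t (f₇ a r) ∷ apart u (f₁₀ a r) ∷ [])) balanced half-run)

    tested : ∀ {cons fin t} → Solved (problem cons [] fin t) → t (map count fin) ≡ true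
    tested (solved (inj₂ e)) = e

    not² : ∀ b → flips 2 b ≡ b
    not² false = refl
    not² true = refl

    not⁴ : ∀ b → flips 4 b ≡ b
    not⁴ false = refl
    not⁴ true = refl

    not⁶ : ∀ b → flips 6 b ≡ b
    not⁶ false = refl
    not⁶ true = refl

    torus : (+ 1 - r) ≈ + 0 → ¬ (+ 4) ≈ + 0 → ¬ (+ 2 + a) ≈ + 0 → ¬ (+ 2 - a) ≈ + 0 → Respected straight
    torus p u s t = respected straight 2 not² (separated straight 2 (tested (run-sound torusProblem 60 torusIn torusOut (form p (f₇ a r) ∷ [])
      (nondegenerate-out +++ (apart u (f₁₀ a r) ∷ apart s (f₁₁ a r) ∷ apart t (f₁₂ a r) ∷ [])) balanced torus-run)))

    familyA : Hard → (+ 4 - + 4 * r) ≈ + 0 → (+ 3 + a - r) ≈ + 0 → Respected twisted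
    familyA h p q = respected twisted 6 not⁶ (separated twisted 6 (tested (run-sound problemA 60 inA mainOut
      (form p (f₁₄ a r) ∷ form q (f₁₅ a r) ∷ []) (out-main h) balanced A-run)))

    familyB : Hard → (+ 4 + a) ≈ + 0 → (+ 4 - + 4 * r) ≈ + 0 → (+ 24) ≈ + 0 ⊎ Respected straight
    familyB h p q = cases (run-sound problemB 60 inB mainOut (form p (f₁₆ a r) ∷ form q (f₁₄ a r) ∷ []) (out-main h) balanced B-run)
      where
        cases : Solved problemB → (+ 24) ≈ + 0 ⊎ Respected straight
        cases (solved (inj₁ (here (l ∷ [])))) = inj₁ (unform (f₁₇ a r) l)
        cases (solved (inj₂ e)) = inj₂ (respected straight 4 not⁴ (separated straight 4 e))

    familyB-12 : Hard → (+ 4 + a) ≈ + 0 → (+ 4 - + 4 * r) ≈ + 0 → ¬ (+ 12) ≈ + 0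
    familyB-12 h p q u = unsolvable (run-sound halfProblem 60 inB′ mainOut (form u (f₁₈ a r) ∷ form p (f₁₆ a r) ∷ form q (f₁₄ a r) ∷ [])
      (out-main h) balanced B-run′)

-- Excluding the parameters that the main search leaves.

module ResidualParameters where
  open RoseWindow
  open DoubleCover
  open LinearForms
  open SymbolicWalks
  open WalkCounting
  open EdgeOrbits
  open RespectedMatchings
  open Parity
  open WalkConclusions
  open TwistedFamily
  open import Data.Integer.Divisibility.Signed using (divides)
  open import Data.Fin as Fin using (Fin; toℕ)
  open import Data.Fin.Properties using (pigeonhole)
  open import Data.List.Relation.Unary.All using (All; []; _∷_)

  module _ {n : ℕ} where
    open Mod n

    flip-zero : ∀ {x} → (- x) ≈ + 0 → x ≈ + 0
    flip-zero {x} p = lin₁ (- + 1) p (lem x)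
      where lem : ∀ x → x - + 0 ≡ (- + 1) * (- x - + 0)
            lem = solve-∀

    simple-neg-a : ∀ {a r} → Simple n a r → Simple n (- a) r
    simple-neg-a S = record { 3≤n = Simple.3≤n S ; a≉0 = Simple.a≉0 S ∘ flip-zero ; 2r≉0 = Simple.2r≉0 S }

    simple-neg-r : ∀ {a r} → Simple n a r → Simple n a (- r)
    simple-neg-r {a} {r} S = record { 3≤n = Simple.3≤n S ; a≉0 = Simple.a≉0 S ; 2r≉0 = λ p → Simple.2r≉0 S (lin₁ (- + 1) p (lem r)) }
      where lem : ∀ r → + 2 * r - + 0 ≡ (- + 1) * (+ 2 * (- r) - + 0)
            lem = solve-∀

    simple-cong : ∀ {a r a' r'} → a ≈ a' → r ≈ r' → Simple n a r → Simple n a' r'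
    simple-cong p q S = record { 3≤n = Simple.3≤n S ; a≉0 = λ e → Simple.a≉0 S (≈-trans p e) ; 2r≉0 = λ e → Simple.2r≉0 S (≈-trans (*-cong≈ (+ 2) q) e) }

  -- A vertex u has four neighbours, and a vertex v only three when 2r = 0.
  module _ {G : Graph} {n : ℕ} {a r : ℤ} (P : Rose G n a r) where
    open Edges P

    even-degree : 3 ℕ.≤ n → ¬ a ≈ + 0 → EdgeTransitive Cov → ¬ (+ 2 * r) ≈ + 0
    even-degree 3≤n a≉0 et 2r≈0 with et (C false (+ 0) false) (C false (+ 1) true) (C true (+ 0) false) (N true (+ 0) false fwd)
                                         (N-adj false (+ 0) false fwd) (N-adj true (+ 0) false fwd)
    ... | σ , ends = go ends
      where
        code : Dir → Fin 3
        code fwd = Fin.zero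
        code bwd = Fin.zero
        code near = Fin.suc Fin.zero
        code far = Fin.suc (Fin.suc Fin.zero)
        dir : Fin 4 → Dir
        dir Fin.zero = fwd
        dir (Fin.suc Fin.zero) = bwd
        dir (Fin.suc (Fin.suc Fin.zero)) = near
        dir (Fin.suc (Fin.suc (Fin.suc Fin.zero))) = far
        same-code : ∀ x b d e → code d ≡ code e → N true x b d ≡ N true x b e
        same-code x b fwd fwd _ = refl
        same-code x b bwd bwd _ = refl
        same-code x b near near _ = refl
        same-code x b far far _ = refl
        same-code x b fwd bwd _ = C-cong {x = x + r} {x - r} (lin₁ (+ 1) 2r≈0 (lem x r))
          where lem : ∀ x r → x + r - (x - r) ≡ + 1 * (+ 2 * r - + 0)
                lem = solve-∀
        same-code x b bwd fwd _ = C-cong {x = x - r} {x + r} (lin₁ (- + 1) 2r≈0 (lem x r))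
          where lem : ∀ x r → x - r - (x + r) ≡ (- + 1) * (+ 2 * r - + 0)
                lem = solve-∀
        apart : ∀ i j → i Fin.< j → N false (+ 0) false (dir i) ≢ N false (+ 0) false (dir j)
        apart Fin.zero (Fin.suc Fin.zero) _ e = ¬D-small (ℕ.s≤s ℕ.z≤n) 3≤n (diff (C-inj e))
        apart Fin.zero (Fin.suc (Fin.suc Fin.zero)) _ e with () ← C-type e
        apart Fin.zero (Fin.suc (Fin.suc (Fin.suc Fin.zero))) _ e with () ← C-type e
        apart (Fin.suc Fin.zero) (Fin.suc (Fin.suc Fin.zero)) _ e with () ← C-type e
        apart (Fin.suc Fin.zero) (Fin.suc (Fin.suc (Fin.suc Fin.zero))) _ e with () ← C-type e
        apart (Fin.suc (Fin.suc Fin.zero)) (Fin.suc (Fin.suc (Fin.suc Fin.zero))) _ e = a≉0 (lin₁ (+ 1) (C-inj e) (lem a))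
          where lem : ∀ a → a - + 0 ≡ + 1 * (+ 0 - (+ 0 - a))
                lem = solve-∀
        apart (Fin.suc Fin.zero) (Fin.suc Fin.zero) (ℕ.s≤s ()) e
        apart (Fin.suc (Fin.suc Fin.zero)) (Fin.suc Fin.zero) (ℕ.s≤s ()) e
        apart (Fin.suc (Fin.suc Fin.zero)) (Fin.suc (Fin.suc Fin.zero)) (ℕ.s≤s (ℕ.s≤s ())) e
        apart (Fin.suc (Fin.suc (Fin.suc Fin.zero))) (Fin.suc Fin.zero) (ℕ.s≤s ()) e
        apart (Fin.suc (Fin.suc (Fin.suc Fin.zero))) (Fin.suc (Fin.suc Fin.zero)) (ℕ.s≤s (ℕ.s≤s ())) e
        apart (Fin.suc (Fin.suc (Fin.suc Fin.zero))) (Fin.suc (Fin.suc (Fin.suc Fin.zero))) (ℕ.s≤s (ℕ.s≤s (ℕ.s≤s ()))) e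
        collapse : ∀ x b → app σ (C false (+ 0) false) ≡ C true x b → ⊥
        collapse x b e with pigeonhole {m = 3} {n = 4} (ℕ.s≤s (ℕ.s≤s (ℕ.s≤s (ℕ.s≤s ℕ.z≤n)))) (λ i → code (proj₁ (image σ false (+ 0) false (dir i) true x b e)))
        ... | i , j , lt , q = apart i j lt (app-injective σ (trans (proj₂ (image σ false (+ 0) false (dir i) true x b e))
                (trans (same-code x b _ _ q) (sym (proj₂ (image σ false (+ 0) false (dir j) true x b e))))))
        go : _ → ⊥
        go (inj₁ (e , _)) = collapse _ _ e
        go (inj₂ (e , _)) = collapse _ _ e

  -- The edge-transitive case

  module _ {G : Graph} {n : ℕ} .{{_ : ℕ.NonZero n}} where
    open Mod n
    open Residues n

    private
      Line-odd : ℤ → Set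
      Line-odd a = ∀ e → a ≈ (+ 2 * + e) → (+ e * a) ≈ + 2 ⊎ (+ e * a) ≈ (- + 2)

      zero⇒ : ∀ {x y} → (x - y) ≈ + 0 → x ≈ y
      zero⇒ {x} {y} p = lin₁ (+ 1) p (lem x y)
        where lem : ∀ x y → x - y ≡ + 1 * (x - y - + 0)
              lem = solve-∀

      ⇒zero : ∀ {x y} → x ≈ y → (x - y) ≈ + 0
      ⇒zero {x} {y} p = lin₁ (+ 1) p (lem x y)
        where lem : ∀ x y → x - y - + 0 ≡ + 1 * (x - y)
              lem = solve-∀

      neg⇒ : ∀ {x y} → (x + y) ≈ + 0 → y ≈ (- x)
      neg⇒ {x} {y} p = lin₁ (+ 1) p (lem x y)
        where lem : ∀ x y → y - (- x) ≡ + 1 * (x + y - + 0)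
              lem = solve-∀

    torus-straight : ∀ {a} r → (P : Rose G n a r) (S : Simple n a r) (et : EdgeTransitive (G ×K₂)) → ¬ HasTwins G → ¬ (+ 4) ≈ + 0 →
      r ≈ + 1 → Transitive.Respected P S et straight
    torus-straight r P S et nt 4≉0 p = Conclude.torus P S et (⇒zero (≈-sym p)) 4≉0
      (λ q → nt (twins P (inj₂ (neg⇒ q)) (inj₁ p))) (λ q → nt (twins P (inj₁ (≈-sym (zero⇒ q))) (inj₁ p)))

    torus-odd : ∀ {a r} → Rose G n a r → Simple n a r → EdgeTransitive (G ×K₂) → ¬ HasTwins G → ¬ (+ 4) ≈ + 0 →
      r ≈ + 1 ⊎ r ≈ (- + 1) → Line-odd a
    torus-odd {a} {r} P S et nt u (inj₁ p) = Transitive.Straight.rim-square P S et (torus-straight r P S et nt u p)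
    torus-odd {a} {r} P S et nt u (inj₂ p) = Transitive.Straight.rim-square (negate-r P) (simple-neg-r S) et
      (torus-straight (- r) (negate-r P) (simple-neg-r S) et nt u (≈-neg P p))

    -- For a even and r odd the graph is bipartite. For a odd, the rim line closes after 2m steps,
    -- hence so does the spoke line and ma = 0; but ma = m, which is not 0.
    torus-even : ∀ {a r} → Rose G n a r → Simple n a r → EdgeTransitive (G ×K₂) → ¬ HasTwins G → ¬ Bipartite G → ¬ (+ 4) ≈ + 0 →
      ∀ m → n ≡ 2 ℕ.* m → ¬ (r ≈ + 1 ⊎ r ≈ (- + 1))
    torus-even {a} {r} P S et nt nb u m e (inj₂ p) = torus-even (negate-r P) (simple-neg-r S) et nt nb u m e (inj₁ (≈-neg P p))
    torus-even {a} {r} P S et nt nb u m e (inj₁ p) with parity a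
    ... | inj₁ ea = nb (bipartite P even-n ea (subst OddZ (lem r) (odd-+ (even-≈ P even-n p) (+ 0 , refl))))
      where open Even m e
            lem : ∀ r → r - + 1 + + 1 ≡ r
            lem = solve-∀
    ... | inj₂ (q , refl) = m≉0 (Simple.3≤n S) (lin₂ (+ 1) (- q) (Transitive.Straight.close-rim P S et (torus-straight r P S et nt u p) m 2m≈0) 2m≈0 (lem (+ m) q))
      where open Even m e
            lem : ∀ m q → m - + 0 ≡ + 1 * (m * (+ 2 * q + + 1) - + 0) + (- q) * (+ 2 * m - + 0)
            lem = solve-∀

    -- Signs are absorbed by relabelling the same graph. The relation between r' and r is recorded
    -- so that the exclusions in `Hard` can be carried over.
    data Residual (a r : ℤ) : Set where
      caseA : ∀ {a' r'} → Rose G n a' r' → Simple n a' r' → (r' ≈ r ⊎ r' ≈ (- r)) → (+ 4 - + 4 * r') ≈ + 0 → (+ 3 + a' - r') ≈ + 0 → Residual a r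
      caseB : ∀ {a' r'} → Rose G n a' r' → Simple n a' r' → (r' ≈ r ⊎ r' ≈ (- r)) → (+ 4 + a') ≈ + 0 → (+ 4 - + 4 * r') ≈ + 0 → Residual a r

    residual : ∀ {a r} (P : Rose G n a r) (S : Simple n a r) (et : EdgeTransitive (G ×K₂)) → Conclude.Hard P S et → Residual a r
    residual {a} {r} P S et h = go (Conclude.main P S et h)
      where
        open Forms n a r using (unform)
        open Lattice n a r
        u₁ : ∀ a r → + 4 - + 4 * r ≡ + 4 + + 0 * a + (- + 4) * r
        u₁ = solve-∀
        u₂ : ∀ a r → + 3 + a - r ≡ + 3 + + 1 * a + (- + 1) * r
        u₂ = solve-∀
        u₃ : ∀ a r → + 3 + - a - r ≡ + 3 + (- + 1) * a + (- + 1) * r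
        u₃ = solve-∀
        u₄ : ∀ a r → + 4 - + 4 * (- r) ≡ + 4 + + 0 * a + + 4 * r
        u₄ = solve-∀
        u₅ : ∀ a r → + 3 + a - (- r) ≡ + 3 + + 1 * a + + 1 * r
        u₅ = solve-∀
        u₆ : ∀ a r → + 3 + - a - (- r) ≡ + 3 + (- + 1) * a + + 1 * r
        u₆ = solve-∀
        u₇ : ∀ a r → + 4 + a ≡ + 4 + + 1 * a + + 0 * r
        u₇ = solve-∀
        u₈ : ∀ a r → + 4 + - a ≡ + 4 + (- + 1) * a + + 0 * r
        u₈ = solve-∀
        same = inj₁ ≈-refl
        opp = inj₂ ≈-refl
        Pa = negate-a P ; Pr = negate-r P ; Par = negate-r (negate-a P)
        Sa = simple-neg-a S ; Sr = simple-neg-r S ; Sar = simple-neg-r (simple-neg-a S)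
        go : Any (All L) mainGoals → Residual a r
        go (here (p ∷ q ∷ [])) = caseA P S same (unform (u₁ a r) p) (unform (u₂ a r) q)
        go (there (here (p ∷ q ∷ []))) = caseA Pa Sa same (unform (u₁ a r) p) (unform (u₃ a r) q)
        go (there (there (here (p ∷ q ∷ [])))) = caseA Pr Sr opp (unform (u₄ a r) p) (unform (u₅ a r) q)
        go (there (there (there (here (p ∷ q ∷ []))))) = caseA Par Sar opp (unform (u₄ a r) p) (unform (u₆ a r) q)
        go (there (there (there (there (here (p ∷ q ∷ [])))))) = caseB Pr Sr opp (unform (u₇ a r) p) (unform (u₄ a r) q)
        go (there (there (there (there (there (here (p ∷ q ∷ []))))))) = caseB Par Sar opp (unform (u₈ a r) p) (unform (u₄ a r) q)
        go (there (there (there (there (there (there (here (p ∷ q ∷ [])))))))) = caseB P S same (unform (u₇ a r) p) (unform (u₁ a r) q)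
        go (there (there (there (there (there (there (there (here (p ∷ q ∷ []))))))))) = caseB Pa Sa same (unform (u₈ a r) p) (unform (u₁ a r) q)

    transfer-hard : ∀ {a r a' r'} (P : Rose G n a r) (S : Simple n a r) (et : EdgeTransitive (G ×K₂)) (P' : Rose G n a' r') (S' : Simple n a' r') →
      (r' ≈ r ⊎ r' ≈ (- r)) → Conclude.Hard P S et → Conclude.Hard P' S' et
    transfer-hard {r = r} {r' = r'} P S et P' S' (inj₁ e) (Conclude.hard p q s t u) = Conclude.hard
        (p ∘ ≈-trans (+-congʳ≈ (+ 1) (≈-sym e))) (q ∘ ≈-trans (+-congʳ≈ (+ 1) (neg-cong≈ (≈-sym e))))
        (s ∘ ≈-trans (+-congʳ≈ (+ 2) (*-cong≈ (+ 2) (≈-sym e)))) (t ∘ ≈-trans (+-congʳ≈ (+ 2) (neg-cong≈ (*-cong≈ (+ 2) (≈-sym e))))) u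
    transfer-hard {r = r} {r' = r'} P S et P' S' (inj₂ e) (Conclude.hard p q s t u) = Conclude.hard
        (λ z → q (lin₂ (+ 1) (- + 1) z e (l₁ r r'))) (λ z → p (lin₂ (+ 1) (+ 1) z e (l₂ r r')))
        (λ z → t (lin₂ (+ 1) (- + 2) z e (l₃ r r'))) (λ z → s (lin₂ (+ 1) (+ 2) z e (l₄ r r'))) u
      where
        l₁ : ∀ r r' → + 1 - r - + 0 ≡ + 1 * (+ 1 + r' - + 0) + (- + 1) * (r' - (- r))
        l₁ = solve-∀
        l₂ : ∀ r r' → + 1 + r - + 0 ≡ + 1 * (+ 1 - r' - + 0) + + 1 * (r' - (- r))
        l₂ = solve-∀
        l₃ : ∀ r r' → + 2 - + 2 * r - + 0 ≡ + 1 * (+ 2 + + 2 * r' - + 0) + (- + 2) * (r' - (- r))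
        l₃ = solve-∀
        l₄ : ∀ r r' → + 2 + + 2 * r - + 0 ≡ + 1 * (+ 2 - + 2 * r' - + 0) + + 2 * (r' - (- r))
        l₄ = solve-∀

  half-par : ∀ k → k ≡ 2 ℕ.* half k ℕ.+ (if par k then 1 else 0)
  half-par zero = refl
  half-par (suc k) with par k | half-par k
  ... | false | e = trans (cong suc (trans e (ℕₚ.+-identityʳ _))) (sym (ℕₚ.+-comm (2 ℕ.* half k) 1))
  ... | true | e = trans (cong suc e) (lem (half k))
    where lem : ∀ h → suc (2 ℕ.* h ℕ.+ 1) ≡ 2 ℕ.* suc h ℕ.+ 0
          lem h = trans (cong suc (ℕₚ.+-comm (2 ℕ.* h) 1)) (trans (sym (ℕₚ.*-suc 2 h)) (sym (ℕₚ.+-identityʳ _)))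

  even-par : ∀ k → par k ≡ false → + k ≡ + 2 * + half k
  even-par k e with par k | half-par k
  ... | false | q = trans (cong +_ (trans q (ℕₚ.+-identityʳ _))) (ℤₚ.pos-* 2 (half k))

  odd-par : ∀ k → par k ≡ true → + k ≡ + 2 * + half k + + 1
  odd-par k e with par k | half-par k
  ... | true | q = trans (cong +_ q) (trans (ℤₚ.pos-+ (2 ℕ.* half k) 1) (cong (_+ + 1) (ℤₚ.pos-* 2 (half k))))

  module _ {G : Graph} {n : ℕ} .{{_ : ℕ.NonZero n}} where
    open Mod n
    open Residues n

    module _ {a r : ℤ} (P : Rose G n a r) (S : Simple n a r) (et : EdgeTransitive (G ×K₂)) (conn : Connected G) (nb : ¬ Bipartite G)
             (m : ℕ) (n≡2m : n ≡ 2 ℕ.* m) (h : Conclude.Hard P S et) where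
      open Even m n≡2m

      -- κ must be odd: otherwise a = κ - 2 is even and r = 1 + κ is odd, and the graph is
      -- bipartite.
      conclude-κ : ∀ κ (P' : Rose G n (+ κ - + 2) (+ 1 + + κ)) (S' : Simple n (+ κ - + 2) (+ 1 + + κ)) → Conclude.Hard P' S' et →
        (+ 4 * + κ) ≈ + 0 → ∀ σ → Commutes {G} σ
      conclude-κ κ P' S' h' 4κ = FamilyA.commutes-all κ P' S' et conn nb
          (Conclude.familyA P' S' et h' (lin₁ (- + 1) 4κ (l₁ (+ κ))) (≈-reflexive (l₂ (+ κ))))
          4κ (λ z → Conclude.Hard.2r≉2 h' (lin₁ (- + 1) z (l₄ (+ κ)))) (by-parity (par κ) refl)
        where
          l₁ : ∀ k → + 4 - + 4 * (+ 1 + k) - + 0 ≡ (- + 1) * (+ 4 * k - + 0)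
          l₁ = solve-∀
          l₂ : ∀ k → + 3 + (k - + 2) - (+ 1 + k) ≡ + 0
          l₂ = solve-∀
          l₄ : ∀ k → + 2 - + 2 * (+ 1 + k) - + 0 ≡ (- + 1) * (+ 2 * k - + 0)
          l₄ = solve-∀
          by-parity : ∀ b → par κ ≡ b → par κ ≡ true
          by-parity true eq = eq
          by-parity false eq = ⊥-elim (nb (bipartite P' even-n (+ half κ - + 1 , trans (cong (_- + 2) (even-par κ eq)) (lem (+ half κ)))
                                     (+ half κ , trans (cong (_+_ (+ 1)) (even-par κ eq)) (ℤₚ.+-comm (+ 1) (+ 2 * + half κ)))))
            where lem : ∀ k → + 2 * k - + 2 ≡ + 2 * (k - + 1)
                  lem = solve-∀

      conclude-k : ∀ {a' r'} κ → (+ κ) ≈ (r' - + 1) → Rose G n a' r' → Simple n a' r' → (r' ≈ r ⊎ r' ≈ (- r)) →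
        (+ 4 - + 4 * r') ≈ + 0 → (+ 3 + a' - r') ≈ + 0 → ∀ σ → Commutes {G} σ
      conclude-k {a'} {r'} κ κ≈ P' S' same p q = conclude-κ κ (retarget a″ r″ P') (simple-cong a″ r″ S')
          (transfer-hard P S et (retarget a″ r″ P') (simple-cong a″ r″ S') (Sum.map (≈-trans (≈-sym r″)) (≈-trans (≈-sym r″)) same) h)
          (lin₂ (- + 1) (+ 4) p κ≈ (l₃ r' (+ κ)))
        where
          a″ : a' ≈ (+ κ - + 2)
          a″ = lin₂ (+ 1) (- + 1) q κ≈ (lem a' r' (+ κ))
            where lem : ∀ a r k → a - (k - + 2) ≡ + 1 * (+ 3 + a - r - + 0) + (- + 1) * (k - (r - + 1))
                  lem = solve-∀
          r″ : r' ≈ (+ 1 + + κ)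
          r″ = lin₁ (- + 1) κ≈ (lem r' (+ κ))
            where lem : ∀ r k → r - (+ 1 + k) ≡ (- + 1) * (k - (r - + 1))
                  lem = solve-∀
          l₃ : ∀ r k → + 4 * k - + 0 ≡ (- + 1) * (+ 4 - + 4 * r - + 0) + + 4 * (k - (r - + 1))
          l₃ = solve-∀

      conclude-A : ∀ {a' r'} → Rose G n a' r' → Simple n a' r' → (r' ≈ r ⊎ r' ≈ (- r)) → (+ 4 - + 4 * r') ≈ + 0 → (+ 3 + a' - r') ≈ + 0 →
        ∀ σ → Commutes {G} σ
      -- Levels are counted by natural numbers, hence the natural representative of r' - 1.
      conclude-A {a'} {r'} = conclude-k (toℕ (ι (r' - + 1))) (ι≈ (r' - + 1))

      -- As 4r = 4 but 2r is not 2, 2 - 2r = m. This is impossible for odd m. For m = 2k with k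
      -- even, r is odd and a = -4 is even, so the graph is bipartite. For k odd, ka = -4k = 0
      -- closes the spoke line after 2k steps, and if `straight` is respected the rim line closes
      -- too, giving m = 2k = 0; what remains is n dividing 24.
      conclude-B : ∀ {a' r'} → Rose G n a' r' → Simple n a' r' → (r' ≈ r ⊎ r' ≈ (- r)) → (+ 4 + a') ≈ + 0 → (+ 4 - + 4 * r') ≈ + 0 → ⊥
      conclude-B {a'} {r'} P' S' same p q with halve (+ 2 - + 2 * r') (≈-trans (≈-reflexive (l₁ r')) q)
        where l₁ : ∀ r → + 2 * (+ 2 - + 2 * r) ≡ + 4 - + 4 * r
              l₁ = solve-∀
      ... | inj₁ z = Conclude.Hard.2r≉2 hard' z
        where hard' = transfer-hard P S et P' S' same h
      ... | inj₂ y = by-parity (par m) refl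
        where
          hard' : Conclude.Hard P' S' et
          hard' = transfer-hard P S et P' S' same h
          3≤n = Simple.3≤n S
          ea : EvenZ a'
          ea = subst EvenZ (lem a') (even-+ (even-≈ P even-n p) (- + 2 , refl))
            where lem : ∀ a → + 4 + a - + 0 + + 2 * (- + 2) ≡ a
                  lem = solve-∀
          by-parity : ∀ b → par m ≡ b → ⊥
          by-parity true e = even≢odd (subst EvenZ (lem r' (+ m)) (even-+ (even-≈ P even-n y) (r' - + 1 , refl)))
              (odd-neg (+ half m , odd-par m e))
            where lem : ∀ r m → + 2 - + 2 * r - m + + 2 * (r - + 1) ≡ - m
                  lem = solve-∀
          by-parity false e = by-half (par k) refl
            where
              k = half m
              m≡ : + m ≡ + 2 * + k
              m≡ = even-par m e
              n≡4k : + n ≡ + 4 * + k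
              n≡4k = trans (sym 2m≡n) (trans (cong (_*_ (+ 2)) m≡) (lem (+ k)))
                where lem : ∀ k → + 2 * (+ 2 * k) ≡ + 4 * k
                      lem = solve-∀
              4k≈0 : (+ 4 * + k) ≈ + 0
              4k≈0 = D⇒≈ (subst D n≡4k Dn)
              by-half : ∀ b → par k ≡ b → ⊥
              by-half false ek = nb (bipartite P' even-n ea (go (diff y)))
                where
                  go : D (+ 2 - + 2 * r' - + m) → OddZ r'
                  go (divides t eq) = - + half k - t * + k , ℤₚ.*-cancelˡ-≡ (+ 2) r' (+ 2 * (- + half k - t * + k) + + 1) (begin
                      + 2 * r'                                                    ≡⟨ lem₁ r' (+ m) ⟩
                      + 2 - + m - (+ 2 - + 2 * r' - + m)                          ≡⟨ cong₂ (λ u v → + 2 - u - v) (trans m≡ (cong (_*_ (+ 2)) (even-par k ek))) (trans eq (cong (_*_ t) n≡4k)) ⟩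
                      + 2 - + 2 * (+ 2 * + half k) - t * (+ 4 * + k)              ≡⟨ lem₂ (+ half k) (+ k) t ⟩
                      + 2 * (+ 2 * (- + half k - t * + k) + + 1) ∎)
                    where
                      open ≡-Reasoning
                      lem₁ : ∀ r m → + 2 * r ≡ + 2 - m - (+ 2 - + 2 * r - m)
                      lem₁ = solve-∀
                      lem₂ : ∀ h k t → + 2 - + 2 * (+ 2 * h) - t * (+ 4 * k) ≡ + 2 * (+ 2 * (- h - t * k) + + 1)
                      lem₂ = solve-∀
              by-half true ok = cases (Conclude.familyB P' S' et hard' p q)
                where
                  lem : ∀ k a → k * a - + 0 ≡ k * (+ 4 + a - + 0) + (- + 1) * (+ 4 * k - + 0)
                  lem = solve-∀
                  lem' : ∀ t k → t * (+ 4 * k) ≡ + 4 * (t * k)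
                  lem' = solve-∀
                  -- If t is even, n divides 12, which has been excluded; if t is odd, tk = 6 is a
                  -- product of two odd numbers.
                  divisor : ∀ t → + 24 ≡ t * + n → EvenZ t ⊎ OddZ t → ⊥
                  divisor t eq (inj₁ (t' , e')) = Conclude.familyB-12 P' S' et hard' p q (mk (divides t'
                    (ℤₚ.*-cancelˡ-≡ (+ 2) (+ 12) (t' * + n) (trans eq (trans (cong (_* + n) e') (ℤₚ.*-assoc (+ 2) t' (+ n)))))))
                  divisor t eq (inj₂ ot) = even≢odd (+ 3 , ℤₚ.*-cancelˡ-≡ (+ 4) (t * + k) (+ 6) (sym (trans eq (trans (cong (_*_ t) n≡4k) (lem' t (+ k))))))
                                (odd-* ot (+ half k , odd-par k ok))
                  cases : (+ 24) ≈ + 0 ⊎ Transitive.Respected P' S' et straight → ⊥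
                  cases (inj₂ str) = m≉0 3≤n (≈-trans (≈-reflexive m≡) (Transitive.Straight.close-spoke P' S' et str k
                      (lin₂ (+ k) (- + 1) p 4k≈0 (lem (+ k) a'))))
                  cases (inj₁ (mk (divides t eq))) = divisor t eq (parity t)

-- Edge-transitive covers: the remaining parameters.

module EdgeTransitiveCovers where
  open RoseWindow
  open DoubleCover
  open LinearForms
  open SymbolicWalks
  open WalkCounting
  open EdgeOrbits
  open RespectedMatchings
  open Parity
  open WalkConclusions
  open TwistedFamily
  open ResidualParameters

  module _ {G : Graph} {n : ℕ} .{{_ : ℕ.NonZero n}} where
    open Mod n
    open Residues n

    -- The parameters of W4 up to the sign of r; the last condition will give A different from m.
    Antipodal : ℤ → ℤ → ℕ → Set
    Antipodal a r m = (r ≈ (+ m - + 1) ⊎ (- r) ≈ (+ m - + 1)) × ¬ (+ 2 * a) ≈ + 0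

    private
      double : ∀ m → n ≡ 2 ℕ.* m → ∀ r → (+ 2 - + 2 * r) ≈ + 0 → r ≈ + 1 ⊎ (- r) ≈ (+ m - + 1)
      double m e r p with Even.halve m e (+ 1 - r) (≈-trans (≈-reflexive (lem r)) p)
        where lem : ∀ r → + 2 * (+ 1 - r) ≡ + 2 - + 2 * r
              lem = solve-∀
      ... | inj₁ z = inj₁ (lin₁ (- + 1) z (lem r))
        where lem : ∀ r → r - + 1 ≡ (- + 1) * (+ 1 - r - + 0)
              lem = solve-∀
      ... | inj₂ z = inj₂ (lin₁ (+ 1) z (lem r (+ m)))
        where lem : ∀ r m → - r - (m - + 1) ≡ + 1 * (+ 1 - r - m)
              lem = solve-∀

      negated : ∀ r → (+ 2 + + 2 * r) ≈ + 0 → (+ 2 - + 2 * (- r)) ≈ + 0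
      negated r = ≈-trans (≈-reflexive (lem r))
        where lem : ∀ r → + 2 - + 2 * (- r) ≡ + 2 + + 2 * r
              lem = solve-∀

      back-neg : ∀ {x y} → (- (- x)) ≈ y → x ≈ y
      back-neg {x} {y} p = lin₁ (+ 1) p (lem x y)
        where lem : ∀ x y → x - y ≡ + 1 * (- (- x) - y)
              lem = solve-∀

      as-zero : ∀ r → ¬ (r ≈ + 1 ⊎ r ≈ (- + 1)) → ¬ (+ 1 + r) ≈ + 0 × ¬ (+ 1 - r) ≈ + 0
      as-zero r ne = (λ p → ne (inj₂ (lin₁ (+ 1) p (lem r)))) , (λ p → ne (inj₁ (lin₁ (- + 1) p (lem' r))))
        where lem : ∀ r → r - (- + 1) ≡ + 1 * (+ 1 + r - + 0)
              lem = solve-∀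
              lem' : ∀ r → r - + 1 ≡ (- + 1) * (+ 1 - r - + 0)
              lem' = solve-∀

      flip-±1 : ∀ {r} → (- r) ≈ + 1 ⊎ (- r) ≈ (- + 1) → r ≈ + 1 ⊎ r ≈ (- + 1)
      flip-±1 {r} (inj₁ p) = inj₂ (lin₁ (- + 1) p (lem r))
        where lem : ∀ r → r - (- + 1) ≡ (- + 1) * (- r - + 1)
              lem = solve-∀
      flip-±1 {r} (inj₂ p) = inj₁ (lin₁ (- + 1) p (lem r))
        where lem : ∀ r → r - + 1 ≡ (- + 1) * (- r - (- + 1))
              lem = solve-∀

    ±1? : ∀ r → Dec (r ≈ + 1 ⊎ r ≈ (- + 1))
    ±1? r with r ≈? (+ 1) | r ≈? (- + 1)
    ... | yes p | _ = yes (inj₁ p)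
    ... | no _ | yes q = yes (inj₂ q)
    ... | no p | no q = no λ { (inj₁ z) → p z ; (inj₂ z) → q z }

    module _ {a r : ℤ} (P : Rose G n a r) (S : Simple n a r) (et : EdgeTransitive (G ×K₂)) (conn : Connected G) (nb : ¬ Bipartite G)
             (nt : ¬ HasTwins G) (m : ℕ) (e : n ≡ 2 ℕ.* m) where

      -- Here m = 2, and 2r nonzero forces r = ±1, that is ±(m - 1). With 2a = 0 one would have a =
      -- 2, and the graph would have twins.
      et-order-4 : (+ 4) ≈ + 0 → Antipodal a r m
      et-order-4 four = side , λ z → nt (twins P (inj₁ (a≈2 z)) r±1)
        where
          open Even m e
          two : (+ 2) ≈ (+ m)
          two with halve (+ 2) four
          ... | inj₁ z = ⊥-elim (¬D-small (ℕ.s≤s ℕ.z≤n) (Simple.3≤n S) (≈⇒D z))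
          ... | inj₂ z = z
          2r≈2 : (+ 2 - + 2 * r) ≈ + 0
          2r≈2 with halve (+ 2 * r) (lin₁ r four (lem r))
            where lem : ∀ r → + 2 * (+ 2 * r) - + 0 ≡ r * (+ 4 - + 0)
                  lem = solve-∀
          ... | inj₁ z = ⊥-elim (Simple.2r≉0 S z)
          ... | inj₂ z = lin₂ (+ 1) (- + 1) two z (lem r (+ m))
            where lem : ∀ r m → + 2 - + 2 * r - + 0 ≡ + 1 * (+ 2 - m) + (- + 1) * (+ 2 * r - m)
                  lem = solve-∀
          r±1 : r ≈ + 1 ⊎ r ≈ (- + 1)
          r±1 with double m e r 2r≈2
          ... | inj₁ z = inj₁ z
          ... | inj₂ z = inj₂ (lin₂ (- + 1) (+ 1) z two (lem r (+ m)))
            where lem : ∀ r m → r - (- + 1) ≡ (- + 1) * (- r - (m - + 1)) + + 1 * (+ 2 - m)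
                  lem = solve-∀
          side : r ≈ (+ m - + 1) ⊎ (- r) ≈ (+ m - + 1)
          side with double m e r 2r≈2
          ... | inj₁ z = inj₁ (lin₂ (+ 1) (+ 1) z two (lem r (+ m)))
            where lem : ∀ r m → r - (m - + 1) ≡ + 1 * (r - + 1) + + 1 * (+ 2 - m)
                  lem = solve-∀
          ... | inj₂ z = inj₂ z
          a≈2 : (+ 2 * a) ≈ + 0 → a ≈ + 2
          a≈2 z with halve a z
          ... | inj₁ y = ⊥-elim (Simple.a≉0 S y)
          ... | inj₂ y = ≈-trans y (≈-sym two)

      private
        antipodal-side : ¬ (r ≈ + 1 ⊎ r ≈ (- + 1)) → r ≈ + 1 ⊎ (- r) ≈ (+ m - + 1) → r ≈ (+ m - + 1) ⊎ (- r) ≈ (+ m - + 1)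
        antipodal-side r≉±1 (inj₁ z) = ⊥-elim (r≉±1 (inj₁ z))
        antipodal-side r≉±1 (inj₂ z) = inj₂ z

        antipodal-side⁻ : ¬ (r ≈ + 1 ⊎ r ≈ (- + 1)) → (- r) ≈ + 1 ⊎ (- (- r)) ≈ (+ m - + 1) → r ≈ (+ m - + 1) ⊎ (- r) ≈ (+ m - + 1)
        antipodal-side⁻ r≉±1 (inj₁ z) = ⊥-elim (r≉±1 (flip-±1 (inj₁ z)))
        antipodal-side⁻ r≉±1 (inj₂ z) = inj₁ (back-neg z)

      et-hard : (h : Conclude.Hard P S et) → Residual a r → ∀ σ → Commutes {G} σ
      et-hard h (caseA P' S' same u v) = conclude-A P S et conn nb m e h P' S' same u v
      et-hard h (caseB P' S' same u v) = ⊥-elim (conclude-B P S et conn nb m e h P' S' same u v)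

      et-generic : ¬ (+ 4) ≈ + 0 → ¬ (r ≈ + 1 ⊎ r ≈ (- + 1)) → Dec ((+ 2 - + 2 * r) ≈ + 0) → Dec ((+ 2 + + 2 * r) ≈ + 0) →
        Antipodal a r m ⊎ (∀ σ → Commutes {G} σ)
      et-generic 4≉0 r≉±1 (yes p) _ = inj₁ (antipodal-side r≉±1 (double m e r p)
        , λ z → Conclude.half-turn P S et p z (proj₁ (as-zero r r≉±1)) (proj₂ (as-zero r r≉±1)) 4≉0)
      et-generic 4≉0 r≉±1 (no _) (yes q) = inj₁ (antipodal-side⁻ r≉±1 (double m e (- r) (negated r q))
        , λ z → Conclude.half-turn (negate-r P) (simple-neg-r S) et (negated r q) z
                                   (proj₁ (as-zero (- r) (r≉±1 ∘ flip-±1))) (proj₂ (as-zero (- r) (r≉±1 ∘ flip-±1))) 4≉0)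
      et-generic 4≉0 r≉±1 (no p) (no q) = inj₂ (et-hard h (residual P S et h))
        where
          h : Conclude.Hard P S et
          h = Conclude.hard (proj₁ (as-zero r r≉±1)) (proj₂ (as-zero r r≉±1)) q p 4≉0

      et-even : Antipodal a r m ⊎ (∀ σ → Commutes {G} σ)
      et-even = by-order ((+ 4) ≈? (+ 0))
        where
          by-rim : ¬ (+ 4) ≈ + 0 → Dec (r ≈ + 1 ⊎ r ≈ (- + 1)) → Antipodal a r m ⊎ (∀ σ → Commutes {G} σ)
          by-rim 4≉0 (yes r±1) = ⊥-elim (torus-even P S et nt nb 4≉0 m e r±1)
          by-rim 4≉0 (no r≉±1) = et-generic 4≉0 r≉±1 ((+ 2 - + 2 * r) ≈? (+ 0)) ((+ 2 + + 2 * r) ≈? (+ 0))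
          by-order : Dec ((+ 4) ≈ + 0) → Antipodal a r m ⊎ (∀ σ → Commutes {G} σ)
          by-order (yes four) = inj₁ (et-order-4 four)
          by-order (no 4≉0) = by-rim 4≉0 (±1? r)

    -- 2 is invertible modulo n, so 2r = ±2 and 4r = ±4 already give r = ±1. Both residual families
    -- thus collapse, and `rim-square` supplies the second condition.
    et-odd : ∀ {a r} → Rose G n a r → Simple n a r → EdgeTransitive (G ×K₂) → ¬ HasTwins G → OddZ (+ n) →
      (r ≈ + 1 ⊎ r ≈ (- + 1)) × (∀ e → a ≈ (+ 2 * + e) → (+ e * a) ≈ + 2 ⊎ (+ e * a) ≈ (- + 2))
    et-odd {a} {r} P S et nt odd = by-rim (±1? r)
      where
        open Odd odd
        4≉0 : ¬ (+ 4) ≈ + 0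
        4≉0 z = ¬D-small (ℕ.s≤s ℕ.z≤n) (ℕₚ.≤-trans (ℕ.s≤s (ℕ.s≤s ℕ.z≤n)) (Simple.3≤n S)) (≈⇒D (halve (+ 1) (halve (+ 2) z)))
        half₁ : ∀ r → (+ 2 - + 2 * r) ≈ + 0 → (+ 1 - r) ≈ + 0
        half₁ r p = halve (+ 1 - r) (≈-trans (≈-reflexive (lem r)) p)
          where lem : ∀ r → + 2 * (+ 1 - r) ≡ + 2 - + 2 * r
                lem = solve-∀
        half₂ : ∀ r → (+ 4 - + 4 * r) ≈ + 0 → (+ 1 - r) ≈ + 0
        half₂ r p = half₁ r (halve (+ 2 - + 2 * r) (≈-trans (≈-reflexive (lem r)) p))
          where lem : ∀ r → + 2 * (+ 2 - + 2 * r) ≡ + 4 - + 4 * r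
                lem = solve-∀
        by-rim : Dec (r ≈ + 1 ⊎ r ≈ (- + 1)) → (r ≈ + 1 ⊎ r ≈ (- + 1)) × (∀ e → a ≈ (+ 2 * + e) → (+ e * a) ≈ + 2 ⊎ (+ e * a) ≈ (- + 2))
        by-rim (yes p) = p , torus-odd P S et nt 4≉0 p
        by-rim (no r≉±1) = ⊥-elim (finish (residual P S et h))
          where
            h : Conclude.Hard P S et
            h = Conclude.hard (proj₁ (as-zero r r≉±1)) (proj₂ (as-zero r r≉±1))
                  (λ p → proj₂ (as-zero (- r) (r≉±1 ∘ flip-±1)) (half₁ (- r) (negated r p))) (λ p → proj₂ (as-zero r r≉±1) (half₁ r p)) 4≉0
            contra : ∀ {r'} → (r' ≈ r ⊎ r' ≈ (- r)) → (+ 4 - + 4 * r') ≈ + 0 → ⊥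
            contra {r'} s u with half₂ r' u
            contra {r'} (inj₁ s) u | z = proj₂ (as-zero r r≉±1) (≈-trans (+-congʳ≈ (+ 1) (neg-cong≈ (≈-sym s))) z)
            contra {r'} (inj₂ s) u | z = proj₂ (as-zero (- r) (r≉±1 ∘ flip-±1)) (≈-trans (+-congʳ≈ (+ 1) (neg-cong≈ (≈-sym s))) z)
            finish : Residual a r → ⊥
            finish (caseA _ _ s u v) = contra s u
            finish (caseB _ _ s u v) = contra s v

-- Automorphisms of the cover when spokes go to spokes.

module SpokeOrbit where
  open RoseWindow
  open DoubleCover
  open SymbolicWalks using (Dir; fwd; bwd; near; far; target)
  open WalkCounting using (module Counting)
  open EdgeOrbits
  open Parity
  open WalkConclusions using (module Residues)

  ℤ-induction : (Q : ℤ → Set) → Q (+ 0) → (∀ x → Q x → Q (x + + 1)) → (∀ x → Q x → Q (x - + 1)) → ∀ x → Q x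
  ℤ-induction Q z s p (+ zero) = z
  ℤ-induction Q z s p (+ suc k) = subst Q (trans (sym (ℤₚ.pos-+ k 1)) (cong +_ (ℕₚ.+-comm k 1))) (s (+ k) (ℤ-induction Q z s p (+ k)))
  ℤ-induction Q z s p -[1+ zero ] = p (+ 0) z
  ℤ-induction Q z s p -[1+ suc k ] = subst Q (ℤₚ.neg-minus-pos k 1) (p -[1+ k ] (ℤ-induction Q z s p -[1+ k ]))

  -- Automorphisms of the cover when the spokes form a single orbit

  module Spokes {G : Graph} {n : ℕ} {a r : ℤ} (P : Rose G n a r) (3≤n : 3 ℕ.≤ n) (a≉0 : ¬ Mod._≈_ n a (+ 0))
                (conn : Connected G) (nb : ¬ Bipartite G) (net : ¬ EdgeTransitive (G ×K₂)) where
    open Edges P public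

    private
      1≉0 : ¬ D (+ 1)
      1≉0 = ¬D-small (ℕ.s≤s ℕ.z≤n) (ℕₚ.≤-trans (ℕ.s≤s (ℕ.s≤s ℕ.z≤n)) 3≤n)

    2≉0 : ¬ (+ 2) ≈ + 0
    2≉0 p = ¬D-small (ℕ.s≤s ℕ.z≤n) 3≤n (≈⇒D p)

    isSpoke : Dir → Bool
    isSpoke fwd = false
    isSpoke bwd = false
    isSpoke near = true
    isSpoke far = true

    target-spoke : ∀ t d → target t d ≡ t xor isSpoke d
    target-spoke false fwd = refl
    target-spoke false bwd = refl
    target-spoke false near = refl
    target-spoke false far = refl
    target-spoke true fwd = refl
    target-spoke true bwd = refl
    target-spoke true near = refl
    target-spoke true far = refl

    near≢far : ∀ t x b → N t x b near ≢ N t x b far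
    near≢far false x b e = a≉0 (lin₁ (+ 1) (C-inj e) (lem x a))
      where lem : ∀ x a → a - + 0 ≡ + 1 * (x - (x - a))
            lem = solve-∀
    near≢far true x b e = a≉0 (lin₁ (- + 1) (C-inj e) (lem x a))
      where lem : ∀ x a → a - + 0 ≡ (- + 1) * (x - (x + a))
            lem = solve-∀

    rail≢spoke : ∀ t x b d d' → isSpoke d ≡ false → isSpoke d' ≡ true → N t x b d ≢ N t x b d'
    rail≢spoke t x b d d' s s' e with trans (sym s) (trans (xor-inj t (trans (sym (target-spoke t d)) (trans (C-type e) (target-spoke t d')))) s')
      where xor-inj : ∀ t {u v} → t xor u ≡ t xor v → u ≡ v
            xor-inj false e = e
            xor-inj true {false} {false} e = refl
            xor-inj true {true} {true} e = refl
    ... | ()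

    module _ (σ : Aut Cov) where

      -- A spoke sent to a rim or hub edge would merge the three orbits of edges by `spoke-moved`,
      -- and the cover would be edge-transitive.
      spoke-image : ∀ t x b d t' x' b' → isSpoke d ≡ true → app σ (C t x b) ≡ C t' x' b' →
        Σ Dir λ d' → isSpoke d' ≡ true × app σ (N t x b d) ≡ N t' x' b' d'
      spoke-image t x b d t' x' b' s e with image σ t x b d t' x' b' e
      ... | d' , e' with isSpoke d' in q
      ... | true = d' , q , e'
      ... | false = ⊥-elim (net (spoke-moved σ t x b d (trans (target-spoke t d) (trans (cong (t xor_) s) (𝔹ₚ.xor-comm t true)))
                      t' x' b' d' e e' (trans (target-spoke t' d') (trans (cong (t' xor_) q) (𝔹ₚ.xor-identityʳ t')))))

      spokes-image : ∀ t x b t' x' b' → app σ (C t x b) ≡ C t' x' b' →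
          (app σ (N t x b near) ≡ N t' x' b' near × app σ (N t x b far) ≡ N t' x' b' far)
        ⊎ (app σ (N t x b near) ≡ N t' x' b' far × app σ (N t x b far) ≡ N t' x' b' near)
      spokes-image t x b t' x' b' e with spoke-image t x b near t' x' b' refl e | spoke-image t x b far t' x' b' refl e
      ... | near , _ , p | far , _ , q = inj₁ (p , q)
      ... | far , _ , p | near , _ , q = inj₂ (p , q)
      ... | near , _ , p | near , _ , q = ⊥-elim (near≢far t x b (app-injective σ (trans p (sym q))))
      ... | far , _ , p | far , _ , q = ⊥-elim (near≢far t x b (app-injective σ (trans p (sym q))))
      ... | fwd , () , _ | _
      ... | bwd , () , _ | _
      ... | near , _ , _ | fwd , () , _
      ... | near , _ , _ | bwd , () , _
      ... | far , _ , _ | fwd , () , _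
      ... | far , _ , _ | bwd , () , _

      rail-image : ∀ t x b d t' x' b' → isSpoke d ≡ false → app σ (C t x b) ≡ C t' x' b' →
        app σ (N t x b d) ≡ N t' x' b' fwd ⊎ app σ (N t x b d) ≡ N t' x' b' bwd
      rail-image t x b d t' x' b' s e with image σ t x b d t' x' b' e
      ... | fwd , p = inj₁ p
      ... | bwd , p = inj₂ p
      ... | near , p = ⊥-elim (clash (spokes-image t x b t' x' b' e))
        where
          clash : _ → ⊥
          clash (inj₁ (q , _)) = rail≢spoke t x b d near s refl (app-injective σ (trans p (sym q)))
          clash (inj₂ (_ , q)) = rail≢spoke t x b d far s refl (app-injective σ (trans p (sym q)))
      ... | far , p = ⊥-elim (clash (spokes-image t x b t' x' b' e))
        where
          clash : _ → ⊥
          clash (inj₁ (_ , q)) = rail≢spoke t x b d far s refl (app-injective σ (trans p (sym q)))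
          clash (inj₂ (q , _)) = rail≢spoke t x b d near s refl (app-injective σ (trans p (sym q)))

      private
        twist : V Cov → Bool
        twist p = type (app σ p) xor type p

        jump : V Cov → Bool
        jump p = proj₂ (app σ p) xor proj₂ p

        type-N : ∀ t x b d → type (N t x b d) ≡ t xor isSpoke d
        type-N t x b d = trans (type-C (target t d) (move t d x) (not b)) (target-spoke t d)

        along : ∀ t x b d → twist (C t x b) ≡ twist (N t x b d) × jump (C t x b) ≡ jump (N t x b d)
        along t x b d = go (isSpoke d) refl
          where
            t' = type (app σ (C t x b))
            x' = index (app σ (C t x b))
            b' = proj₂ (app σ (C t x b))
            e : app σ (C t x b) ≡ C t' x' b'
            e = sym (C-surj (app σ (C t x b)))
            result : ∀ d' → isSpoke d' ≡ isSpoke d → app σ (N t x b d) ≡ N t' x' b' d' → twist (C t x b) ≡ twist (N t x b d) × jump (C t x b) ≡ jump (N t x b d)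
            result d' s p =
                trans (cong (t' xor_) (type-C t x b)) (sym (trans (cong₂ _xor_ (trans (cong type p) (type-N t' x' b' d')) (type-N t x b d))
                   (trans (cong (λ s → (t' xor s) xor (t xor isSpoke d)) s) (cancel t' t (isSpoke d)))))
              , sym (trans (cong (λ q → proj₂ q xor not b) p) (not-xor-not b' b))
              where
                cancel : ∀ u v s → (u xor s) xor (v xor s) ≡ u xor v
                cancel false false false = refl
                cancel false false true = refl
                cancel false true false = refl
                cancel false true true = refl
                cancel true false false = refl
                cancel true false true = refl
                cancel true true false = refl
                cancel true true true = refl
                not-xor-not : ∀ a b → not a xor not b ≡ a xor b
                not-xor-not false false = refl
                not-xor-not false true = refl
                not-xor-not true false = refl
                not-xor-not true true = refl
            go : ∀ s → isSpoke d ≡ s → twist (C t x b) ≡ twist (N t x b d) × jump (C t x b) ≡ jump (N t x b d)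
            go true s with spoke-image t x b d t' x' b' s e
            ... | d' , s' , p = result d' (trans s' (sym s)) p
            go false s with rail-image t x b d t' x' b' s e
            ... | inj₁ p = result fwd (sym s) p
            ... | inj₂ p = result bwd (sym s) p

        edge : ∀ (f : V Cov → Bool) → (∀ t x b d → f (C t x b) ≡ f (N t x b d)) → ∀ p q → Adj Cov p q → f p ≡ f q
        edge f h p q adj with N-view {type p} {index p} {proj₂ p} {q} (subst (λ p → Adj Cov p q) (sym (C-surj p)) adj)
        ... | d , refl = trans (cong f (sym (C-surj p))) (h (type p) (index p) (proj₂ p) d)

        xor-move : ∀ u {v w} → u xor v ≡ w → u ≡ v xor w
        xor-move false {v} refl = sym (𝔹ₚ.xor-same v)
        xor-move true {false} refl = refl
        xor-move true {true} refl = refl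

      -- Crossing a spoke changes the type of a vertex and that of its image; rim and hub edges
      -- change neither, and every edge changes both levels. So the effect of σ on types and on
      -- levels is constant on the cover, which is connected.
      uniform : ∀ t₀ x₀ b₀ t₁ x₁ b₁ → app σ (C t₀ x₀ b₀) ≡ C t₁ x₁ b₁ → ∀ t x b →
        Σ ℤ λ y → app σ (C t x b) ≡ C (t xor (t₁ xor t₀)) y (b xor (b₁ xor b₀))
      uniform t₀ x₀ b₀ t₁ x₁ b₁ e t x b = index q , trans (sym (C-surj q)) (cong₂ (λ t b → C t (index q) b)
          (xor-move (type q) (trans (cong (type q xor_) (sym (type-C t x b)))
            (trans (cover-constant conn nb twist (edge twist (λ t x b d → proj₁ (along t x b d))) (C t x b) (C t₀ x₀ b₀))
                   (cong₂ _xor_ (trans (cong type e) (type-C t₁ x₁ b₁)) (type-C t₀ x₀ b₀)))))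
          (xor-move (proj₂ q) (trans (cover-constant conn nb jump (edge jump (λ t x b d → proj₂ (along t x b d))) (C t x b) (C t₀ x₀ b₀))
                   (cong (λ p → proj₂ p xor b₀) e))))
        where q = app σ (C t x b)

      -- The image of a rim line of the cover is again a rim line, or a hub line.
      rail : ∀ t' b₀ → (∀ x b → Σ ℤ λ y → app σ (C false x b) ≡ C t' y b) →
        Σ ℤ λ e → Σ ℤ λ c → (move t' fwd (+ 0) ≡ e ⊎ move t' bwd (+ 0) ≡ e) × (∀ x → app σ (C false x (bit x xor b₀)) ≡ C t' (e * x + c) (bit x xor b₀))
      rail t' b₀ h = go (rail-image false (+ 0) b₀ fwd t' c b₀ refl e₀)
        where
          c = proj₁ (h (+ 0) b₀)
          e₀ : app σ (C false (+ 0) b₀) ≡ C t' c b₀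
          e₀ = proj₂ (h (+ 0) b₀)
          move-fwd : ∀ t x → move t fwd x ≡ x + move t fwd (+ 0)
          move-fwd false x = refl
          move-fwd true x = cong (_+_ x) (sym (ℤₚ.+-identityˡ r))
          move-bwd : ∀ t x → move t bwd x ≡ x + move t bwd (+ 0)
          move-bwd false x = refl
          move-bwd true x = cong (_+_ x) (sym (ℤₚ.+-identityˡ (- r)))
          N-fwd : ∀ t z b → N t z b fwd ≡ C t (z + move t fwd (+ 0)) (not b)
          N-fwd false z b = refl
          N-fwd true z b = cong (λ w → C true w (not b)) (move-fwd true z)
          N-bwd : ∀ t z b → N t z b bwd ≡ C t (z + move t bwd (+ 0)) (not b)
          N-bwd false z b = refl
          N-bwd true z b = cong (λ w → C true w (not b)) (move-bwd true z)
          opposite : ∀ t → move t bwd (+ 0) ≡ - move t fwd (+ 0)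
          opposite false = refl
          opposite true = trans (ℤₚ.+-identityˡ (- r)) (cong -_ (sym (ℤₚ.+-identityˡ r)))
          lev : ℤ → Bool
          lev x = bit x xor b₀
          lev-suc : ∀ x → lev (x + + 1) ≡ not (lev x)
          lev-suc x = trans (cong (_xor b₀) (bit-suc x)) (sym (𝔹ₚ.not-distribˡ-xor (bit x) b₀))
          lev-pred : ∀ x → lev (x - + 1) ≡ not (lev x)
          lev-pred x = trans (cong (_xor b₀) (bit-odd+ x (- + 1 , refl))) (sym (𝔹ₚ.not-distribˡ-xor (bit x) b₀))
          module _ (e : ℤ) (es : move t' fwd (+ 0) ≡ e ⊎ move t' bwd (+ 0) ≡ e) where
            At : ℤ → Set
            At x = app σ (C false x (lev x)) ≡ C t' (e * x + c) (lev x)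
            -- one of the two rail neighbours is already taken by the previous vertex
            onward : ∀ y b z s → app σ (C false y b) ≡ C t' z b → (s ≡ + 1 ⊎ s ≡ - + 1) → app σ (C false (y - s) (not b)) ≡ C t' (z - s * e) (not b) →
              app σ (C false (y + s) (not b)) ≡ C t' (z + s * e) (not b)
            onward y b z s p ss q = pick (rail-image false y b (dir ss) t' z b (sp ss) p)
              where
                dir : (s ≡ + 1 ⊎ s ≡ - + 1) → Dir
                dir (inj₁ _) = fwd
                dir (inj₂ _) = bwd
                sp : ∀ ss → isSpoke (dir ss) ≡ false
                sp (inj₁ _) = refl
                sp (inj₂ _) = refl
                N≡ : ∀ ss → N false y b (dir ss) ≡ C false (y + s) (not b)
                N≡ (inj₁ refl) = refl
                N≡ (inj₂ refl) = refl
                apart : C false (y + s) (not b) ≢ C false (y - s) (not b)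
                apart w = two ss (C-inj w)
                  where two : (s ≡ + 1 ⊎ s ≡ - + 1) → ¬ (y + s) ≈ (y - s)
                        two (inj₁ refl) v = 2≉0 (lin₁ (+ 1) v (lem y))
                          where lem : ∀ y → + 2 - + 0 ≡ + 1 * (y + + 1 - (y - + 1))
                                lem = solve-∀
                        two (inj₂ refl) v = 2≉0 (lin₁ (- + 1) v (lem y))
                          where lem : ∀ y → + 2 - + 0 ≡ (- + 1) * (y + (- + 1) - (y - (- + 1)))
                                lem = solve-∀
                either : ∀ ω → (ω ≡ e ⊎ - ω ≡ e) → (z + ω ≡ z + s * e ⊎ z + ω ≡ z - s * e) × (z - ω ≡ z + s * e ⊎ z - ω ≡ z - s * e)
                either ω (inj₁ refl) = plus ss
                  where plus : (s ≡ + 1 ⊎ s ≡ - + 1) → (z + ω ≡ z + s * ω ⊎ z + ω ≡ z - s * ω) × (z - ω ≡ z + s * ω ⊎ z - ω ≡ z - s * ω)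
                        plus (inj₁ refl) = inj₁ (l₁ z ω) , inj₂ (l₂ z ω)
                          where l₁ : ∀ z w → z + w ≡ z + + 1 * w
                                l₁ = solve-∀
                                l₂ : ∀ z w → z - w ≡ z - + 1 * w
                                l₂ = solve-∀
                        plus (inj₂ refl) = inj₂ (l₁ z ω) , inj₁ (l₂ z ω)
                          where l₁ : ∀ z w → z + w ≡ z - (- + 1) * w
                                l₁ = solve-∀
                                l₂ : ∀ z w → z - w ≡ z + (- + 1) * w
                                l₂ = solve-∀
                either ω (inj₂ refl) = minus ss
                  where minus : (s ≡ + 1 ⊎ s ≡ - + 1) → (z + ω ≡ z + s * (- ω) ⊎ z + ω ≡ z - s * (- ω)) × (z - ω ≡ z + s * (- ω) ⊎ z - ω ≡ z - s * (- ω))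
                        minus (inj₁ refl) = inj₂ (l₁ z ω) , inj₁ (l₂ z ω)
                          where l₁ : ∀ z w → z + w ≡ z - + 1 * (- w)
                                l₁ = solve-∀
                                l₂ : ∀ z w → z - w ≡ z + + 1 * (- w)
                                l₂ = solve-∀
                        minus (inj₂ refl) = inj₁ (l₁ z ω) , inj₂ (l₂ z ω)
                          where l₁ : ∀ z w → z + w ≡ z + (- + 1) * (- w)
                                l₁ = solve-∀
                                l₂ : ∀ z w → z - w ≡ z - (- + 1) * (- w)
                                l₂ = solve-∀
                ω = move t' fwd (+ 0)
                both = either ω (Sum.map₂ (trans (sym (opposite t'))) es)
                settle : ∀ {w} → (w ≡ z + s * e ⊎ w ≡ z - s * e) → app σ (C false (y + s) (not b)) ≡ C t' w (not b) → app σ (C false (y + s) (not b)) ≡ C t' (z + s * e) (not b)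
                settle (inj₁ refl) v = v
                settle (inj₂ refl) v = ⊥-elim (apart (app-injective σ (trans v (sym q))))
                pick : _ → app σ (C false (y + s) (not b)) ≡ C t' (z + s * e) (not b)
                pick (inj₁ v) = settle (proj₁ both) (trans (cong (app σ) (sym (N≡ ss))) (trans v (N-fwd t' z b)))
                pick (inj₂ v) = settle (proj₂ both) (trans (cong (app σ) (sym (N≡ ss))) (trans v (trans (N-bwd t' z b) (cong (λ w → C t' (z + w) (not b)) (opposite t')))))
            -- Two consecutive vertices fix the direction of the image line, hence the induction
            -- carries pairs.
            Pair : ℤ → Set
            Pair x = At x × At (x + + 1)
            up : ∀ x → Pair x → Pair (x + + 1)
            up x (p , q) = q , trans (cong (λ l → app σ (C false (x + + 1 + + 1) l)) (lev-suc (x + + 1)))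
                (trans (onward (x + + 1) (lev (x + + 1)) (e * (x + + 1) + c) (+ 1) q (inj₁ refl)
                          (trans (cong₂ (λ y l → app σ (C false y l)) (l₁ x) (trans (cong not (lev-suc x)) (𝔹ₚ.not-involutive _))) (trans p (cong₂ (C t') (l₂ e x c) (sym (trans (cong not (lev-suc x)) (𝔹ₚ.not-involutive _)))))))
                       (cong₂ (C t') (l₃ e x c) (sym (lev-suc (x + + 1)))))
              where l₁ : ∀ x → x + + 1 - + 1 ≡ x
                    l₁ = solve-∀
                    l₂ : ∀ e x c → e * x + c ≡ e * (x + + 1) + c - + 1 * e
                    l₂ = solve-∀
                    l₃ : ∀ e x c → e * (x + + 1) + c + + 1 * e ≡ e * (x + + 1 + + 1) + c
                    l₃ = solve-∀
            down : ∀ x → Pair x → Pair (x - + 1)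
            down x (p , q) = trans (cong (λ l → app σ (C false (x - + 1) l)) (lev-pred x))
                (trans (onward x (lev x) (e * x + c) (- + 1) p (inj₂ refl)
                          (trans (cong (λ l → app σ (C false (x - (- + 1)) l)) (sym (lev-suc x))) (trans q (cong₂ (C t') (l₂ e x c) (lev-suc x)))))
                       (cong₂ (C t') (l₃ e x c) (sym (lev-pred x))))
              , subst At (l₁ x) p
              where l₁ : ∀ x → x ≡ x - + 1 + + 1
                    l₁ = solve-∀
                    l₂ : ∀ e x c → e * (x + + 1) + c ≡ e * x + c - (- + 1) * e
                    l₂ = solve-∀
                    l₃ : ∀ e x c → e * x + c + (- + 1) * e ≡ e * (x - + 1) + c
                    l₃ = solve-∀
            all : app σ (C false (+ 1) (not b₀)) ≡ C t' (c + e) (not b₀) → ∀ x → At x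
            all e₁ x = proj₁ (ℤ-induction Pair
                (trans e₀ (cong (λ z → C t' z b₀) (l₁ e c)) , trans e₁ (cong (λ z → C t' z (not b₀)) (l₂ e c))) up down x)
              where l₁ : ∀ e c → c ≡ e * + 0 + c
                    l₁ = solve-∀
                    l₂ : ∀ e c → c + e ≡ e * + 1 + c
                    l₂ = solve-∀
          go : app σ (N false (+ 0) b₀ fwd) ≡ N t' c b₀ fwd ⊎ app σ (N false (+ 0) b₀ fwd) ≡ N t' c b₀ bwd → _
          go (inj₁ v) = move t' fwd (+ 0) , c , inj₁ refl , all _ (inj₁ refl) (trans v (N-fwd t' c b₀))
          go (inj₂ v) = move t' bwd (+ 0) , c , inj₂ refl , all _ (inj₂ refl) (trans v (N-bwd t' c b₀))

-- Automorphisms that preserve the types of the vertices.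

module TypePreserving where
  open RoseWindow
  open DoubleCover
  open SymbolicWalks using (Dir; fwd; bwd; near; far; target)
  open WalkCounting using (module Counting)
  open EdgeOrbits
  open RespectedMatchings using (par; half)
  open Parity
  open WalkConclusions using (module Residues)
  open ResidualParameters using (even-par; odd-par)
  open SpokeOrbit

  module _ (n : ℕ) where
    open Mod n

    -- The parameters for which an unexpected automorphism preserves the set of spokes
    data Exceptional (a r : ℤ) (m : ℕ) : Set where
      halved-a : (+ 2 * a) ≈ + 0 → EvenZ (+ m) → Exceptional a r m
      quartered-r : (+ 4 * r) ≈ + 0 → ¬ (+ 2 * r) ≈ + 0 → EvenZ a → EvenZ r → Exceptional a r m
      quartered-a : (+ 4 * a) ≈ + 0 → ¬ (+ 2 * a) ≈ + 0 → OddZ a → OddZ r → Exceptional a r m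
      order-4 : (+ 4) ≈ + 0 → ¬ (+ 2 * a) ≈ + 0 → ¬ (+ 2 * r) ≈ + 0 → Exceptional a r m
      involution : ((+ m - r) * (+ m - r)) ≈ + 1 → ((+ m - r) * a) ≈ a ⊎ ((+ m - r) * a) ≈ (- a) → ¬ (+ 2 * a) ≈ + 0 → Exceptional a r m
      square : a ≈ + m → OddZ (+ m) → EvenZ r → (+ 2 * (r * r)) ≈ + 2 ⊎ (+ 2 * (r * r)) ≈ (- + 2) → Exceptional a r m

    pigeon : ∀ {x y z u v} → x ≈ u ⊎ x ≈ v → y ≈ u ⊎ y ≈ v → z ≈ u ⊎ z ≈ v → x ≈ y ⊎ y ≈ z ⊎ x ≈ z
    pigeon (inj₁ p) (inj₁ q) _ = inj₁ (≈-trans p (≈-sym q))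
    pigeon (inj₂ p) (inj₂ q) _ = inj₁ (≈-trans p (≈-sym q))
    pigeon (inj₁ p) (inj₂ q) (inj₁ s) = inj₂ (inj₂ (≈-trans p (≈-sym s)))
    pigeon (inj₁ p) (inj₂ q) (inj₂ s) = inj₂ (inj₁ (≈-trans q (≈-sym s)))
    pigeon (inj₂ p) (inj₁ q) (inj₁ s) = inj₂ (inj₁ (≈-trans q (≈-sym s)))
    pigeon (inj₂ p) (inj₁ q) (inj₂ s) = inj₂ (inj₂ (≈-trans p (≈-sym s)))

    -- 0, 2k and 4k cannot lie in two classes unless two of them coincide.
    two-of-three : ∀ k u v → (∀ x → (+ 2 * (k * x)) ≈ u ⊎ (+ 2 * (k * x)) ≈ v) → (+ 2 * k) ≈ + 0 ⊎ (+ 4 * k) ≈ + 0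
    two-of-three k u v h = go (pigeon (h (+ 0)) (h (+ 1)) (h (+ 2)))
      where
        l₁ : ∀ k → + 2 * k - + 0 ≡ (- + 1) * (+ 2 * (k * + 0) - + 2 * (k * + 1))
        l₁ = solve-∀
        l₂ : ∀ k → + 2 * k - + 0 ≡ (- + 1) * (+ 2 * (k * + 1) - + 2 * (k * + 2))
        l₂ = solve-∀
        l₃ : ∀ k → + 4 * k - + 0 ≡ (- + 1) * (+ 2 * (k * + 0) - + 2 * (k * + 2))
        l₃ = solve-∀
        go : _ → (+ 2 * k) ≈ + 0 ⊎ (+ 4 * k) ≈ + 0
        go (inj₁ p) = inj₁ (lin₁ (- + 1) p (l₁ k))
        go (inj₂ (inj₁ p)) = inj₁ (lin₁ (- + 1) p (l₂ k))
        go (inj₂ (inj₂ p)) = inj₂ (lin₁ (- + 1) p (l₃ k))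

    two-of-three₁ : ∀ u v → (∀ x → (+ 2 * x) ≈ u ⊎ (+ 2 * x) ≈ v) → (+ 2) ≈ + 0 ⊎ (+ 4) ≈ + 0
    two-of-three₁ u v h = go (pigeon (h (+ 0)) (h (+ 1)) (h (+ 2)))
      where
        go : _ → (+ 2) ≈ + 0 ⊎ (+ 4) ≈ + 0
        go (inj₁ p) = inj₁ (≈-sym p)
        go (inj₂ (inj₁ p)) = inj₁ (lin₁ (- + 1) p refl)
        go (inj₂ (inj₂ p)) = inj₂ (≈-sym p)

  module Preserving {G : Graph} {n : ℕ} {a r : ℤ} (P : Rose G n a r) (3≤n : 3 ℕ.≤ n) (a≉0 : ¬ Mod._≈_ n a (+ 0))
                    (conn : Connected G) (nb : ¬ Bipartite G) (net : ¬ EdgeTransitive (G ×K₂)) where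
    open Spokes P 3≤n a≉0 conn nb net

    module Based (σ : Aut Cov) (fix₀ : app σ (C false (+ 0) false) ≡ C false (+ 0) false) (fix₁ : app σ (C false (+ 1) true) ≡ C false (+ 1) true) where
      open Residues n

      abstract
        same-type : ∀ t x b → Σ ℤ λ y → app σ (C t x b) ≡ C t y b
        same-type t x b with uniform σ false (+ 0) false false (+ 0) false fix₀ t x b
        ... | y , e = y , trans e (cong₂ (λ t b → C t y b) (𝔹ₚ.xor-identityʳ t) (𝔹ₚ.xor-identityʳ b))

      abstract
        -- `rail` makes σ affine on the line of the u_x on level `bit x`, and an affine map fixing 0
        -- and 1 is the identity.
        line₀ : ∀ x → app σ (C false x (bit x)) ≡ C false x (bit x)
        line₀ x with rail σ false false (same-type false)
        ... | e , c , _ , h = trans (sym (cong (λ l → app σ (C false x l)) (𝔹ₚ.xor-identityʳ (bit x)))) (trans (h x) (trans (C-cong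
            (lin₂ (+ 1 - x) x (C-inj {b = false} {c = false} (trans (sym (h (+ 0))) fix₀)) (C-inj {b = true} {c = true} (trans (sym (h (+ 1))) fix₁)) (lem e c x)))
            (cong (C false x) (𝔹ₚ.xor-identityʳ (bit x)))))
          where lem : ∀ e c x → e * x + c - x ≡ (+ 1 - x) * (e * + 0 + c - + 0) + x * (e * + 1 + c - + 1)
                lem = solve-∀

      abstract
        spokes-at : ∀ x b {X Y} → app σ (C false x (not b)) ≡ C false X (not b) → app σ (C false (x + a) (not b)) ≡ C false Y (not b) →
          Σ ℤ λ y → app σ (C true x b) ≡ C true y b × ((X ≈ y × Y ≈ (y + a)) ⊎ (X ≈ (y + a) × Y ≈ y))
        spokes-at x b p q with same-type true x b
        ... | y , e with spokes-image σ true x b true y b e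
        ... | inj₁ (u , v) = y , e , inj₁ (C-inj (trans (sym p) u) , C-inj (trans (sym q) v))
        ... | inj₂ (u , v) = y , e , inj₂ (C-inj (trans (sym p) u) , C-inj (trans (sym q) v))

      double-a : ∀ {x y} → x ≈ (y + a) → (x + a) ≈ y → (+ 2 * a) ≈ + 0
      double-a {x} {y} p q = lin₂ (- + 1) (+ 1) p q (lem x y a)
        where lem : ∀ x y a → + 2 * a - + 0 ≡ (- + 1) * (x - (y + a)) + + 1 * (x + a - y)
              lem = solve-∀

      -- If v_x goes to v_y, then y and y + a are x and x + a in some order; the reversed order
      -- gives 2a = 0.
      fixed-v : ¬ (+ 2 * a) ≈ + 0 → ∀ x b → app σ (C false x (not b)) ≡ C false x (not b) → app σ (C false (x + a) (not b)) ≡ C false (x + a) (not b) →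
        app σ (C true x b) ≡ C true x b
      fixed-v 2a≉0 x b p q with spokes-at x b p q
      ... | y , e , inj₁ (u , _) = trans e (C-cong (≈-sym u))
      ... | y , e , inj₂ (u , v) = ⊥-elim (2a≉0 (double-a u v))

      identity-commutes : (∀ t x b → app σ (C t x b) ≡ C t x b) → Commutes {G} σ
      identity-commutes h p = trans (all (flip p)) (cong flip (sym (all p)))
        where
          all : ∀ q → app σ q ≡ q
          all q = trans (cong (app σ) (sym (C-surj q))) (trans (h (type q) (index q) (proj₂ q)) (C-surj q))

      fixing-u : ¬ (+ 2 * a) ≈ + 0 → (∀ x b → app σ (C false x b) ≡ C false x b) → Commutes {G} σ
      fixing-u 2a≉0 h = identity-commutes λ { false x b → h x b ; true x b → fixed-v 2a≉0 x b (h x (not b)) (h (x + a) (not b)) }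

      -- For odd n the numbers x and x + n have different parities but the same residue, so the one
      -- fixed line runs through every u on both levels.
      odd-case : OddZ (+ n) → Commutes {G} σ
      odd-case odd = fixing-u (a≉0 ∘ Odd.halve odd a) all
        where
          x+n : ∀ x → (x + + n) ≈ x
          x+n x = mk (subst D (lem x (+ n)) Dn)
            where lem : ∀ x n → n ≡ x + n - x
                  lem = solve-∀
          all : ∀ x b → app σ (C false x b) ≡ C false x b
          all x b with bit x 𝔹ₚ.≟ b
          ... | yes refl = line₀ x
          ... | no ne = trans (cong (app σ) (trans (C-cong (≈-sym (x+n x))) (cong (C false (x + + n)) lev))) (trans (line₀ (x + + n)) (trans (cong (C false (x + + n)) (sym lev)) (C-cong (x+n x))))
            where lev : b ≡ bit (x + + n)
                  lev = trans (≢⇒≡not ne) (sym (bit-odd+ x odd))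

      module EvenOrder (m : ℕ) (n≡2m : n ≡ 2 ℕ.* m) where
        open Even m n≡2m

        Along : (ℤ → ℤ) → Set
        Along X = ∀ x → app σ (C false x (not (bit x))) ≡ C false (X x) (not (bit x))

        -- For even n the vertices u_x on the opposite level form a second line, on which σ can
        -- still be a shift or a reflection; c is its only freedom.
        other : Σ ℤ λ c → Along (λ x → x + c) ⊎ Along (λ x → c - x)
        other with rail σ false true (same-type false)
        ... | e , c , es , h = c , Sum.map plus minus es
          where
            at : Along (λ x → e * x + c)
            at x = subst (λ l → app σ (C false x l) ≡ C false (e * x + c) l) (𝔹ₚ.xor-comm (bit x) true) (h x)
            plus : + 1 ≡ e → Along (λ x → x + c)
            plus q x = trans (at x) (cong (λ z → C false z (not (bit x))) (trans (cong (λ e → e * x + c) (sym q)) (lem x c)))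
              where lem : ∀ x c → + 1 * x + c ≡ x + c
                    lem = solve-∀
            minus : - + 1 ≡ e → Along (λ x → c - x)
            minus q x = trans (at x) (cong (λ z → C false z (not (bit x))) (trans (cong (λ e → e * x + c) (sym q)) (lem x c)))
              where lem : ∀ x c → (- + 1) * x + c ≡ c - x
                    lem = solve-∀

        fix-all : ∀ {c} → c ≈ + 0 → Along (λ x → x + c) → ∀ x b → app σ (C false x b) ≡ C false x b
        fix-all {c} p h x b with bit x 𝔹ₚ.≟ b
        ... | yes refl = line₀ x
        ... | no ne = subst (λ l → app σ (C false x l) ≡ C false x l) (sym (≢⇒≡not ne)) (trans (h x) (C-cong (lin₁ (+ 1) p (lem x c))))
          where lem : ∀ x c → x + c - x ≡ + 1 * (c - + 0)
                lem = solve-∀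

        halves-a : ¬ a ≈ + 0 → (+ 2 * a) ≈ + 0 → a ≈ + m
        halves-a a≉0 p with halve a p
        ... | inj₁ z = ⊥-elim (a≉0 z)
        ... | inj₂ z = z

        even-m : a ≈ + m → EvenZ a → EvenZ (+ m)
        even-m p ea = subst EvenZ (lem a (+ m)) (even-+ ea (even-neg (even-≈ P even-n p)))
          where lem : ∀ a m → a + - (a - m) ≡ m
                lem = solve-∀

        hub-step : ∀ x b d y z → isSpoke d ≡ false → app σ (C true x b) ≡ C true y b → app σ (N true x b d) ≡ C true z (not b) → z ≈ (y + r) ⊎ z ≈ (y - r)
        hub-step x b d y z s p q with rail-image σ true x b d true y b s p
        ... | inj₁ u = inj₁ (C-inj (trans (sym q) u))
        ... | inj₂ u = inj₂ (C-inj (trans (sym q) u))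

        Image : (ℤ → ℤ) → ℤ → ℤ → Set
        Image X x y = (X x ≈ y × X (x + a) ≈ (y + a)) ⊎ (X x ≈ (y + a) × X (x + a) ≈ y)

        -- a and r even: the two rim lines, each with its attached v's, are joined by hub edges only.
        module BothEven (2a≉0 : ¬ (+ 2 * a) ≈ + 0) (ea : EvenZ a) (er : EvenZ r) where

          v-fixed : ∀ x → app σ (C true x (not (bit x))) ≡ C true x (not (bit x))
          v-fixed x = fixed-v 2a≉0 x (not (bit x)) (at (𝔹ₚ.not-involutive (bit x))) (at' (trans (𝔹ₚ.not-involutive (bit x)) (sym (bit-even+ x ea))))
            where at : ∀ {l} → l ≡ bit x → app σ (C false x l) ≡ C false x l
                  at refl = line₀ x
                  at' : ∀ {l} → l ≡ bit (x + a) → app σ (C false (x + a) l) ≡ C false (x + a) l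
                  at' refl = line₀ (x + a)

          module _ (X : ℤ → ℤ) (h : Along X) where

            moved-v : ∀ x → Σ ℤ λ y → app σ (C true x (bit x)) ≡ C true y (bit x) × Image X x y
            moved-v x = spokes-at x (bit x) (h x) (at (cong not (sym (bit-even+ x ea))))
              where at : ∀ {l} → l ≡ not (bit (x + a)) → app σ (C false (x + a) l) ≡ C false (X (x + a)) l
                    at refl = h (x + a)

            v : ℤ → ℤ
            v x = proj₁ (moved-v x)

            v-image : ∀ x → Image X x (v x)
            v-image x = proj₂ (proj₂ (moved-v x))

            private
              lev : ∀ x {y} → EvenZ (y - x) → bit y ≡ not (not (bit x))
              lev x ev = trans (bit-same ev) (sym (𝔹ₚ.not-involutive (bit x)))
              at : ∀ y {l} → bit y ≡ l → app σ (C true y l) ≡ C true (v y) l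
              at y refl = proj₁ (proj₂ (moved-v y))
              ev₁ : ∀ x → EvenZ (x + r - x)
              ev₁ x = subst EvenZ (lem x r) er
                where lem : ∀ x r → r ≡ x + r - x
                      lem = solve-∀
              ev₂ : ∀ x → EvenZ (x - r - x)
              ev₂ x = subst EvenZ (lem x r) (even-neg er)
                where lem : ∀ x r → - r ≡ x - r - x
                      lem = solve-∀

            hub⁺ : ∀ x → v (x + r) ≈ (x + r) ⊎ v (x + r) ≈ (x - r)
            hub⁺ x = hub-step x (not (bit x)) fwd x (v (x + r)) refl (v-fixed x) (at (x + r) (lev x (ev₁ x)))

            hub⁻ : ∀ x → v (x - r) ≈ (x + r) ⊎ v (x - r) ≈ (x - r)
            hub⁻ x = hub-step x (not (bit x)) bwd x (v (x - r)) refl (v-fixed x) (at (x - r) (lev x (ev₂ x)))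

          shifted : ∀ c → Along (λ x → x + c) → Commutes {G} σ ⊎ Exceptional n a r m
          shifted c h = split (c ≈? (+ 0))
            where
              w = v (λ x → x + c) h
              y≈ : ∀ x → (x + c) ≈ w x
              y≈ x = go (v-image (λ x → x + c) h x)
                where
                  go : Image (λ x → x + c) x (w x) → (x + c) ≈ w x
                  go (inj₁ (u , _)) = u
                  go (inj₂ (u , t)) = ⊥-elim (2a≉0 (lin₂ (- + 1) (+ 1) u t (lem x c (w x) a)))
                    where lem : ∀ x c y a → + 2 * a - + 0 ≡ (- + 1) * (x + c - (y + a)) + + 1 * (x + a + c - y)
                          lem = solve-∀
              split : Dec (c ≈ + 0) → Commutes {G} σ ⊎ Exceptional n a r m
              split (yes p) = inj₁ (fixing-u 2a≉0 (fix-all p h))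
              split (no ¬p) = inj₂ (quartered-r 4r≈0 2r≉0 ea er)
                where
                  up : (c + + 2 * r) ≈ + 0
                  up = go (hub⁺ (λ x → x + c) h (+ 0))
                    where
                      lem : ∀ c r y → c - + 0 ≡ + 1 * (+ 0 + r + c - y) + + 1 * (y - (+ 0 + r))
                      lem = solve-∀
                      lem' : ∀ c r y → c + + 2 * r - + 0 ≡ + 1 * (+ 0 + r + c - y) + + 1 * (y - (+ 0 - r))
                      lem' = solve-∀
                      go : w (+ 0 + r) ≈ (+ 0 + r) ⊎ w (+ 0 + r) ≈ (+ 0 - r) → (c + + 2 * r) ≈ + 0
                      go (inj₁ u) = ⊥-elim (¬p (lin₂ (+ 1) (+ 1) (y≈ (+ 0 + r)) u (lem c r (w (+ 0 + r)))))
                      go (inj₂ u) = lin₂ (+ 1) (+ 1) (y≈ (+ 0 + r)) u (lem' c r (w (+ 0 + r)))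
                  down : (c - + 2 * r) ≈ + 0
                  down = go (hub⁻ (λ x → x + c) h (+ 0))
                    where
                      lem : ∀ c r y → c - + 0 ≡ + 1 * (+ 0 - r + c - y) + + 1 * (y - (+ 0 - r))
                      lem = solve-∀
                      lem' : ∀ c r y → c - + 2 * r - + 0 ≡ + 1 * (+ 0 - r + c - y) + + 1 * (y - (+ 0 + r))
                      lem' = solve-∀
                      go : w (+ 0 - r) ≈ (+ 0 + r) ⊎ w (+ 0 - r) ≈ (+ 0 - r) → (c - + 2 * r) ≈ + 0
                      go (inj₂ u) = ⊥-elim (¬p (lin₂ (+ 1) (+ 1) (y≈ (+ 0 - r)) u (lem c r (w (+ 0 - r)))))
                      go (inj₁ u) = lin₂ (+ 1) (+ 1) (y≈ (+ 0 - r)) u (lem' c r (w (+ 0 - r)))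
                  4r≈0 : (+ 4 * r) ≈ + 0
                  4r≈0 = lin₂ (+ 1) (- + 1) up down (lem c r)
                    where lem : ∀ c r → + 4 * r - + 0 ≡ + 1 * (c + + 2 * r - + 0) + (- + 1) * (c - + 2 * r - + 0)
                          lem = solve-∀
                  2r≉0 : ¬ (+ 2 * r) ≈ + 0
                  2r≉0 z = ¬p (lin₂ (+ 1) (- + 1) up z (lem c r))
                    where lem : ∀ c r → c - + 0 ≡ + 1 * (c + + 2 * r - + 0) + (- + 1) * (+ 2 * r - + 0)
                          lem = solve-∀

          -- The hub edges confine 2x to two classes for every x, so n divides 2 or 4; the former is
          -- impossible and the latter gives 2a = 0 for even a.
          mirrored : ∀ c → ¬ Along (λ x → c - x)
          mirrored c h = finish (two-of-three₁ n (c - a - + 2 * r) (c - a) vals)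
            where
              w = v (λ x → c - x) h
              y≈ : ∀ x → (c - x - a) ≈ w x
              y≈ x = go (v-image (λ x → c - x) h x)
                where
                  go : Image (λ x → c - x) x (w x) → (c - x - a) ≈ w x
                  go (inj₂ (u , _)) = lin₁ (+ 1) u (lem x c (w x) a)
                    where lem : ∀ x c y a → c - x - a - y ≡ + 1 * (c - x - (y + a))
                          lem = solve-∀
                  go (inj₁ (u , t)) = ⊥-elim (2a≉0 (lin₂ (+ 1) (- + 1) u t (lem x c (w x) a)))
                    where lem : ∀ x c y a → + 2 * a - + 0 ≡ + 1 * (c - x - y) + (- + 1) * (c - (x + a) - (y + a))
                          lem = solve-∀
              vals : ∀ x → (+ 2 * x) ≈ (c - a - + 2 * r) ⊎ (+ 2 * x) ≈ (c - a)
              vals x = go (hub⁺ (λ x → c - x) h x)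
                where
                  lem : ∀ x c a r y → + 2 * x - (c - a - + 2 * r) ≡ (- + 1) * (c - (x + r) - a - y) + (- + 1) * (y - (x + r))
                  lem = solve-∀
                  lem' : ∀ x c a r y → + 2 * x - (c - a) ≡ (- + 1) * (c - (x + r) - a - y) + (- + 1) * (y - (x - r))
                  lem' = solve-∀
                  go : w (x + r) ≈ (x + r) ⊎ w (x + r) ≈ (x - r) → (+ 2 * x) ≈ (c - a - + 2 * r) ⊎ (+ 2 * x) ≈ (c - a)
                  go (inj₁ u) = inj₁ (lin₂ (- + 1) (- + 1) (y≈ (x + r)) u (lem x c a r (w (x + r))))
                  go (inj₂ u) = inj₂ (lin₂ (- + 1) (- + 1) (y≈ (x + r)) u (lem' x c a r (w (x + r))))
              finish : (+ 2) ≈ + 0 ⊎ (+ 4) ≈ + 0 → ⊥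
              finish (inj₁ z) = 2≉0 z
              finish (inj₂ z) = 2a≉0 (lin₁ (proj₁ ea) z (trans (cong (λ a → + 2 * a - + 0) (proj₂ ea)) (lem (proj₁ ea))))
                where lem : ∀ q → + 2 * (+ 2 * q) - + 0 ≡ q * (+ 4 - + 0)
                      lem = solve-∀

        case-even : EvenZ a → EvenZ r → Commutes {G} σ ⊎ Exceptional n a r m
        case-even ea er = split ((+ 2 * a) ≈? (+ 0))
          where
            go : ¬ (+ 2 * a) ≈ + 0 → (Σ ℤ λ c → Along (λ x → x + c) ⊎ Along (λ x → c - x)) → Commutes {G} σ ⊎ Exceptional n a r m
            go ne (c , inj₁ h) = BothEven.shifted ne ea er c h
            go ne (c , inj₂ h) = ⊥-elim (BothEven.mirrored ne ea er c h)
            split : Dec ((+ 2 * a) ≈ + 0) → Commutes {G} σ ⊎ Exceptional n a r m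
            split (yes p) = inj₂ (halved-a p (even-m (halves-a a≉0 p) ea))
            split (no ne) = go ne other

        module OddA (oa : OddZ a) where

          private
            bit+a : ∀ x → bit (x + a) ≡ not (bit x)
            bit+a x = bit-odd+ x oa
            on₀ : ∀ y {l} → l ≡ bit y → app σ (C false y l) ≡ C false y l
            on₀ y refl = line₀ y

          no-cycle : ∀ {x} → ¬ x ≈ (x + a)
          no-cycle {x} p = a≉0 (lin₁ (- + 1) p (lem x a))
            where lem : ∀ x a → a - + 0 ≡ (- + 1) * (x - (x + a))
                  lem = solve-∀

          module _ (X : ℤ → ℤ) (h : Along X) where

            private
              on₁ : ∀ y {l} → l ≡ not (bit y) → app σ (C false y l) ≡ C false (X y) l
              on₁ y refl = h y

            at₀ : ∀ x → Σ ℤ λ y → app σ (C true x (not (bit x))) ≡ C true y (not (bit x)) × ((x ≈ y × X (x + a) ≈ (y + a)) ⊎ (x ≈ (y + a) × X (x + a) ≈ y))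
            at₀ x = spokes-at x (not (bit x)) (on₀ x (𝔹ₚ.not-involutive (bit x))) (on₁ (x + a) (cong not (sym (bit+a x))))

            at₁ : ∀ x → Σ ℤ λ y → app σ (C true x (bit x)) ≡ C true y (bit x) × ((X x ≈ y × (x + a) ≈ (y + a)) ⊎ (X x ≈ (y + a) × (x + a) ≈ y))
            at₁ x = spokes-at x (bit x) (on₁ x refl) (on₀ (x + a) (sym (bit+a x)))

            v₀ v₁ : ℤ → ℤ
            v₀ x = proj₁ (at₀ x)
            v₁ x = proj₁ (at₁ x)

            v₀-image : ∀ x → (x ≈ v₀ x × X (x + a) ≈ (v₀ x + a)) ⊎ (x ≈ (v₀ x + a) × X (x + a) ≈ v₀ x)
            v₀-image x = proj₂ (proj₂ (at₀ x))

            v₁-image : ∀ x → (X x ≈ v₁ x × (x + a) ≈ (v₁ x + a)) ⊎ (X x ≈ (v₁ x + a) × (x + a) ≈ v₁ x)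
            v₁-image x = proj₂ (proj₂ (at₁ x))

            hub⁺ : EvenZ r → ∀ x → v₁ (x + r) ≈ (v₀ x + r) ⊎ v₁ (x + r) ≈ (v₀ x - r)
            hub⁺ er x = hub-step x (not (bit x)) fwd (v₀ x) (v₁ (x + r)) refl (proj₁ (proj₂ (at₀ x)))
                (at (x + r) (trans (bit-even+ x er) (sym (𝔹ₚ.not-involutive (bit x)))))
              where at : ∀ y {l} → bit y ≡ l → app σ (C true y l) ≡ C true (v₁ y) l
                    at y refl = proj₁ (proj₂ (at₁ y))

          -- Every u is fixed, so σ exchanges v_x and v_{x+a} or fixes both; hub edges propagate the choice.
          swapping : (+ 2 * a) ≈ + 0 → (∀ x b → app σ (C false x b) ≡ C false x b) → Commutes {G} σ
          swapping 2a≈0 h p = trans (cong (app σ) (cong flip (sym (C-surj p)))) (trans (result (type p) (index p) (proj₂ p)) (cong (λ q → flip (app σ q)) (C-surj p)))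
            where
              a≈m : a ≈ + m
              a≈m = halves-a a≉0 2a≈0
              om : OddZ (+ m)
              om = subst OddZ (lem a (+ m)) (odd-+ (even-neg (even-≈ P even-n a≈m)) oa)
                where lem : ∀ a m → - (a - m) + a ≡ m
                      lem = solve-∀
              par-m : par m ≡ true
              par-m = go (par m) refl
                where go : ∀ b → par m ≡ b → par m ≡ true
                      go true e = e
                      go false e = ⊥-elim (even≢odd (+ half m , even-par m e) om)
              stays : ∀ x b → app σ (C true x b) ≡ C true x b ⊎ app σ (C true x b) ≡ C true (x + a) b
              stays x b = go (spokes-at x b (h x (not b)) (h (x + a) (not b)))
                where
                  go : (Σ ℤ λ y → app σ (C true x b) ≡ C true y b × ((x ≈ y × (x + a) ≈ (y + a)) ⊎ (x ≈ (y + a) × (x + a) ≈ y))) → _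
                  go (y , e , inj₁ (u , _)) = inj₁ (trans e (C-cong (≈-sym u)))
                  go (y , e , inj₂ (_ , u)) = inj₂ (trans e (C-cong (≈-sym u)))
              Fixed : ℤ → Bool → Set
              Fixed x b = app σ (C true x b) ≡ C true x b
              next : ∀ x b → Fixed x b → Fixed (x + r) (not b)
              next x b f = go (stays (x + r) (not b))
                where
                  go : _ → Fixed (x + r) (not b)
                  go (inj₁ e) = e
                  go (inj₂ e) = ⊥-elim (clash (hub-step x b fwd x (x + r + a) refl f e))
                    where
                      clash : (x + r + a) ≈ (x + r) ⊎ (x + r + a) ≈ (x - r) → ⊥
                      clash (inj₁ u) = no-cycle (≈-sym u)
                      clash (inj₂ u) = even≢odd (subst EvenZ (lem x r a) (even-+ (even-≈ P even-n u) (- r , refl))) oa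
                        where lem : ∀ x r a → x + r + a - (x - r) + + 2 * (- r) ≡ a
                              lem = solve-∀
              iterate : ∀ k x b → Fixed x b → Fixed (x + + k * r) (b xor par k)
              iterate zero x b f = subst₂ Fixed (lem x r) (sym (𝔹ₚ.xor-identityʳ b)) f
                where lem : ∀ x r → x ≡ x + + 0 * r
                      lem = solve-∀
              iterate (suc k) x b f = subst₂ Fixed (trans (lem x (+ k) r) (cong (λ z → x + z * r) (trans (sym (ℤₚ.pos-+ k 1)) (cong +_ (ℕₚ.+-comm k 1))))) (𝔹ₚ.not-distribʳ-xor b (par k)) (next (x + + k * r) (b xor par k) (iterate k x b f))
                where lem : ∀ x k r → x + k * r + r ≡ x + (k + + 1) * r
                      lem = solve-∀
              from-shift : ∀ x b → Fixed (x + a) b → Fixed x b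
              from-shift x b f = go (stays x b)
                where go : _ → Fixed x b
                      go (inj₁ e) = e
                      go (inj₂ e) = ⊥-elim (no-cycle (C-inj (app-injective σ (trans e (sym f)))))
              fixed-cong : ∀ {x y b} → x ≈ y → Fixed x b → Fixed y b
              fixed-cong p f = trans (cong (app σ) (C-cong (≈-sym p))) (trans f (C-cong p))
              -- m is odd, so m hub steps change the level; they end at v_x if r is even and at
              -- v_{x+a} if r is odd, because mr is 0 or m = a.
              other-level : ∀ x b → Fixed x b → Fixed x (not b)
              other-level x b f = go (parity r)
                where
                  f' : Fixed (x + + m * r) (not b)
                  f' = subst (Fixed (x + + m * r)) (trans (cong (b xor_) par-m) (𝔹ₚ.xor-comm b true)) (iterate m x b f)
                  go : EvenZ r ⊎ OddZ r → Fixed x (not b)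
                  go (inj₁ (q , e)) = fixed-cong (lin₁ q 2m≈0 (trans (cong (λ r → x + + m * r - x) e) (lem x (+ m) q))) f'
                    where lem : ∀ x m q → x + m * (+ 2 * q) - x ≡ q * (+ 2 * m - + 0)
                          lem = solve-∀
                  go (inj₂ (q , e)) = from-shift x (not b) (fixed-cong (lin₂ q (- + 1) 2m≈0 a≈m (trans (cong (λ r → x + + m * r - (x + a)) e) (lem x (+ m) q a))) f')
                    where lem : ∀ x m q a → x + m * (+ 2 * q + + 1) - (x + a) ≡ q * (+ 2 * m - + 0) + (- + 1) * (a - m)
                          lem = solve-∀
              result : ∀ t x b → app σ (C t x (not b)) ≡ flip (app σ (C t x b))
              result false x b = trans (h x (not b)) (cong flip (sym (h x b)))
              result true x b = go (stays x b) (stays x (not b))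
                where
                  go : _ → _ → app σ (C true x (not b)) ≡ flip (app σ (C true x b))
                  go (inj₁ e) _ = trans (other-level x b e) (cong flip (sym e))
                  go (inj₂ e) (inj₂ e') = trans e' (cong flip (sym e))
                  go (inj₂ e) (inj₁ e') = ⊥-elim (no-cycle (C-inj (trans (sym (subst (Fixed x) (𝔹ₚ.not-involutive b) (other-level x (not b) e'))) e)))

          -- Every v now joins a vertex of the fixed line to one of the moved line. For c nonzero
          -- the spokes give c = -2a and c = 2a, hence 4a = 0. If r were even, a hub edge would add
          -- 2a = 0 or 2(r + a) = 0; both fail, since r + a is odd while m, congruent to 2a, is
          -- even.
          shifted : ∀ c → Along (λ x → x + c) → Commutes {G} σ ⊎ Exceptional n a r m
          shifted c h = split (c ≈? (+ 0)) ((+ 2 * a) ≈? (+ 0))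
            where
              w₀ = v₀ (λ x → x + c) h
              w₁ = v₁ (λ x → x + c) h
              module _ (¬p : ¬ c ≈ + 0) where
                low : ∀ x → (c ≈ (- (+ 2 * a))) × w₀ x ≈ (x - a)
                low x = go (v₀-image (λ x → x + c) h x)
                  where
                    l₁ : ∀ x c a y → c - + 0 ≡ (- + 1) * (x - y) + + 1 * (x + a + c - (y + a))
                    l₁ = solve-∀
                    l₂ : ∀ x c a y → c - (- (+ 2 * a)) ≡ (- + 1) * (x - (y + a)) + + 1 * (x + a + c - y)
                    l₂ = solve-∀
                    l₃ : ∀ x a y → y - (x - a) ≡ (- + 1) * (x - (y + a))
                    l₃ = solve-∀
                    go : _ → (c ≈ (- (+ 2 * a))) × w₀ x ≈ (x - a)
                    go (inj₁ (u , t)) = ⊥-elim (¬p (lin₂ (- + 1) (+ 1) u t (l₁ x c a (w₀ x))))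
                    go (inj₂ (u , t)) = lin₂ (- + 1) (+ 1) u t (l₂ x c a (w₀ x)) , lin₁ (- + 1) u (l₃ x a (w₀ x))
                high : ∀ x → (c ≈ (+ 2 * a)) × w₁ x ≈ (x + a)
                high x = go (v₁-image (λ x → x + c) h x)
                  where
                    l₁ : ∀ x c a y → c - + 0 ≡ + 1 * (x + c - y) + (- + 1) * (x + a - (y + a))
                    l₁ = solve-∀
                    l₂ : ∀ x c a y → c - + 2 * a ≡ + 1 * (x + c - (y + a)) + (- + 1) * (x + a - y)
                    l₂ = solve-∀
                    go : _ → (c ≈ (+ 2 * a)) × w₁ x ≈ (x + a)
                    go (inj₁ (u , t)) = ⊥-elim (¬p (lin₂ (+ 1) (- + 1) u t (l₁ x c a (w₁ x))))
                    go (inj₂ (u , t)) = lin₂ (+ 1) (- + 1) u t (l₂ x c a (w₁ x)) , ≈-sym t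
                4a≈0 : (+ 4 * a) ≈ + 0
                4a≈0 = lin₂ (+ 1) (- + 1) (proj₁ (low (+ 0))) (proj₁ (high (+ 0))) (lem c a)
                  where lem : ∀ c a → + 4 * a - + 0 ≡ + 1 * (c - (- (+ 2 * a))) + (- + 1) * (c - + 2 * a)
                        lem = solve-∀
                2a≉0 : ¬ (+ 2 * a) ≈ + 0
                2a≉0 z = ¬p (≈-trans (proj₁ (high (+ 0))) z)
                r-even : EvenZ r → ⊥
                r-even er = go (hub⁺ (λ x → x + c) h er (+ 0))
                  where
                    l₁ : ∀ r a y z → + 2 * a - + 0 ≡ (- + 1) * (z - (+ 0 + r + a)) + (+ 1 * (z - (y + r)) + + 1 * (y - (+ 0 - a)))
                    l₁ = solve-∀
                    l₂ : ∀ r a y z → + 2 * (r + a) - + 0 ≡ (- + 1) * (z - (+ 0 + r + a)) + (+ 1 * (z - (y - r)) + + 1 * (y - (+ 0 - a)))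
                    l₂ = solve-∀
                    odd-sum : OddZ (r + a)
                    odd-sum = odd-+ er oa
                    m-even : EvenZ (+ m)
                    m-even = go' (halve (+ 2 * a) (≈-trans (≈-reflexive (lem a)) 4a≈0))
                      where
                        lem : ∀ a → + 2 * (+ 2 * a) ≡ + 4 * a
                        lem = solve-∀
                        lem' : ∀ a m → + 2 * a + - (+ 2 * a - m) ≡ m
                        lem' = solve-∀
                        go' : _ → EvenZ (+ m)
                        go' (inj₁ z) = ⊥-elim (2a≉0 z)
                        go' (inj₂ z) = subst EvenZ (lem' a (+ m)) (even-+ (a , refl) (even-neg (even-≈ P even-n z)))
                    go : _ → ⊥
                    go (inj₁ u) = 2a≉0 (lin₃ (- + 1) (+ 1) (+ 1) (proj₂ (high (+ 0 + r))) u (proj₂ (low (+ 0))) (l₁ r a (w₀ (+ 0)) (w₁ (+ 0 + r))))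
                    go (inj₂ u) = done (halve (r + a) (lin₃ (- + 1) (+ 1) (+ 1) (proj₂ (high (+ 0 + r))) u (proj₂ (low (+ 0))) (l₂ r a (w₀ (+ 0)) (w₁ (+ 0 + r)))))
                      where
                        done : _ → ⊥
                        done (inj₁ z) = even≢odd (even-≈ P even-n z) (subst OddZ (lem (r + a)) odd-sum)
                          where lem : ∀ x → x ≡ x - + 0
                                lem = solve-∀
                        done (inj₂ z) = even≢odd (even-≈ P even-n z) (subst OddZ (ℤₚ.+-comm (- + m) (r + a)) (odd-+ (even-neg m-even) odd-sum))
              split : Dec (c ≈ + 0) → Dec ((+ 2 * a) ≈ + 0) → Commutes {G} σ ⊎ Exceptional n a r m
              split (yes p) (yes q) = inj₁ (swapping q (fix-all p h))
              split (yes p) (no q) = inj₁ (fixing-u q (fix-all p h))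
              split (no ¬p) _ = go (parity r)
                where go : _ → Commutes {G} σ ⊎ Exceptional n a r m
                      go (inj₁ er) = ⊥-elim (r-even ¬p er)
                      go (inj₂ or) = inj₂ (quartered-a (4a≈0 ¬p) (2a≉0 ¬p) oa or)

          -- The spokes confine 2x to two classes for every x, so n divides 4.
          mirrored : ∀ c → Along (λ x → c - x) → Exceptional n a r m
          mirrored c h = finish (two-of-three₁ n (c - + 2 * a) c vals)
            where
              w₀ = v₀ (λ x → c - x) h
              w₁ = v₁ (λ x → c - x) h
              low : ∀ x → (x ≈ w₀ x × (+ 2 * x) ≈ (c - + 2 * a)) ⊎ ((x - a) ≈ w₀ x × (+ 2 * x) ≈ c)
              low x = go (v₀-image (λ x → c - x) h x)
                where
                  l₁ : ∀ x c a y → + 2 * x - (c - + 2 * a) ≡ + 1 * (x - y) + (- + 1) * (c - (x + a) - (y + a))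
                  l₁ = solve-∀
                  l₂ : ∀ x c a y → + 2 * x - c ≡ + 1 * (x - (y + a)) + (- + 1) * (c - (x + a) - y)
                  l₂ = solve-∀
                  l₃ : ∀ x a y → x - a - y ≡ + 1 * (x - (y + a))
                  l₃ = solve-∀
                  go : _ → _
                  go (inj₁ (u , t)) = inj₁ (u , lin₂ (+ 1) (- + 1) u t (l₁ x c a (w₀ x)))
                  go (inj₂ (u , t)) = inj₂ (lin₁ (+ 1) u (l₃ x a (w₀ x)) , lin₂ (+ 1) (- + 1) u t (l₂ x c a (w₀ x)))
              high : ∀ x → (x ≈ w₁ x × c ≈ (+ 2 * x)) ⊎ ((x + a) ≈ w₁ x × c ≈ (+ 2 * x + + 2 * a))
              high x = go (v₁-image (λ x → c - x) h x)
                where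
                  l₁ : ∀ x c a y → c - + 2 * x ≡ + 1 * (c - x - y) + (- + 1) * (x + a - (y + a))
                  l₁ = solve-∀
                  l₂ : ∀ x c a y → c - (+ 2 * x + + 2 * a) ≡ + 1 * (c - x - (y + a)) + (- + 1) * (x + a - y)
                  l₂ = solve-∀
                  l₃ : ∀ x a y → x - y ≡ + 1 * (x + a - (y + a))
                  l₃ = solve-∀
                  go : _ → _
                  go (inj₁ (u , t)) = inj₁ (lin₁ (+ 1) t (l₃ x a (w₁ x)) , lin₂ (+ 1) (- + 1) u t (l₁ x c a (w₁ x)))
                  go (inj₂ (u , t)) = inj₂ (t , lin₂ (+ 1) (- + 1) u t (l₂ x c a (w₁ x)))
              vals : ∀ x → (+ 2 * x) ≈ (c - + 2 * a) ⊎ (+ 2 * x) ≈ c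
              vals x = Sum.map proj₂ proj₂ (low x)
              finish : (+ 2) ≈ + 0 ⊎ (+ 4) ≈ + 0 → Exceptional n a r m
              finish (inj₁ z) = ⊥-elim (2≉0 z)
              finish (inj₂ four) = order-4 four (twice-odd a oa) 2r≉0
                where
                  twice-odd : ∀ x → OddZ x → ¬ (+ 2 * x) ≈ + 0
                  twice-odd x (q , e) z = 2≉0 (lin₂ (+ 1) (- q) z four (trans (lem q) (cong (λ x → + 1 * (+ 2 * x - + 0) + (- q) * (+ 4 - + 0)) (sym e))))
                    where lem : ∀ q → + 2 - + 0 ≡ + 1 * (+ 2 * (+ 2 * q + + 1) - + 0) + (- q) * (+ 4 - + 0)
                          lem = solve-∀
                  2r≉0 : ¬ (+ 2 * r) ≈ + 0
                  2r≉0 2r≈0 = go (parity r)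
                    where
                      2a≉0 = twice-odd a oa
                      l₁ : ∀ c r a → + 2 * a - + 0 ≡ + 1 * (+ 2 * + 0 - (c - + 2 * a)) + (+ 1 * (c - + 2 * (+ 0 + r)) + + 1 * (+ 2 * r - + 0))
                      l₁ = solve-∀
                      l₂ : ∀ c r a → + 2 * a - + 0 ≡ (- + 1) * (+ 2 * + 0 - c) + ((- + 1) * (c - (+ 2 * (+ 0 + r) + + 2 * a)) + (- + 1) * (+ 2 * r - + 0))
                      l₂ = solve-∀
                      same : ∀ {y z} → z ≈ (y + r) ⊎ z ≈ (y - r) → z ≈ (y + r)
                      same (inj₁ u) = u
                      same {y} {z} (inj₂ u) = lin₂ (+ 1) (- + 1) u 2r≈0 (lem y z r)
                        where lem : ∀ y z r → z - (y + r) ≡ + 1 * (z - (y - r)) + (- + 1) * (+ 2 * r - + 0)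
                              lem = solve-∀
                      l₃ : ∀ r a y z → a - + 0 ≡ + 1 * (+ 0 + r + a - z) + (+ 1 * (z - (y + r)) + (- + 1) * (+ 0 - y))
                      l₃ = solve-∀
                      l₄ : ∀ r a y z → a - + 0 ≡ + 1 * (+ 0 + r - z) + (+ 1 * (z - (y + r)) + (- + 1) * (+ 0 - a - y))
                      l₄ = solve-∀
                      clash : EvenZ r → ⊥
                      clash er = go (low (+ 0)) (high (+ 0 + r)) (same {w₀ (+ 0)} {w₁ (+ 0 + r)} (hub⁺ (λ x → c - x) h er (+ 0)))
                        where
                          go : _ → _ → w₁ (+ 0 + r) ≈ (w₀ (+ 0) + r) → ⊥
                          go (inj₁ (y , k)) (inj₁ (z , l)) _ = 2a≉0 (lin₃ (+ 1) (+ 1) (+ 1) k l 2r≈0 (l₁ c r a))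
                          go (inj₂ (y , k)) (inj₂ (z , l)) _ = 2a≉0 (lin₃ (- + 1) (- + 1) (- + 1) k l 2r≈0 (l₂ c r a))
                          go (inj₁ (y , k)) (inj₂ (z , l)) u = a≉0 (lin₃ (+ 1) (+ 1) (- + 1) z u y (l₃ r a (w₀ (+ 0)) (w₁ (+ 0 + r))))
                          go (inj₂ (y , k)) (inj₁ (z , l)) u = a≉0 (lin₃ (+ 1) (+ 1) (- + 1) z u y (l₄ r a (w₀ (+ 0)) (w₁ (+ 0 + r))))
                      go : EvenZ r ⊎ OddZ r → ⊥
                      go (inj₁ er) = clash er
                      go (inj₂ or) = twice-odd r or 2r≈0

          case-odd : Commutes {G} σ ⊎ Exceptional n a r m
          case-odd = go other
            where
              go : (Σ ℤ λ c → Along (λ x → x + c) ⊎ Along (λ x → c - x)) → Commutes {G} σ ⊎ Exceptional n a r m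
              go (c , inj₁ h) = shifted c h
              go (c , inj₂ h) = inj₂ (mirrored c h)

-- Automorphisms that exchange the types of the vertices.

module TypeReversing where
  open RoseWindow
  open DoubleCover
  open SymbolicWalks using (Dir; fwd; bwd; near; far; target)
  open WalkCounting using (module Counting)
  open EdgeOrbits
  open RespectedMatchings using (par; half)
  open Parity
  open WalkConclusions using (module Residues)
  open ResidualParameters using (even-par; odd-par)
  open SpokeOrbit
  open TypePreserving

  module Reversing {G : Graph} {n : ℕ} {a r : ℤ} (P : Rose G n a r) (3≤n : 3 ℕ.≤ n) (a≉0 : ¬ Mod._≈_ n a (+ 0))
                   (conn : Connected G) (nb : ¬ Bipartite G) (net : ¬ EdgeTransitive (G ×K₂)) where
    open Spokes P 3≤n a≉0 conn nb net

    module Based (σ : Aut Cov) (rev₀ : app σ (C false (+ 0) false) ≡ C true (+ 0) false) (rev₁ : app σ (C false (+ 1) true) ≡ C true r true) where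
      open Residues n

      abstract
        swap-type : ∀ t x b → Σ ℤ λ y → app σ (C t x b) ≡ C (not t) y b
        swap-type t x b = go (uniform σ false (+ 0) false true (+ 0) false rev₀ t x b)
          where
            go : (Σ ℤ λ y → app σ (C t x b) ≡ C (t xor true) y (b xor false)) → Σ ℤ λ y → app σ (C t x b) ≡ C (not t) y b
            go (y , e) = y , trans e (cong₂ (λ t b → C t y b) (𝔹ₚ.xor-comm t true) (𝔹ₚ.xor-identityʳ b))

      abstract
        line₀ : ∀ x → app σ (C false x (bit x)) ≡ C true (r * x) (bit x)
        line₀ x = go (rail σ true false (swap-type false))
          where
            lem : ∀ e c r x → e * x + c - r * x ≡ (+ 1 - x) * (e * + 0 + c - + 0) + x * (e * + 1 + c - r)
            lem = solve-∀
            go : (Σ ℤ λ e → Σ ℤ λ c → (move true fwd (+ 0) ≡ e ⊎ move true bwd (+ 0) ≡ e) × (∀ x → app σ (C false x (bit x xor false)) ≡ C true (e * x + c) (bit x xor false))) → app σ (C false x (bit x)) ≡ C true (r * x) (bit x)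
            go (e , c , _ , h) = trans (sym (cong (λ l → app σ (C false x l)) (𝔹ₚ.xor-identityʳ (bit x)))) (trans (h x) (trans (C-cong
              (lin₂ (+ 1 - x) x (C-inj {b = false} {c = false} (trans (sym (h (+ 0))) rev₀)) (C-inj {b = true} {c = true} (trans (sym (h (+ 1))) rev₁)) (lem e c r x)))
              (cong (C true (r * x)) (𝔹ₚ.xor-identityʳ (bit x)))))

      -- For even x the vertex u_x on level `false` lies on the line through u_0, which σ maps
      -- injectively by x to rx.
      even-injective : ∀ x → EvenZ x → (r * x) ≈ + 0 → x ≈ + 0
      even-injective x ev p = C-inj (app-injective σ (trans (at (bit-even ev)) (trans (C-cong p) (sym rev₀))))
        where at : ∀ {l} → bit x ≡ l → app σ (C false x l) ≡ C true (r * x) l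
              at refl = line₀ x

      2r≉0 : ¬ (+ 2 * r) ≈ + 0
      2r≉0 p = 2≉0 (even-injective (+ 2) (+ 1 , refl) (≈-trans (≈-reflexive (ℤₚ.*-comm r (+ 2))) p))

      abstract
        spokes-at : ∀ x b {X Y} → app σ (C false x (not b)) ≡ C true X (not b) → app σ (C false (x + a) (not b)) ≡ C true Y (not b) →
          Σ ℤ λ y → app σ (C true x b) ≡ C false y b × ((X ≈ y × Y ≈ (y - a)) ⊎ (X ≈ (y - a) × Y ≈ y))
        spokes-at x b p q with swap-type true x b
        ... | y , e with spokes-image σ true x b false y b e
        ... | inj₁ (u , v) = y , e , inj₁ (C-inj (trans (sym p) u) , C-inj (trans (sym q) v))
        ... | inj₂ (u , v) = y , e , inj₂ (C-inj (trans (sym p) u) , C-inj (trans (sym q) v))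

      hub-step : ∀ x b d y z → isSpoke d ≡ false → app σ (C true x b) ≡ C false y b → app σ (N true x b d) ≡ C false z (not b) → z ≈ (y + + 1) ⊎ z ≈ (y - + 1)
      hub-step x b d y z s p q with rail-image σ true x b d false y b s p
      ... | inj₁ u = inj₁ (C-inj (trans (sym q) u))
      ... | inj₂ u = inj₂ (C-inj (trans (sym q) u))

      All-lines : Set
      All-lines = ∀ x b → app σ (C false x b) ≡ C true (r * x) b

      level-free : (∀ t x b → app σ (C t x (not b)) ≡ flip (app σ (C t x b))) → Commutes {G} σ
      level-free h p = trans (cong (app σ) (cong flip (sym (C-surj p)))) (trans (h (type p) (index p) (proj₂ p)) (cong (λ q → flip (app σ q)) (C-surj p)))

      module Uniform (h : All-lines) where

        v-at : ∀ x b → Σ ℤ λ y → app σ (C true x b) ≡ C false y b × (((r * x) ≈ y × (r * (x + a)) ≈ (y - a)) ⊎ ((r * x) ≈ (y - a) × (r * (x + a)) ≈ y))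
        v-at x b = spokes-at x b (h x (not b)) (h (x + a) (not b))

        -- The ends u_x and u_{x+a} of the spokes at v_x have the same images on both levels, so v_x
        -- has too, unless the two ends change roles between the levels; that would give 2a = 0.
        commutes : ¬ (+ 2 * a) ≈ + 0 → Commutes {G} σ
        commutes 2a≉0 = level-free result
          where
            clash : ∀ {x y y'} → (r * x) ≈ y → (r * (x + a)) ≈ (y - a) → (r * x) ≈ (y' - a) → (r * (x + a)) ≈ y' → ⊥
            clash {x} {y} {y'} p q p' q' = 2a≉0 (lin₂ (+ 1) (- + 1) (≈-trans (≈-sym p) p') (≈-trans (≈-sym q) q') (lem y y' a))
              where lem : ∀ y y' a → + 2 * a - + 0 ≡ + 1 * (y - (y' - a)) + (- + 1) * (y - a - y')
                    lem = solve-∀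
            result : ∀ t x b → app σ (C t x (not b)) ≡ flip (app σ (C t x b))
            result false x b = trans (h x (not b)) (cong flip (sym (h x b)))
            result true x b = go (v-at x b) (v-at x (not b))
              where
                go : _ → _ → app σ (C true x (not b)) ≡ flip (app σ (C true x b))
                go (y , e , inj₁ (p , _)) (y' , e' , inj₁ (p' , _)) = trans e' (trans (C-cong (≈-trans (≈-sym p') p)) (cong flip (sym e)))
                go (y , e , inj₂ (_ , q)) (y' , e' , inj₂ (_ , q')) = trans e' (trans (C-cong (≈-trans (≈-sym q') q)) (cong flip (sym e)))
                go (y , e , inj₁ (p , q)) (y' , e' , inj₂ (p' , q')) = ⊥-elim (clash p q p' q')
                go (y , e , inj₂ (p' , q')) (y' , e' , inj₁ (p , q)) = ⊥-elim (clash p q p' q')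

      odd-case : OddZ (+ n) → Commutes {G} σ
      odd-case odd = Uniform.commutes all (a≉0 ∘ Odd.halve odd a)
        where
          x+n : ∀ x → (x + + n) ≈ x
          x+n x = mk (subst D (lem x (+ n)) Dn)
            where lem : ∀ x n → n ≡ x + n - x
                  lem = solve-∀
          all : All-lines
          all x b with bit x 𝔹ₚ.≟ b
          ... | yes refl = line₀ x
          ... | no ne = trans (cong (app σ) (trans (C-cong (≈-sym (x+n x))) (cong (C false (x + + n)) lev)))
                              (trans (line₀ (x + + n)) (trans (cong (C true (r * (x + + n))) (sym lev)) (C-cong (*-cong≈ r (x+n x)))))
            where lev : b ≡ bit (x + + n)
                  lev = trans (≢⇒≡not ne) (sym (bit-odd+ x odd))

      module EvenOrder (m : ℕ) (n≡2m : n ≡ 2 ℕ.* m) where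
        open Even m n≡2m

        Along : (ℤ → ℤ) → Set
        Along X = ∀ x → app σ (C false x (not (bit x))) ≡ C true (X x) (not (bit x))

        other : Σ ℤ λ c → Along (λ x → r * x + c) ⊎ Along (λ x → c - r * x)
        other = go (rail σ true true (swap-type false))
          where
            go : (Σ ℤ λ e → Σ ℤ λ c → ((+ 0 + r) ≡ e ⊎ (+ 0 - r) ≡ e) × (∀ x → app σ (C false x (bit x xor true)) ≡ C true (e * x + c) (bit x xor true))) →
                 Σ ℤ λ c → Along (λ x → r * x + c) ⊎ Along (λ x → c - r * x)
            go (e , c , es , h) = c , Sum.map plus minus es
              where
                at : Along (λ x → e * x + c)
                at x = subst (λ l → app σ (C false x l) ≡ C true (e * x + c) l) (𝔹ₚ.xor-comm (bit x) true) (h x)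
                plus : + 0 + r ≡ e → Along (λ x → r * x + c)
                plus q x = trans (at x) (cong (λ z → C true z (not (bit x))) (trans (cong (λ e → e * x + c) (sym q)) (lem r x c)))
                  where lem : ∀ r x c → (+ 0 + r) * x + c ≡ r * x + c
                        lem = solve-∀
                minus : + 0 - r ≡ e → Along (λ x → c - r * x)
                minus q x = trans (at x) (cong (λ z → C true z (not (bit x))) (trans (cong (λ e → e * x + c) (sym q)) (lem r x c)))
                  where lem : ∀ r x c → (+ 0 - r) * x + c ≡ c - r * x
                        lem = solve-∀

        all-lines : ∀ {c} → c ≈ + 0 → Along (λ x → r * x + c) → All-lines
        all-lines {c} p h x b with bit x 𝔹ₚ.≟ b
        ... | yes refl = line₀ x
        ... | no ne = subst (λ l → app σ (C false x l) ≡ C true (r * x) l) (sym (≢⇒≡not ne)) (trans (h x) (C-cong (lin₁ (+ 1) p (lem r x c))))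
          where lem : ∀ r x c → r * x + c - r * x ≡ + 1 * (c - + 0)
                lem = solve-∀

        order-4-of : (+ 4 * r) ≈ + 0 → (+ 4) ≈ + 0
        order-4-of p = even-injective (+ 4) (+ 2 , refl) (≈-trans (≈-reflexive (ℤₚ.*-comm r (+ 4))) p)

        even-r⇒4≉0 : EvenZ r → ¬ (+ 4) ≈ + 0
        even-r⇒4≉0 (q , e) z = 2r≉0 (lin₁ q z (trans (cong (λ r → + 2 * r - + 0) e) (lem q)))
          where lem : ∀ q → + 2 * (+ 2 * q) - + 0 ≡ q * (+ 4 - + 0)
                lem = solve-∀

        -- If m and r were even, rm would be a multiple of 2m, hence 0, and `even-injective` would
        -- give m = 0.
        even-r⇒odd-m : EvenZ r → OddZ (+ m)
        even-r⇒odd-m (q , e) = go (parity (+ m))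
          where
            lem : ∀ q m → + 2 * q * m - + 0 ≡ q * (+ 2 * m - + 0)
            lem = solve-∀
            go : EvenZ (+ m) ⊎ OddZ (+ m) → OddZ (+ m)
            go (inj₂ o) = o
            go (inj₁ ev) = ⊥-elim (m≉0 3≤n (even-injective (+ m) ev (lin₁ q 2m≈0 (trans (cong (λ r → r * + m - + 0) e) (lem q (+ m))))))

        odd-residue : ∀ {x y} → OddZ x → x ≈ y → OddZ y
        odd-residue {x} {y} o p = subst OddZ (lem x y) (odd-+ (even-neg (even-≈ P even-n p)) o)
          where lem : ∀ x y → - (x - y) + x ≡ y
                lem = solve-∀

        even-residue : ∀ {x y} → EvenZ x → x ≈ y → EvenZ y
        even-residue {x} {y} o p = subst EvenZ (lem x y) (even-+ (even-neg (even-≈ P even-n p)) o)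
          where lem : ∀ x y → - (x - y) + x ≡ y
                lem = solve-∀

        even-a⇒2a≉0 : EvenZ a → EvenZ r → ¬ (+ 2 * a) ≈ + 0
        even-a⇒2a≉0 ea er z = go (halve a z)
          where
            go : a ≈ + 0 ⊎ a ≈ + m → ⊥
            go (inj₁ y) = a≉0 y
            go (inj₂ y) = even≢odd (even-residue ea y) (even-r⇒odd-m er)

        m*even : ∀ {x} → EvenZ x → (+ m * x) ≈ + 0
        m*even {x} (q , e) = lin₁ q 2m≈0 (trans (cong (λ x → + m * x - + 0) e) (lem (+ m) q))
          where lem : ∀ m q → m * (+ 2 * q) - + 0 ≡ q * (+ 2 * m - + 0)
                lem = solve-∀

        m*odd : ∀ {x} → OddZ x → (+ m * x) ≈ + m
        m*odd {x} (q , e) = lin₁ q 2m≈0 (trans (cong (λ x → + m * x - + m) e) (lem (+ m) q))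
          where lem : ∀ m q → m * (+ 2 * q + + 1) - m ≡ q * (+ 2 * m - + 0)
                lem = solve-∀

        -- The number m - r is the s of W9, up to sign. Its square is ±1, because the mixed term 2mr
        -- vanishes. The value -1 is impossible: from (m - r)a = ±a one gets (m - r)²a = a, hence 2a
        -- = 0.
        from-involution : ∀ {u} → (+ m * + m) ≈ u → (r * r + u) ≈ + 1 ⊎ (r * r + u) ≈ (- + 1) → ((+ m - r) * a) ≈ a ⊎ ((+ m - r) * a) ≈ (- a) → ¬ (+ 2 * a) ≈ + 0 → Exceptional n a r m
        from-involution {u} mm sq sa 2a≉0 = go sq
          where
            l₁ : ∀ r m u w → (m - r) * (m - r) - w ≡ + 1 * (m * m - u) + (+ 1 * (r * r + u - w) + (- r) * (+ 2 * m - + 0))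
            l₁ = solve-∀
            square-of : ∀ {w} → (r * r + u) ≈ w → ((+ m - r) * (+ m - r)) ≈ w
            square-of {w} p = lin₃ (+ 1) (+ 1) (- r) mm p 2m≈0 (l₁ r (+ m) u w)
            contra : ((+ m - r) * (+ m - r)) ≈ (- + 1) → ((+ m - r) * a) ≈ a ⊎ ((+ m - r) * a) ≈ (- a) → ⊥
            contra p (inj₁ q) = 2a≉0 (lin₂ (a) (- (+ m - r + + 1)) p q (k₁ (+ m - r) a))
              where k₁ : ∀ s a → + 2 * a - + 0 ≡ a * (s * s - (- + 1)) + (- (s + + 1)) * (s * a - a)
                    k₁ = solve-∀
            contra p (inj₂ q) = 2a≉0 (lin₂ (a) (+ 1 - (+ m - r)) p q (k₂ (+ m - r) a))
              where k₂ : ∀ s a → + 2 * a - + 0 ≡ a * (s * s - (- + 1)) + (+ 1 - s) * (s * a - (- a))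
                    k₂ = solve-∀
            go : _ → Exceptional n a r m
            go (inj₁ p) = involution (square-of p) sa 2a≉0
            go (inj₂ p) = ⊥-elim (contra (square-of p) sa)

        module BothEven (ea : EvenZ a) (er : EvenZ r) where

          private
            2a≉0 : ¬ (+ 2 * a) ≈ + 0
            2a≉0 = even-a⇒2a≉0 ea er
            on₀ : ∀ y {l} → l ≡ bit y → app σ (C false y l) ≡ C true (r * y) l
            on₀ y refl = line₀ y

          at₀ : ∀ x → Σ ℤ λ y → app σ (C true x (not (bit x))) ≡ C false y (not (bit x)) × (((r * x) ≈ y × (r * (x + a)) ≈ (y - a)) ⊎ ((r * x) ≈ (y - a) × (r * (x + a)) ≈ y))
          at₀ x = spokes-at x (not (bit x)) (on₀ x (𝔹ₚ.not-involutive (bit x))) (on₀ (x + a) (trans (𝔹ₚ.not-involutive (bit x)) (sym (bit-even+ x ea))))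

          v₀ : ℤ → ℤ
          v₀ x = proj₁ (at₀ x)

          v₀-image : ∀ x → ((r * x) ≈ v₀ x × (r * (x + a)) ≈ (v₀ x - a)) ⊎ ((r * x) ≈ (v₀ x - a) × (r * (x + a)) ≈ v₀ x)
          v₀-image x = proj₂ (proj₂ (at₀ x))

          -- Comparing the two spokes at one v gives ra = -a or ra = a. Since 2a is nonzero these
          -- exclude each other, so the same alternative holds at all the v's.
          shape : (((r * a) ≈ (- a)) × ∀ x → v₀ x ≈ (r * x)) ⊎ ((r * a) ≈ a × ∀ x → v₀ x ≈ (r * x + a))
          shape = go (v₀-image (+ 0))
            where
              l₁ : ∀ r x y a → r * a - (- a) ≡ (- + 1) * (r * x - y) + + 1 * (r * (x + a) - (y - a))
              l₁ = solve-∀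
              l₂ : ∀ r x y a → r * a - a ≡ (- + 1) * (r * x - (y - a)) + + 1 * (r * (x + a) - y)
              l₂ = solve-∀
              l₃ : ∀ r x y a → y - (r * x + a) ≡ (- + 1) * (r * x - (y - a))
              l₃ = solve-∀
              Sh : ℤ → Set
              Sh x = ((r * x) ≈ v₀ x × (r * (x + a)) ≈ (v₀ x - a)) ⊎ ((r * x) ≈ (v₀ x - a) × (r * (x + a)) ≈ v₀ x)
              minus : ∀ x → (r * x) ≈ v₀ x → (r * (x + a)) ≈ (v₀ x - a) → (r * a) ≈ (- a)
              minus x p q = lin₂ (- + 1) (+ 1) p q (l₁ r x (v₀ x) a)
              plus : ∀ x → (r * x) ≈ (v₀ x - a) → (r * (x + a)) ≈ v₀ x → (r * a) ≈ a
              plus x p q = lin₂ (- + 1) (+ 1) p q (l₂ r x (v₀ x) a)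
              clash : (r * a) ≈ (- a) → (r * a) ≈ a → ⊥
              clash p q = 2a≉0 (lin₂ (+ 1) (- + 1) p q (lem (r * a) a))
                where lem : ∀ w a → + 2 * a - + 0 ≡ + 1 * (w - (- a)) + (- + 1) * (w - a)
                      lem = solve-∀
              go : Sh (+ 0) → _
              go (inj₁ (p , q)) = inj₁ (minus (+ 0) p q , λ x → all x (v₀-image x))
                where all : ∀ x → Sh x → v₀ x ≈ (r * x)
                      all x (inj₁ (p' , _)) = ≈-sym p'
                      all x (inj₂ (p' , q')) = ⊥-elim (clash (minus (+ 0) p q) (plus x p' q'))
              go (inj₂ (p , q)) = inj₂ (plus (+ 0) p q , λ x → all x (v₀-image x))
                where all : ∀ x → Sh x → v₀ x ≈ (r * x + a)
                      all x (inj₂ (p' , _)) = lin₁ (- + 1) p' (l₃ r x (v₀ x) a)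
                      all x (inj₁ (p' , q')) = ⊥-elim (clash (minus x p' q') (plus (+ 0) p q))

          module _ (X : ℤ → ℤ) (h : Along X) where

            at₁ : ∀ x → Σ ℤ λ y → app σ (C true x (bit x)) ≡ C false y (bit x) × ((X x ≈ y × X (x + a) ≈ (y - a)) ⊎ (X x ≈ (y - a) × X (x + a) ≈ y))
            at₁ x = spokes-at x (bit x) (h x) (at (cong not (sym (bit-even+ x ea))))
              where at : ∀ {l} → l ≡ not (bit (x + a)) → app σ (C false (x + a) l) ≡ C true (X (x + a)) l
                    at refl = h (x + a)

            v₁ : ℤ → ℤ
            v₁ x = proj₁ (at₁ x)

            v₁-image : ∀ x → (X x ≈ v₁ x × X (x + a) ≈ (v₁ x - a)) ⊎ (X x ≈ (v₁ x - a) × X (x + a) ≈ v₁ x)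
            v₁-image x = proj₂ (proj₂ (at₁ x))

            private
              lev : ∀ x {y} → EvenZ (y - x) → bit y ≡ not (not (bit x))
              lev x ev = trans (bit-same ev) (sym (𝔹ₚ.not-involutive (bit x)))
              at : ∀ y {l} → bit y ≡ l → app σ (C true y l) ≡ C false (v₁ y) l
              at y refl = proj₁ (proj₂ (at₁ y))
              ev₁ : ∀ x → EvenZ (x + r - x)
              ev₁ x = subst EvenZ (lem x r) er
                where lem : ∀ x r → r ≡ x + r - x
                      lem = solve-∀
              ev₂ : ∀ x → EvenZ (x - r - x)
              ev₂ x = subst EvenZ (lem x r) (even-neg er)
                where lem : ∀ x r → - r ≡ x - r - x
                      lem = solve-∀

            hub⁺ : ∀ x → v₁ (x + r) ≈ (v₀ x + + 1) ⊎ v₁ (x + r) ≈ (v₀ x - + 1)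
            hub⁺ x = hub-step x (not (bit x)) fwd (v₀ x) (v₁ (x + r)) refl (proj₁ (proj₂ (at₀ x))) (at (x + r) (lev x (ev₁ x)))

            hub⁻ : ∀ x → v₁ (x - r) ≈ (v₀ x + + 1) ⊎ v₁ (x - r) ≈ (v₀ x - + 1)
            hub⁻ x = hub-step x (not (bit x)) bwd (v₀ x) (v₁ (x - r)) refl (proj₁ (proj₂ (at₀ x))) (at (x - r) (lev x (ev₂ x)))

          -- The hub edges confine 2rx to two classes, so 2r = 0 or 4r = 0. The former is excluded;
          -- the latter gives 4 = 0, excluded for even r.
          mirrored : ∀ c → ¬ Along (λ x → c - r * x)
          mirrored c h = finish shape
            where
              X : ℤ → ℤ
              X x = c - r * x
              w = v₁ X h
              lx : ∀ c r x a y → r * a - (- a) ≡ + 1 * (c - r * x - (y - a)) + (- + 1) * (c - r * (x + a) - y)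
              lx = solve-∀
              ly : ∀ c r x a y → r * a - a ≡ + 1 * (c - r * x - y) + (- + 1) * (c - r * (x + a) - (y - a))
              ly = solve-∀
              clash : (r * a) ≈ (- a) → (r * a) ≈ a → ⊥
              clash p q = 2a≉0 (lin₂ (+ 1) (- + 1) p q (lem (r * a) a))
                where lem : ∀ w a → + 2 * a - + 0 ≡ + 1 * (w - (- a)) + (- + 1) * (w - a)
                      lem = solve-∀
              done : ∀ u v → (∀ x → (+ 2 * (r * x)) ≈ u ⊎ (+ 2 * (r * x)) ≈ v) → ⊥
              done u v vals = go (two-of-three n r u v vals)
                where go : _ → ⊥
                      go (inj₁ z) = 2r≉0 z
                      go (inj₂ z) = even-r⇒4≉0 er (order-4-of z)
              finish : _ → ⊥
              finish (inj₁ (ra , v≈)) = done (c - r * r + a - + 1) (c - r * r + a + + 1) vals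
                where
                  w≈ : ∀ x → (X x + a) ≈ w x
                  w≈ x = go (v₁-image X h x)
                    where
                      lem : ∀ z a y → z + a - y ≡ + 1 * (z - (y - a))
                      lem = solve-∀
                      go : _ → (X x + a) ≈ w x
                      go (inj₁ (p , q)) = ⊥-elim (clash ra (lin₂ (+ 1) (- + 1) p q (ly c r x a (w x))))
                      go (inj₂ (p , q)) = lin₁ (+ 1) p (lem (X x) a (w x))
                  k : ∀ c r x a y z e → + 2 * (r * x) - (c - r * r + a - e) ≡ (- + 1) * (c - r * (x + r) + a - z) + ((- + 1) * (z - (y + e)) + (- + 1) * (y - r * x))
                  k = solve-∀
                  k' : ∀ c r x a y z e → + 2 * (r * x) - (c - r * r + a + e) ≡ (- + 1) * (c - r * (x + r) + a - z) + ((- + 1) * (z - (y - e)) + (- + 1) * (y - r * x))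
                  k' = solve-∀
                  vals : ∀ x → (+ 2 * (r * x)) ≈ (c - r * r + a - + 1) ⊎ (+ 2 * (r * x)) ≈ (c - r * r + a + + 1)
                  vals x = Sum.map (λ u → lin₃ (- + 1) (- + 1) (- + 1) (w≈ (x + r)) u (v≈ x) (k c r x a (v₀ x) (w (x + r)) (+ 1)))
                                   (λ u → lin₃ (- + 1) (- + 1) (- + 1) (w≈ (x + r)) u (v≈ x) (k' c r x a (v₀ x) (w (x + r)) (+ 1))) (hub⁺ X h x)
              finish (inj₂ (ra , v≈)) = done (c - r * r - a - + 1) (c - r * r - a + + 1) vals
                where
                  w≈ : ∀ x → X x ≈ w x
                  w≈ x = go (v₁-image X h x)
                    where
                      go : _ → X x ≈ w x
                      go (inj₂ (p , q)) = ⊥-elim (clash (lin₂ (+ 1) (- + 1) p q (lx c r x a (w x))) ra)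
                      go (inj₁ (p , q)) = p
                  k : ∀ c r x a y z e → + 2 * (r * x) - (c - r * r - a - e) ≡ (- + 1) * (c - r * (x + r) - z) + ((- + 1) * (z - (y + e)) + (- + 1) * (y - (r * x + a)))
                  k = solve-∀
                  k' : ∀ c r x a y z e → + 2 * (r * x) - (c - r * r - a + e) ≡ (- + 1) * (c - r * (x + r) - z) + ((- + 1) * (z - (y - e)) + (- + 1) * (y - (r * x + a)))
                  k' = solve-∀
                  vals : ∀ x → (+ 2 * (r * x)) ≈ (c - r * r - a - + 1) ⊎ (+ 2 * (r * x)) ≈ (c - r * r - a + + 1)
                  vals x = Sum.map (λ u → lin₃ (- + 1) (- + 1) (- + 1) (w≈ (x + r)) u (v≈ x) (k c r x a (v₀ x) (w (x + r)) (+ 1)))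
                                   (λ u → lin₃ (- + 1) (- + 1) (- + 1) (w≈ (x + r)) u (v≈ x) (k' c r x a (v₀ x) (w (x + r)) (+ 1))) (hub⁺ X h x)

          -- The hub edges from v_0 give r² + c = ±1 and -r² + c = ±1. Equal signs yield 2r² = 0,
          -- hence 2r = 0 by injectivity. Opposite signs yield 2c = 0, and c = 0 fails because r² is
          -- even; so c = m, which is m² since m is odd, and (m - r)² = ±1.
          shifted : ∀ c → Along (λ x → r * x + c) → Exceptional n a r m
          shifted c h = split up down
            where
              X : ℤ → ℤ
              X x = r * x + c
              w = v₁ X h
              lx : ∀ c r x a y → r * a - a ≡ (- + 1) * (r * x + c - (y - a)) + + 1 * (r * (x + a) + c - y)
              lx = solve-∀
              ly : ∀ c r x a y → r * a - (- a) ≡ (- + 1) * (r * x + c - y) + + 1 * (r * (x + a) + c - (y - a))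
              ly = solve-∀
              clash : (r * a) ≈ (- a) → (r * a) ≈ a → ⊥
              clash p q = 2a≉0 (lin₂ (+ 1) (- + 1) p q (lem (r * a) a))
                where lem : ∀ w a → + 2 * a - + 0 ≡ + 1 * (w - (- a)) + (- + 1) * (w - a)
                      lem = solve-∀
              same-shift : ∀ x y → (w x - v₀ y) ≈ (r * x + c - r * y)
              same-shift x y = go shape (v₁-image X h x)
                where
                  l₁ : ∀ r x c y w v → w - v - (r * x + c - r * y) ≡ (- + 1) * (r * x + c - w) + (- + 1) * (v - r * y)
                  l₁ = solve-∀
                  l₂ : ∀ r x c y w v a → w - v - (r * x + c - r * y) ≡ (- + 1) * (r * x + c - (w - a)) + (- + 1) * (v - (r * y + a))
                  l₂ = solve-∀
                  go : _ → _ → (w x - v₀ y) ≈ (r * x + c - r * y)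
                  go (inj₁ (ra , v≈)) (inj₁ (p , q)) = lin₂ (- + 1) (- + 1) p (v≈ y) (l₁ r x c y (w x) (v₀ y))
                  go (inj₂ (ra , v≈)) (inj₂ (p , q)) = lin₂ (- + 1) (- + 1) p (v≈ y) (l₂ r x c y (w x) (v₀ y) a)
                  go (inj₁ (ra , v≈)) (inj₂ (p , q)) = ⊥-elim (clash ra (lin₂ (- + 1) (+ 1) p q (lx c r x a (w x))))
                  go (inj₂ (ra , v≈)) (inj₁ (p , q)) = ⊥-elim (clash (lin₂ (- + 1) (+ 1) p q (ly c r x a (w x))) ra)
              up : (r * r + c) ≈ + 1 ⊎ (r * r + c) ≈ (- + 1)
              up = Sum.map (λ u → lin₂ (- + 1) (+ 1) (same-shift (+ 0 + r) (+ 0)) u (l r c (w (+ 0 + r)) (v₀ (+ 0)) (+ 1)))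
                           (λ u → lin₂ (- + 1) (+ 1) (same-shift (+ 0 + r) (+ 0)) u (l' r c (w (+ 0 + r)) (v₀ (+ 0)) (+ 1))) (hub⁺ X h (+ 0))
                where
                  l : ∀ r c w v e → r * r + c - e ≡ (- + 1) * (w - v - (r * (+ 0 + r) + c - r * + 0)) + + 1 * (w - (v + e))
                  l = solve-∀
                  l' : ∀ r c w v e → r * r + c - (- e) ≡ (- + 1) * (w - v - (r * (+ 0 + r) + c - r * + 0)) + + 1 * (w - (v - e))
                  l' = solve-∀
              down : (- (r * r) + c) ≈ + 1 ⊎ (- (r * r) + c) ≈ (- + 1)
              down = Sum.map (λ u → lin₂ (- + 1) (+ 1) (same-shift (+ 0 - r) (+ 0)) u (l r c (w (+ 0 - r)) (v₀ (+ 0)) (+ 1)))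
                             (λ u → lin₂ (- + 1) (+ 1) (same-shift (+ 0 - r) (+ 0)) u (l' r c (w (+ 0 - r)) (v₀ (+ 0)) (+ 1))) (hub⁻ X h (+ 0))
                where
                  l : ∀ r c w v e → - (r * r) + c - e ≡ (- + 1) * (w - v - (r * (+ 0 - r) + c - r * + 0)) + + 1 * (w - (v + e))
                  l = solve-∀
                  l' : ∀ r c w v e → - (r * r) + c - (- e) ≡ (- + 1) * (w - v - (r * (+ 0 - r) + c - r * + 0)) + + 1 * (w - (v - e))
                  l' = solve-∀
              same-sign : ∀ {e} → (r * r + c) ≈ e → (- (r * r) + c) ≈ e → ⊥
              same-sign {e} p q = 2r≉0 (even-injective (+ 2 * r) (r , refl) (lin₂ (+ 1) (- + 1) p q (lem r c e)))
                where lem : ∀ r c e → r * (+ 2 * r) - + 0 ≡ + 1 * (r * r + c - e) + (- + 1) * (- (r * r) + c - e)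
                      lem = solve-∀
              2c : ∀ {e e'} → e + e' ≡ + 0 → (r * r + c) ≈ e → (- (r * r) + c) ≈ e' → (+ 2 * c) ≈ + 0
              2c {e} {e'} z p q = lin₂ (+ 1) (+ 1) p q (trans (cong (_-_ (+ 2 * c)) (sym z)) (lem r c e e'))
                where lem : ∀ r c e e' → + 2 * c - (e + e') ≡ + 1 * (r * r + c - e) + + 1 * (- (r * r) + c - e')
                      lem = solve-∀
              odd-not-zero : ∀ {e} → OddZ e → (r * r + c) ≈ e → ¬ c ≈ + 0
              odd-not-zero {e} oe p z = even≢odd (even-residue (even-* r er) (lin₂ (+ 1) (- + 1) p z (lem r c e))) oe
                where lem : ∀ r c e → r * r - e ≡ + 1 * (r * r + c - e) + (- + 1) * (c - + 0)
                      lem = solve-∀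
              sa : ((+ m - r) * a) ≈ a ⊎ ((+ m - r) * a) ≈ (- a)
              sa = go shape
                where
                  l₁ : ∀ m r a → (m - r) * a - a ≡ + 1 * (m * a - + 0) + (- + 1) * (r * a - (- a))
                  l₁ = solve-∀
                  l₂ : ∀ m r a → (m - r) * a - (- a) ≡ + 1 * (m * a - + 0) + (- + 1) * (r * a - a)
                  l₂ = solve-∀
                  go : _ → _
                  go (inj₁ (ra , _)) = inj₁ (lin₂ (+ 1) (- + 1) (m*even ea) ra (l₁ (+ m) r a))
                  go (inj₂ (ra , _)) = inj₂ (lin₂ (+ 1) (- + 1) (m*even ea) ra (l₂ (+ m) r a))
              opposite : ∀ {e e'} → OddZ e → e + e' ≡ + 0 → (r * r + c) ≈ e → (- (r * r) + c) ≈ e' → Exceptional n a r m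
              opposite {e} oe z p q = go (halve c (2c z p q))
                where
                  go : c ≈ + 0 ⊎ c ≈ + m → Exceptional n a r m
                  go (inj₁ y) = ⊥-elim (odd-not-zero oe p y)
                  go (inj₂ y) = from-involution {u = + m} (m*odd (even-r⇒odd-m er)) (Sum.map conv conv up) sa 2a≉0
                    where
                      lem : ∀ r c m e → r * r + m - e ≡ + 1 * (r * r + c - e) + (- + 1) * (c - m)
                      lem = solve-∀
                      conv : ∀ {e} → (r * r + c) ≈ e → (r * r + + m) ≈ e
                      conv {e} p = lin₂ (+ 1) (- + 1) p y (lem r c (+ m) e)
              split : _ → _ → Exceptional n a r m
              split (inj₁ p) (inj₁ q) = ⊥-elim (same-sign p q)
              split (inj₂ p) (inj₂ q) = ⊥-elim (same-sign p q)
              split (inj₁ p) (inj₂ q) = opposite (+ 0 , refl) refl p q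
              split (inj₂ p) (inj₁ q) = opposite (- + 1 , refl) refl p q

          case-even : Exceptional n a r m
          case-even = go other
            where
              go : (Σ ℤ λ c → Along (λ x → r * x + c) ⊎ Along (λ x → c - r * x)) → Exceptional n a r m
              go (c , inj₁ h) = shifted c h
              go (c , inj₂ h) = ⊥-elim (mirrored c h)

        module OddA (oa : OddZ a) where

          private
            bit+a : ∀ x → bit (x + a) ≡ not (bit x)
            bit+a x = bit-odd+ x oa
            on₀ : ∀ y {l} → l ≡ bit y → app σ (C false y l) ≡ C true (r * y) l
            on₀ y refl = line₀ y

          no-cycle : ∀ {x} → ¬ x ≈ (x + a)
          no-cycle {x} p = a≉0 (lin₁ (- + 1) p (lem x a))
            where lem : ∀ x a → a - + 0 ≡ (- + 1) * (x - (x + a))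
                  lem = solve-∀

          module _ (X : ℤ → ℤ) (h : Along X) where

            private
              on₁ : ∀ y {l} → l ≡ not (bit y) → app σ (C false y l) ≡ C true (X y) l
              on₁ y refl = h y

            at₀ : ∀ x → Σ ℤ λ y → app σ (C true x (not (bit x))) ≡ C false y (not (bit x)) × (((r * x) ≈ y × X (x + a) ≈ (y - a)) ⊎ ((r * x) ≈ (y - a) × X (x + a) ≈ y))
            at₀ x = spokes-at x (not (bit x)) (on₀ x (𝔹ₚ.not-involutive (bit x))) (on₁ (x + a) (cong not (sym (bit+a x))))

            at₁ : ∀ x → Σ ℤ λ y → app σ (C true x (bit x)) ≡ C false y (bit x) × ((X x ≈ y × (r * (x + a)) ≈ (y - a)) ⊎ (X x ≈ (y - a) × (r * (x + a)) ≈ y))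
            at₁ x = spokes-at x (bit x) (on₁ x refl) (on₀ (x + a) (sym (bit+a x)))

            v₀ v₁ : ℤ → ℤ
            v₀ x = proj₁ (at₀ x)
            v₁ x = proj₁ (at₁ x)

            v₀-image : ∀ x → ((r * x) ≈ v₀ x × X (x + a) ≈ (v₀ x - a)) ⊎ ((r * x) ≈ (v₀ x - a) × X (x + a) ≈ v₀ x)
            v₀-image x = proj₂ (proj₂ (at₀ x))

            v₁-image : ∀ x → (X x ≈ v₁ x × (r * (x + a)) ≈ (v₁ x - a)) ⊎ (X x ≈ (v₁ x - a) × (r * (x + a)) ≈ v₁ x)
            v₁-image x = proj₂ (proj₂ (at₁ x))

            hub₁ : EvenZ r → ∀ x → v₁ (x + r) ≈ (v₀ x + + 1) ⊎ v₁ (x + r) ≈ (v₀ x - + 1)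
            hub₁ er x = hub-step x (not (bit x)) fwd (v₀ x) (v₁ (x + r)) refl (proj₁ (proj₂ (at₀ x)))
                (at (x + r) (trans (bit-even+ x er) (sym (𝔹ₚ.not-involutive (bit x)))))
              where at : ∀ y {l} → bit y ≡ l → app σ (C true y l) ≡ C false (v₁ y) l
                    at y refl = proj₁ (proj₂ (at₁ y))

            hub₀ : OddZ r → ∀ x → v₀ (x + r) ≈ (v₀ x + + 1) ⊎ v₀ (x + r) ≈ (v₀ x - + 1)
            hub₀ or x = hub-step x (not (bit x)) fwd (v₀ x) (v₀ (x + r)) refl (proj₁ (proj₂ (at₀ x))) (at (x + r) (cong not (bit-odd+ x or)))
              where at : ∀ y {l} → not (bit y) ≡ l → app σ (C true y l) ≡ C false (v₀ y) l
                    at y refl = proj₁ (proj₂ (at₀ y))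

          mirrored : ∀ c → Along (λ x → c - r * x) → Exceptional n a r m
          mirrored c h = go (two-of-three n r (c - r * a + a) (c - r * a - a) vals)
            where
              X : ℤ → ℤ
              X x = c - r * x
              l₁ : ∀ x c r a y → + 2 * (r * x) - (c - r * a + a) ≡ + 1 * (r * x - y) + (- + 1) * (c - r * (x + a) - (y - a))
              l₁ = solve-∀
              l₂ : ∀ x c r a y → + 2 * (r * x) - (c - r * a - a) ≡ + 1 * (r * x - (y - a)) + (- + 1) * (c - r * (x + a) - y)
              l₂ = solve-∀
              vals : ∀ x → (+ 2 * (r * x)) ≈ (c - r * a + a) ⊎ (+ 2 * (r * x)) ≈ (c - r * a - a)
              vals x = Sum.map (λ { (p , q) → lin₂ (+ 1) (- + 1) p q (l₁ x c r a (v₀ X h x)) })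
                               (λ { (p , q) → lin₂ (+ 1) (- + 1) p q (l₂ x c r a (v₀ X h x)) }) (v₀-image X h x)
              twice-odd : (+ 4) ≈ + 0 → OddZ a → ¬ (+ 2 * a) ≈ + 0
              twice-odd four (q , e) z = 2≉0 (lin₂ (+ 1) (- q) z four (trans (lem q) (cong (λ x → + 1 * (+ 2 * x - + 0) + (- q) * (+ 4 - + 0)) (sym e))))
                where lem : ∀ q → + 2 - + 0 ≡ + 1 * (+ 2 * (+ 2 * q + + 1) - + 0) + (- q) * (+ 4 - + 0)
                      lem = solve-∀
              go : _ → Exceptional n a r m
              go (inj₁ z) = ⊥-elim (2r≉0 z)
              go (inj₂ z) = order-4 (order-4-of z) (twice-odd (order-4-of z) oa) 2r≉0

          -- Every u_x goes to v_{rx}; for r odd the hub edges propagate the choice made at one v along both levels.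
          swapping : OddZ r → a ≈ + m → All-lines → Commutes {G} σ
          swapping or a≈m h = level-free result
            where
              om : OddZ (+ m)
              om = odd-residue oa a≈m
              par-m : par m ≡ true
              par-m = go (par m) refl
                where go : ∀ b → par m ≡ b → par m ≡ true
                      go true e = e
                      go false e = ⊥-elim (even≢odd (+ half m , even-par m e) om)
              stays : ∀ x b → app σ (C true x b) ≡ C false (r * x) b ⊎ app σ (C true x b) ≡ C false (r * (x + a)) b
              stays x b = go (Uniform.v-at h x b)
                where
                  go : _ → app σ (C true x b) ≡ C false (r * x) b ⊎ app σ (C true x b) ≡ C false (r * (x + a)) b
                  go (y , e , inj₁ (p , _)) = inj₁ (trans e (C-cong (≈-sym p)))
                  go (y , e , inj₂ (_ , q)) = inj₂ (trans e (C-cong (≈-sym q)))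
              separated : ∀ {x} → ¬ (r * x) ≈ (r * (x + a))
              separated {x} p = no-cycle (C-inj (app-injective σ (trans (h x false) (trans (C-cong p) (sym (h (x + a) false))))))
              Fixed : ℤ → Bool → Set
              Fixed x b = app σ (C true x b) ≡ C false (r * x) b
              next : ∀ x b → Fixed x b → Fixed (x + r) (not b)
              next x b f = go (stays (x + r) (not b))
                where
                  lem : ∀ r x a e → r * (r + a) - e ≡ + 1 * (r * (x + r + a) - (r * x + e))
                  lem = solve-∀
                  lem' : ∀ r x a e → r * (r + a) - (- e) ≡ + 1 * (r * (x + r + a) - (r * x - e))
                  lem' = solve-∀
                  even-rra : EvenZ (r * (r + a))
                  even-rra = even-* r (odd-+-odd or oa)
                  clash : (r * (x + r + a)) ≈ (r * x + + 1) ⊎ (r * (x + r + a)) ≈ (r * x - + 1) → ⊥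
                  clash (inj₁ u) = even≢odd (even-residue even-rra (lin₁ (+ 1) u (lem r x a (+ 1)))) (+ 0 , refl)
                  clash (inj₂ u) = even≢odd (even-residue even-rra (lin₁ (+ 1) u (lem' r x a (+ 1)))) (- + 1 , refl)
                  go : _ → Fixed (x + r) (not b)
                  go (inj₁ e) = e
                  go (inj₂ e) = ⊥-elim (clash (hub-step x b fwd (r * x) (r * (x + r + a)) refl f e))
              iterate : ∀ k x b → Fixed x b → Fixed (x + + k * r) (b xor par k)
              iterate zero x b f = subst₂ Fixed (lem x r) (sym (𝔹ₚ.xor-identityʳ b)) f
                where lem : ∀ x r → x ≡ x + + 0 * r
                      lem = solve-∀
              iterate (suc k) x b f = subst₂ Fixed (trans (lem x (+ k) r) (cong (λ z → x + z * r) (trans (sym (ℤₚ.pos-+ k 1)) (cong +_ (ℕₚ.+-comm k 1))))) (𝔹ₚ.not-distribʳ-xor b (par k)) (next (x + + k * r) (b xor par k) (iterate k x b f))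
                where lem : ∀ x k r → x + k * r + r ≡ x + (k + + 1) * r
                      lem = solve-∀
              from-shift : ∀ x b → Fixed (x + a) b → Fixed x b
              from-shift x b f = go (stays x b)
                where go : _ → Fixed x b
                      go (inj₁ e) = e
                      go (inj₂ e) = ⊥-elim (no-cycle (C-inj (app-injective σ (trans e (sym f)))))
              fixed-cong : ∀ {x y b} → x ≈ y → Fixed x b → Fixed y b
              fixed-cong p f = trans (cong (app σ) (C-cong (≈-sym p))) (trans f (C-cong (*-cong≈ r p)))
              other-level : ∀ x b → Fixed x b → Fixed x (not b)
              other-level x b f = from-shift x (not b) (fixed-cong (+-congʳ≈ x (≈-trans (m*odd or) (≈-sym a≈m)))
                  (subst (Fixed (x + + m * r)) (trans (cong (b xor_) par-m) (𝔹ₚ.xor-comm b true)) (iterate m x b f)))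
              result : ∀ t x b → app σ (C t x (not b)) ≡ flip (app σ (C t x b))
              result false x b = trans (h x (not b)) (cong flip (sym (h x b)))
              result true x b = go (stays x b) (stays x (not b))
                where
                  go : _ → _ → app σ (C true x (not b)) ≡ flip (app σ (C true x b))
                  go (inj₁ e) _ = trans (other-level x b e) (cong flip (sym e))
                  go (inj₂ e) (inj₂ e') = trans e' (cong flip (sym e))
                  go (inj₂ e) (inj₁ e') = ⊥-elim (separated (C-inj (trans (sym (subst (Fixed x) (𝔹ₚ.not-involutive b) (other-level x (not b) e'))) e)))

          module _ (c : ℤ) (h : Along (λ x → r * x + c)) where

            private
              X : ℤ → ℤ
              X x = r * x + c
              w₀ = v₀ X h
              w₁ = v₁ X h

            sign₀ : ∀ x → ((r * a + c) ≈ (- a) × w₀ x ≈ (r * x)) ⊎ ((r * a + c) ≈ a × w₀ x ≈ (r * x + a))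
            sign₀ x = go (v₀-image X h x)
              where
                l₁ : ∀ r x c a y → r * a + c - (- a) ≡ (- + 1) * (r * x - y) + + 1 * (r * (x + a) + c - (y - a))
                l₁ = solve-∀
                l₂ : ∀ r x c a y → r * a + c - a ≡ (- + 1) * (r * x - (y - a)) + + 1 * (r * (x + a) + c - y)
                l₂ = solve-∀
                l₃ : ∀ r x a y → y - (r * x + a) ≡ (- + 1) * (r * x - (y - a))
                l₃ = solve-∀
                go : _ → _
                go (inj₁ (p , q)) = inj₁ (lin₂ (- + 1) (+ 1) p q (l₁ r x c a (w₀ x)) , ≈-sym p)
                go (inj₂ (p , q)) = inj₂ (lin₂ (- + 1) (+ 1) p q (l₂ r x c a (w₀ x)) , lin₁ (- + 1) p (l₃ r x a (w₀ x)))

            sign₁ : ∀ x → ((r * a - c) ≈ (- a) × w₁ x ≈ (r * x + c)) ⊎ ((r * a - c) ≈ a × w₁ x ≈ (r * x + c + a))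
            sign₁ x = go (v₁-image X h x)
              where
                l₁ : ∀ r x c a y → r * a - c - (- a) ≡ (- + 1) * (r * x + c - y) + + 1 * (r * (x + a) - (y - a))
                l₁ = solve-∀
                l₂ : ∀ r x c a y → r * a - c - a ≡ (- + 1) * (r * x + c - (y - a)) + + 1 * (r * (x + a) - y)
                l₂ = solve-∀
                l₃ : ∀ r x c a y → y - (r * x + c + a) ≡ (- + 1) * (r * x + c - (y - a))
                l₃ = solve-∀
                go : _ → _
                go (inj₁ (p , q)) = inj₁ (lin₂ (- + 1) (+ 1) p q (l₁ r x c a (w₁ x)) , ≈-sym p)
                go (inj₂ (p , q)) = inj₂ (lin₂ (- + 1) (+ 1) p q (l₂ r x c a (w₁ x)) , lin₁ (- + 1) p (l₃ r x c a (w₁ x)))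

            -- Spokes give ra + c = ±a and ra - c = ±a. Opposite signs yield 2ra = 0, contradicting
            -- injectivity; equal signs yield 2c = 0. For c = 0 the two levels are treated alike and
            -- σ commutes with `flip`. For c = m the hub edges give r² = ±1 or r² + m = ±1,
            -- according to the parity of r, and in both cases (m - r)² = ±1.
            generic : ¬ (+ 2 * a) ≈ + 0 → Commutes {G} σ ⊎ Exceptional n a r m
            generic 2a≉0 = go (halve c (2c (sign₀ (+ 0)) (sign₁ (+ 0))))
              where
                exclude : (r * a + c) ≈ (- a) → (r * a + c) ≈ a → ⊥
                exclude p q = 2a≉0 (lin₂ (+ 1) (- + 1) p q (lem (r * a + c) a))
                  where lem : ∀ w a → + 2 * a - + 0 ≡ + 1 * (w - (- a)) + (- + 1) * (w - a)
                        lem = solve-∀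
                conflict : ∀ {e e'} → e + e' ≡ + 0 → (r * a + c) ≈ e → (r * a - c) ≈ e' → ⊥
                conflict {e} {e'} z p q = 2a≉0 (even-injective (+ 2 * a) (a , refl) (lin₂ (+ 1) (+ 1) p q (trans (cong (_-_ (r * (+ 2 * a))) (sym z)) (lem r a c e e'))))
                  where lem : ∀ r a c e e' → r * (+ 2 * a) - (e + e') ≡ + 1 * (r * a + c - e) + + 1 * (r * a - c - e')
                        lem = solve-∀
                difference : ∀ {e} → (r * a + c) ≈ e → (r * a - c) ≈ e → (+ 2 * c) ≈ + 0
                difference {e} p q = lin₂ (+ 1) (- + 1) p q (lem (r * a) c e)
                  where lem : ∀ w c e → + 2 * c - + 0 ≡ + 1 * (w + c - e) + (- + 1) * (w - c - e)
                        lem = solve-∀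
                2c : _ → _ → (+ 2 * c) ≈ + 0
                2c (inj₁ (p , _)) (inj₁ (q , _)) = difference p q
                2c (inj₂ (p , _)) (inj₂ (q , _)) = difference p q
                2c (inj₁ (p , _)) (inj₂ (q , _)) = ⊥-elim (conflict (ℤₚ.+-inverseˡ a) p q)
                2c (inj₂ (p , _)) (inj₁ (q , _)) = ⊥-elim (conflict (ℤₚ.+-inverseʳ a) p q)
                gap₀ : ∀ x y → (w₀ x - w₀ y) ≈ (r * x - r * y)
                gap₀ x y = pick (sign₀ x) (sign₀ y)
                  where
                    l₁ : ∀ r x y u v → u - v - (r * x - r * y) ≡ + 1 * (u - r * x) + (- + 1) * (v - r * y)
                    l₁ = solve-∀
                    l₂ : ∀ r x y u v a → u - v - (r * x - r * y) ≡ + 1 * (u - (r * x + a)) + (- + 1) * (v - (r * y + a))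
                    l₂ = solve-∀
                    pick : _ → _ → (w₀ x - w₀ y) ≈ (r * x - r * y)
                    pick (inj₁ (_ , p)) (inj₁ (_ , q)) = lin₂ (+ 1) (- + 1) p q (l₁ r x y (w₀ x) (w₀ y))
                    pick (inj₂ (_ , p)) (inj₂ (_ , q)) = lin₂ (+ 1) (- + 1) p q (l₂ r x y (w₀ x) (w₀ y) a)
                    pick (inj₁ (p , _)) (inj₂ (q , _)) = ⊥-elim (exclude p q)
                    pick (inj₂ (p , _)) (inj₁ (q , _)) = ⊥-elim (exclude q p)
                gap₁ : ∀ x y → (w₁ x - w₀ y) ≈ (r * x + c - r * y)
                gap₁ x y = pick (sign₁ x) (sign₀ y)
                  where
                    l₁ : ∀ r x c y u v → u - v - (r * x + c - r * y) ≡ + 1 * (u - (r * x + c)) + (- + 1) * (v - r * y)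
                    l₁ = solve-∀
                    l₂ : ∀ r x c y u v a → u - v - (r * x + c - r * y) ≡ + 1 * (u - (r * x + c + a)) + (- + 1) * (v - (r * y + a))
                    l₂ = solve-∀
                    pick : _ → _ → (w₁ x - w₀ y) ≈ (r * x + c - r * y)
                    pick (inj₁ (_ , p)) (inj₁ (_ , q)) = lin₂ (+ 1) (- + 1) p q (l₁ r x c y (w₁ x) (w₀ y))
                    pick (inj₂ (_ , p)) (inj₂ (_ , q)) = lin₂ (+ 1) (- + 1) p q (l₂ r x c y (w₁ x) (w₀ y) a)
                    pick (inj₁ (p , _)) (inj₂ (q , _)) = ⊥-elim (conflict (ℤₚ.+-inverseʳ a) q p)
                    pick (inj₂ (p , _)) (inj₁ (q , _)) = ⊥-elim (conflict (ℤₚ.+-inverseˡ a) q p)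
                module _ (c≈m : c ≈ + m) where
                  sa : ((+ m - r) * a) ≈ a ⊎ ((+ m - r) * a) ≈ (- a)
                  sa = pick (sign₀ (+ 0))
                    where
                      l₁ : ∀ m r a c → (m - r) * a - a ≡ + 1 * (m * (a + + 1) - + 0) + ((- + 1) * (r * a + c - (- a)) + + 1 * (c - m))
                      l₁ = solve-∀
                      l₂ : ∀ m r a c → (m - r) * a - (- a) ≡ + 1 * (m * (a + + 1) - + 0) + ((- + 1) * (r * a + c - a) + + 1 * (c - m))
                      l₂ = solve-∀
                      pick : _ → _
                      pick (inj₁ (p , _)) = inj₁ (lin₃ (+ 1) (- + 1) (+ 1) (m*even (odd+1 oa)) p c≈m (l₁ (+ m) r a c))
                      pick (inj₂ (p , _)) = inj₂ (lin₃ (+ 1) (- + 1) (+ 1) (m*even (odd+1 oa)) p c≈m (l₂ (+ m) r a c))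
                  by-parity : EvenZ r ⊎ OddZ r → Exceptional n a r m
                  by-parity (inj₂ or) = from-involution {u = + 0} (m*even even-m) (Sum.map (λ u → lin₂ (- + 1) (+ 1) (gap₀ (+ 0 + r) (+ 0)) u (l r (w₀ (+ 0 + r)) (w₀ (+ 0)) (+ 1)))
                                                                    (λ u → lin₂ (- + 1) (+ 1) (gap₀ (+ 0 + r) (+ 0)) u (l' r (w₀ (+ 0 + r)) (w₀ (+ 0)) (+ 1))) (hub₀ X h or (+ 0))) sa 2a≉0
                    where
                      l : ∀ r u v e → r * r + + 0 - e ≡ (- + 1) * (u - v - (r * (+ 0 + r) - r * + 0)) + + 1 * (u - (v + e))
                      l = solve-∀
                      l' : ∀ r u v e → r * r + + 0 - (- e) ≡ (- + 1) * (u - v - (r * (+ 0 + r) - r * + 0)) + + 1 * (u - (v - e))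
                      l' = solve-∀
                      k : ∀ w c m e → e - w - m ≡ (- + 1) * (w + c - e) + + 1 * (c - m)
                      k = solve-∀
                      even-m : EvenZ (+ m)
                      even-m = pick (sign₀ (+ 0))
                        where
                          ra : OddZ (- (r * a))
                          ra = odd-neg (odd-* or oa)
                          pick : _ → EvenZ (+ m)
                          pick (inj₁ (p , _)) = even-residue (odd-+-odd (odd-neg oa) ra) (lin₂ (- + 1) (+ 1) p c≈m (k (r * a) c (+ m) (- a)))
                          pick (inj₂ (p , _)) = even-residue (odd-+-odd oa ra) (lin₂ (- + 1) (+ 1) p c≈m (k (r * a) c (+ m) a))
                  by-parity (inj₁ er) = from-involution {u = + m} (m*odd (even-r⇒odd-m er)) (Sum.map (λ u → lin₃ (- + 1) (+ 1) (- + 1) (gap₁ (+ 0 + r) (+ 0)) u c≈m (l r (w₁ (+ 0 + r)) (w₀ (+ 0)) (+ 1) c (+ m)))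
                                                                    (λ u → lin₃ (- + 1) (+ 1) (- + 1) (gap₁ (+ 0 + r) (+ 0)) u c≈m (l' r (w₁ (+ 0 + r)) (w₀ (+ 0)) (+ 1) c (+ m))) (hub₁ X h er (+ 0))) sa 2a≉0
                    where
                      l : ∀ r u v e c m → r * r + m - e ≡ (- + 1) * (u - v - (r * (+ 0 + r) + c - r * + 0)) + (+ 1 * (u - (v + e)) + (- + 1) * (c - m))
                      l = solve-∀
                      l' : ∀ r u v e c m → r * r + m - (- e) ≡ (- + 1) * (u - v - (r * (+ 0 + r) + c - r * + 0)) + (+ 1 * (u - (v - e)) + (- + 1) * (c - m))
                      l' = solve-∀
                go : c ≈ + 0 ⊎ c ≈ + m → Commutes {G} σ ⊎ Exceptional n a r m
                go (inj₁ z) = inj₁ (Uniform.commutes (all-lines z h) 2a≉0)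
                go (inj₂ z) = inj₂ (by-parity z (parity r))

            -- With 2a = 2c = 0 the image of each v_x is known only up to doubling, where it is 2rx.
            -- For r odd c vanishes and hub edges settle the choice; for r even a hub edge gives 2r²
            -- = ±2.
            degenerate : (+ 2 * a) ≈ + 0 → Commutes {G} σ ⊎ Exceptional n a r m
            degenerate 2a≈0 = go (parity r)
              where
                a≈m : a ≈ + m
                a≈m = pick (halve a 2a≈0)
                  where
                    pick : a ≈ + 0 ⊎ a ≈ + m → a ≈ + m
                    pick (inj₁ z) = ⊥-elim (a≉0 z)
                    pick (inj₂ z) = z
                c≈ : (r * a + c) ≈ (- a) ⊎ (r * a + c) ≈ a
                c≈ = Sum.map proj₁ proj₁ (sign₀ (+ 0))
                2c≈0 : (+ 2 * c) ≈ + 0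
                2c≈0 = pick c≈
                  where
                    l₁ : ∀ r a c → + 2 * c - + 0 ≡ + 2 * (r * a + c - (- a)) + (- (r + + 1)) * (+ 2 * a - + 0)
                    l₁ = solve-∀
                    l₂ : ∀ r a c → + 2 * c - + 0 ≡ + 2 * (r * a + c - a) + (+ 1 - r) * (+ 2 * a - + 0)
                    l₂ = solve-∀
                    pick : _ → (+ 2 * c) ≈ + 0
                    pick (inj₁ p) = lin₂ (+ 2) (- (r + + 1)) p 2a≈0 (l₁ r a c)
                    pick (inj₂ p) = lin₂ (+ 2) (+ 1 - r) p 2a≈0 (l₂ r a c)
                c≈0 : OddZ r → c ≈ + 0
                c≈0 (q , e) = pick c≈
                  where
                    l₁ : ∀ q a c → c - + 0 ≡ + 1 * ((+ 2 * q + + 1) * a + c - (- a)) + (- (q + + 1)) * (+ 2 * a - + 0)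
                    l₁ = solve-∀
                    l₂ : ∀ q a c → c - + 0 ≡ + 1 * ((+ 2 * q + + 1) * a + c - a) + (- q) * (+ 2 * a - + 0)
                    l₂ = solve-∀
                    pick : _ → c ≈ + 0
                    pick (inj₁ p) = lin₂ (+ 1) (- (q + + 1)) p 2a≈0 (trans (l₁ q a c) (cong (λ r → + 1 * (r * a + c - (- a)) + (- (q + + 1)) * (+ 2 * a - + 0)) (sym e)))
                    pick (inj₂ p) = lin₂ (+ 1) (- q) p 2a≈0 (trans (l₂ q a c) (cong (λ r → + 1 * (r * a + c - a) + (- q) * (+ 2 * a - + 0)) (sym e)))
                double₀ : ∀ x → (+ 2 * w₀ x) ≈ (+ 2 * (r * x))
                double₀ x = pick (sign₀ x)
                  where
                    l₁ : ∀ z u → + 2 * u - + 2 * z ≡ + 2 * (u - z)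
                    l₁ = solve-∀
                    l₂ : ∀ z u a → + 2 * u - + 2 * z ≡ + 2 * (u - (z + a)) + + 1 * (+ 2 * a - + 0)
                    l₂ = solve-∀
                    pick : _ → (+ 2 * w₀ x) ≈ (+ 2 * (r * x))
                    pick (inj₁ (_ , p)) = lin₁ (+ 2) p (l₁ (r * x) (w₀ x))
                    pick (inj₂ (_ , p)) = lin₂ (+ 2) (+ 1) p 2a≈0 (l₂ (r * x) (w₀ x) a)
                double₁ : ∀ x → (+ 2 * w₁ x) ≈ (+ 2 * (r * x))
                double₁ x = pick (sign₁ x)
                  where
                    l₁ : ∀ z u c → + 2 * u - + 2 * z ≡ + 2 * (u - (z + c)) + + 1 * (+ 2 * c - + 0)
                    l₁ = solve-∀
                    l₂ : ∀ z u c a → + 2 * u - + 2 * z ≡ + 2 * (u - (z + c + a)) + (+ 1 * (+ 2 * a - + 0) + + 1 * (+ 2 * c - + 0))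
                    l₂ = solve-∀
                    pick : _ → (+ 2 * w₁ x) ≈ (+ 2 * (r * x))
                    pick (inj₁ (_ , p)) = lin₂ (+ 2) (+ 1) p 2c≈0 (l₁ (r * x) (w₁ x) c)
                    pick (inj₂ (_ , p)) = lin₃ (+ 2) (+ 1) (+ 1) p 2a≈0 2c≈0 (l₂ (r * x) (w₁ x) c a)
                2r² : EvenZ r → (+ 2 * (r * r)) ≈ + 2 ⊎ (+ 2 * (r * r)) ≈ (- + 2)
                2r² er = Sum.map (λ u → lin₃ (- + 1) (+ 2) (+ 1) (double₁ (+ 0 + r)) u (double₀ (+ 0)) (l₁ r (w₁ (+ 0 + r)) (w₀ (+ 0))))
                                 (λ u → lin₃ (- + 1) (+ 2) (+ 1) (double₁ (+ 0 + r)) u (double₀ (+ 0)) (l₂ r (w₁ (+ 0 + r)) (w₀ (+ 0)))) (hub₁ X h er (+ 0))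
                  where
                    l₁ : ∀ r u v → + 2 * (r * r) - + 2 ≡ (- + 1) * (+ 2 * u - + 2 * (r * (+ 0 + r))) + (+ 2 * (u - (v + + 1)) + + 1 * (+ 2 * v - + 2 * (r * + 0)))
                    l₁ = solve-∀
                    l₂ : ∀ r u v → + 2 * (r * r) - (- + 2) ≡ (- + 1) * (+ 2 * u - + 2 * (r * (+ 0 + r))) + (+ 2 * (u - (v - + 1)) + + 1 * (+ 2 * v - + 2 * (r * + 0)))
                    l₂ = solve-∀
                go : EvenZ r ⊎ OddZ r → Commutes {G} σ ⊎ Exceptional n a r m
                go (inj₂ or) = inj₁ (swapping or a≈m (all-lines (c≈0 or) h))
                go (inj₁ er) = inj₂ (square a≈m (odd-residue oa a≈m) er (2r² er))

            shifted : Commutes {G} σ ⊎ Exceptional n a r m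
            shifted = go ((+ 2 * a) ≈? (+ 0))
              where
                go : Dec ((+ 2 * a) ≈ + 0) → Commutes {G} σ ⊎ Exceptional n a r m
                go (yes z) = degenerate z
                go (no ne) = generic ne

          case-odd : Commutes {G} σ ⊎ Exceptional n a r m
          case-odd = go other
            where
              go : (Σ ℤ λ c → Along (λ x → r * x + c) ⊎ Along (λ x → c - r * x)) → Commutes {G} σ ⊎ Exceptional n a r m
              go (c , inj₁ h) = shifted c h
              go (c , inj₂ h) = inj₂ (mirrored c h)

-- Recognising the families W1 and W3 to W9.

module FamilyRecognition where
  open RoseWindow
  open DoubleCover
  open SymbolicWalks using (Dir; fwd; bwd; near; far; target)
  open WalkCounting using (module Counting)
  open EdgeOrbits
  open RespectedMatchings using (par; half)
  open Parity
  open WalkConclusions using (module Residues)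
  open ResidualParameters using (even-par; odd-par)
  open TypePreserving using (Exceptional; halved-a; quartered-r; quartered-a; order-4; involution; square)
  import Data.Nat.Divisibility as ℕ∣
  open import Data.Integer.Divisibility.Signed using (divides)
  open import Data.Nat.Tactic.RingSolver using () renaming (solve-∀ to solveℕ)
  open import Data.Fin using (toℕ)
  open import Data.Fin.Properties using (toℕ-fromℕ<)
  open import Relation.Nullary.Decidable using (_×-dec_; _⊎-dec_; ¬?; map′)
  open import Relation.Binary.Definitions using (tri<; tri≈; tri>)

  even⇒EvenZ : ∀ {k} → Even k → EvenZ (+ k)
  even⇒EvenZ (ℕ∣.divides q e) = + q , trans (cong +_ e) (trans (ℤₚ.pos-* q 2) (ℤₚ.*-comm (+ q) (+ 2)))

  EvenZ⇒even : ∀ {k} → EvenZ (+ k) → Even k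
  EvenZ⇒even {k} (q , e) = Mod.D⇒∣ 2 (divides q (trans e (ℤₚ.*-comm (+ 2) q)))

  OddZ⇒odd : ∀ {k} → OddZ (+ k) → Odd k
  OddZ⇒odd o ev = even≢odd (even⇒EvenZ ev) o

  odd⇒OddZ : ∀ {k} → Odd k → OddZ (+ k)
  odd⇒OddZ {k} o = go (parity (+ k))
    where
      go : EvenZ (+ k) ⊎ OddZ (+ k) → OddZ (+ k)
      go (inj₁ e) = ⊥-elim (o (EvenZ⇒even e))
      go (inj₂ e) = e

  even? : ∀ x → Dec (EvenZ x)
  even? x with parity x
  ... | inj₁ e = yes e
  ... | inj₂ o = no (λ e → even≢odd e o)

  odd? : ∀ x → Dec (OddZ x)
  odd? x with parity x
  ... | inj₁ e = no (even≢odd e)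
  ... | inj₂ o = yes o

  module _ (n : ℕ) (a r : ℤ) (m : ℕ) where
    open Mod n

    -- Needed because no particular σ is at hand: only if these conditions can be assumed to fail do
    -- all automorphisms commute with `flip`.
    exceptional? : Dec (Exceptional n a r m)
    exceptional? = map′ to from
        (((+ 2 * a) ≈? (+ 0) ×-dec even? (+ m))
        ⊎-dec ((+ 4 * r) ≈? (+ 0) ×-dec ¬? ((+ 2 * r) ≈? (+ 0)) ×-dec even? a ×-dec even? r)
        ⊎-dec ((+ 4 * a) ≈? (+ 0) ×-dec ¬? ((+ 2 * a) ≈? (+ 0)) ×-dec odd? a ×-dec odd? r)
        ⊎-dec ((+ 4) ≈? (+ 0) ×-dec ¬? ((+ 2 * a) ≈? (+ 0)) ×-dec ¬? ((+ 2 * r) ≈? (+ 0)))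
        ⊎-dec (((+ m - r) * (+ m - r)) ≈? (+ 1) ×-dec (((+ m - r) * a) ≈? a ⊎-dec ((+ m - r) * a) ≈? (- a)) ×-dec ¬? ((+ 2 * a) ≈? (+ 0)))
        ⊎-dec (a ≈? (+ m) ×-dec odd? (+ m) ×-dec even? r ×-dec ((+ 2 * (r * r)) ≈? (+ 2) ⊎-dec (+ 2 * (r * r)) ≈? (- + 2))))
      where
        Conditions : Set
        Conditions = ((+ 2 * a) ≈ (+ 0) × EvenZ (+ m))
          ⊎ ((+ 4 * r) ≈ (+ 0) × (¬ (+ 2 * r) ≈ (+ 0)) × EvenZ a × EvenZ r)
          ⊎ ((+ 4 * a) ≈ (+ 0) × (¬ (+ 2 * a) ≈ (+ 0)) × OddZ a × OddZ r)
          ⊎ ((+ 4) ≈ (+ 0) × (¬ (+ 2 * a) ≈ (+ 0)) × (¬ (+ 2 * r) ≈ (+ 0)))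
          ⊎ (((+ m - r) * (+ m - r)) ≈ (+ 1) × (((+ m - r) * a) ≈ a ⊎ ((+ m - r) * a) ≈ (- a)) × (¬ (+ 2 * a) ≈ (+ 0)))
          ⊎ (a ≈ (+ m) × OddZ (+ m) × EvenZ r × ((+ 2 * (r * r)) ≈ (+ 2) ⊎ (+ 2 * (r * r)) ≈ (- + 2)))
        to : Conditions → Exceptional n a r m
        to (inj₁ (p , q)) = halved-a p q
        to (inj₂ (inj₁ (p , q , s , t))) = quartered-r p q s t
        to (inj₂ (inj₂ (inj₁ (p , q , s , t)))) = quartered-a p q s t
        to (inj₂ (inj₂ (inj₂ (inj₁ (p , q , s))))) = order-4 p q s
        to (inj₂ (inj₂ (inj₂ (inj₂ (inj₁ (p , q , s)))))) = involution p q s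
        to (inj₂ (inj₂ (inj₂ (inj₂ (inj₂ (p , q , s , t)))))) = square p q s t
        from : Exceptional n a r m → Conditions
        from (halved-a p q) = inj₁ (p , q)
        from (quartered-r p q s t) = inj₂ (inj₁ (p , q , s , t))
        from (quartered-a p q s t) = inj₂ (inj₂ (inj₁ (p , q , s , t)))
        from (order-4 p q s) = inj₂ (inj₂ (inj₂ (inj₁ (p , q , s))))
        from (involution p q s) = inj₂ (inj₂ (inj₂ (inj₂ (inj₁ (p , q , s)))))
        from (square p q s t) = inj₂ (inj₂ (inj₂ (inj₂ (inj₂ (p , q , s , t)))))

  module _ (m k : ℕ) where
    open Mod m

    private
      shift : ∀ x → x ≈ (- + 1) → (x + + 1) ≈ + 0
      shift x p = lin₁ (+ 1) p (lem x)
        where lem : ∀ x → x + + 1 - + 0 ≡ + 1 * (x - (- + 1))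
              lem = solve-∀

      unshift : ∀ x → (x + + 1) ≈ + 0 → x ≈ (- + 1)
      unshift x p = lin₁ (+ 1) p (lem x)
        where lem : ∀ x → x - (- + 1) ≡ + 1 * (x + + 1 - + 0)
              lem = solve-∀

    root-of-1 : (+ k * + k) ≈ + 1 → Cong m (k ℕ.* k) 1
    root-of-1 p = ≈⇒cong {k ℕ.* k} {1} (subst (λ z → z ≈ + 1) (sym (ℤₚ.pos-* k k)) p)

    root-of--1 : (+ k * + k) ≈ (- + 1) → Cong m (k ℕ.* k ℕ.+ 1) 0
    root-of--1 p = ≈⇒cong {k ℕ.* k ℕ.+ 1} {0}
      (subst (λ z → z ≈ + 0) (sym (trans (ℤₚ.pos-+ (k ℕ.* k) 1) (cong (λ z → z + + 1) (ℤₚ.pos-* k k)))) (shift (+ k * + k) p))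

    cong-1 : Cong m k 1 → (+ k) ≈ (+ 1)
    cong-1 c = cong⇒≈ {k} {1} c

    cong--1 : Cong m (k ℕ.+ 1) 0 → (+ k) ≈ (- + 1)
    cong--1 c = unshift (+ k) (subst (λ z → z ≈ + 0) (ℤₚ.pos-+ k 1) (cong⇒≈ {k ℕ.+ 1} {0} c))

  -- Recognising the families, up to replacing a or r by its negative

  module Families (n a r : ℕ) .{{_ : ℕ.NonZero n}} (3≤n : 3 ℕ.≤ n) (0<a : 0 ℕ.< a) (a<n : a ℕ.< n) (0<r : 0 ℕ.< r) (r<n : r ℕ.< n) where
    open Mod n
    open Residues n

    G : Graph
    G = RW n a r

    P : Rose G n (+ a) (+ r)
    P = rose n a r

    a≉0 : ¬ (+ a) ≈ + 0
    a≉0 p = ¬D-small 0<a a<n (≈⇒D p)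

    Signed : ℤ → ℤ → Set
    Signed x y = x ≈ y ⊎ (- x) ≈ y

    family : ∀ (W : ℕ → ℕ → ℕ → Set) A R → 0 ℕ.< A × A ℕ.< n → 0 ℕ.< R × R ℕ.< n → Signed (+ a) (+ A) → Signed (+ r) (+ R) → W n A R → IsoToFamily W G
    family W A R bA bR sA sR w = n , A , R , (3≤n , bA , bR) , w , rose-iso (renamed sA sR) (rose n A R)
      where
        renamed : Signed (+ a) (+ A) → Signed (+ r) (+ R) → Rose G n (+ A) (+ R)
        renamed (inj₁ p) (inj₁ q) = retarget p q P
        renamed (inj₁ p) (inj₂ q) = retarget p q (negate-r P)
        renamed (inj₂ p) (inj₁ q) = retarget p q (negate-a P)
        renamed (inj₂ p) (inj₂ q) = retarget p q (negate-r (negate-a P))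

    same-a : Signed (+ a) (+ a)
    same-a = inj₁ ≈-refl

    same-r : Signed (+ r) (+ r)
    same-r = inj₁ ≈-refl

    small-injective : ∀ {x y} → x ℕ.< n → y ℕ.< n → (+ x) ≈ (+ y) → x ≡ y
    small-injective {x} {y} p q e = trans (sym (toℕ-fromℕ< p)) (trans (cong toℕ (toℕ-≈-inj
        (subst₂ (λ x y → (+ x) ≈ (+ y)) (sym (toℕ-fromℕ< p)) (sym (toℕ-fromℕ< q)) e))) (toℕ-fromℕ< q))

    complement : ∀ {x} → x ℕ.< n → (+ (n ℕ.∸ x)) ≈ (- + x)
    complement {x} x<n = mk (subst D (trans (cong +_ (sym (ℕₚ.m∸n+n≡m (ℕₚ.<⇒≤ x<n)))) (trans (ℤₚ.pos-+ (n ℕ.∸ x) x) (lem (+ (n ℕ.∸ x)) (+ x)))) Dn)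
      where lem : ∀ u x → u + x ≡ u - (- x)
            lem = solve-∀

    complement-bounds : ∀ {x} → 0 ℕ.< x → x ℕ.< n → 0 ℕ.< n ℕ.∸ x × n ℕ.∸ x ℕ.< n
    complement-bounds p q = ℕₚ.m<n⇒0<n∸m q , ℕₚ.∸-monoʳ-< p (ℕₚ.<⇒≤ q)

    module EvenOrder (m : ℕ) (n≡2m : n ≡ 2 ℕ.* m) where
      open Even m n≡2m

      n≡m+m : n ≡ m ℕ.+ m
      n≡m+m = trans n≡2m (cong (m ℕ.+_) (ℕₚ.+-identityʳ m))

      2≤m : 2 ℕ.≤ m
      2≤m = go m n≡2m 3≤n
        where
          go : ∀ m → n ≡ 2 ℕ.* m → 3 ℕ.≤ n → 2 ℕ.≤ m
          go zero refl ()
          go (suc zero) refl (ℕ.s≤s (ℕ.s≤s ()))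
          go (suc (suc m)) _ _ = ℕ.s≤s (ℕ.s≤s ℕ.z≤n)

      1≤m : 1 ℕ.≤ m
      1≤m = ℕₚ.≤-trans (ℕ.s≤s ℕ.z≤n) 2≤m

      m<n : m ℕ.< n
      m<n = subst (m ℕ.<_) (sym n≡m+m) (ℕₚ.m<m+n m 1≤m)

      m-1 : + (m ℕ.∸ 1) ≡ + m - + 1
      m-1 = trans (lem (+ (m ℕ.∸ 1))) (cong (_- + 1) (trans (sym (ℤₚ.pos-+ (m ℕ.∸ 1) 1)) (cong +_ (ℕₚ.m∸n+n≡m 1≤m))))
        where lem : ∀ k → k ≡ k + + 1 - + 1
              lem = solve-∀

      m-1-bounds : 0 ℕ.< m ℕ.∸ 1 × m ℕ.∸ 1 ℕ.< n
      m-1-bounds = ℕₚ.m<n⇒0<n∸m 2≤m , ℕₚ.≤-<-trans (ℕₚ.m∸n≤m m 1) m<n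

      even-residue : ∀ {x y} → EvenZ x → x ≈ y → EvenZ y
      even-residue {x} {y} o p = subst EvenZ (lem x y) (even-+ (even-neg (even-≈ P even-n p)) o)
        where lem : ∀ x y → - (x - y) + x ≡ y
              lem = solve-∀

      even-signed : ∀ {x y} → EvenZ x → Signed x y → EvenZ y
      even-signed e (inj₁ p) = even-residue e p
      even-signed e (inj₂ p) = even-residue (even-neg e) p

      odd-signed : ∀ {x y} → OddZ x → Signed x y → OddZ y
      odd-signed {x} {y} o s = go (parity y) s
        where
          back : EvenZ y → Signed x y → EvenZ x
          back e (inj₁ p) = even-residue e (≈-sym p)
          back e (inj₂ p) = subst EvenZ (ℤₚ.neg-involutive x) (even-neg (even-residue e (≈-sym p)))
          go : EvenZ y ⊎ OddZ y → Signed x y → OddZ y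
          go (inj₁ e) s = ⊥-elim (even≢odd (back e s) o)
          go (inj₂ o) _ = o

      -- 2x is a residue other than 0 whose double is 0, so 2x = m and m is even; then x - m/2 is 0
      -- or m, that is, x = ±m/2.
      quarter : ∀ x → (+ 4 * x) ≈ + 0 → ¬ (+ 2 * x) ≈ + 0 → Σ ℕ λ q → m ≡ 2 ℕ.* q × Signed x (+ q)
      quarter x p ne = split (halve (+ 2 * x) (≈-trans (≈-reflexive (lem₀ x)) p))
        where
          lem₀ : ∀ x → + 2 * (+ 2 * x) ≡ + 4 * x
          lem₀ = solve-∀
          module _ (2x≈m : (+ 2 * x) ≈ + m) (q : ℕ) (e : m ≡ q ℕ.* 2) where
            m≡2q : m ≡ 2 ℕ.* q
            m≡2q = trans e (ℕₚ.*-comm q 2)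
            mZ : + m ≡ + 2 * + q
            mZ = trans (cong +_ m≡2q) (ℤₚ.pos-* 2 q)
            l₁ : ∀ x q → + 2 * (x - q) - + 0 ≡ + 1 * (+ 2 * x - + 2 * q)
            l₁ = solve-∀
            l₂ : ∀ x q → x - q ≡ + 1 * (x - q - + 0)
            l₂ = solve-∀
            l₃ : ∀ x q → - x - q ≡ (- + 1) * (x - q - + 2 * q) + (- + 1) * (+ 2 * (+ 2 * q) - + 0)
            l₃ = solve-∀
            sign : (x - + q) ≈ + 0 ⊎ (x - + q) ≈ + m → Signed x (+ q)
            sign (inj₁ z) = inj₁ (lin₁ (+ 1) z (l₂ x (+ q)))
            sign (inj₂ z) = inj₂ (lin₂ (- + 1) (- + 1) z 2m≈0 (trans (l₃ x (+ q)) (cong (λ m → (- + 1) * (x - + q - m) + (- + 1) * (+ 2 * m - + 0)) (sym mZ))))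
            result : Σ ℕ λ q → m ≡ 2 ℕ.* q × Signed x (+ q)
            result = q , m≡2q , sign (halve (x - + q) (lin₁ (+ 1) 2x≈m (trans (l₁ x (+ q)) (cong (λ z → + 1 * (+ 2 * x - z)) (sym mZ)))))
          split : (+ 2 * x) ≈ + 0 ⊎ (+ 2 * x) ≈ + m → Σ ℕ λ q → m ≡ 2 ℕ.* q × Signed x (+ q)
          split (inj₁ z) = ⊥-elim (ne z)
          split (inj₂ z) = go (EvenZ⇒even (even-residue (x , refl) z))
            where go : Even m → _
                  go (ℕ∣.divides q e) = result z q e

      quarter-bounds : ∀ {q} → m ≡ 2 ℕ.* q → 0 ℕ.< q × q ℕ.< n
      quarter-bounds {zero} e = ⊥-elim (ℕₚ.<-irrefl (sym e) 1≤m)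
      quarter-bounds {suc q} e = ℕ.s≤s ℕ.z≤n , ℕₚ.<-trans (subst (suc q ℕ.<_) (sym e) (ℕₚ.m<m+n (suc q) (ℕ.s≤s ℕ.z≤n))) m<n

      in-W1 : (+ 2 * + a) ≈ + 0 → EvenZ (+ m) → IsoToFamily W1 G
      in-W1 p ev = go (halve (+ a) p) (EvenZ⇒even ev)
        where
          go : (+ a) ≈ + 0 ⊎ (+ a) ≈ + m → Even m → IsoToFamily W1 G
          go (inj₁ z) _ = ⊥-elim (a≉0 z)
          go (inj₂ z) (ℕ∣.divides q e) = family W1 a r (0<a , a<n) (0<r , r<n) same-a same-r
            (q , proj₁ (quarter-bounds m≡2q) , trans n≡2m (trans (cong (2 ℕ.*_) e) (lem q)) , trans (small-injective a<n m<n z) m≡2q)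
            where
              m≡2q = trans e (ℕₚ.*-comm q 2)
              lem : ∀ q → 2 ℕ.* (q ℕ.* 2) ≡ 4 ℕ.* q
              lem = solveℕ

      in-W5 : (+ 4 * + r) ≈ + 0 → ¬ (+ 2 * + r) ≈ + 0 → EvenZ (+ a) → EvenZ (+ r) → IsoToFamily W5 G
      in-W5 p ne ea er = go (quarter (+ r) p ne)
        where
          go : (Σ ℕ λ q → m ≡ 2 ℕ.* q × Signed (+ r) (+ q)) → IsoToFamily W5 G
          go (q , e , s) = go' (EvenZ⇒even (even-signed er s))
            where
              go' : Even q → IsoToFamily W5 G
              go' (ℕ∣.divides k ek) = family W5 a q (0<a , a<n) (quarter-bounds e) same-a s
                (k , pos k ek , trans n≡2m (trans (cong (2 ℕ.*_) (trans e (cong (2 ℕ.*_) ek))) (lem k)) , EvenZ⇒even ea , trans ek (ℕₚ.*-comm k 2))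
                where
                  lem : ∀ k → 2 ℕ.* (2 ℕ.* (k ℕ.* 2)) ≡ 8 ℕ.* k
                  lem = solveℕ
                  pos : ∀ k → q ≡ k ℕ.* 2 → 1 ℕ.≤ k
                  pos zero ek = ⊥-elim (ℕₚ.<-irrefl (sym ek) (proj₁ (quarter-bounds e)))
                  pos (suc k) _ = ℕ.s≤s ℕ.z≤n

      in-W4 : Signed (+ r) (+ m - + 1) → ¬ (+ 2 * + a) ≈ + 0 → IsoToFamily W4 G
      in-W4 s ne = family W4 a (m ℕ.∸ 1) (0<a , a<n) m-1-bounds same-a (Sum.map conv conv s)
          (m , 1≤m , n≡2m , (λ e → ne (≈-trans (≈-reflexive (cong (λ x → + 2 * + x) e)) 2m≈0)) , (0 , inj₁ (sym (ℕₚ.+-identityʳ _))))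
        where
          conv : ∀ {x} → x ≈ (+ m - + 1) → x ≈ (+ (m ℕ.∸ 1))
          conv p = ≈-trans p (≈-reflexive (sym m-1))

      antipodal-4 : (+ 4) ≈ + 0 → ¬ (+ 2 * + r) ≈ + 0 → Signed (+ r) (+ m - + 1)
      antipodal-4 four ne = go r refl m≡2
        where
          n≤4 : n ℕ.≤ 4
          n≤4 = ℕ∣.∣⇒≤ (D⇒∣ (≈⇒D four))
          small : ∀ k → n ≡ 2 ℕ.* k → 2 ℕ.≤ k → k ≡ 2
          small (suc zero) e (ℕ.s≤s ())
          small (suc (suc zero)) e _ = refl
          small (suc (suc (suc k))) e _ = ⊥-elim (ℕₚ.<⇒≱ {4} {6} (ℕ.s≤s (ℕ.s≤s (ℕ.s≤s (ℕ.s≤s (ℕ.s≤s ℕ.z≤n)))))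
            (ℕₚ.≤-trans (ℕₚ.*-monoʳ-≤ 2 {3} {3 ℕ.+ k} (ℕₚ.m≤m+n 3 k)) (subst (ℕ._≤ 4) e n≤4)))
          m≡2 : m ≡ 2
          m≡2 = small m n≡2m 2≤m
          go : ∀ k → r ≡ k → m ≡ 2 → Signed (+ r) (+ m - + 1)
          go zero e _ = ⊥-elim (ℕₚ.<-irrefl (sym e) 0<r)
          go (suc zero) e me = inj₁ (≈-reflexive (trans (cong +_ e) (cong (λ m → + m - + 1) (sym me))))
          go (suc (suc zero)) e _ = ⊥-elim (ne (≈-trans (≈-reflexive (cong (λ r → + 2 * + r) e)) four))
          go (suc (suc (suc zero))) e me = inj₂ (≈-trans (≈-reflexive (cong (λ r → - + r) e)) (≈-trans (lin₁ (- + 1) four refl) (≈-reflexive (cong (λ m → + m - + 1) (sym me)))))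
          go (suc (suc (suc (suc k)))) e _ = ⊥-elim (ℕₚ.<⇒≱ (ℕₚ.<-≤-trans r<n n≤4) (subst (4 ℕ.≤_) (sym e) (ℕₚ.m≤m+n 4 k)))

      -- Up to sign a is q = n/4, an odd number. W6 asks q to be at least 3; for q = 1 the order n
      -- is 4, and W4 takes the graph.
      in-W4-or-W6 : (+ 4 * + a) ≈ + 0 → ¬ (+ 2 * + a) ≈ + 0 → OddZ (+ a) → OddZ (+ r) → IsoToFamily W4 G ⊎ IsoToFamily W6 G
      in-W4-or-W6 p ne oa or = go (quarter (+ a) p ne)
        where
          go : (Σ ℕ λ q → m ≡ 2 ℕ.* q × Signed (+ a) (+ q)) → IsoToFamily W4 G ⊎ IsoToFamily W6 G
          go (q , e , s) = by-size q e s (odd-signed oa s)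
            where
              lem : ∀ q → 2 ℕ.* (2 ℕ.* q) ≡ 4 ℕ.* q
              lem = solveℕ
              n≡4q : ∀ {q} → m ≡ 2 ℕ.* q → n ≡ 4 ℕ.* q
              n≡4q {q} e = trans n≡2m (trans (cong (2 ℕ.*_) e) (lem q))
              by-size : ∀ q → m ≡ 2 ℕ.* q → Signed (+ a) (+ q) → OddZ (+ q) → IsoToFamily W4 G ⊎ IsoToFamily W6 G
              by-size zero e s o = ⊥-elim (even≢odd (+ 0 , refl) o)
              by-size (suc zero) e s o = inj₁ (in-W4 (antipodal-4 four 2r≉0) ne)
                where
                  four : (+ 4) ≈ + 0
                  four = D⇒≈ (subst (λ k → D (+ k)) (n≡4q {1} e) Dn)
                  2r≉0 : ¬ (+ 2 * + r) ≈ + 0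
                  2r≉0 z = pick (halve (+ r) z)
                    where
                      pick : _ → ⊥
                      pick (inj₁ y) = even≢odd (even-residue (+ 0 , refl) (≈-sym y)) or
                      pick (inj₂ y) = even≢odd (even-residue (+ 1 , cong +_ e) (≈-sym y)) or
              by-size (suc (suc zero)) e s o = ⊥-elim (even≢odd (+ 1 , refl) o)
              by-size (suc (suc (suc k))) e s o = inj₂ (family W6 (3 ℕ.+ k) r (quarter-bounds {3 ℕ.+ k} e) (0<r , r<n) s same-r
                (3 ℕ.+ k , ℕ.s≤s ℕ.z≤n , n≡4q {3 ℕ.+ k} e , refl , OddZ⇒odd o , OddZ⇒odd or , ℕ.s≤s (ℕ.s≤s (ℕ.s≤s ℕ.z≤n))))

      -- W9 requires A < m, so a is replaced by n - a if necessary; a = m would give 2a = 0.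
      W9-with : ∀ R s → 0 ℕ.< R × R ℕ.< n → Signed (+ r) (+ R) → (+ R + s) ≈ + m → (s * s) ≈ + 1 → (s * + a) ≈ (- + a) → ¬ (+ 2 * + a) ≈ + 0 → IsoToFamily W9 G
      W9-with R s bR sR sum sq sa ne = by-size (ℕₚ.<-cmp a m)
        where
          S : ℕ
          S = toℕ (ι s)
          S≈ : (+ S) ≈ s
          S≈ = ι≈ s
          W9-at : ∀ A → (+ a) ≈ (+ A) ⊎ (- + a) ≈ (+ A) → A ℕ.< m → W9 n A R
          W9-at A σA A<m = m , S , 1≤m , n≡2m , ≈⇒cong (≈-trans (≈-reflexive (ℤₚ.pos-+ R S)) (≈-trans (+-congʳ≈ (+ R) S≈) sum))
              , ≈⇒cong (≈-trans (≈-reflexive (ℤₚ.pos-* S S)) (≈-trans (lin₁ (+ S + s) S≈ (l₀ (+ S) s)) sq))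
              , ≈⇒cong (≈-trans (≈-reflexive (trans (ℤₚ.pos-+ (S ℕ.* A) A) (cong (_+ + A) (ℤₚ.pos-* S A)))) (zero-sum σA)) , A<m
            where
              l₀ : ∀ S s → S * S - s * s ≡ (S + s) * (S - s)
              l₀ = solve-∀
              l₁ : ∀ S s a A → S * A + A - + 0 ≡ A * (S - s) + ((- (s + + 1)) * (a - A) + + 1 * (s * a - (- a)))
              l₁ = solve-∀
              l₂ : ∀ S s a A → S * A + A - + 0 ≡ A * (S - s) + ((- (s + + 1)) * (- a - A) + (- + 1) * (s * a - (- a)))
              l₂ = solve-∀
              zero-sum : (+ a) ≈ (+ A) ⊎ (- + a) ≈ (+ A) → (+ S * + A + + A) ≈ + 0
              zero-sum (inj₁ p) = lin₃ (+ A) (- (s + + 1)) (+ 1) S≈ p sa (l₁ (+ S) s (+ a) (+ A))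
              zero-sum (inj₂ p) = lin₃ (+ A) (- (s + + 1)) (- + 1) S≈ p sa (l₂ (+ S) s (+ a) (+ A))
          by-size : _ → IsoToFamily W9 G
          by-size (tri< a<m _ _) = family W9 a R (0<a , a<n) bR same-a sR (W9-at a same-a a<m)
          by-size (tri≈ _ e _) = ⊥-elim (ne (≈-trans (≈-reflexive (cong (λ x → + 2 * + x) e)) 2m≈0))
          by-size (tri> _ _ m<a) = family W9 (n ℕ.∸ a) R (complement-bounds 0<a a<n) bR (inj₂ (≈-sym (complement a<n))) sR
            (W9-at (n ℕ.∸ a) (inj₂ (≈-sym (complement a<n))) (subst (n ℕ.∸ a ℕ.<_) (trans (cong (ℕ._∸ m) n≡m+m) (ℕₚ.m+n∸n≡m m m)) (ℕₚ.∸-monoʳ-< m<a (ℕₚ.<⇒≤ a<n))))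

      -- W9 requires sa = -a. If m - r fixes a instead, its negative m + r is taken for s, and -r
      -- for the hub parameter.
      in-W9 : ((+ m - + r) * (+ m - + r)) ≈ + 1 → ((+ m - + r) * + a) ≈ (+ a) ⊎ ((+ m - + r) * + a) ≈ (- + a) → ¬ (+ 2 * + a) ≈ + 0 → IsoToFamily W9 G
      in-W9 sq (inj₂ sa) ne = W9-with r (+ m - + r) (0<r , r<n) same-r (≈-reflexive (lem (+ r) (+ m))) sq sa ne
        where lem : ∀ r m → r + (m - r) ≡ m
              lem = solve-∀
      in-W9 sq (inj₁ sa) ne = W9-with (n ℕ.∸ r) (+ m + + r) (complement-bounds 0<r r<n) (inj₂ (≈-sym (complement r<n)))
          (lin₁ (+ 1) (complement r<n) (l₁ (+ (n ℕ.∸ r)) (+ m) (+ r))) (lin₂ (+ 1) (+ 2 * + r) sq 2m≈0 (l₂ (+ m) (+ r))) (lin₂ (- + 1) (+ a) sa 2m≈0 (l₃ (+ m) (+ r) (+ a))) ne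
        where
          l₁ : ∀ R m r → R + (m + r) - m ≡ + 1 * (R - (- r))
          l₁ = solve-∀
          l₂ : ∀ m r → (m + r) * (m + r) - + 1 ≡ + 1 * ((m - r) * (m - r) - + 1) + + 2 * r * (+ 2 * m - + 0)
          l₂ = solve-∀
          l₃ : ∀ m r a → (m + r) * a - (- a) ≡ (- + 1) * ((m - r) * a - a) + a * (+ 2 * m - + 0)
          l₃ = solve-∀

      -- Since n = 2m, a congruence 2x ≈ 2y mod n says that x and y agree mod m.
      halved-congruence : ∀ x y → (+ 2 * x) ≈ (+ 2 * y) → Mod._≈_ m x y
      halved-congruence x y (mk (divides q e)) = Mod.mk (divides q (ℤₚ.*-cancelˡ-≡ (+ 2) (x - y) (q * + m)
          (trans (l₁ x y) (trans e (trans (cong (q *_) (sym 2m≡n)) (l₂ q (+ m)))))))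
        where
          l₁ : ∀ x y → + 2 * (x - y) ≡ + 2 * x - + 2 * y
          l₁ = solve-∀
          l₂ : ∀ q m → q * (+ 2 * m) ≡ + 2 * (q * m)
          l₂ = solve-∀

      -- Halving 2r² = ±2 gives r² = ±1 modulo m. If r = ±1 modulo m, then r - 1 or r + 1 is an odd
      -- multiple of m, as r is even, hence congruent to m modulo n; this makes r = ±(m - 1) and
      -- leads to W7. All else is W8.
      in-W7-or-W8 : (+ a) ≈ (+ m) → OddZ (+ m) → EvenZ (+ r) → (+ 2 * (+ r * + r)) ≈ (+ 2) ⊎ (+ 2 * (+ r * + r)) ≈ (- + 2) → IsoToFamily W7 G ⊎ IsoToFamily W8 G
      in-W7-or-W8 a≈m om er sq = split (Mod._≈?_ m (+ r) (+ 1)) (Mod._≈?_ m (+ r) (- + 1))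
        where
          a≡m : a ≡ m
          a≡m = small-injective a<n m<n a≈m
          conv : ∀ {x} → x ≈ (+ m - + 1) → x ≈ (+ (m ℕ.∸ 1))
          conv p = ≈-trans p (≈-reflexive (sym m-1))
          in-W7 : Signed (+ r) (+ m - + 1) → IsoToFamily W7 G
          in-W7 s = family W7 a (m ℕ.∸ 1) (0<a , a<n) m-1-bounds same-a (Sum.map conv conv s)
            (m , 1≤m , n≡2m , a≡m , (0 , inj₁ (sym (ℕₚ.+-identityʳ _))) , OddZ⇒odd om)
          r+1-odd : OddZ (+ r + + 1)
          r+1-odd = even+1 er
          r-1-odd : OddZ (+ r - + 1)
          r-1-odd = odd-+ er (- + 1 , refl)
          odd-multiple : ∀ {x} → OddZ x → Mod.D m x → x ≈ + m
          odd-multiple {x} o (divides q e) = go (parity q)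
            where
              l₁ : ∀ q m → + 2 * q * m ≡ + 2 * (q * m)
              l₁ = solve-∀
              l₂ : ∀ q m → (+ 2 * q + + 1) * m - m ≡ q * (+ 2 * m - + 0)
              l₂ = solve-∀
              go : EvenZ q ⊎ OddZ q → x ≈ + m
              go (inj₁ (k , ek)) = ⊥-elim (even≢odd (k * + m , trans e (trans (cong (_* + m) ek) (l₁ k (+ m)))) o)
              go (inj₂ (k , ek)) = lin₁ k 2m≈0 (trans (cong (_- + m) (trans e (cong (_* + m) ek))) (l₂ k (+ m)))
          roots : ∀ x → (+ 2 * x) ≈ (+ 2) ⊎ (+ 2 * x) ≈ (- + 2) → Mod._≈_ m x (+ 1) ⊎ Mod._≈_ m x (- + 1)
          roots x (inj₁ e) = inj₁ (halved-congruence x (+ 1) e)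
          roots x (inj₂ e) = inj₂ (halved-congruence x (- + 1) e)
          split : Dec (Mod._≈_ m (+ r) (+ 1)) → Dec (Mod._≈_ m (+ r) (- + 1)) → IsoToFamily W7 G ⊎ IsoToFamily W8 G
          split (yes p) _ = inj₁ (in-W7 (inj₂ (lin₂ (- + 1) (- + 1) (odd-multiple r-1-odd (Mod.diff p)) 2m≈0 (lem (+ r) (+ m)))))
            where lem : ∀ r m → - r - (m - + 1) ≡ (- + 1) * (r - + 1 - m) + (- + 1) * (+ 2 * m - + 0)
                  lem = solve-∀
          split (no _) (yes p) = inj₁ (in-W7 (inj₁ (lin₁ (+ 1) (odd-multiple r+1-odd (Mod.diff p)) (lem (+ r) (+ m)))))
            where lem : ∀ r m → r - (m - + 1) ≡ + 1 * (r + + 1 - m)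
                  lem = solve-∀
          split (no p) (no q) = inj₂ (family W8 a r (0<a , a<n) (0<r , r<n) same-a same-r
              (m , 1≤m , n≡2m , a≡m , OddZ⇒odd om , EvenZ⇒even er , Sum.map (root-of-1 m r) (root-of--1 m r) (roots (+ r * + r) sq)
              , (λ c → p (cong-1 m r c)) , (λ c → q (cong--1 m r c))))

      classify : Exceptional n (+ a) (+ r) m →
        IsoToFamily W1 G ⊎ IsoToFamily W4 G ⊎ IsoToFamily W5 G ⊎ IsoToFamily W6 G ⊎ IsoToFamily W7 G ⊎ IsoToFamily W8 G ⊎ IsoToFamily W9 G
      classify (halved-a p q) = inj₁ (in-W1 p q)
      classify (quartered-r p q s t) = inj₂ (inj₂ (inj₁ (in-W5 p q s t)))
      classify (quartered-a p q s t) = Sum.[ (λ w → inj₂ (inj₁ w)) , (λ w → inj₂ (inj₂ (inj₂ (inj₁ w)))) ]′ (in-W4-or-W6 p q s t)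
      classify (order-4 p q s) = inj₂ (inj₁ (in-W4 (antipodal-4 p s) q))
      classify (involution p q s) = inj₂ (inj₂ (inj₂ (inj₂ (inj₂ (inj₂ (in-W9 p q s))))))
      classify (square p q s t) = Sum.[ (λ w → inj₂ (inj₂ (inj₂ (inj₂ (inj₁ w))))) , (λ w → inj₂ (inj₂ (inj₂ (inj₂ (inj₂ (inj₁ w)))))) ]′ (in-W7-or-W8 p q s t)

    module OddOrder (odd : OddZ (+ n)) (nt : ¬ HasTwins G) where
      open Odd odd

      -- e serves as d. As r = ±1 and there are no twins, a is not ±2; this excludes d = ±1 and also
      -- n = 3, where 1 and 2 are the only values of a.
      in-W3 : (+ r) ≈ + 1 ⊎ (+ r) ≈ (- + 1) → ∀ e → (+ a) ≈ (+ 2 * + e) → (+ e * + a) ≈ + 2 ⊎ (+ e * + a) ≈ (- + 2) → IsoToFamily W3 G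
      in-W3 r±1 e a≈2e ea = family W3 a 1 (0<a , a<n) (ℕ.s≤s ℕ.z≤n , ℕₚ.≤-trans (ℕ.s≤s (ℕ.s≤s ℕ.z≤n)) 3≤n) same-a (Sum.map₂ (≈-neg P) r±1)
          (n , e , ℕₚ.≤-trans (ℕ.s≤s ℕ.z≤n) 3≤n , refl , ≈⇒cong {a} {2 ℕ.* e} (≈-trans a≈2e (≈-reflexive (sym (ℤₚ.pos-* 2 e)))) , refl
          , OddZ⇒odd odd , 5≤ , Sum.map (root-of-1 n e) (root-of--1 n e) (roots (+ a) (+ e) a≈2e ea) , not-1 , not--1)
        where
          a≉±2 : ¬ ((+ a) ≈ + 2 ⊎ (+ a) ≈ (- + 2))
          a≉±2 s = nt (twins P s r±1)
          not-1 : ¬ Cong n e 1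
          not-1 c = a≉±2 (inj₁ (≈-trans a≈2e (*-cong≈ (+ 2) (cong-1 n e c))))
          not--1 : ¬ Cong n (e ℕ.+ 1) 0
          not--1 c = a≉±2 (inj₂ (≈-trans a≈2e (*-cong≈ (+ 2) (cong--1 n e c))))
          5≤ : 5 ℕ.≤ n
          5≤ = ℕₚ.≤∧≢⇒< (ℕₚ.≤∧≢⇒< 3≤n three) (λ four → even≢odd (subst (λ k → EvenZ (+ k)) four (+ 2 , refl)) odd)
            where
              three : 3 ≢ n
              three n≡3 = go a refl
                where
                  D3 : (+ 3) ≈ + 0
                  D3 = D⇒≈ (subst (λ k → D (+ k)) (sym n≡3) Dn)
                  go : ∀ k → a ≡ k → ⊥
                  go zero q = ℕₚ.<-irrefl (sym q) 0<a
                  go (suc zero) q = a≉±2 (inj₂ (≈-trans (≈-reflexive (cong +_ q)) (lin₁ (+ 1) D3 refl)))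
                  go (suc (suc zero)) q = a≉±2 (inj₁ (≈-reflexive (cong +_ q)))
                  go (suc (suc (suc k))) q = ℕₚ.<⇒≱ (subst (a ℕ.<_) (sym n≡3) a<n) (subst (3 ℕ.≤_) (sym q) (ℕₚ.m≤m+n 3 k))
          roots : ∀ x y → x ≈ (+ 2 * y) → (y * x) ≈ + 2 ⊎ (y * x) ≈ (- + 2) → (y * y) ≈ + 1 ⊎ (y * y) ≈ (- + 1)
          roots x y q = Sum.map (λ p → lin₁ (+ 1) (halve (y * y - + 1) (lin₂ (+ 1) (- y) p q (l₁ x y))) (l₃ (y * y)))
                                (λ p → lin₁ (+ 1) (halve (y * y + + 1) (lin₂ (+ 1) (- y) p q (l₂ x y))) (l₄ (y * y)))
            where
              l₁ : ∀ a e → + 2 * (e * e - + 1) - + 0 ≡ + 1 * (e * a - + 2) + (- e) * (a - + 2 * e)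
              l₁ = solve-∀
              l₂ : ∀ a e → + 2 * (e * e + + 1) - + 0 ≡ + 1 * (e * a - (- + 2)) + (- e) * (a - + 2 * e)
              l₂ = solve-∀
              l₃ : ∀ x → x - + 1 ≡ + 1 * (x - + 1 - + 0)
              l₃ = solve-∀
              l₄ : ∀ x → x - (- + 1) ≡ + 1 * (x + + 1 - + 0)
              l₄ = solve-∀

-- Normalising automorphisms, and the conclusion.

open RoseWindow
open DoubleCover
open SymbolicWalks using (Dir; fwd; bwd; near; far; target)
open WalkCounting using (module Counting)
open EdgeOrbits
open RespectedMatchings using (par; half)
open Parity
open WalkConclusions using (module Residues)
open ResidualParameters using (even-par; odd-par)
open WalkCounting using (Simple)
open EdgeTransitiveCovers using (et-even; et-odd)
open ResidualParameters using (even-degree)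
open SpokeOrbit
open TypePreserving
open TypeReversing
open FamilyRecognition
import Data.Nat.Divisibility as ℕ∣
open import Data.Integer.Divisibility.Signed using (divides)
open import Data.Nat.Tactic.RingSolver using () renaming (solve-∀ to solveℕ)
open import Relation.Nullary.Decidable using (_⊎-dec_)

module Automorphisms {G : Graph} {n : ℕ} {a r : ℤ} (P : Rose G n a r) (3≤n : 3 ℕ.≤ n) (a≉0 : ¬ Mod._≈_ n a (+ 0))
                     (conn : Connected G) (nb : ¬ Bipartite G) (net : ¬ EdgeTransitive (G ×K₂)) where
  open Spokes P 3≤n a≉0 conn nb net

  Preserves Reverses : Aut Cov → Set
  Preserves σ = app σ (C false (+ 0) false) ≡ C false (+ 0) false × app σ (C false (+ 1) true) ≡ C false (+ 1) true
  Reverses σ = app σ (C false (+ 0) false) ≡ C true (+ 0) false × app σ (C false (+ 1) true) ≡ C true r true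

  -- Translations and reflections commute with the level swap, so σ may be composed with them.
  normalise : ∀ {Q : Set} → (∀ σ → Preserves σ → Commutes {G} σ ⊎ Q) → (∀ σ → Reverses σ → Commutes {G} σ ⊎ Q) → ∀ σ → Commutes {G} σ ⊎ Q
  normalise {Q} keep rev σ = Sum.map₁ (commutes-cancel ρ σ (translate-commutes (- x) b)) (by-type t e₀)
    where
      p₀ = app σ (C false (+ 0) false)
      t = type p₀
      x = index p₀
      b = proj₂ p₀
      ρ = translate (- x) b
      τ = ρ ⊙ σ
      e₀ : app τ (C false (+ 0) false) ≡ C t (+ 0) false
      e₀ = trans (cong (app ρ) (sym (C-surj p₀))) (trans (translate-C (- x) b t x b)
             (trans (C-cong (≈-reflexive (ℤₚ.+-inverseʳ x))) (cong (C t (+ 0)) (𝔹ₚ.xor-same b))))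
      by-type : ∀ t → app τ (C false (+ 0) false) ≡ C t (+ 0) false → Commutes {G} τ ⊎ Q
      by-type false e = pick (rail-image τ false (+ 0) false fwd false (+ 0) false refl e)
        where
          μ = reflect (- a)
          l₀ : ∀ a → - a + a - + 0 ≡ + 0
          l₀ = solve-∀
          l₁ : ∀ a → - a + a - (+ 0 - + 1) ≡ + 1
          l₁ = solve-∀
          pick : app τ (C false (+ 1) true) ≡ C false (+ 1) true ⊎ app τ (C false (+ 1) true) ≡ C false (- + 1) true → Commutes {G} τ ⊎ Q
          pick (inj₁ u) = keep τ (e , u)
          pick (inj₂ u) = Sum.map₁ (commutes-cancel μ τ (reflect-commutes (- a))) (keep (μ ⊙ τ)
              ( trans (cong (app μ) e) (trans (reflect-C (- a) false (+ 0) false) (C-cong (≈-reflexive (l₀ a))))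
              , trans (cong (app μ) u) (trans (reflect-C (- a) false (- + 1) true) (C-cong (≈-reflexive (l₁ a))))))
      by-type true e = pick (rail-image τ false (+ 0) false fwd true (+ 0) false refl e)
        where
          μ = reflect (+ 0)
          l₁ : ∀ r → + 0 - (+ 0 - r) ≡ r
          l₁ = solve-∀
          pick : app τ (C false (+ 1) true) ≡ C true (+ 0 + r) true ⊎ app τ (C false (+ 1) true) ≡ C true (+ 0 - r) true → Commutes {G} τ ⊎ Q
          pick (inj₁ u) = rev τ (e , trans u (C-cong (≈-reflexive (ℤₚ.+-identityˡ r))))
          pick (inj₂ u) = Sum.map₁ (commutes-cancel μ τ (reflect-commutes (+ 0))) (rev (μ ⊙ τ)
              ( trans (cong (app μ) e) (reflect-C (+ 0) true (+ 0) false)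
              , trans (cong (app μ) u) (trans (reflect-C (+ 0) true (+ 0 - r) true) (C-cong (≈-reflexive (l₁ r))))))

  all-commute-odd : OddZ (+ n) → ∀ σ → Commutes {G} σ
  all-commute-odd odd σ = go (normalise {⊥} (λ { σ (p , q) → inj₁ (Preserving.Based.odd-case P 3≤n a≉0 conn nb net σ p q odd) })
                                            (λ { σ (p , q) → inj₁ (Reversing.Based.odd-case P 3≤n a≉0 conn nb net σ p q odd) }) σ)
    where
      go : Commutes {G} σ ⊎ ⊥ → Commutes {G} σ
      go (inj₁ c) = c

  commutes-or-exceptional : ∀ m → n ≡ 2 ℕ.* m → ∀ σ → Commutes {G} σ ⊎ Exceptional n a r m
  commutes-or-exceptional m e = normalise (λ { σ (p , q) → keep σ p q (parity a) (parity r) }) (λ { σ (p , q) → rev σ p q (parity a) (parity r) })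
    where
      keep : ∀ σ → _ → _ → EvenZ a ⊎ OddZ a → EvenZ r ⊎ OddZ r → Commutes {G} σ ⊎ Exceptional n a r m
      keep σ p q (inj₁ ea) (inj₁ er) = Preserving.Based.EvenOrder.case-even P 3≤n a≉0 conn nb net σ p q m e ea er
      keep σ p q (inj₁ ea) (inj₂ or) = ⊥-elim (nb (bipartite P (Residues.Even.even-n n m e) ea or))
      keep σ p q (inj₂ oa) _ = Preserving.Based.EvenOrder.OddA.case-odd P 3≤n a≉0 conn nb net σ p q m e oa
      rev : ∀ σ → _ → _ → EvenZ a ⊎ OddZ a → EvenZ r ⊎ OddZ r → Commutes {G} σ ⊎ Exceptional n a r m
      rev σ p q (inj₁ ea) (inj₁ er) = inj₂ (Reversing.Based.EvenOrder.BothEven.case-even P 3≤n a≉0 conn nb net σ p q m e ea er)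
      rev σ p q (inj₁ ea) (inj₂ or) = ⊥-elim (nb (bipartite P (Residues.Even.even-n n m e) ea or))
      rev σ p q (inj₂ oa) _ = Reversing.Based.EvenOrder.OddA.case-odd P 3≤n a≉0 conn nb net σ p q m e oa

theorem1p3 : (n a r : ℕ) → RWParams n a r → NontriviallyUnstable (RW n a r) →
    (Odd n → IsoToFamily W3 (RW n a r))
  × (Even n → ¬ EdgeTransitive ((RW n a r) ×K₂) →
       IsoToFamily W1 (RW n a r) ⊎ IsoToFamily W4 (RW n a r) ⊎ IsoToFamily W5 (RW n a r)
     ⊎ IsoToFamily W6 (RW n a r) ⊎ IsoToFamily W7 (RW n a r) ⊎ IsoToFamily W8 (RW n a r)
     ⊎ IsoToFamily W9 (RW n a r))
  × (Even n → EdgeTransitive ((RW n a r) ×K₂) →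
       IsoToFamily W2 (RW n a r) ⊎ IsoToFamily W4 (RW n a r))
theorem1p3 n a r (3≤n , (0<a , a<n) , (0<r , r<n)) (unstable , conn , nb , nt) = odd-order , not-edge-transitive , edge-transitive
  where
    instance
      n≢0 : ℕ.NonZero n
      n≢0 = ℕ.>-nonZero (ℕₚ.≤-trans (ℕ.s≤s ℕ.z≤n) 3≤n)
    open Families n a r 3≤n 0<a a<n 0<r r<n
    open Mod n

    some-not-commuting : ¬ (∀ σ → Commutes {G} σ)
    some-not-commuting h = unstable (stable conn (Rose.vtx P false (+ 0)) h)

    simple : EdgeTransitive (G ×K₂) → Simple n (+ a) (+ r)
    simple et = record { 3≤n = 3≤n ; a≉0 = a≉0 ; 2r≉0 = even-degree P 3≤n a≉0 et }

    odd-order : Odd n → IsoToFamily W3 G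
    -- If one of the two W3 conditions fails, `et-odd` refutes edge-transitivity of the cover, and
    -- without it every automorphism commutes with `flip` for odd n, against instability.
    odd-order on = decide ((+ r) ≈? (+ 1) ⊎-dec (+ r) ≈? (- + 1)) ((+ e * + a) ≈? (+ 2) ⊎-dec (+ e * + a) ≈? (- + 2))
      where
        odd : OddZ (+ n)
        odd = odd⇒OddZ on
        n≡ : + n ≡ + 2 * + half n + + 1
        n≡ = go (par n) refl
          where go : ∀ b → par n ≡ b → + n ≡ + 2 * + half n + + 1
                go true q = odd-par n q
                go false q = ⊥-elim (even≢odd (+ half n , even-par n q) odd)
        -- 2⁻¹ a mod n
        e : ℕ
        e = a ℕ.* (half n ℕ.+ 1)
        a≈2e : (+ a) ≈ (+ 2 * + e)
        a≈2e = lin₁ (- + a) (D⇒≈ Dn) (trans (cong (λ z → + a - + 2 * z) (trans (ℤₚ.pos-* a (half n ℕ.+ 1)) (cong (+ a *_) (ℤₚ.pos-+ (half n) 1))))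
          (trans (lem (+ a) (+ half n)) (cong (λ z → - + a * (z - + 0)) (sym n≡))))
          where lem : ∀ a h → a - + 2 * (a * (h + + 1)) ≡ - a * (+ 2 * h + + 1 - + 0)
                lem = solve-∀
        impossible : ¬ EdgeTransitive (G ×K₂) → IsoToFamily W3 G
        impossible net = ⊥-elim (some-not-commuting (Automorphisms.all-commute-odd P 3≤n a≉0 conn nb net odd))
        decide : _ → _ → IsoToFamily W3 G
        decide (yes r±1) (yes ea) = OddOrder.in-W3 odd nt r±1 e a≈2e ea
        decide (no ¬p) _ = impossible (λ et → ¬p (proj₁ (et-odd P (simple et) et nt odd)))
        decide (yes _) (no ¬p) = impossible (λ et → ¬p (proj₂ (et-odd P (simple et) et nt odd) e a≈2e))

    not-edge-transitive : Even n → ¬ EdgeTransitive (G ×K₂) →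
      IsoToFamily W1 G ⊎ IsoToFamily W4 G ⊎ IsoToFamily W5 G ⊎ IsoToFamily W6 G ⊎ IsoToFamily W7 G ⊎ IsoToFamily W8 G ⊎ IsoToFamily W9 G
    not-edge-transitive (ℕ∣.divides m n≡m2) net = decide (exceptional? n (+ a) (+ r) m)
      where
        n≡2m : n ≡ 2 ℕ.* m
        n≡2m = trans n≡m2 (ℕₚ.*-comm m 2)
        decide : Dec (Exceptional n (+ a) (+ r) m) → _
        decide (yes x) = EvenOrder.classify m n≡2m x
        decide (no ¬x) = ⊥-elim (some-not-commuting (λ σ → go σ (Automorphisms.commutes-or-exceptional P 3≤n a≉0 conn nb net m n≡2m σ)))
          where
            go : ∀ σ → Commutes {G} σ ⊎ Exceptional n (+ a) (+ r) m → Commutes {G} σ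
            go σ (inj₁ c) = c
            go σ (inj₂ x) = ⊥-elim (¬x x)

    edge-transitive : Even n → EdgeTransitive (G ×K₂) → IsoToFamily W2 G ⊎ IsoToFamily W4 G
    edge-transitive (ℕ∣.divides m n≡m2) et = go (et-even P (simple et) et conn nb nt m n≡2m)
      where
        n≡2m : n ≡ 2 ℕ.* m
        n≡2m = trans n≡m2 (ℕₚ.*-comm m 2)
        go : _ → IsoToFamily W2 G ⊎ IsoToFamily W4 G
        go (inj₁ (s , ne)) = inj₂ (EvenOrder.in-W4 m n≡2m s ne)
        go (inj₂ h) = ⊥-elim (some-not-commuting h)
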